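{- Let $q$ be an odd prime power, let $n\ge 3$ be an integer, and let $f(x,y,z)=x(y+z)$ be viewed as a function from $SL_n(\mathbb{F}_q)\times SL_n(\mathbb{F}_q)\times M_n(\mathbb{F}_q)$ to $M_n(\mathbb{F}_q)$. There are constants $C_0,c>0$ (independent of $q$ and the sets) such that for all $A,B\subset SL_n(\mathbb{F}_q)$ and $C\subset M_n(\mathbb{F}_q)$ with $|B|\ge C_0 q^{n^2-2}$ and $|C|\ge C_0 q^{(n-1)^2}$, \[ |f(A,B,C)| \ge c\,\min\left\{ q^{n^2},\; \frac{|A||B|^2|C|}{q^{3n^2-3n-2}},\; \frac{|A||B|}{q^{n^2-n-1}}\right\}.\]
   Context: $M_n(\mathbb{F}_q)$ is the ring of $n\times n$ matrices over $\mathbb{F}_q$, $SL_n(\mathbb{F}_q)$ the matrices of determinant $1$, and $f(A,B,C)=\{a(b+c): a\in A,b\in B,c\in C\}$. -}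

module Defs where

open import Level using (0ℓ)
open import Data.Nat as ℕ using (ℕ; zero; suc; _≤_; _<_)
open import Data.Nat.Primality using (Prime)
open import Data.Integer using (+_)
open import Data.Rational as ℚ using (ℚ; 0ℚ)
open import Data.Fin using (Fin; zero; suc)
open import Data.Vec as Vec using (Vec; []; _∷_)
open import Data.List as List using (List; length; deduplicate; concatMap)
open import Data.List.Membership.Propositional using (_∈_)
open import Data.List.Relation.Unary.Unique.Propositional using (Unique)
open import Data.Product using (Σ; _×_; ∃)
open import Relation.Binary.PropositionalEquality using (_≡_; _≢_)
open import Relation.Binary.Definitions using (DecidableEquality)
open import Algebra.Structures using (IsCommutativeRing)
import Data.Vec.Properties as VecP

IsOddPrimePower : ℕ → Set
IsOddPrimePower q = Σ ℕ λ p → Σ ℕ λ k →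
  Prime p × (p ≢ 2) × (1 ≤ k) × (q ≡ p ℕ.^ k)

record FiniteField (q : ℕ) : Set₁ where
  field
    Carrier : Set
    _+_ _*_ : Carrier → Carrier → Carrier
    -_      : Carrier → Carrier
    0# 1#   : Carrier
    isCommutativeRing : IsCommutativeRing _≡_ _+_ _*_ -_ 0# 1#
    0≢1     : 0# ≢ 1#
    inverse : ∀ x → x ≢ 0# → Σ Carrier λ y → x * y ≡ 1#
    _≟_     : DecidableEquality Carrier
    elements : List Carrier
    elements-unique   : Unique elements
    elements-complete : ∀ x → x ∈ elements
    elements-size     : length elements ≡ q

module Matrices {q : ℕ} (F : FiniteField q) where
  open FiniteField F

  Mat : ℕ → Set
  Mat n = Vec (Vec Carrier n) n

  _≟M_ : ∀ {n} → DecidableEquality (Mat n)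
  _≟M_ = VecP.≡-dec (VecP.≡-dec _≟_)

  addM : ∀ {n} → Mat n → Mat n → Mat n
  addM = Vec.zipWith (Vec.zipWith _+_)

  sumV : ∀ {n} → Vec Carrier n → Carrier
  sumV = Vec.foldr _ _+_ 0#

  mulM : ∀ {n} → Mat n → Mat n → Mat n
  mulM {n} X Y = Vec.map (λ row → Vec.map (λ col → sumV (Vec.zipWith _*_ row col)) (Vec.transpose Y)) X

  dropAt : ∀ {n} → Fin (suc n) → Vec Carrier (suc n) → Vec Carrier n
  dropAt zero    (x ∷ xs) = xs
  dropAt {suc n} (suc i) (x ∷ xs) = x ∷ dropAt i xs

  det : ∀ {n} → Mat n → Carrier
  det {zero} [] = 1#
  det {suc n} (r ∷ rs) = go r (Vec.allFin (suc n)) 1#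
    where
      minor : Fin (suc n) → Mat n
      minor j = Vec.map (dropAt j) rs
      go : ∀ {k} → Vec Carrier k → Vec (Fin (suc n)) k → Carrier → Carrier
      go [] [] s = 0#
      go (a ∷ as) (j ∷ js) s = (s * (a * det (minor j))) + go as js (- s)

  -- a finite subset of M_n(F_q), given as a duplicate-free list
  -- |f(A,B,C)| for f(x,y,z) = x(y+z)
  fImage : ∀ {n} → List (Mat n) → List (Mat n) → List (Mat n) → List (Mat n)
  fImage A B C = deduplicate _≟M_
    (concatMap (λ a → concatMap (λ b → List.map (λ c → mulM a (addM b c)) C) B) A)

  InSL : ∀ {n} → Mat n → Set
  InSL M = det M ≡ 1#

-- natural-number division into ℚ (denominators used are always nonzero)
_÷_ : ℕ → ℕ → ℚ
x ÷ zero = 0ℚ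
x ÷ suc d = (+ x) ℚ./ suc d

minℚ3 : ℚ → ℚ → ℚ → ℚ
minℚ3 a b c = a ℚ.⊓ (b ℚ.⊓ c)

{-# OPTIONS --safe #-}

-- Let r(y) be the number of representations y = b + c, and E = Σ r² the additive energy. Grouping y by its
-- determinant d ≠ 0, Cauchy–Schwarz bounds (|A| Σ_{det y ≠ 0} r(y))² by |f(A,B,C)| Σ_t (Σ_{a ∈ A} r(a⁻¹t))², and the
-- last sum is estimated by quasirandomness of SL_n: on X = {det = d}, with v = q^(n-1),
--   v |X| Σ_t (Σ_{a ∈ A} g(at))² ≤ |X|² |A| Σ g² + v |A|² (Σ g)².
-- No characters are used for it. For g with zero sums over the cosets of the abelian group V ≅ F^(n-1) of first-column
-- unipotents, Lagrange's identity in ℤ[V], averaged over the copy of SL_{n-1} that permutes V \ 0 transitively, gives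
-- the estimate; conjugates of V generate SL_n, and alternately averaging over them kills the non-constant part of g.
-- Both E and Σ_{d ≠ 0} #{det(b + c) = d}² follow by Cauchy–Schwarz from the fact that det x and det (x + m) are almost
-- independent for every m ≠ 0. This goes by induction on n: expanding along the first row, only those x contribute
-- whose other rows lie, together with those of m, in a common hyperplane. Finally b + c is singular for few b ∈ SL_n,
-- as it kills a vector w and then bw = -cw is prescribed.
module Submission where

open import Level using (0ℓ)
open import Algebra.Bundles using (CommutativeRing)
open import Algebra.Structures using (IsAbelianGroup; IsCommutativeRing)
import Algebra.Solver.Ring as RingSolver
open import Algebra.Solver.Ring.AlmostCommutativeRing using (fromCommutativeRing; _-Raw-AlmostCommutative⟶_)
open import Data.Bool.Base using (Bool; true; false)
open import Data.Empty using (⊥)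
import Data.Integer as ℤ
import Data.Integer.Properties as ℤP
open import Data.List.Base as List using (List; length)
open import Data.List.Membership.Propositional using (_∈_)
open import Data.List.Relation.Unary.All as All using (All)
open import Data.List.Relation.Unary.Any using (here; there)
open import Data.List.Relation.Unary.Unique.Propositional using (Unique)
open import Data.Maybe.Base using (Maybe)
open import Data.Nat.Base as ℕ using (ℕ; zero; suc)
import Data.Nat.Properties as ℕP
open import Data.Product using (Σ; _×_; _,_; proj₁; proj₂)
open import Data.Rational as ℚ using (ℚ; 0ℚ)
import Data.Rational.Properties as ℚP
open import Data.Sum as Sum using (_⊎_; inj₁; inj₂)
import Data.Vec.Properties as VecP
open import Function.Base using (_∘_; id)
open import Relation.Binary.Definitions using (DecidableEquality)
open import Relation.Binary.PropositionalEquality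
open import Relation.Nullary using (Dec; yes; no; ¬_; contradiction)
open import Relation.Nullary.Decidable using (dec⇒maybe)
open import Defs

-- Everything is kept in ℤ: averages and projections appear as unnormalised sums, so factors such as
-- |V| or q - 1 travel on both sides of an inequality until a positive factor can be cancelled. The
-- obstacle in the quasirandomness estimate is that Lagrange's identity says nothing about the part
-- of g that is constant on V-cosets. The excess of the left side over the right side is therefore
-- watched while g is replaced by its coset sums: a positive excess would grow by the factor |V|² at
-- least, whereas the variance of g, which dominates the excess, grows on average by strictly less.
-- How much less depends on a Poincaré constant that comes from mere connectedness and is not
-- controlled; since the replacement can be iterated without end, any constant will do and none is
-- left in the result. The correlation of det x and det (x + m) is the opposite case. A constant
-- lost in one dimension would be lost again in the next, so the bound q^(n²)/(q - 1)² is chosen to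
-- reproduce itself exactly in the induction on n.

module Integers where
  open import Data.Integer using (ℤ; ∣_∣; _≤_; _<_; 0ℤ; 1ℤ; +≤+; +<+) renaming (+_ to pos; -[1+_] to negative) public
  open import Data.Integer.Properties using (≤-refl; ≤-trans; ≤-reflexive; ≤-total;
    <⇒≤; ≤⇒≯; ≮⇒≥; i<j⇒suc[i]≤j; 0≤i⇒+∣i∣≡i) public

  infixl 6 _+_ _-_
  infixl 7 _*_
  infix  8 -_

  -- The arithmetic of ℤ is made opaque: its clauses unfold eagerly and defeat unification.
  opaque
    _+_ _*_ : ℤ → ℤ → ℤ
    _+_ = ℤ._+_
    _*_ = ℤ._*_

    -_ : ℤ → ℤ
    -_ = ℤ.-_

    isCommutativeRing : IsCommutativeRing _≡_ _+_ _*_ -_ 0ℤ 1ℤ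
    isCommutativeRing = ℤP.+-*-isCommutativeRing

    pos-+ : ∀ m n → pos (m ℕ.+ n) ≡ pos m + pos n
    pos-+ = ℤP.pos-+

    pos-* : ∀ m n → pos (m ℕ.* n) ≡ pos m * pos n
    pos-* = ℤP.pos-*

    +-mono-≤ : ∀ {i j k l} → i ≤ j → k ≤ l → i + k ≤ j + l
    +-mono-≤ = ℤP.+-mono-≤

    neg-mono-≤ : ∀ {i j} → i ≤ j → - j ≤ - i
    neg-mono-≤ = ℤP.neg-mono-≤

    *-monoˡ : ∀ {i j k} → 0ℤ ≤ i → j ≤ k → i * j ≤ i * k
    *-monoˡ {i} p q = ℤP.*-monoˡ-≤-nonNeg i {{ℤ.nonNegative p}} q

    *-cancelˡ : ∀ {k i j} → 0ℤ < k → k * i ≤ k * j → i ≤ j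
    *-cancelˡ {k} {i} {j} p = ℤP.*-cancelˡ-≤-pos i j k {{ℤ.positive p}}

    *-cancelˡ-≡ : ∀ {k i j} → 0ℤ < k → k * i ≡ k * j → i ≡ j
    *-cancelˡ-≡ {k} {i} {j} p = ℤP.*-cancelˡ-≡ k i j {{ℤ.>-nonZero p}}

    0<m*n : ∀ {i j} → 0ℤ < i → 0ℤ < j → 0ℤ < i * j
    0<m*n {i} {j} p q = subst (_< i * j) (ℤP.*-zeroʳ i) (ℤP.*-monoˡ-<-pos i {{ℤ.positive p}} q)

    i<i+1 : ∀ i → i < i + 1ℤ
    i<i+1 i = subst (i <_) (ℤP.+-comm 1ℤ i) (ℤP.suc[i]≤j⇒i<j ≤-refl)

    i≤∣i∣ : ∀ i → i ≤ pos ∣ i ∣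
    i≤∣i∣ (ℤ.+ n)      = ≤-refl
    i≤∣i∣ (ℤ.-[1+ n ]) = ℤ.-≤+

    +-homo : ∀ i j → i ℤ.+ j ≡ i + j
    +-homo _ _ = refl

    *-homo : ∀ i j → i ℤ.* j ≡ i * j
    *-homo _ _ = refl

    -‿homo : ∀ i → ℤ.- i ≡ - i
    -‿homo _ = refl

  _-_ : ℤ → ℤ → ℤ
  i - j = i + - j

  ℤ-ring : CommutativeRing 0ℓ 0ℓ
  ℤ-ring = record { isCommutativeRing = isCommutativeRing }

  open CommutativeRing ℤ-ring public
    using (+-assoc; +-comm; +-identityˡ; +-identityʳ; *-assoc; *-comm; *-identityˡ; *-identityʳ;
           zeroˡ; zeroʳ; distribˡ; distribʳ; -‿inverseˡ; -‿inverseʳ)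

  identity-morphism : CommutativeRing.rawRing ℤP.+-*-commutativeRing -Raw-AlmostCommutative⟶ fromCommutativeRing ℤ-ring
  identity-morphism = record { ⟦_⟧ = λ i → i ; +-homo = +-homo ; *-homo = *-homo ; -‿homo = -‿homo ; 0-homo = refl ; 1-homo = refl }

  coeff≟ : ∀ i j → Maybe (i ≡ j)
  coeff≟ i j = dec⇒maybe (i ℤ.≟ j)

  module Solver = RingSolver (CommutativeRing.rawRing ℤP.+-*-commutativeRing) (fromCommutativeRing ℤ-ring) identity-morphism coeff≟
  open Solver public using (solve; _:=_; _:+_; _:*_; _:-_; :-_; con)

  negative-absurd : ∀ k → 0ℤ ≤ negative k → ⊥
  negative-absurd k ()

-- Finite sums over ℤ, Cauchy-Schwarz, and comparison of geometric growth

module Sums where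
  open Integers
  open import Data.List.Base using ([]; _∷_; map; concatMap; filter; _++_)
  open import Data.List.Relation.Unary.AllPairs using (_∷_)

  private
    variable
      A B : Set

  ∑ : List A → (A → ℤ) → ℤ
  ∑ []       f = 0ℤ
  ∑ (x ∷ xs) f = f x + ∑ xs f

  syntax ∑ xs (λ x → e) = ∑[ x ∈ xs ] e
  infixr 5 ∑

  0≤1 : 0ℤ ≤ 1ℤ
  0≤1 = +≤+ ℕ.z≤n

  0≤pos : ∀ n → 0ℤ ≤ pos n
  0≤pos n = +≤+ ℕ.z≤n

  0<2 : 0ℤ < pos 2
  0<2 = +<+ (ℕ.s≤s ℕ.z≤n)

  ∑-cong∈ : ∀ (xs : List A) {f g} → (∀ {x} → x ∈ xs → f x ≡ g x) → ∑ xs f ≡ ∑ xs g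
  ∑-cong∈ []       h = refl
  ∑-cong∈ (x ∷ xs) h = cong₂ _+_ (h (here refl)) (∑-cong∈ xs λ p → h (there p))

  ∑-cong : ∀ (xs : List A) {f g} → (∀ x → f x ≡ g x) → ∑ xs f ≡ ∑ xs g
  ∑-cong xs h = ∑-cong∈ xs λ {x} _ → h x

  ∑-mono∈ : ∀ (xs : List A) {f g} → (∀ {x} → x ∈ xs → f x ≤ g x) → ∑ xs f ≤ ∑ xs g
  ∑-mono∈ []       h = ≤-refl
  ∑-mono∈ (x ∷ xs) h = +-mono-≤ (h (here refl)) (∑-mono∈ xs λ p → h (there p))

  ∑-mono : ∀ (xs : List A) {f g} → (∀ x → f x ≤ g x) → ∑ xs f ≤ ∑ xs g
  ∑-mono xs h = ∑-mono∈ xs λ {x} _ → h x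

  ∑-zero : ∀ (xs : List A) → ∑ xs (λ _ → 0ℤ) ≡ 0ℤ
  ∑-zero []       = refl
  ∑-zero (x ∷ xs) = trans (+-identityˡ _) (∑-zero xs)

  ∑-zero′ : ∀ (xs : List A) {f} → (∀ x → f x ≡ 0ℤ) → ∑ xs f ≡ 0ℤ
  ∑-zero′ xs h = trans (∑-cong xs h) (∑-zero xs)

  ∑-nonneg : ∀ (xs : List A) {f} → (∀ x → 0ℤ ≤ f x) → 0ℤ ≤ ∑ xs f
  ∑-nonneg xs h = ≤-trans (≤-reflexive (sym (∑-zero xs))) (∑-mono xs h)

  interchange : ∀ a b c d → (a + b) + (c + d) ≡ (a + c) + (b + d)
  interchange = solve 4 (λ a b c d → (a :+ b) :+ (c :+ d) := (a :+ c) :+ (b :+ d)) refl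

  ∑-+ : ∀ (xs : List A) f g → ∑ xs (λ x → f x + g x) ≡ ∑ xs f + ∑ xs g
  ∑-+ []       f g = sym (+-identityˡ 0ℤ)
  ∑-+ (x ∷ xs) f g = trans (cong (f x + g x +_) (∑-+ xs f g)) (interchange (f x) (g x) _ _)

  ∑-*ˡ : ∀ c (xs : List A) f → ∑ xs (λ x → c * f x) ≡ c * ∑ xs f
  ∑-*ˡ c []       f = sym (zeroʳ c)
  ∑-*ˡ c (x ∷ xs) f = trans (cong (c * f x +_) (∑-*ˡ c xs f)) (sym (distribˡ c (f x) _))

  ∑-*ʳ : ∀ c (xs : List A) f → ∑ xs (λ x → f x * c) ≡ ∑ xs f * c
  ∑-*ʳ c xs f = trans (∑-cong xs λ x → *-comm (f x) c) (trans (∑-*ˡ c xs f) (*-comm c _))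

  ∑-neg : ∀ (xs : List A) f → ∑ xs (λ x → - f x) ≡ - ∑ xs f
  ∑-neg []       f = sym (solve 0 (:- con 0ℤ := con 0ℤ) refl)
  ∑-neg (x ∷ xs) f = trans (cong (- f x +_) (∑-neg xs f)) (solve 2 (λ a b → :- a :+ :- b := :- (a :+ b)) refl (f x) _)

  ∑-− : ∀ (xs : List A) f g → ∑ xs (λ x → f x - g x) ≡ ∑ xs f - ∑ xs g
  ∑-− xs f g = trans (∑-+ xs f (λ x → - g x)) (cong (∑ xs f +_) (∑-neg xs g))

  ∑-swap : ∀ (xs : List A) (ys : List B) (f : A → B → ℤ) →
    ∑[ x ∈ xs ] ∑[ y ∈ ys ] f x y ≡ ∑[ y ∈ ys ] ∑[ x ∈ xs ] f x y
  ∑-swap []       ys f = sym (∑-zero ys)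
  ∑-swap (x ∷ xs) ys f =
    trans (cong (∑ ys (f x) +_) (∑-swap xs ys f)) (sym (∑-+ ys (f x) _))

  ∑-const : ∀ (xs : List A) c → ∑ xs (λ _ → c) ≡ pos (length xs) * c
  ∑-const []       c = sym (zeroˡ c)
  ∑-const (x ∷ xs) c = trans (cong (c +_) (∑-const xs c)) (trans (solve 2 (λ c l → c :+ l :* c :=
    (con 1ℤ :+ l) :* c) refl c (pos (length xs))) (cong (_* c) (sym (pos-+ 1 (length xs)))))

  ∑-one : ∀ (xs : List A) → ∑ xs (λ _ → 1ℤ) ≡ pos (length xs)
  ∑-one xs = trans (∑-const xs 1ℤ) (*-identityʳ _)

  ∑-prod : ∀ (xs : List A) (ys : List B) (f : A → ℤ) (g : B → ℤ) →
    ∑[ x ∈ xs ] ∑[ y ∈ ys ] f x * g y ≡ ∑ xs f * ∑ ys g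
  ∑-prod xs ys f g = trans (∑-cong xs λ x → ∑-*ˡ (f x) ys g) (∑-*ʳ (∑ ys g) xs f)

  ∑-++ : ∀ (xs ys : List A) f → ∑ (xs ++ ys) f ≡ ∑ xs f + ∑ ys f
  ∑-++ []       ys f = sym (+-identityˡ _)
  ∑-++ (x ∷ xs) ys f = trans (cong (f x +_) (∑-++ xs ys f)) (sym (+-assoc (f x) _ _))

  ∑-map : ∀ (xs : List A) (h : A → B) f → ∑ (map h xs) f ≡ ∑[ x ∈ xs ] f (h x)
  ∑-map []       h f = refl
  ∑-map (x ∷ xs) h f = cong (f (h x) +_) (∑-map xs h f)

  ∑-concatMap : ∀ (xs : List A) (h : A → List B) f →
    ∑ (concatMap h xs) f ≡ ∑[ x ∈ xs ] ∑ (h x) f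
  ∑-concatMap []       h f = refl
  ∑-concatMap (x ∷ xs) h f =
    trans (∑-++ (h x) (concatMap h xs) f) (cong (∑ (h x) f +_) (∑-concatMap xs h f))

  𝟙 : ∀ {P : Set} → Dec P → ℤ
  𝟙 (yes _) = 1ℤ
  𝟙 (no  _) = 0ℤ

  𝟙-yes : ∀ {P : Set} (d : Dec P) → P → 𝟙 d ≡ 1ℤ
  𝟙-yes (yes _) p = refl
  𝟙-yes (no ¬p) p = contradiction p ¬p

  𝟙-no : ∀ {P : Set} (d : Dec P) → ¬ P → 𝟙 d ≡ 0ℤ
  𝟙-no (yes p) ¬p = contradiction p ¬p
  𝟙-no (no _)  ¬p = refl

  𝟙-⇔ : ∀ {P Q : Set} (d : Dec P) (e : Dec Q) → (P → Q) → (Q → P) → 𝟙 d ≡ 𝟙 e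
  𝟙-⇔ (yes p) e f g = sym (𝟙-yes e (f p))
  𝟙-⇔ (no ¬p) e f g = sym (𝟙-no e λ q → ¬p (g q))

  𝟙-nonneg : ∀ {P : Set} (d : Dec P) → 0ℤ ≤ 𝟙 d
  𝟙-nonneg (yes _) = 0≤1
  𝟙-nonneg (no  _) = ≤-refl

  𝟙≤1 : ∀ {P : Set} (d : Dec P) → 𝟙 d ≤ 1ℤ
  𝟙≤1 (yes _) = ≤-refl
  𝟙≤1 (no  _) = 0≤1

  𝟙-idem : ∀ {P : Set} (d : Dec P) → 𝟙 d * 𝟙 d ≡ 𝟙 d
  𝟙-idem (yes _) = *-identityˡ 1ℤ
  𝟙-idem (no  _) = zeroˡ 0ℤ

  ∑-filter : ∀ {P : A → Set} (P? : ∀ x → Dec (P x)) (xs : List A) f →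
    ∑ (filter P? xs) f ≡ ∑[ x ∈ xs ] 𝟙 (P? x) * f x
  ∑-filter P? []       f = refl
  ∑-filter P? (x ∷ xs) f with P? x
  ... | yes _ = cong₂ _+_ (sym (*-identityˡ (f x))) (∑-filter P? xs f)
  ... | no  _ = trans (∑-filter P? xs f) (sym (trans (cong (_+ _) (zeroˡ (f x))) (+-identityˡ _)))

  0≤m*n : ∀ {i j} → 0ℤ ≤ i → 0ℤ ≤ j → 0ℤ ≤ i * j
  0≤m*n {i} p q = ≤-trans (≤-reflexive (sym (zeroʳ i))) (*-monoˡ p q)

  *-monoʳ : ∀ {i j k} → 0ℤ ≤ i → j ≤ k → j * i ≤ k * i
  *-monoʳ {i} {j} {k} p q = subst₂ _≤_ (*-comm i j) (*-comm i k) (*-monoˡ p q)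

  *-mono : ∀ {i j k l} → 0ℤ ≤ i → 0ℤ ≤ l → i ≤ j → k ≤ l → i * k ≤ j * l
  *-mono p q r s = ≤-trans (*-monoˡ p s) (*-monoʳ q r)

  neg-nonneg : ∀ {i} → i ≤ 0ℤ → 0ℤ ≤ - i
  neg-nonneg p = ≤-trans (≤-reflexive (sym (solve 0 (:- con 0ℤ := con 0ℤ) refl))) (neg-mono-≤ p)

  0≤sq : ∀ i → 0ℤ ≤ i * i
  0≤sq i with ≤-total 0ℤ i
  ... | inj₁ p = 0≤m*n p p
  ... | inj₂ p = ≤-trans (0≤m*n (neg-nonneg p) (neg-nonneg p))
    (≤-reflexive (solve 1 (λ i → (:- i) :* (:- i) := i :* i) refl i))

  0≤i+j : ∀ {i j} → 0ℤ ≤ i → 0ℤ ≤ j → 0ℤ ≤ i + j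
  0≤i+j p q = ≤-trans (≤-reflexive (sym (+-identityˡ 0ℤ))) (+-mono-≤ p q)

  from-diff : ∀ {i j k} → j - i ≡ k → 0ℤ ≤ k → i ≤ j
  from-diff {i} {j} refl p = subst₂ _≤_ (+-identityˡ i)
    (solve 2 (λ i j → (j :- i) :+ i := j) refl i j) (+-mono-≤ p (≤-refl {i}))

  -- Lagrange's identity: twice the difference of the two sides is the double sum of the squared
  -- minors f x · g y - f y · g x.
  cauchy-schwarz : ∀ (xs : List A) (f g : A → ℤ) →
    (∑[ x ∈ xs ] f x * g x) * (∑[ x ∈ xs ] f x * g x)
      ≤ (∑[ x ∈ xs ] f x * f x) * (∑[ x ∈ xs ] g x * g x)
  cauchy-schwarz xs f g = *-cancelˡ 0<2 (from-diff expand
      (∑-nonneg xs λ x → ∑-nonneg xs λ y → 0≤sq (f x * g y - f y * g x)))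
    where
    sq : ∀ a b c d → (a * d - c * b) * (a * d - c * b)
      ≡ ((a * a) * (d * d) + (b * b) * (c * c)) - pos 2 * ((a * b) * (c * d))
    sq = solve 4 (λ a b c d → (a :* d :- c :* b) :* (a :* d :- c :* b) :=
       ((a :* a) :* (d :* d) :+ (b :* b) :* (c :* c)) :- con (pos 2) :* ((a :* b) :* (c :* d))) refl
    fin : ∀ F G H → pos 2 * (F * G) - pos 2 * (H * H) ≡ (F * G + G * F) - pos 2 * (H * H)
    fin = solve 3 (λ F G H → con (pos 2) :* (F :* G) :- con (pos 2) :* (H :* H) :=
       (F :* G :+ G :* F) :- con (pos 2) :* (H :* H)) refl
    FF = ∑[ x ∈ xs ] f x * f x
    GG = ∑[ x ∈ xs ] g x * g x
    FG = ∑[ x ∈ xs ] f x * g x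
    open ≡-Reasoning
    expand : pos 2 * (FF * GG) - pos 2 * (FG * FG) ≡
      ∑[ x ∈ xs ] ∑[ y ∈ xs ] (f x * g y - f y * g x) * (f x * g y - f y * g x)
    expand = sym (begin
      ∑[ x ∈ xs ] ∑[ y ∈ xs ] (f x * g y - f y * g x) * (f x * g y - f y * g x)
        ≡⟨ (∑-cong xs λ x → ∑-cong xs λ y → sq (f x) (g x) (f y) (g y)) ⟩
      ∑[ x ∈ xs ] ∑[ y ∈ xs ] (((f x * f x) * (g y * g y) + (g x * g x) * (f y * f y))
         - pos 2 * ((f x * g x) * (f y * g y)))
        ≡⟨ (∑-cong xs λ x → trans (∑-− xs _ _) (cong₂ _-_ (∑-+ xs _ _) (∑-*ˡ (pos 2) xs _))) ⟩
      ∑[ x ∈ xs ] ((∑[ y ∈ xs ] (f x * f x) * (g y * g y)) + (∑[ y ∈ xs ] (g x * g x) * (f y * f y))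
         - pos 2 * (∑[ y ∈ xs ] (f x * g x) * (f y * g y)))
        ≡⟨ trans (∑-− xs _ _) (cong₂ _-_ (∑-+ xs _ _) (∑-*ˡ (pos 2) xs _)) ⟩
      ((∑[ x ∈ xs ] ∑[ y ∈ xs ] (f x * f x) * (g y * g y)) + (∑[ x ∈ xs ] ∑[ y ∈ xs ] (g x * g x) * (f y * f y)))
         - pos 2 * (∑[ x ∈ xs ] ∑[ y ∈ xs ] (f x * g x) * (f y * g y))
        ≡⟨ cong₂ _-_ (cong₂ _+_ (∑-prod xs xs _ _) (∑-prod xs xs _ _)) (cong (pos 2 *_) (∑-prod xs xs _ _)) ⟩
      (FF * GG + GG * FF) - pos 2 * (FG * FG)
        ≡⟨ sym (fin FF GG FG) ⟩
      pos 2 * (FF * GG) - pos 2 * (FG * FG) ∎)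

  -- That every element occurs exactly once is stated as an equation between integers: in this form
  -- it passes to products by multiplication of sums, and it yields the evaluation rule `delta`
  -- directly.
  record Finite (A : Set) : Set where
    field
      _≟_   : DecidableEquality A
      enum  : List A
      once  : ∀ y → ∑[ x ∈ enum ] 𝟙 (x ≟ y) ≡ 1ℤ

    delta : ∀ y (f : A → ℤ) → ∑[ x ∈ enum ] 𝟙 (x ≟ y) * f x ≡ f y
    delta y f = trans (∑-cong enum at) (trans (∑-*ʳ (f y) enum _)
        (trans (cong (_* f y) (once y)) (*-identityˡ (f y))))
      where
      at : ∀ x → 𝟙 (x ≟ y) * f x ≡ 𝟙 (x ≟ y) * f y
      at x with x ≟ y
      ... | yes refl = refl
      ... | no _     = trans (zeroˡ _) (sym (zeroˡ _))

  open Finite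

  -- Both sums are compared with the double sum over the graph of the bijection, so no permutation
  -- of lists has to be constructed.
  reindex : ∀ {A B} (FA : Finite A) (FB : Finite B) (φ : A → B) (ψ : B → A) →
    (∀ x → ψ (φ x) ≡ x) → (∀ y → φ (ψ y) ≡ y) → ∀ (f : B → ℤ) →
    ∑[ x ∈ enum FA ] f (φ x) ≡ ∑ (enum FB) f
  reindex FA FB φ ψ ψφ φψ f = begin
    ∑[ x ∈ enum FA ] f (φ x)
      ≡⟨ (∑-cong (enum FA) λ x → sym (delta FB (φ x) f)) ⟩
    ∑[ x ∈ enum FA ] ∑[ y ∈ enum FB ] 𝟙 (_≟_ FB y (φ x)) * f y
      ≡⟨ ∑-swap (enum FA) (enum FB) _ ⟩
    ∑[ y ∈ enum FB ] ∑[ x ∈ enum FA ] 𝟙 (_≟_ FB y (φ x)) * f y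
      ≡⟨ (∑-cong (enum FB) λ y → ∑-cong (enum FA) λ x → cong (_* f y)
           (𝟙-⇔ (_≟_ FB y (φ x)) (_≟_ FA x (ψ y))
             (λ e → trans (sym (ψφ x)) (cong ψ (sym e))) (λ e → trans (sym (φψ y)) (cong φ (sym e))))) ⟩
    ∑[ y ∈ enum FB ] ∑[ x ∈ enum FA ] 𝟙 (_≟_ FA x (ψ y)) * f y
      ≡⟨ (∑-cong (enum FB) λ y → delta FA (ψ y) (λ _ → f y)) ⟩
    ∑ (enum FB) f ∎
    where open ≡-Reasoning

  count-∉ : ∀ (_≟_ : DecidableEquality A) (xs : List A) y → All (λ x → ¬ y ≡ x) xs →
    ∑[ x ∈ xs ] 𝟙 (x ≟ y) ≡ 0ℤ
  count-∉ _≟_ []       y All.[]       = refl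
  count-∉ _≟_ (x ∷ xs) y (n All.∷ ns) =
    trans (cong₂ _+_ (𝟙-no (x ≟ y) λ e → n (sym e)) (count-∉ _≟_ xs y ns)) (+-identityˡ 0ℤ)

  count-∈ : ∀ (_≟_ : DecidableEquality A) (xs : List A) {y} → Unique xs → y ∈ xs →
    ∑[ x ∈ xs ] 𝟙 (x ≟ y) ≡ 1ℤ
  count-∈ _≟_ (x ∷ xs) {y} (n ∷ u) (here refl) =
    trans (cong₂ _+_ (𝟙-yes (x ≟ y) refl) (count-∉ _≟_ xs y n)) (+-identityʳ 1ℤ)
  count-∈ _≟_ (x ∷ xs) {y} (n ∷ u) (there p) =
    trans (cong₂ _+_ (𝟙-no (x ≟ y) λ e → All.lookup n p e) (count-∈ _≟_ xs u p)) (+-identityˡ 1ℤ)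

  count≤1 : ∀ (_≟_ : DecidableEquality A) (xs : List A) y → Unique xs →
    ∑[ x ∈ xs ] 𝟙 (x ≟ y) ≤ 1ℤ
  count≤1 _≟_ []       y _       = 0≤1
  count≤1 _≟_ (x ∷ xs) y (n ∷ u) with x ≟ y
  ... | yes refl = ≤-reflexive (trans (cong (1ℤ +_) (count-∉ _≟_ xs x n)) (+-identityʳ 1ℤ))
  ... | no _     = ≤-trans (≤-reflexive (+-identityˡ _)) (count≤1 _≟_ xs y u)

  ∑-swap₁ : ∀ (xs : List A) (ys : List B) (f : A → B → ℤ) {g : B → ℤ} →
    (∀ y → ∑[ x ∈ xs ] f x y ≡ g y) → ∑[ x ∈ xs ] ∑[ y ∈ ys ] f x y ≡ ∑ ys g
  ∑-swap₁ xs ys f h = trans (∑-swap xs ys f) (∑-cong ys h)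

  term≤∑ : ∀ (xs : List A) {f : A → ℤ} {y} → (∀ x → 0ℤ ≤ f x) → y ∈ xs → f y ≤ ∑ xs f
  term≤∑ (x ∷ xs) {f} h (here refl) = ≤-trans (≤-reflexive (sym (+-identityʳ (f x))))
    (+-mono-≤ ≤-refl (∑-nonneg xs h))
  term≤∑ (x ∷ xs) {f} {y} h (there p) = ≤-trans (≤-reflexive (sym (+-identityˡ (f y))))
    (+-mono-≤ (h x) (term≤∑ xs h p))

  0≤∑𝟙 : ∀ {P : A → Set} (xs : List A) (P? : ∀ x → Dec (P x)) → 0ℤ ≤ ∑[ x ∈ xs ] 𝟙 (P? x)
  0≤∑𝟙 xs P? = ∑-nonneg xs λ x → 𝟙-nonneg (P? x)

  infixr 8 _^′_

  _^′_ : ℤ → ℕ → ℤ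
  i ^′ zero  = 1ℤ
  i ^′ suc n = i * i ^′ n

  0≤^ : ∀ {i} n → 0ℤ ≤ i → 0ℤ ≤ i ^′ n
  0≤^ zero    p = 0≤1
  0≤^ (suc n) p = 0≤m*n p (0≤^ n p)

  -- Bernoulli's inequality (α/β)^k ≥ 1 + k/β with the denominators cleared, so that β = 0 is
  -- allowed.
  bernoulli : ∀ {α β} → 0ℤ ≤ β → β + 1ℤ ≤ α → ∀ k → β ^′ k * (β + pos k) ≤ α ^′ k * β
  bernoulli {α} {β} p q zero    = ≤-reflexive (cong (1ℤ *_) (+-identityʳ β))
  bernoulli {α} {β} p q (suc k) = ≤-trans
    (≤-trans (≤-reflexive (cong (λ z → β * β ^′ k * (β + z)) (pos-+ 1 k)))
      (from-diff {k = β ^′ k * pos k} (solve 3 (λ b x k →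
        ((b :+ con 1ℤ) :* (x :* (b :+ k))) :- (b :* x :* (b :+ (con 1ℤ :+ k))) := x :* k) refl β (β ^′ k) (pos k))
        (0≤m*n (0≤^ k p) (0≤pos k))))
    (≤-trans (*-mono (0≤i+j p 0≤1) (0≤m*n (0≤^ k 0≤α) p) ≤-refl (bernoulli p q k))
      (≤-trans (*-monoʳ (0≤m*n (0≤^ k 0≤α) p) q) (≤-reflexive (sym (*-assoc α (α ^′ k) β)))))
    where
    0≤α : 0ℤ ≤ α
    0≤α = ≤-trans (0≤i+j p 0≤1) q

  -- A positive integer Λ is at least 1, hence α^k would stay below c · b^k for every k, although α
  -- exceeds b.
  geometric-limit : ∀ {α b c Λ} → pos b + 1ℤ ≤ α →
    (∀ k → α ^′ k * Λ ≤ (pos b) ^′ k * pos c) → Λ ≤ 0ℤ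
  geometric-limit {α} {b} {c} {Λ} q h = ≮⇒≥ λ Λ>0 → absurd b q h (i<j⇒suc[i]≤j Λ>0)
    where
    absurd : ∀ b → pos b + 1ℤ ≤ α → (∀ k → α ^′ k * Λ ≤ (pos b) ^′ k * pos c) → 1ℤ ≤ Λ → ⊥
    -- For b = 0 Bernoulli's inequality is void; already k = 1 gives 1 ≤ α Λ ≤ 0.
    absurd zero q h 1≤Λ = ≤⇒≯ (≤-trans (≤-trans (≤-trans (≤-reflexive (sym (*-identityˡ 1ℤ)))
        (*-mono 0≤1 (≤-trans 0≤1 1≤Λ) (≤-trans (≤-trans (≤-reflexive (sym (+-identityˡ 1ℤ))) q)
          (≤-reflexive (sym (*-identityʳ α)))) 1≤Λ)) (h 1))
        (≤-reflexive (trans (cong (_* pos c) (zeroˡ 1ℤ)) (zeroˡ (pos c))))) (+<+ (ℕ.s≤s ℕ.z≤n))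
    absurd b′@(suc b₀) q h 1≤Λ = ≤⇒≯ (*-cancelˡ 0<β^k chain) (i<i+1 _)
      where
      β = pos b′
      -- With this k: (k + 1) β^k ≤ (β + k) β^k ≤ α^k β ≤ c β β^k = k β^k, which is absurd.
      k = b′ ℕ.* c
      0≤α : 0ℤ ≤ α
      0≤α = ≤-trans (0≤i+j (0≤pos b′) 0≤1) q
      0<^ : ∀ n → 0ℤ < β ^′ n
      0<^ zero    = +<+ (ℕ.s≤s ℕ.z≤n)
      0<^ (suc n) = 0<m*n (+<+ (ℕ.s≤s ℕ.z≤n)) (0<^ n)
      0<β^k : 0ℤ < β ^′ k
      0<β^k = 0<^ k
      chain : β ^′ k * (pos k + 1ℤ) ≤ β ^′ k * pos k
      chain = ≤-trans (*-monoˡ (<⇒≤ 0<β^k) (≤-trans (+-mono-≤ ≤-refl (+≤+ (ℕ.s≤s ℕ.z≤n))) (≤-reflexive (solve 2 (λ k b → k :+ b := b :+ k) refl (pos k) β))))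
        (≤-trans (bernoulli (0≤pos b′) q k)
        (≤-trans (*-monoʳ (0≤pos b′) (≤-trans (≤-reflexive (sym (*-identityʳ _)))
          (≤-trans (*-monoˡ (0≤^ k 0≤α) 1≤Λ) (h k))))
        (≤-reflexive (trans (solve 3 (λ x c b → x :* c :* b := x :* (b :* c)) refl (β ^′ k) (pos c) β)
          (cong (β ^′ k *_) (sym (pos-* b′ c)))))))

  to-diff : ∀ {i j} → i ≤ j → 0ℤ ≤ j - i
  to-diff {i} {j} p = ≤-trans (≤-reflexive (sym (-‿inverseʳ i))) (+-mono-≤ p ≤-refl)

  occurs : ∀ (_≟_ : DecidableEquality A) (xs : List A) {y} → ∑[ x ∈ xs ] 𝟙 (x ≟ y) ≡ 1ℤ → y ∈ xs
  occurs _≟_ (x ∷ xs) {y} e with x ≟ y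
  ... | yes refl = here refl
  ... | no _     = there (occurs _≟_ xs (trans (sym (+-identityˡ _)) e))

  𝟙-× : ∀ {P Q R : Set} (d : Dec P) (e : Dec Q) (c : Dec R) → (R → P) → (R → Q) → (P → Q → R) →
    𝟙 c ≡ 𝟙 d * 𝟙 e
  𝟙-× (yes p) (yes q) c f g h = trans (𝟙-yes c (h p q)) (sym (*-identityˡ 1ℤ))
  𝟙-× (yes p) (no ¬q) c f g h = trans (𝟙-no c λ r → ¬q (g r)) (sym (*-identityˡ 0ℤ))
  𝟙-× (no ¬p) e       c f g h = trans (𝟙-no c λ r → ¬p (f r)) (sym (zeroˡ (𝟙 e)))

  𝟙-mono : ∀ {P Q : Set} (d : Dec P) (e : Dec Q) → (P → Q) → 𝟙 d ≤ 𝟙 e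
  𝟙-mono (yes p) e f = ≤-reflexive (sym (𝟙-yes e (f p)))
  𝟙-mono (no _)  e f = 𝟙-nonneg e

  1-𝟙≤1 : ∀ {P : Set} (d : Dec P) → 1ℤ - 𝟙 d ≤ 1ℤ
  1-𝟙≤1 d = from-diff {k = 𝟙 d} (solve 1 (λ x → con 1ℤ :- (con 1ℤ :- x) := x) refl (𝟙 d)) (𝟙-nonneg d)

-- Quasirandomness from an abelian group action, without characters

module Mixing where
  open Integers
  open Sums
  open import Data.List.Base using ([]; _∷_)

  -- The model is V acting by right translation on the matrices of a fixed determinant. Invariance
  -- of sums over X under V is all that is asked of the list X at this stage.
  module Action
    {M V : Set} (FV : Finite V)
    {_⊕_ : V → V → V} {0v : V} {⊖_ : V → V} (isAb : IsAbelianGroup _≡_ _⊕_ 0v ⊖_)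
    (X : List M) (_·_ : M → V → M)
    (·-⊕ : ∀ x u v → (x · u) · v ≡ x · (u ⊕ v))
    (∑-· : ∀ v (f : M → ℤ) → ∑[ x ∈ X ] f (x · v) ≡ ∑ X f)
    where

    open IsAbelianGroup isAb using (assoc; comm; identityˡ; identityʳ; inverseˡ; inverseʳ)
    open ≡-Reasoning

    Vs : List V
    Vs = Finite.enum FV

    ∣V∣ : ℤ
    ∣V∣ = pos (length Vs)

    cancel : ∀ u w → u ⊕ ((⊖ u) ⊕ w) ≡ w
    cancel u w = trans (sym (assoc u (⊖ u) w)) (trans (cong (_⊕ w) (inverseʳ u)) (identityˡ w))

    cancel′ : ∀ u w → (⊖ u) ⊕ (u ⊕ w) ≡ w
    cancel′ u w = trans (sym (assoc (⊖ u) u w)) (trans (cong (_⊕ w) (inverseˡ u)) (identityˡ w))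

    ∑-⊕ : ∀ u (f : V → ℤ) → ∑[ w ∈ Vs ] f (u ⊕ w) ≡ ∑ Vs f
    ∑-⊕ u f = reindex FV FV (u ⊕_) ((⊖ u) ⊕_) (cancel′ u) (cancel u) f

    ∑-⊖ : ∀ (f : V → ℤ) → ∑[ w ∈ Vs ] f (⊖ w) ≡ ∑ Vs f
    ∑-⊖ f = reindex FV FV ⊖_ ⊖_ inv-inv inv-inv f
      where
      inv-inv : ∀ w → ⊖ (⊖ w) ≡ w
      inv-inv w = trans (sym (cancel w (⊖ (⊖ w))))
        (trans (cong (w ⊕_) (inverseʳ (⊖ w))) (identityʳ w))

    corr : (M → ℤ) → (M → ℤ) → V → ℤ
    corr φ ψ w = ∑[ y ∈ X ] φ y * ψ (y · w)

    shift : ∀ φ ψ u w → ∑[ y ∈ X ] φ (y · u) * ψ (y · w) ≡ corr φ ψ ((⊖ u) ⊕ w)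
    shift φ ψ u w = trans
      (∑-cong X λ y → cong (λ z → φ (y · u) * ψ z)
        (sym (trans (·-⊕ y u _) (cong (y ·_) (cancel u w)))))
      (∑-· u λ y → φ y * ψ (y · ((⊖ u) ⊕ w)))

    -- Lagrange's identity in the commutative group ring ℤ[V], in the form
    -- Σ Y(y,z) Y(z,y) ≤ Σ Y(y,z)² for Y(y,z) = Σ_v φ(y·v) ψ(z·(-v)).
    corr-lagrange : ∀ φ ψ →
      ∑[ w ∈ Vs ] corr φ ψ w * corr φ ψ w ≤ ∑[ u ∈ Vs ] corr φ φ u * corr ψ ψ u
    corr-lagrange φ ψ = by-size Vs refl
      where
      Y : M → M → ℤ
      Y y z = ∑[ v ∈ Vs ] φ (y · v) * ψ (z · (⊖ v))

      expand : ∀ (f g : V → ℤ) → ∑ Vs f * ∑ Vs g ≡ ∑[ v ∈ Vs ] ∑[ v′ ∈ Vs ] f v * g v′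
      expand f g = sym (∑-prod Vs Vs f g)

      pull : ∀ (F : M → M → V → V → ℤ) →
        ∑[ y ∈ X ] ∑[ z ∈ X ] ∑[ v ∈ Vs ] ∑[ v′ ∈ Vs ] F y z v v′
        ≡ ∑[ v ∈ Vs ] ∑[ v′ ∈ Vs ] ∑[ y ∈ X ] ∑[ z ∈ X ] F y z v v′
      pull F = begin
        ∑[ y ∈ X ] ∑[ z ∈ X ] ∑[ v ∈ Vs ] ∑[ v′ ∈ Vs ] F y z v v′
          ≡⟨ (∑-cong X λ y → ∑-swap₁ X Vs _ λ v → ∑-swap X Vs _) ⟩
        ∑[ y ∈ X ] ∑[ v ∈ Vs ] ∑[ v′ ∈ Vs ] ∑[ z ∈ X ] F y z v v′
          ≡⟨ (∑-swap₁ X Vs _ λ v → ∑-swap X Vs _) ⟩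
        ∑[ v ∈ Vs ] ∑[ v′ ∈ Vs ] ∑[ y ∈ X ] ∑[ z ∈ X ] F y z v v′ ∎

      swapped : ∑[ y ∈ X ] ∑[ z ∈ X ] Y y z * Y z y ≡ ∣V∣ * (∑[ w ∈ Vs ] corr φ ψ w * corr φ ψ w)
      swapped = begin
        ∑[ y ∈ X ] ∑[ z ∈ X ] Y y z * Y z y
          ≡⟨ (∑-cong X λ y → ∑-cong X λ z → expand _ _) ⟩
        ∑[ y ∈ X ] ∑[ z ∈ X ] ∑[ v ∈ Vs ] ∑[ v′ ∈ Vs ]
          φ (y · v) * ψ (z · (⊖ v)) * (φ (z · v′) * ψ (y · (⊖ v′)))
          ≡⟨ pull _ ⟩
        ∑[ v ∈ Vs ] ∑[ v′ ∈ Vs ] ∑[ y ∈ X ] ∑[ z ∈ X ]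
          φ (y · v) * ψ (z · (⊖ v)) * (φ (z · v′) * ψ (y · (⊖ v′)))
          ≡⟨ (∑-cong Vs λ v → ∑-cong Vs λ v′ → trans
               (∑-cong X λ y → ∑-cong X λ z → solve 4 (λ a b c d →
                  a :* b :* (c :* d) := (a :* d) :* (c :* b)) refl (φ (y · v)) (ψ (z · (⊖ v))) (φ (z · v′)) (ψ (y · (⊖ v′))))
               (∑-prod X X (λ y → φ (y · v) * ψ (y · (⊖ v′))) (λ z → φ (z · v′) * ψ (z · (⊖ v))))) ⟩
        ∑[ v ∈ Vs ] ∑[ v′ ∈ Vs ] (∑[ y ∈ X ] φ (y · v) * ψ (y · (⊖ v′))) * (∑[ z ∈ X ] φ (z · v′) * ψ (z · (⊖ v)))
          ≡⟨ (∑-cong Vs λ v → ∑-cong Vs λ v′ → cong₂ _*_ (shift φ ψ v (⊖ v′))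
               (trans (shift φ ψ v′ (⊖ v)) (cong (corr φ ψ) (comm (⊖ v′) (⊖ v))))) ⟩
        ∑[ v ∈ Vs ] ∑[ v′ ∈ Vs ] κ ((⊖ v) ⊕ (⊖ v′))
          ≡⟨ (∑-cong Vs λ v → trans (∑-⊖ λ v′ → κ ((⊖ v) ⊕ v′)) (∑-⊕ (⊖ v) κ)) ⟩
        ∑[ v ∈ Vs ] ∑ Vs κ
          ≡⟨ ∑-const Vs _ ⟩
        ∣V∣ * ∑ Vs κ ∎
        where
        κ : V → ℤ
        κ w = corr φ ψ w * corr φ ψ w

      squared : ∑[ y ∈ X ] ∑[ z ∈ X ] Y y z * Y y z ≡ ∣V∣ * (∑[ u ∈ Vs ] corr φ φ u * corr ψ ψ u)
      squared = begin
        ∑[ y ∈ X ] ∑[ z ∈ X ] Y y z * Y y z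
          ≡⟨ (∑-cong X λ y → ∑-cong X λ z → expand _ _) ⟩
        ∑[ y ∈ X ] ∑[ z ∈ X ] ∑[ v ∈ Vs ] ∑[ v′ ∈ Vs ]
          φ (y · v) * ψ (z · (⊖ v)) * (φ (y · v′) * ψ (z · (⊖ v′)))
          ≡⟨ pull _ ⟩
        ∑[ v ∈ Vs ] ∑[ v′ ∈ Vs ] ∑[ y ∈ X ] ∑[ z ∈ X ]
          φ (y · v) * ψ (z · (⊖ v)) * (φ (y · v′) * ψ (z · (⊖ v′)))
          ≡⟨ (∑-cong Vs λ v → ∑-cong Vs λ v′ → trans
               (∑-cong X λ y → ∑-cong X λ z → solve 4 (λ a b c d →
                  a :* b :* (c :* d) := (a :* c) :* (d :* b)) refl (φ (y · v)) (ψ (z · (⊖ v))) (φ (y · v′)) (ψ (z · (⊖ v′))))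
               (∑-prod X X (λ y → φ (y · v) * φ (y · v′)) (λ z → ψ (z · (⊖ v′)) * ψ (z · (⊖ v))))) ⟩
        ∑[ v ∈ Vs ] ∑[ v′ ∈ Vs ] (∑[ y ∈ X ] φ (y · v) * φ (y · v′)) * (∑[ z ∈ X ] ψ (z · (⊖ v′)) * ψ (z · (⊖ v)))
          ≡⟨ (∑-cong Vs λ v → ∑-cong Vs λ v′ → cong₂ _*_ (shift φ φ v v′)
               (trans (shift ψ ψ (⊖ v′) (⊖ v)) (cong (corr ψ ψ) (flip v v′)))) ⟩
        ∑[ v ∈ Vs ] ∑[ v′ ∈ Vs ] κ ((⊖ v) ⊕ v′)
          ≡⟨ (∑-cong Vs λ v → ∑-⊕ (⊖ v) κ) ⟩
        ∑[ v ∈ Vs ] ∑ Vs κ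
          ≡⟨ ∑-const Vs _ ⟩
        ∣V∣ * ∑ Vs κ ∎
        where
        κ : V → ℤ
        κ u = corr φ φ u * corr ψ ψ u
        flip : ∀ v v′ → (⊖ (⊖ v′)) ⊕ (⊖ v) ≡ (⊖ v) ⊕ v′
        flip v v′ = trans (comm _ (⊖ v)) (cong ((⊖ v) ⊕_)
          (trans (sym (cancel v′ (⊖ (⊖ v′)))) (trans (cong (v′ ⊕_) (inverseʳ (⊖ v′))) (identityʳ v′))))

      am-gm : ∑[ y ∈ X ] ∑[ z ∈ X ] Y y z * Y z y ≤ ∑[ y ∈ X ] ∑[ z ∈ X ] Y y z * Y y z
      am-gm = *-cancelˡ 0<2 (from-diff (sym (begin
        ∑[ y ∈ X ] ∑[ z ∈ X ] (Y y z - Y z y) * (Y y z - Y z y)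
          ≡⟨ (∑-cong X λ y → ∑-cong X λ z → solve 2 (λ a b →
               (a :- b) :* (a :- b) := (a :* a :+ b :* b) :- con (pos 2) :* (a :* b)) refl (Y y z) (Y z y)) ⟩
        ∑[ y ∈ X ] ∑[ z ∈ X ] ((Y y z * Y y z + Y z y * Y z y) - pos 2 * (Y y z * Y z y))
          ≡⟨ (∑-cong X λ y → trans (∑-− X _ _) (cong₂ _-_ (∑-+ X _ _) (∑-*ˡ (pos 2) X _))) ⟩
        ∑[ y ∈ X ] ((∑[ z ∈ X ] Y y z * Y y z) + (∑[ z ∈ X ] Y z y * Y z y) - pos 2 * (∑[ z ∈ X ] Y y z * Y z y))
          ≡⟨ trans (∑-− X _ _) (cong₂ _-_ (trans (∑-+ X _ _) (cong ((∑[ y ∈ X ] ∑[ z ∈ X ] Y y z * Y y z) +_) (∑-swap X X _))) (∑-*ˡ (pos 2) X _)) ⟩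
        ((∑[ y ∈ X ] ∑[ z ∈ X ] Y y z * Y y z) + (∑[ y ∈ X ] ∑[ z ∈ X ] Y y z * Y y z)) - pos 2 * (∑[ y ∈ X ] ∑[ z ∈ X ] Y y z * Y z y)
          ≡⟨ solve 2 (λ a b → (a :+ a) :- con (pos 2) :* b := con (pos 2) :* a :- con (pos 2) :* b) refl _ _ ⟩
        pos 2 * (∑[ y ∈ X ] ∑[ z ∈ X ] Y y z * Y y z) - pos 2 * (∑[ y ∈ X ] ∑[ z ∈ X ] Y y z * Y z y) ∎))
        (∑-nonneg X λ y → ∑-nonneg X λ z → 0≤sq (Y y z - Y z y)))

      by-size : ∀ vs → vs ≡ Vs →
        ∑[ w ∈ Vs ] corr φ ψ w * corr φ ψ w ≤ ∑[ u ∈ Vs ] corr φ φ u * corr ψ ψ u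
      by-size [] refl = ≤-refl
      by-size (x ∷ vs) e = *-cancelˡ (subst (λ l → 0ℤ < pos (length l)) e (+<+ (ℕ.s≤s ℕ.z≤n)))
        (subst₂ _≤_ swapped squared am-gm)

    -- |V| times the orthogonal projection onto the V-invariant functions; `fluct` below is |V|
    -- times the complementary projection, and `pythagoras` expresses their orthogonality.
    E : (M → ℤ) → M → ℤ
    E g x = ∑[ w ∈ Vs ] g (x · w)

    N : (M → ℤ) → ℤ
    N g = ∑[ x ∈ X ] g x * g x

    N-cong : ∀ {f g} → (∀ x → f x ≡ g x) → N f ≡ N g
    N-cong h = ∑-cong X λ x → cong₂ _*_ (h x) (h x)

    0≤N : ∀ g → 0ℤ ≤ N g
    0≤N g = ∑-nonneg X λ x → 0≤sq (g x)

    E-· : ∀ g x v → E g (x · v) ≡ E g x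
    E-· g x v = trans (∑-cong Vs λ w → cong g (·-⊕ x v w)) (∑-⊕ v λ w → g (x · w))

    N-E : ∀ k → N (E k) ≡ ∣V∣ * (∑[ x ∈ X ] k x * E k x)
    N-E k = begin
      ∑[ x ∈ X ] E k x * E k x
        ≡⟨ (∑-cong X λ x → sym (∑-*ˡ (E k x) Vs _)) ⟩
      ∑[ x ∈ X ] ∑[ w ∈ Vs ] E k x * k (x · w)
        ≡⟨ (∑-swap₁ X Vs _ λ w → trans
              (∑-cong X λ x → trans (cong (_* k (x · w)) (sym (E-· k x w))) (*-comm _ _))
              (∑-· w λ x → k x * E k x)) ⟩
      ∑[ w ∈ Vs ] ∑[ x ∈ X ] k x * E k x
        ≡⟨ ∑-const Vs _ ⟩
      ∣V∣ * (∑[ x ∈ X ] k x * E k x) ∎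

    fluct : (M → ℤ) → M → ℤ
    fluct k x = ∣V∣ * k x - E k x

    pythagoras : ∀ k → N (fluct k) ≡ ∣V∣ * ∣V∣ * N k - N (E k)
    pythagoras k = begin
      ∑[ x ∈ X ] fluct k x * fluct k x
        ≡⟨ (∑-cong X λ x → solve 3 (λ v a b → (v :* a :- b) :* (v :* a :- b) :=
              (v :* v :* (a :* a) :+ b :* b) :- con (pos 2) :* v :* (a :* b)) refl ∣V∣ (k x) (E k x)) ⟩
      ∑[ x ∈ X ] (∣V∣ * ∣V∣ * (k x * k x) + E k x * E k x - pos 2 * ∣V∣ * (k x * E k x))
        ≡⟨ trans (∑-− X _ _) (cong₂ _-_ (trans (∑-+ X _ _) (cong (_+ N (E k)) (∑-*ˡ (∣V∣ * ∣V∣) X _))) (∑-*ˡ (pos 2 * ∣V∣) X _)) ⟩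
      (∣V∣ * ∣V∣ * N k + N (E k)) - pos 2 * ∣V∣ * (∑[ x ∈ X ] k x * E k x)
        ≡⟨ cong (λ z → (∣V∣ * ∣V∣ * N k + z) - pos 2 * ∣V∣ * (∑[ x ∈ X ] k x * E k x)) (N-E k) ⟩
      (∣V∣ * ∣V∣ * N k + ∣V∣ * (∑[ x ∈ X ] k x * E k x)) - pos 2 * ∣V∣ * (∑[ x ∈ X ] k x * E k x)
        ≡⟨ solve 3 (λ v n c → (v :* v :* n :+ v :* c) :- con (pos 2) :* v :* c := v :* v :* n :- v :* c) refl ∣V∣ (N k) _ ⟩
      ∣V∣ * ∣V∣ * N k - ∣V∣ * (∑[ x ∈ X ] k x * E k x)
        ≡⟨ cong (λ z → ∣V∣ * ∣V∣ * N k - z) (sym (N-E k)) ⟩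
      ∣V∣ * ∣V∣ * N k - N (E k) ∎

    E-fluct : ∀ k x → E (fluct k) x ≡ 0ℤ
    E-fluct k x = begin
      ∑[ w ∈ Vs ] (∣V∣ * k (x · w) - E k (x · w))
        ≡⟨ trans (∑-− Vs _ _) (cong₂ _-_ (∑-*ˡ ∣V∣ Vs _) (trans (∑-cong Vs λ w → E-· k x w) (∑-const Vs (E k x)))) ⟩
      ∣V∣ * E k x - ∣V∣ * E k x
        ≡⟨ -‿inverseʳ _ ⟩
      0ℤ ∎

    ∑-E : ∀ k → ∑ X (E k) ≡ ∣V∣ * ∑ X k
    ∑-E k = trans (∑-swap₁ X Vs _ λ w → ∑-· w k) (∑-const Vs _)

    -- The norm lost under `E` is rewritten as squared differences along V-orbits; in this form it
    -- can be related to paths between points of X.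
    dirichlet : ∀ k → ∣V∣ * (∑[ x ∈ X ] ∑[ w ∈ Vs ] (k x - k (x · w)) * (k x - k (x · w)))
      ≡ pos 2 * (∣V∣ * ∣V∣ * N k - N (E k))
    dirichlet k = begin
      ∣V∣ * (∑[ x ∈ X ] ∑[ w ∈ Vs ] (k x - k (x · w)) * (k x - k (x · w)))
        ≡⟨ cong (∣V∣ *_) (∑-cong X λ x → ∑-cong Vs λ w → solve 2 (λ a b →
             (a :- b) :* (a :- b) := (a :* a :+ b :* b) :- con (pos 2) :* (a :* b)) refl (k x) (k (x · w))) ⟩
      ∣V∣ * (∑[ x ∈ X ] ∑[ w ∈ Vs ] (k x * k x + k (x · w) * k (x · w) - pos 2 * (k x * k (x · w))))
        ≡⟨ cong (∣V∣ *_) (∑-cong X λ x → trans (∑-− Vs _ _) (cong₂ _-_ (trans (∑-+ Vs _ _) (cong (λ z → z + (∑[ w ∈ Vs ] k (x · w) * k (x · w))) (∑-const Vs _)))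
             (trans (∑-*ˡ (pos 2) Vs _) (cong (pos 2 *_) (∑-*ˡ (k x) Vs _))))) ⟩
      ∣V∣ * (∑[ x ∈ X ] (∣V∣ * (k x * k x) + (∑[ w ∈ Vs ] k (x · w) * k (x · w)) - pos 2 * (k x * E k x)))
        ≡⟨ cong (∣V∣ *_) (trans (∑-− X _ _) (cong₂ _-_ (trans (∑-+ X _ _) (cong₂ _+_ (∑-*ˡ ∣V∣ X _)
             (trans (∑-swap₁ X Vs _ λ w → ∑-· w λ x → k x * k x) (∑-const Vs _)))) (∑-*ˡ (pos 2) X _))) ⟩
      ∣V∣ * ((∣V∣ * N k + ∣V∣ * N k) - pos 2 * (∑[ x ∈ X ] k x * E k x))
        ≡⟨ solve 3 (λ v n c → v :* ((v :* n :+ v :* n) :- con (pos 2) :* c) :=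
             con (pos 2) :* (v :* v :* n :- v :* c)) refl ∣V∣ (N k) _ ⟩
      pos 2 * (∣V∣ * ∣V∣ * N k - ∣V∣ * (∑[ x ∈ X ] k x * E k x))
        ≡⟨ cong (λ z → pos 2 * (∣V∣ * ∣V∣ * N k - z)) (sym (N-E k)) ⟩
      pos 2 * (∣V∣ * ∣V∣ * N k - N (E k)) ∎

    module Averaging
      (_≟_ : DecidableEquality M)
      (once : ∀ {y} → y ∈ X → ∑[ x ∈ X ] 𝟙 (x ≟ y) ≡ 1ℤ)
      (·-0 : ∀ x → x · 0v ≡ x)
      (·-∈ : ∀ {x} v → x ∈ X → (x · v) ∈ X)
      {A : Set} (As : List A) (_▹_ : A → M → M)
      (▹-∈ : ∀ {a x} → a ∈ As → x ∈ X → (a ▹ x) ∈ X)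
      (▹-∑ : ∀ {a} → a ∈ As → (f : M → ℤ) → ∑[ x ∈ X ] f (a ▹ x) ≡ ∑ X f)
      (▹-· : ∀ a x v → a ▹ (x · v) ≡ (a ▹ x) · v)
      (free : ∀ {x} → x ∈ X → ∑[ a ∈ As ] ∑[ b ∈ As ] 𝟙 ((b ▹ x) ≟ (a ▹ x)) ≡ pos (length As))
      where

      ∣A∣ ∣X∣ : ℤ
      ∣A∣ = pos (length As)
      ∣X∣ = pos (length X)

      Sᴬ : (M → ℤ) → M → ℤ
      Sᴬ g t = ∑[ a ∈ As ] g (a ▹ t)

      s : (M → ℤ) → ℤ
      s g = N (Sᴬ g)

      δ-∑ : ∀ {y} → y ∈ X → (f : M → ℤ) → ∑[ x ∈ X ] 𝟙 (x ≟ y) * f x ≡ f y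
      δ-∑ {y} p f = trans (∑-cong X at) (trans (∑-*ʳ (f y) X _)
          (trans (cong (_* f y) (once p)) (*-identityˡ (f y))))
        where
        at : ∀ x → 𝟙 (x ≟ y) * f x ≡ 𝟙 (x ≟ y) * f y
        at x with x ≟ y
        ... | yes refl = refl
        ... | no _     = trans (zeroˡ _) (sym (zeroˡ _))

      Sᴬ-E : ∀ g t → Sᴬ (E g) t ≡ E (Sᴬ g) t
      Sᴬ-E g t = trans (∑-swap As Vs _)
        (∑-cong Vs λ w → ∑-cong As λ a → cong g (sym (▹-· a t w)))

      Sᴬ-fluct : ∀ g t → Sᴬ (fluct g) t ≡ fluct (Sᴬ g) t
      Sᴬ-fluct g t = trans (∑-− As _ _) (cong₂ _-_ (∑-*ˡ ∣V∣ As _) (Sᴬ-E g t))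

      s-split : ∀ g → ∣V∣ * ∣V∣ * s g ≡ s (fluct g) + s (E g)
      s-split g = begin
        ∣V∣ * ∣V∣ * s g
          ≡⟨ solve 2 (λ a b → a := (a :- b) :+ b) refl _ (N (E (Sᴬ g))) ⟩
        (∣V∣ * ∣V∣ * N (Sᴬ g) - N (E (Sᴬ g))) + N (E (Sᴬ g))
          ≡⟨ cong₂ _+_ (sym (trans (N-cong (Sᴬ-fluct g)) (pythagoras (Sᴬ g)))) (sym (N-cong (Sᴬ-E g))) ⟩
        s (fluct g) + s (E g) ∎

      -- Cauchy-Schwarz in a. This trivial estimate serves as the start of the iteration that
      -- improves it.
      young : ∀ g → s g ≤ ∣A∣ * ∣A∣ * N g
      young g = ≤-trans (∑-mono X λ t → ≤-trans
          (≤-reflexive (cong₂ _*_ (sym (∑-cong As λ a → *-identityˡ _)) (sym (∑-cong As λ a → *-identityˡ _))))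
          (cauchy-schwarz As (λ _ → 1ℤ) (λ a → g (a ▹ t))))
        (≤-reflexive (begin
          ∑[ t ∈ X ] (∑[ a ∈ As ] 1ℤ * 1ℤ) * (∑[ a ∈ As ] g (a ▹ t) * g (a ▹ t))
            ≡⟨ ∑-*ˡ _ X _ ⟩
          (∑[ a ∈ As ] 1ℤ * 1ℤ) * (∑[ t ∈ X ] ∑[ a ∈ As ] g (a ▹ t) * g (a ▹ t))
            ≡⟨ cong₂ _*_ (trans (∑-cong As λ _ → *-identityˡ 1ℤ) (∑-one As))
                 (trans (∑-swap X As _) (trans (∑-cong∈ As λ p → ▹-∑ p λ x → g x * g x) (∑-const As _))) ⟩
          ∣A∣ * (∣A∣ * N g)
            ≡⟨ sym (*-assoc ∣A∣ ∣A∣ (N g)) ⟩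
          ∣A∣ * ∣A∣ * N g ∎))

      -- `R h` models right translation by an element that normalises V, and `ρ h` the automorphism
      -- induced on V; `uniform` says that the vectors `ρ h u` are equidistributed among the nonzero
      -- ones.
      module Transitive
        {H : Set} (L : List H) (R : H → M → M) (ρ : H → V → V)
        (R-· : ∀ {h} → h ∈ L → ∀ x v → R h (x · v) ≡ R h x · ρ h v)
        (R-▹ : ∀ h a x → R h (a ▹ x) ≡ a ▹ R h x)
        (R-∑ : ∀ {h} → h ∈ L → (f : M → ℤ) → ∑[ x ∈ X ] f (R h x) ≡ ∑ X f)
        (ρ-0 : ∀ h → ρ h 0v ≡ 0v)
        (uniform : ∀ u → u ≢ 0v → (Ψ : V → ℤ) →
          (∣V∣ - 1ℤ) * (∑[ h ∈ L ] Ψ (ρ h u)) ≡ pos (length L) * (∑ Vs Ψ - Ψ 0v))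
        (0<L : 0ℤ < pos (length L)) (1<V : 0ℤ < ∣V∣ - 1ℤ)
        where

        ∣L∣ : ℤ
        ∣L∣ = pos (length L)

        module _ (γ : M → ℤ) (Eγ : ∀ x → E γ x ≡ 0ℤ) where

          -- The indicator function of the translate A t. It turns the sum over A into an inner
          -- product on X, hence into a value of `corr`.
          φ : M → M → ℤ
          φ t y = ∑[ a ∈ As ] 𝟙 (y ≟ (a ▹ t))

          φ-∑ : ∀ {t} → t ∈ X → (f : M → ℤ) → ∑[ y ∈ X ] φ t y * f y ≡ ∑[ a ∈ As ] f (a ▹ t)
          φ-∑ {t} t∈ f = begin
            ∑[ y ∈ X ] φ t y * f y
              ≡⟨ (∑-cong X λ y → sym (∑-*ʳ (f y) As _)) ⟩
            ∑[ y ∈ X ] ∑[ a ∈ As ] 𝟙 (y ≟ (a ▹ t)) * f y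
              ≡⟨ ∑-swap X As _ ⟩
            ∑[ a ∈ As ] ∑[ y ∈ X ] 𝟙 (y ≟ (a ▹ t)) * f y
              ≡⟨ (∑-cong∈ As λ p → δ-∑ (▹-∈ p t∈) f) ⟩
            ∑[ a ∈ As ] f (a ▹ t) ∎

          Ψ : V → ℤ
          Ψ = corr γ γ

          Ψ-0 : Ψ 0v ≡ N γ
          Ψ-0 = ∑-cong X λ y → cong (λ z → γ y * γ z) (·-0 y)

          ∑-Ψ : ∑ Vs Ψ ≡ 0ℤ
          ∑-Ψ = trans (∑-swap Vs X _) (∑-zero′ X λ y →
            trans (∑-*ˡ (γ y) Vs _) (trans (cong (γ y *_) (Eγ y)) (zeroʳ (γ y))))

          0≤φφ : ∀ t u → 0ℤ ≤ corr (φ t) (φ t) u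
          0≤φφ t u = ∑-nonneg X λ y → 0≤m*n (0≤∑𝟙 As _) (0≤∑𝟙 As _)

          φφ-0 : ∀ {t} → t ∈ X → corr (φ t) (φ t) 0v ≡ ∣A∣
          φφ-0 {t} t∈ = trans (φ-∑ t∈ λ y → φ t (y · 0v))
            (trans (∑-cong As λ a → cong (φ t) (·-0 (a ▹ t)))
              (trans (∑-swap As As _) (free′ t∈)))
            where
            free′ : ∀ {t} → t ∈ X → ∑[ b ∈ As ] ∑[ a ∈ As ] 𝟙 ((a ▹ t) ≟ (b ▹ t)) ≡ ∣A∣
            free′ = free

          -- `s γ` does not change when t is replaced by `R h (t · w)`. Summing over w makes Σ_w
          -- `corr (φ t) ψ w`² appear, with ψ = γ ∘ `R h`; Lagrange's identity then separates φ from
          -- ψ, and the autocorrelation of ψ at u is that of γ at `ρ h u`.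
          per-h : ∀ {h} → h ∈ L →
            ∣V∣ * s γ ≤ ∑[ t ∈ X ] ∑[ u ∈ Vs ] corr (φ t) (φ t) u * Ψ (ρ h u)
          per-h {h} h∈ = ≤-trans (≤-reflexive average) (∑-mono∈ X λ {t} t∈ → ≤-trans
            (≤-reflexive (∑-cong Vs λ w → cong (λ z → z * z) (at t∈ w)))
            (≤-trans (corr-lagrange (φ t) ψ) (≤-reflexive (∑-cong Vs λ u → cong (corr (φ t) (φ t) u *_) (ψψ u)))))
            where
            ψ : M → ℤ
            ψ y = γ (R h y)
            F : M → ℤ
            F t = Sᴬ γ t * Sᴬ γ t
            average : ∣V∣ * s γ ≡ ∑[ t ∈ X ] ∑[ w ∈ Vs ] F (R h (t · w))
            average = sym (trans (∑-swap₁ X Vs _ λ w → trans (∑-· w λ t → F (R h t)) (R-∑ h∈ F)) (∑-const Vs _))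
            at : ∀ {t} → t ∈ X → ∀ w → Sᴬ γ (R h (t · w)) ≡ corr (φ t) ψ w
            at {t} t∈ w = sym (trans (φ-∑ t∈ λ y → ψ (y · w)) (∑-cong As λ a → cong γ
              (trans (cong (R h) (sym (▹-· a t w))) (R-▹ h a (t · w)))))
            ψψ : ∀ u → corr ψ ψ u ≡ Ψ (ρ h u)
            ψψ u = trans (∑-cong X λ y → cong (λ z → γ (R h y) * γ z) (R-· h∈ y u))
              (R-∑ h∈ λ y → γ y * γ (y · ρ h u))

          per-u : ∀ u → (∣V∣ - 1ℤ) * (∑[ h ∈ L ] Ψ (ρ h u))
            ≤ 𝟙 (Finite._≟_ FV u 0v) * ((∣V∣ - 1ℤ) * (∣L∣ * N γ))
          per-u u with Finite._≟_ FV u 0v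
          ... | yes refl = ≤-reflexive (trans (cong ((∣V∣ - 1ℤ) *_) (trans
                  (∑-cong L λ h → trans (cong Ψ (ρ-0 h)) Ψ-0) (∑-const L _))) (sym (*-identityˡ _)))
          ... | no u≢0 = ≤-trans (≤-reflexive (trans (uniform u u≢0 Ψ) (trans (cong₂ (λ a b → ∣L∣ * (a - b)) ∑-Ψ Ψ-0)
                   (solve 2 (λ l n → l :* (con 0ℤ :- n) := :- (l :* n)) refl ∣L∣ (N γ)))))
                 (≤-trans (≤-trans (neg-mono-≤ (0≤m*n (<⇒≤ 0<L) (0≤N γ)))
                   (≤-reflexive (solve 0 (:- con 0ℤ := con 0ℤ) refl))) (≤-reflexive (sym (zeroˡ _))))

          -- After averaging `per-h` over h only u = 0 is left, where the two autocorrelations are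
          -- |A| and `N γ`. The weights at u ≠ 0 are autocorrelations of a nonnegative function,
          -- which is why dropping them is legitimate.
          key : ∣V∣ * s γ ≤ ∣X∣ * ∣A∣ * N γ
          key = *-cancelˡ 0<L (*-cancelˡ 1<V (≤-trans (≤-trans (≤-reflexive lhs) (*-monoˡ (<⇒≤ 1<V) (∑-mono∈ L per-h)))
              (≤-trans (≤-reflexive rearrange) (≤-trans
                (∑-mono X λ t → ∑-mono Vs λ u → *-monoˡ (0≤φφ t u) (per-u u))
                (≤-reflexive final)))))
            where
            lhs : (∣V∣ - 1ℤ) * (∣L∣ * (∣V∣ * s γ)) ≡ (∣V∣ - 1ℤ) * (∑[ h ∈ L ] ∣V∣ * s γ)
            lhs = cong ((∣V∣ - 1ℤ) *_) (sym (∑-const L _))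
            rearrange : (∣V∣ - 1ℤ) * (∑[ h ∈ L ] ∑[ t ∈ X ] ∑[ u ∈ Vs ] corr (φ t) (φ t) u * Ψ (ρ h u))
              ≡ ∑[ t ∈ X ] ∑[ u ∈ Vs ] corr (φ t) (φ t) u * ((∣V∣ - 1ℤ) * (∑[ h ∈ L ] Ψ (ρ h u)))
            rearrange = trans (cong ((∣V∣ - 1ℤ) *_) (trans (∑-swap L X _) (∑-cong X λ t → ∑-swap L Vs _)))
              (trans (sym (∑-*ˡ (∣V∣ - 1ℤ) X _)) (∑-cong X λ t → trans (sym (∑-*ˡ (∣V∣ - 1ℤ) Vs _))
                (∑-cong Vs λ u → trans (cong ((∣V∣ - 1ℤ) *_) (∑-*ˡ _ L _))
                  (solve 3 (λ a b c → a :* (b :* c) := b :* (a :* c)) refl (∣V∣ - 1ℤ) _ _))))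
            C = (∣V∣ - 1ℤ) * (∣L∣ * N γ)
            final : ∑[ t ∈ X ] ∑[ u ∈ Vs ] corr (φ t) (φ t) u * (𝟙 (Finite._≟_ FV u 0v) * C)
              ≡ (∣V∣ - 1ℤ) * (∣L∣ * (∣X∣ * ∣A∣ * N γ))
            final = trans (∑-cong∈ X λ {t} t∈ → trans
                (∑-cong Vs λ u → solve 3 (λ a b c → a :* (b :* c) := b :* (a :* c)) refl (corr (φ t) (φ t) u) _ C)
                (trans (Finite.delta FV 0v λ u → corr (φ t) (φ t) u * C) (cong (_* C) (φφ-0 t∈))))
              (trans (∑-const X _) (solve 5 (λ x a v l n → x :* (a :* (v :* (l :* n))) := v :* (l :* (x :* a :* n))) refl
                ∣X∣ ∣A∣ (∣V∣ - 1ℤ) ∣L∣ (N γ)))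

        -- `T p` models right translation by p, so that the behaviour of `Tᵍ p g` along V is the
        -- behaviour of g along a conjugate of V.
        module Connected
          {P : Set} (Ps : List P) (T : P → M → M)
          (T-▹ : ∀ p a x → T p (a ▹ x) ≡ a ▹ T p x)
          (T-∑ : ∀ {p} → p ∈ Ps → (f : M → ℤ) → ∑[ x ∈ X ] f (T p x) ≡ ∑ X f)
          (1≤P : 1ℤ ≤ pos (length Ps)) (1≤X : 1ℤ ≤ ∣X∣)
          where

          ∣P∣ : ℤ
          ∣P∣ = pos (length Ps)

          Tᵍ : P → (M → ℤ) → M → ℤ
          Tᵍ p g x = g (T p x)

          𝓓 : (M → ℤ) → ℤ
          𝓓 g = ∑[ p ∈ Ps ] N (fluct (Tᵍ p g))

          0≤𝓓 : ∀ g → 0ℤ ≤ 𝓓 g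
          0≤𝓓 g = ∑-nonneg Ps λ p → 0≤N _

          -- A quantitative form of the statement that functions invariant under all the conjugates
          -- of V agree at x and y: 𝓓 is the Dirichlet form that vanishes on these functions. The
          -- constant K must work for every g but is otherwise arbitrary.
          Conn : M → M → Set
          Conn x y = Σ ℕ λ K → ∀ g → (g x - g y) * (g x - g y) ≤ pos K * 𝓓 g

          conn-refl : ∀ {x y} → x ≡ y → Conn x y
          conn-refl {x} refl = 0 , λ g → ≤-reflexive
            (trans (solve 1 (λ a → (a :- a) :* (a :- a) := con 0ℤ) refl (g x)) (sym (zeroˡ _)))

          conn-sym : ∀ {x y} → Conn x y → Conn y x
          conn-sym {x} {y} (K , h) = K , λ g → ≤-trans (≤-reflexive
            (solve 2 (λ a b → (a :- b) :* (a :- b) := (b :- a) :* (b :- a)) refl (g y) (g x))) (h g)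

          conn-trans : ∀ {x y z} → Conn x y → Conn y z → Conn x z
          conn-trans {x} {y} {z} (K , h) (K′ , h′) = 2 ℕ.* (K ℕ.+ K′) , λ g →
            ≤-trans (from-diff (solve 3 (λ a b c →
                con (pos 2) :* ((a :- b) :* (a :- b) :+ (b :- c) :* (b :- c)) :- (a :- c) :* (a :- c)
                := (a :- b :- (b :- c)) :* (a :- b :- (b :- c))) refl (g x) (g y) (g z)) (0≤sq _))
              (≤-trans (*-monoˡ (<⇒≤ 0<2) (+-mono-≤ (h g) (h′ g))) (≤-reflexive (trans
                (solve 3 (λ k k′ d → con (pos 2) :* (k :* d :+ k′ :* d) := con (pos 2) :* (k :+ k′) :* d)
                  refl (pos K) (pos K′) (𝓓 g))
                (cong (_* 𝓓 g) (trans (cong (pos 2 *_) (sym (pos-+ K K′))) (sym (pos-* 2 (K ℕ.+ K′))))))))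

          -- The squared difference is one term of the sum in `dirichlet`, whose factor 2 becomes
          -- the constant.
          conn-step : ∀ {p x} → p ∈ Ps → x ∈ X → ∀ w → Conn (T p x) (T p (x · w))
          conn-step {p} {x} p∈ x∈ w = 2 , λ g → let k = Tᵍ p g in
            ≤-trans (term≤∑ Vs {λ w → (k x - k (x · w)) * (k x - k (x · w))} (λ w → 0≤sq _) (w-∈ w))
            (≤-trans (term≤∑ X {λ x → ∑[ w ∈ Vs ] (k x - k (x · w)) * (k x - k (x · w))}
               (λ x → ∑-nonneg Vs λ w → 0≤sq _) x∈)
            (≤-trans (≤-trans (≤-reflexive (sym (*-identityˡ _)))
               (*-monoʳ (∑-nonneg X λ x → ∑-nonneg Vs λ w → 0≤sq _) 1≤V))
            (≤-trans (≤-reflexive (trans (dirichlet k) (cong (pos 2 *_) (sym (pythagoras k)))))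
            (*-monoˡ (<⇒≤ 0<2) (term≤∑ Ps {λ p → N (fluct (Tᵍ p g))} (λ p → 0≤N _) p∈)))))
            where
            1≤V : 1ℤ ≤ ∣V∣
            1≤V = ≤-trans (≤-reflexive (sym (+-identityˡ 1ℤ))) (≤-trans (+-mono-≤ (<⇒≤ 1<V) (≤-refl {1ℤ}))
              (≤-reflexive (solve 1 (λ v → (v :- con 1ℤ) :+ con 1ℤ := v) refl ∣V∣)))
            w-∈ : ∀ w → w ∈ Vs
            w-∈ w = occurs (Finite._≟_ FV) Vs (Finite.once FV w)

          module Poincare (conn : ∀ {x y} → x ∈ X → y ∈ X → Conn x y) where

            gather : ∀ {B : Set} (ys : List B) (q : B → (M → ℤ) → ℤ) →
              (∀ {y} → y ∈ ys → Σ ℕ λ K → ∀ g → q y g ≤ pos K * 𝓓 g) →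
              Σ ℕ λ K → ∀ g → ∑[ y ∈ ys ] q y g ≤ pos K * 𝓓 g
            gather []       q h = 0 , λ g → ≤-reflexive (sym (zeroˡ _))
            gather (y ∷ ys) q h with h (here refl) | gather ys q (λ p → h (there p))
            ... | K , h₁ | K′ , h₂ = K ℕ.+ K′ , λ g → ≤-trans (+-mono-≤ (h₁ g) (h₂ g))
              (≤-reflexive (trans (sym (distribʳ (𝓓 g) (pos K) (pos K′))) (cong (_* 𝓓 g) (sym (pos-+ K K′)))))

            all-pairs : Σ ℕ λ K → ∀ g → ∑[ x ∈ X ] ∑[ y ∈ X ] (g x - g y) * (g x - g y) ≤ pos K * 𝓓 g
            all-pairs = gather X (λ x g → ∑[ y ∈ X ] (g x - g y) * (g x - g y)) λ {x} x∈ →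
              gather X (λ y g → (g x - g y) * (g x - g y)) λ y∈ → conn x∈ y∈

            -- Λ is the excess of the left over the right side of the estimate `mixing`, so the aim
            -- is Λ g ≤ 0; `Var` is the variance scaled by |X|².
            G Var Λ : (M → ℤ) → ℤ
            G g = ∑ X g
            Var g = ∣X∣ * N g - G g * G g
            Λ g = ∣V∣ * ∣X∣ * s g - (∣X∣ * ∣X∣ * ∣A∣ * N g + ∣V∣ * (∣A∣ * ∣A∣) * (G g * G g))

            2Var : ∀ g → ∑[ x ∈ X ] ∑[ y ∈ X ] (g x - g y) * (g x - g y) ≡ pos 2 * Var g
            2Var g = begin
              ∑[ x ∈ X ] ∑[ y ∈ X ] (g x - g y) * (g x - g y)
                ≡⟨ (∑-cong X λ x → ∑-cong X λ y → solve 2 (λ a b →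
                     (a :- b) :* (a :- b) := (a :* a :+ b :* b) :- con (pos 2) :* (a :* b)) refl (g x) (g y)) ⟩
              ∑[ x ∈ X ] ∑[ y ∈ X ] (g x * g x + g y * g y - pos 2 * (g x * g y))
                ≡⟨ (∑-cong X λ x → trans (∑-− X _ _) (cong₂ _-_ (trans (∑-+ X _ _) (cong (_+ N g) (∑-const X (g x * g x)))) (∑-*ˡ (pos 2) X _))) ⟩
              ∑[ x ∈ X ] (∣X∣ * (g x * g x) + N g - pos 2 * (∑[ y ∈ X ] g x * g y))
                ≡⟨ trans (∑-− X _ _) (cong₂ _-_ (trans (∑-+ X _ _) (cong₂ _+_ (∑-*ˡ ∣X∣ X _) (∑-const X (N g))))
                     (trans (∑-*ˡ (pos 2) X _) (cong (pos 2 *_) (∑-prod X X g g)))) ⟩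
              (∣X∣ * N g + ∣X∣ * N g) - pos 2 * (G g * G g)
                ≡⟨ solve 3 (λ x n c → (x :* n :+ x :* n) :- con (pos 2) :* c := con (pos 2) :* (x :* n :- c)) refl ∣X∣ (N g) (G g * G g) ⟩
              pos 2 * Var g ∎

            -- Besides the constant from `all-pairs`, the summand `length X` guarantees |X| ≤ α,
            -- which makes α - |X| a natural number as `geometric-limit` demands.
            K₁ : ℕ
            K₁ = proj₁ all-pairs ℕ.+ length X

            poincare : ∀ g → Var g ≤ pos K₁ * 𝓓 g
            poincare g = *-cancelˡ 0<2 (≤-trans (≤-trans (≤-reflexive (sym (2Var g))) (proj₂ all-pairs g))
              (from-diff {k = pos (proj₁ all-pairs) * 𝓓 g + pos 2 * (∣X∣ * 𝓓 g)}
                (trans (cong (λ z → pos 2 * (z * 𝓓 g) - pos (proj₁ all-pairs) * 𝓓 g) (pos-+ _ _))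
                  (solve 3 (λ k x d → con (pos 2) :* ((k :+ x) :* d) :- k :* d := k :* d :+ con (pos 2) :* (x :* d))
                    refl (pos (proj₁ all-pairs)) ∣X∣ (𝓓 g)))
                (0≤i+j (0≤m*n (0≤pos _) (0≤𝓓 g)) (0≤m*n (<⇒≤ 0<2) (0≤m*n (0≤pos _) (0≤𝓓 g))))))

            -- The quadratic forms in Λ split orthogonally into contributions of `E k` and
            -- `fluct k`, and the total `G` is carried by `E k` alone. The contribution of `fluct k`
            -- is nonpositive by `key`.
            Λ-E : ∀ k → ∣V∣ * ∣V∣ * Λ k ≤ Λ (E k)
            Λ-E k = from-diff {k = ∣X∣ * (∣X∣ * ∣A∣ * N (fluct k) - ∣V∣ * s (fluct k))} (begin
                Λ (E k) - ∣V∣ * ∣V∣ * Λ k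
                  ≡⟨ cong₂ (λ a b → (∣V∣ * ∣X∣ * a - (∣X∣ * ∣X∣ * ∣A∣ * N (E k) + ∣V∣ * (∣A∣ * ∣A∣) * (b * b))) - ∣V∣ * ∣V∣ * Λ k)
                       s-E (∑-E k) ⟩
                (∣V∣ * ∣X∣ * (∣V∣ * ∣V∣ * s k - s (fluct k)) - (∣X∣ * ∣X∣ * ∣A∣ * N (E k) + ∣V∣ * (∣A∣ * ∣A∣) * (∣V∣ * G k * (∣V∣ * G k)))) - ∣V∣ * ∣V∣ * Λ k
                  ≡⟨ solve 8 (λ v x a s f n n′ g →
                       (v :* x :* (v :* v :* s :- f) :- (x :* x :* a :* n′ :+ v :* (a :* a) :* (v :* g :* (v :* g))))
                         :- v :* v :* (v :* x :* s :- (x :* x :* a :* n :+ v :* (a :* a) :* (g :* g)))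
                       := x :* (x :* a :* (v :* v :* n :- n′) :- v :* f)) refl ∣V∣ ∣X∣ ∣A∣ (s k) (s (fluct k)) (N k) (N (E k)) (G k) ⟩
                ∣X∣ * (∣X∣ * ∣A∣ * (∣V∣ * ∣V∣ * N k - N (E k)) - ∣V∣ * s (fluct k))
                  ≡⟨ cong (λ z → ∣X∣ * (∣X∣ * ∣A∣ * z - ∣V∣ * s (fluct k))) (sym (pythagoras k)) ⟩
                ∣X∣ * (∣X∣ * ∣A∣ * N (fluct k) - ∣V∣ * s (fluct k)) ∎)
                (0≤m*n (0≤pos _) (to-diff (key (fluct k) (E-fluct k))))
              where
              s-E : s (E k) ≡ ∣V∣ * ∣V∣ * s k - s (fluct k)
              s-E = trans (solve 2 (λ a b → b := a :+ b :- a) refl (s (fluct k)) (s (E k)))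
                (cong (_- s (fluct k)) (sym (s-split k)))

            Var-E : ∀ k → Var (E k) ≡ ∣V∣ * ∣V∣ * Var k - ∣X∣ * N (fluct k)
            Var-E k = trans (cong (λ z → ∣X∣ * N (E k) - z * z) (∑-E k)) (trans
              (solve 5 (λ v x n n′ g → x :* n′ :- v :* g :* (v :* g) :=
                 v :* v :* (x :* n :- g :* g) :- x :* (v :* v :* n :- n′)) refl ∣V∣ ∣X∣ (N k) (N (E k)) (G k))
              (cong (λ z → ∣V∣ * ∣V∣ * Var k - ∣X∣ * z) (sym (pythagoras k))))

            Var-T : ∀ {p} → p ∈ Ps → ∀ g → Var (Tᵍ p g) ≡ Var g
            Var-T p∈ g = cong₂ (λ a b → ∣X∣ * a - b * b) (T-∑ p∈ λ x → g x * g x) (T-∑ p∈ g)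

            Λ-T : ∀ {p} → p ∈ Ps → ∀ g → Λ (Tᵍ p g) ≡ Λ g
            Λ-T {p} p∈ g = cong₂ _-_ (cong (∣V∣ * ∣X∣ *_) (trans
                (N-cong λ t → ∑-cong As λ a → cong g (T-▹ p a t)) (T-∑ p∈ λ t → Sᴬ g t * Sᴬ g t)))
              (cong₂ (λ a b → ∣X∣ * ∣X∣ * ∣A∣ * a + ∣V∣ * (∣A∣ * ∣A∣) * (b * b)) (T-∑ p∈ λ x → g x * g x) (T-∑ p∈ g))

            -- By `Var-E`, the sum over p of `Var (E (Tᵍ p g))` is |P| |V|² Var g - |X| 𝓓 g.
            -- Multiplying by K₁ and inserting `poincare` leaves at most (α - |X|) Var g, which
            -- explains α; c is the constant in Λ g ≤ c · Var g.
            α c : ℤ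
            α = pos K₁ * ∣P∣ * (∣V∣ * ∣V∣)
            c = ∣V∣ * (∣A∣ * ∣A∣)

            0≤c : 0ℤ ≤ c
            0≤c = 0≤m*n (0≤pos _) (0≤m*n (0≤pos _) (0≤pos _))

            X≤α : ∣X∣ ≤ α
            X≤α = ≤-trans (≤-trans (≤-reflexive (solve 1 (λ x → x := x :* con 1ℤ :* (con 1ℤ :* con 1ℤ)) refl ∣X∣))
              (*-mono (0≤m*n (0≤pos _) 0≤1) (0≤m*n (0≤pos _) (0≤pos _)) (*-mono (0≤pos _) (0≤pos _) X≤K₁ 1≤P)
                (*-mono 0≤1 (0≤pos _) 1≤V 1≤V))) ≤-refl
              where
              1≤V : 1ℤ ≤ ∣V∣
              1≤V = ≤-trans (≤-reflexive (sym (+-identityˡ 1ℤ))) (≤-trans (+-mono-≤ (<⇒≤ 1<V) (≤-refl {1ℤ}))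
                (≤-reflexive (solve 1 (λ v → (v :- con 1ℤ) :+ con 1ℤ := v) refl ∣V∣)))
              X≤K₁ : ∣X∣ ≤ pos K₁
              X≤K₁ = from-diff {k = pos (proj₁ all-pairs)} (trans (cong (_- ∣X∣) (pos-+ (proj₁ all-pairs) (length X)))
                (solve 2 (λ k x → k :+ x :- x := k) refl (pos (proj₁ all-pairs)) ∣X∣)) (0≤pos _)

            b : ℕ
            b = ∣ α - ∣X∣ ∣

            β≡ : pos b ≡ α - ∣X∣
            β≡ = 0≤i⇒+∣i∣≡i (to-diff X≤α)

            -- Averaged over Ps, E ∘ Tᵍ p scales Λ by at least |V|² but Var by strictly less, so Λ g > 0 is impossible.
            iterate : ∀ k g → α ^′ k * Λ g ≤ (pos b) ^′ k * (c * Var g)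
            iterate zero g = *-monoˡ 0≤1 (from-diff
              {k = ∣V∣ * ∣X∣ * (∣A∣ * ∣A∣ * N g - s g) + ∣X∣ * ∣X∣ * ∣A∣ * N g}
              (solve 6 (λ v x a s n g → v :* (a :* a) :* (x :* n :- g :* g)
                  :- (v :* x :* s :- (x :* x :* a :* n :+ v :* (a :* a) :* (g :* g)))
                 := v :* x :* (a :* a :* n :- s) :+ x :* x :* a :* n) refl ∣V∣ ∣X∣ ∣A∣ (s g) (N g) (G g))
              (0≤i+j (0≤m*n (0≤m*n (0≤pos _) (0≤pos _)) (to-diff (young g)))
                (0≤m*n (0≤m*n (0≤m*n (0≤pos _) (0≤pos _)) (0≤pos _)) (0≤N g))))
            iterate (suc k) g = ≤-trans (≤-reflexive (solve 5 (λ k p v a l → (k :* p :* (v :* v) :* a) :* l :=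
                   k :* (p :* (a :* (v :* v :* l)))) refl (pos K₁) ∣P∣ ∣V∣ (α ^′ k) (Λ g)))
              (≤-trans (*-monoˡ (0≤pos K₁) summed)
              (≤-trans (≤-reflexive (solve 7 (λ k p v w x d t → k :* (t :* (p :* (v :* v :* w) :- x :* d)) :=
                   t :* (k :* p :* (v :* v) :* w :- x :* (k :* d))) refl (pos K₁) ∣P∣ ∣V∣ (Var g) ∣X∣ (𝓓 g) (B * c)))
              (≤-trans (*-monoˡ (0≤m*n 0≤B 0≤c) (+-mono-≤ ≤-refl (neg-mono-≤ (*-monoˡ (0≤pos _) (poincare g)))))
              (≤-reflexive (trans (solve 5 (λ t u a w x → (t :* u) :* (a :* w :- x :* w) := (a :- x) :* t :* (u :* w))
                   refl B c α (Var g) ∣X∣) (cong (λ z → z * B * (c * Var g)) (sym β≡)))))))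
              where
              B = (pos b) ^′ k
              0≤B : 0ℤ ≤ B
              0≤B = 0≤^ k (0≤pos b)
              0≤α : 0ℤ ≤ α
              0≤α = ≤-trans (0≤pos _) X≤α
              one : ∀ {p} → p ∈ Ps → α ^′ k * (∣V∣ * ∣V∣ * Λ g)
                ≤ B * c * (∣V∣ * ∣V∣ * Var g - ∣X∣ * N (fluct (Tᵍ p g)))
              one {p} p∈ = ≤-trans (*-monoˡ (0≤^ k 0≤α) (≤-trans (≤-reflexive (cong (∣V∣ * ∣V∣ *_) (sym (Λ-T p∈ g)))) (Λ-E (Tᵍ p g))))
                (≤-trans (iterate k (E (Tᵍ p g))) (≤-reflexive (trans (sym (*-assoc B c _)) (cong (B * c *_)
                  (trans (Var-E (Tᵍ p g)) (cong (λ z → ∣V∣ * ∣V∣ * z - ∣X∣ * N (fluct (Tᵍ p g))) (Var-T p∈ g)))))))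
              summed : ∣P∣ * (α ^′ k * (∣V∣ * ∣V∣ * Λ g)) ≤ B * c * (∣P∣ * (∣V∣ * ∣V∣ * Var g) - ∣X∣ * 𝓓 g)
              summed = ≤-trans (≤-reflexive (sym (∑-const Ps _))) (≤-trans (∑-mono∈ Ps one) (≤-reflexive
                (trans (∑-*ˡ (B * c) Ps _) (cong (B * c *_) (trans (∑-− Ps _ _) (cong₂ _-_ (∑-const Ps _) (∑-*ˡ ∣X∣ Ps _)))))))

            -- `iterate` bounds α^k Λ g by a fixed multiple of (α - |X|)^k for every k. As X is
            -- nonempty, the second base is smaller and Λ g cannot be positive.
            mixing : ∀ g → ∣V∣ * ∣X∣ * s g ≤ ∣X∣ * ∣X∣ * ∣A∣ * N g + ∣V∣ * (∣A∣ * ∣A∣) * (G g * G g)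
            mixing g = from-diff {k = - Λ g} (solve 2 (λ a b → b :- a := :- (a :- b)) refl _ _)
              (neg-nonneg (geometric-limit {α} {b} {∣ c * Var g ∣}
                (≤-trans (≤-reflexive (cong (_+ 1ℤ) β≡)) (≤-trans (+-mono-≤ ≤-refl 1≤X)
                  (≤-reflexive (solve 2 (λ a x → a :- x :+ x := a) refl α ∣X∣))))
                (λ k → ≤-trans (iterate k g) (*-monoˡ (0≤^ k (0≤pos b)) (i≤∣i∣ (c * Var g))))))

-- A ring solver with integer coefficients for an abstract field

module RingSolving where
  open ℤ using (ℤ)
  open import Data.Maybe.Base using (map)

  -- The arithmetic of an abstract field does not compute, so the coefficients of the solver are taken from ℤ.
  module IntegerCoefficients {C : Set} {_+_ _*_ : C → C → C} { -_ : C → C} {0# 1# : C}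
    (isCR : IsCommutativeRing _≡_ _+_ _*_ -_ 0# 1#) where

    R : CommutativeRing 0ℓ 0ℓ
    R = record { isCommutativeRing = isCR }

    open CommutativeRing R using (+-assoc; +-comm; +-identityˡ; +-identityʳ; -‿inverseʳ; -‿inverseˡ; ring; semiring)
    open import Algebra.Properties.Ring ring using (-0#≈0#; -‿+-comm; -‿distribˡ-*; -‿distribʳ-*; -‿involutive)
    open import Algebra.Properties.Semiring.Mult.TCOptimised semiring using (×-homo-+; ×1-homo-*; 1+×) renaming (_×_ to _·_)
    open ≡-Reasoning

    ι : ℤ → C
    ι (ℤ.+ n)      = n · 1#
    ι (ℤ.-[1+ n ]) = - (suc n · 1#)

    ι-⊖ : ∀ m n → ι (m ℤ.⊖ n) ≡ (m · 1#) + (- (n · 1#))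
    ι-⊖ m zero = begin
      ι (m ℤ.⊖ 0)             ≡⟨ refl ⟩
      m · 1#                  ≡⟨ sym (+-identityʳ _) ⟩
      (m · 1#) + 0#           ≡⟨ cong ((m · 1#) +_) (sym -0#≈0#) ⟩
      (m · 1#) + (- 0#)       ∎
    ι-⊖ zero (suc n) = sym (+-identityˡ _)
    ι-⊖ (suc m) (suc n) = begin
      ι (suc m ℤ.⊖ suc n)                   ≡⟨ cong ι (ℤP.[1+m]⊖[1+n]≡m⊖n m n) ⟩
      ι (m ℤ.⊖ n)                           ≡⟨ ι-⊖ m n ⟩
      a + (- b)                             ≡⟨ cong (_+ (- b)) (sym (+-identityʳ a)) ⟩
      (a + 0#) + (- b)                      ≡⟨ cong (λ z → (a + z) + (- b)) (sym (-‿inverseʳ 1#)) ⟩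
      (a + (1# + (- 1#))) + (- b)           ≡⟨ cong (_+ (- b)) (trans (sym (+-assoc a 1# (- 1#))) (cong (_+ (- 1#)) (+-comm a 1#))) ⟩
      ((1# + a) + (- 1#)) + (- b)           ≡⟨ +-assoc _ _ _ ⟩
      (1# + a) + ((- 1#) + (- b))           ≡⟨ cong ((1# + a) +_) (-‿+-comm 1# b) ⟩
      (1# + a) + (- (1# + b))               ≡⟨ sym (cong₂ (λ u v → u + (- v)) (1+× m 1#) (1+× n 1#)) ⟩
      (suc m · 1#) + (- (suc n · 1#))       ∎
      where
      a = m · 1#
      b = n · 1#

    ι-neg : ∀ i → ι (ℤ.- i) ≡ - ι i
    ι-neg (ℤ.+ zero)      = sym -0#≈0#
    ι-neg (ℤ.+ suc n)     = refl
    ι-neg (ℤ.-[1+ n ])    = sym (-‿involutive _)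

    ι-+ : ∀ i j → ι (i ℤ.+ j) ≡ ι i + ι j
    ι-+ (ℤ.+ m)      (ℤ.+ n)      = ×-homo-+ 1# m n
    ι-+ (ℤ.+ m)      (ℤ.-[1+ n ]) = ι-⊖ m (suc n)
    ι-+ (ℤ.-[1+ m ]) (ℤ.+ n)      = trans (ι-⊖ n (suc m)) (+-comm _ _)
    ι-+ (ℤ.-[1+ m ]) (ℤ.-[1+ n ]) = sym (trans (-‿+-comm _ _)
      (cong -_ (trans (sym (×-homo-+ 1# (suc m) (suc n))) (cong (λ k → suc k · 1#) (ℕ-+-suc m n)))))
      where
      ℕ-+-suc : ∀ m n → m ℕ.+ suc n ≡ suc (m ℕ.+ n)
      ℕ-+-suc zero    n = refl
      ℕ-+-suc (suc m) n = cong suc (ℕ-+-suc m n)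

    ι-pos* : ∀ m j → ι (ℤ.+ m ℤ.* j) ≡ ι (ℤ.+ m) * ι j
    ι-pos* m (ℤ.+ n)      = trans (cong ι (sym (ℤP.pos-* m n))) (×1-homo-* m n)
    ι-pos* m (ℤ.-[1+ n ]) = begin
      ι (ℤ.+ m ℤ.* ℤ.- (ℤ.+ suc n))   ≡⟨ cong ι (sym (ℤP.neg-distribʳ-* (ℤ.+ m) (ℤ.+ suc n))) ⟩
      ι (ℤ.- (ℤ.+ m ℤ.* ℤ.+ suc n))   ≡⟨ ι-neg (ℤ.+ m ℤ.* ℤ.+ suc n) ⟩
      - ι (ℤ.+ m ℤ.* ℤ.+ suc n)       ≡⟨ cong -_ (ι-pos* m (ℤ.+ suc n)) ⟩
      - (ι (ℤ.+ m) * ι (ℤ.+ suc n))   ≡⟨ -‿distribʳ-* _ _ ⟩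
      ι (ℤ.+ m) * (- ι (ℤ.+ suc n))   ∎

    ι-* : ∀ i j → ι (i ℤ.* j) ≡ ι i * ι j
    ι-* (ℤ.+ m)      j = ι-pos* m j
    ι-* (ℤ.-[1+ m ]) j = begin
      ι (ℤ.- (ℤ.+ suc m) ℤ.* j)     ≡⟨ cong ι (sym (ℤP.neg-distribˡ-* (ℤ.+ suc m) j)) ⟩
      ι (ℤ.- (ℤ.+ suc m ℤ.* j))     ≡⟨ ι-neg (ℤ.+ suc m ℤ.* j) ⟩
      - ι (ℤ.+ suc m ℤ.* j)         ≡⟨ cong -_ (ι-pos* (suc m) j) ⟩
      - (ι (ℤ.+ suc m) * ι j)       ≡⟨ -‿distribˡ-* _ _ ⟩
      (- ι (ℤ.+ suc m)) * ι j       ∎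

    coeff≟ : ∀ i j → Maybe (ι i ≡ ι j)
    coeff≟ i j = map (cong ι) (dec⇒maybe (i ℤ.≟ j))

    morphism : CommutativeRing.rawRing ℤP.+-*-commutativeRing -Raw-AlmostCommutative⟶ fromCommutativeRing R
    morphism = record { ⟦_⟧ = ι ; +-homo = ι-+ ; *-homo = ι-* ; -‿homo = ι-neg ; 0-homo = refl ; 1-homo = refl }

    module Solver = RingSolver (CommutativeRing.rawRing ℤP.+-*-commutativeRing) (fromCommutativeRing R) morphism coeff≟
    open Solver public using (solve; _:=_; _:+_; _:*_; _:-_; :-_; con; Polynomial)

-- Vectors, matrices and the determinant through the exterior algebra

module LinAlg where
  open RingSolving
  open import Data.Vec.Base as Vec using (Vec; []; _∷_; map; zipWith; replicate)
  open import Data.Fin.Base using (Fin; zero; suc)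
  open import Data.Fin.Properties using (suc-injective)

  module Linear {q : ℕ} (F : FiniteField q) where

    open FiniteField F public using (Carrier; 0#; 1#; isCommutativeRing; 0≢1; inverse; _≟_)
      renaming (_+_ to infixl 6 _+_; _*_ to infixl 7 _*_; -_ to infix 8 -_)
    open Matrices F public using (Mat; _≟M_; addM; mulM; sumV; dropAt; det; InSL)
    open IntegerCoefficients isCommutativeRing public using (solve; _:=_; _:+_; _:*_; _:-_; :-_; con; Polynomial)
    open IsCommutativeRing isCommutativeRing public
      using (+-assoc; +-comm; +-identityˡ; +-identityʳ; *-assoc; *-comm; *-identityˡ; *-identityʳ;
             zeroˡ; zeroʳ; distribˡ; distribʳ; -‿inverseˡ; -‿inverseʳ)
    open ≡-Reasoning

    c0 c1 : ∀ {n} → Polynomial n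
    c0 = con (ℤ.+ 0)
    c1 = con (ℤ.+ 1)

    Row : ℕ → Set
    Row n = Vec Carrier n

    infixl 6 _⊕_
    infixl 7 _⊙_ _⊗_

    _⊕_ : ∀ {n} → Row n → Row n → Row n
    _⊕_ = zipWith _+_

    ⊖_ : ∀ {n} → Row n → Row n
    ⊖_ = map -_

    0ᵛ : ∀ {n} → Row n
    0ᵛ = replicate _ 0#

    _⊙_ : ∀ {n} → Carrier → Row n → Row n
    c ⊙ v = map (c *_) v

    dot : ∀ {n} → Row n → Row n → Carrier
    dot u v = sumV (zipWith _*_ u v)

    ⊕-assoc : ∀ {n} (u v w : Row n) → (u ⊕ v) ⊕ w ≡ u ⊕ (v ⊕ w)
    ⊕-assoc = VecP.zipWith-assoc +-assoc

    ⊕-comm : ∀ {n} (u v : Row n) → u ⊕ v ≡ v ⊕ u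
    ⊕-comm = VecP.zipWith-comm +-comm

    ⊕-identityˡ : ∀ {n} (v : Row n) → 0ᵛ ⊕ v ≡ v
    ⊕-identityˡ = VecP.zipWith-identityˡ +-identityˡ

    ⊕-identityʳ : ∀ {n} (v : Row n) → v ⊕ 0ᵛ ≡ v
    ⊕-identityʳ = VecP.zipWith-identityʳ +-identityʳ

    ⊕-inverseˡ : ∀ {n} (v : Row n) → ⊖ v ⊕ v ≡ 0ᵛ
    ⊕-inverseˡ []      = refl
    ⊕-inverseˡ (a ∷ v) = cong₂ _∷_ (-‿inverseˡ a) (⊕-inverseˡ v)

    ⊕-inverseʳ : ∀ {n} (v : Row n) → v ⊕ (⊖ v) ≡ 0ᵛ
    ⊕-inverseʳ v = trans (⊕-comm v (⊖ v)) (⊕-inverseˡ v)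

    ⊕-isAbelianGroup : ∀ {n} → IsAbelianGroup _≡_ (_⊕_ {n}) 0ᵛ ⊖_
    ⊕-isAbelianGroup = record
      { isGroup = record
        { isMonoid = record
          { isSemigroup = record
            { isMagma = record { isEquivalence = isEquivalence ; ∙-cong = cong₂ _⊕_ }
            ; assoc = ⊕-assoc }
          ; identity = ⊕-identityˡ , ⊕-identityʳ }
        ; inverse = ⊕-inverseˡ , ⊕-inverseʳ
        ; ⁻¹-cong = cong ⊖_ }
      ; comm = ⊕-comm }

    0⊙ : ∀ {n} (v : Row n) → 0# ⊙ v ≡ 0ᵛ
    0⊙ []      = refl
    0⊙ (a ∷ v) = cong₂ _∷_ (zeroˡ a) (0⊙ v)

    1⊙ : ∀ {n} (v : Row n) → 1# ⊙ v ≡ v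
    1⊙ []      = refl
    1⊙ (a ∷ v) = cong₂ _∷_ (*-identityˡ a) (1⊙ v)

    ⊙0 : ∀ {n} c → c ⊙ 0ᵛ {n} ≡ 0ᵛ
    ⊙0 {zero}  c = refl
    ⊙0 {suc n} c = cong₂ _∷_ (zeroʳ c) (⊙0 c)

    ⊙-⊙ : ∀ {n} c d (v : Row n) → c ⊙ (d ⊙ v) ≡ (c * d) ⊙ v
    ⊙-⊙ c d []      = refl
    ⊙-⊙ c d (a ∷ v) = cong₂ _∷_ (sym (*-assoc c d a)) (⊙-⊙ c d v)

    ⊙-⊕ : ∀ {n} c (u v : Row n) → c ⊙ (u ⊕ v) ≡ c ⊙ u ⊕ c ⊙ v
    ⊙-⊕ c []      []      = refl
    ⊙-⊕ c (a ∷ u) (b ∷ v) = cong₂ _∷_ (distribˡ c a b) (⊙-⊕ c u v)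

    +-⊙ : ∀ {n} c d (v : Row n) → (c + d) ⊙ v ≡ c ⊙ v ⊕ d ⊙ v
    +-⊙ c d []      = refl
    +-⊙ c d (a ∷ v) = cong₂ _∷_ (distribʳ a c d) (+-⊙ c d v)

    dot-comm : ∀ {n} (u v : Row n) → dot u v ≡ dot v u
    dot-comm []      []      = refl
    dot-comm (a ∷ u) (b ∷ v) = cong₂ _+_ (*-comm a b) (dot-comm u v)

    dot-0ˡ : ∀ {n} (v : Row n) → dot 0ᵛ v ≡ 0#
    dot-0ˡ []      = refl
    dot-0ˡ (a ∷ v) = trans (cong₂ _+_ (zeroˡ a) (dot-0ˡ v)) (+-identityˡ 0#)

    dot-0ʳ : ∀ {n} (v : Row n) → dot v 0ᵛ ≡ 0#
    dot-0ʳ v = trans (dot-comm v 0ᵛ) (dot-0ˡ v)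

    dot-⊕ˡ : ∀ {n} (u v w : Row n) → dot (u ⊕ v) w ≡ dot u w + dot v w
    dot-⊕ˡ []      []      []      = sym (+-identityˡ 0#)
    dot-⊕ˡ (a ∷ u) (b ∷ v) (c ∷ w) = trans (cong ((a + b) * c +_) (dot-⊕ˡ u v w))
      (solve 5 (λ a b c x y → (a :+ b) :* c :+ (x :+ y) := (a :* c :+ x) :+ (b :* c :+ y)) refl a b c _ _)

    dot-⊙ˡ : ∀ {n} d (u w : Row n) → dot (d ⊙ u) w ≡ d * dot u w
    dot-⊙ˡ d []      []      = sym (zeroʳ d)
    dot-⊙ˡ d (a ∷ u) (c ∷ w) = trans (cong (d * a * c +_) (dot-⊙ˡ d u w))
      (solve 4 (λ d a c x → d :* a :* c :+ d :* x := d :* (a :* c :+ x)) refl d a c _)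

    dot-⊕ʳ : ∀ {n} (w u v : Row n) → dot w (u ⊕ v) ≡ dot w u + dot w v
    dot-⊕ʳ w u v = trans (dot-comm w (u ⊕ v)) (trans (dot-⊕ˡ u v w) (cong₂ _+_ (dot-comm u w) (dot-comm v w)))

    dot-⊙ʳ : ∀ {n} d (w u : Row n) → dot w (d ⊙ u) ≡ d * dot w u
    dot-⊙ʳ d w u = trans (dot-comm w (d ⊙ u)) (trans (dot-⊙ˡ d u w) (cong (d *_) (dot-comm u w)))

    vm : ∀ {k n} → Row k → Vec (Row n) k → Row n
    vm []      []      = 0ᵛ
    vm (a ∷ u) (r ∷ M) = a ⊙ r ⊕ vm u M

    mv : ∀ {k n} → Vec (Row n) k → Row n → Row k
    mv M w = map (λ r → dot r w) M

    _⊗_ : ∀ {l k n} → Vec (Row k) l → Vec (Row n) k → Vec (Row n) l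
    X ⊗ Y = map (λ r → vm r Y) X

    vm-0 : ∀ {k n} (M : Vec (Row n) k) → vm 0ᵛ M ≡ 0ᵛ
    vm-0 []      = refl
    vm-0 (r ∷ M) = trans (cong₂ _⊕_ (0⊙ r) (vm-0 M)) (⊕-identityˡ 0ᵛ)

    ⊕-interchange : ∀ {n} (a b c d : Row n) → (a ⊕ b) ⊕ (c ⊕ d) ≡ (a ⊕ c) ⊕ (b ⊕ d)
    ⊕-interchange []      []      []      []      = refl
    ⊕-interchange (a ∷ u) (b ∷ v) (c ∷ w) (d ∷ x) = cong₂ _∷_
      (solve 4 (λ a b c d → (a :+ b) :+ (c :+ d) := (a :+ c) :+ (b :+ d)) refl a b c d) (⊕-interchange u v w x)

    vm-⊕ : ∀ {k n} (u v : Row k) (M : Vec (Row n) k) → vm (u ⊕ v) M ≡ vm u M ⊕ vm v M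
    vm-⊕ []      []      []      = sym (⊕-identityˡ 0ᵛ)
    vm-⊕ (a ∷ u) (b ∷ v) (r ∷ M) = trans (cong₂ _⊕_ (+-⊙ a b r) (vm-⊕ u v M))
      (⊕-interchange (a ⊙ r) (b ⊙ r) (vm u M) (vm v M))

    vm-⊙ : ∀ {k n} c (u : Row k) (M : Vec (Row n) k) → vm (c ⊙ u) M ≡ c ⊙ vm u M
    vm-⊙ c []      []      = sym (⊙0 c)
    vm-⊙ c (a ∷ u) (r ∷ M) = trans (cong₂ _⊕_ (sym (⊙-⊙ c a r)) (vm-⊙ c u M)) (sym (⊙-⊕ c _ _))

    vm-vm : ∀ {l k n} (u : Row l) (X : Vec (Row k) l) (Y : Vec (Row n) k) → vm (vm u X) Y ≡ vm u (X ⊗ Y)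
    vm-vm []      []      Y = vm-0 Y
    vm-vm (a ∷ u) (r ∷ X) Y = trans (vm-⊕ (a ⊙ r) (vm u X) Y) (cong₂ _⊕_ (vm-⊙ a r Y) (vm-vm u X Y))

    dot-vm : ∀ {k n} (u : Row k) (M : Vec (Row n) k) w → dot (vm u M) w ≡ dot u (mv M w)
    dot-vm []      []      w = dot-0ˡ w
    dot-vm (a ∷ u) (r ∷ M) w = trans (dot-⊕ˡ (a ⊙ r) (vm u M) w) (cong₂ _+_ (dot-⊙ˡ a r w) (dot-vm u M w))

    ⊗-assoc : ∀ {j l k n} (X : Vec (Row l) j) (Y : Vec (Row k) l) (Z : Vec (Row n) k) → (X ⊗ Y) ⊗ Z ≡ X ⊗ (Y ⊗ Z)
    ⊗-assoc X Y Z = trans (sym (VecP.map-∘ _ _ X)) (VecP.map-cong (λ r → vm-vm r Y Z) X)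

    mv-⊗ : ∀ {l k n} (X : Vec (Row k) l) (Y : Vec (Row n) k) w → mv (X ⊗ Y) w ≡ mv X (mv Y w)
    mv-⊗ X Y w = trans (sym (VecP.map-∘ _ _ X)) (VecP.map-cong (λ r → dot-vm r Y w) X)

    Id : ∀ n → Mat n
    Id zero    = []
    Id (suc n) = (1# ∷ 0ᵛ) ∷ map (0# ∷_) (Id n)

    vm-cons : ∀ {k n} (u w : Row k) (M : Vec (Row n) k) → vm u (zipWith _∷_ w M) ≡ dot u w ∷ vm u M
    vm-cons []      []      []      = refl
    vm-cons (a ∷ u) (b ∷ w) (r ∷ M) = cong ((a ⊙ (b ∷ r)) ⊕_) (vm-cons u w M)

    map-0∷ : ∀ {k n} (M : Vec (Row n) k) → map (0# ∷_) M ≡ zipWith _∷_ 0ᵛ M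
    map-0∷ []      = refl
    map-0∷ (r ∷ M) = cong ((0# ∷ r) ∷_) (map-0∷ M)

    vm-Id : ∀ {n} (u : Row n) → vm u (Id n) ≡ u
    vm-Id []      = refl
    vm-Id {suc n} (a ∷ u) = begin
      a ⊙ (1# ∷ 0ᵛ) ⊕ vm u (map (0# ∷_) (Id n))
        ≡⟨ cong₂ _⊕_ (cong₂ _∷_ (*-identityʳ a) (⊙0 a))
             (trans (cong (vm u) (map-0∷ (Id n))) (trans (vm-cons u 0ᵛ (Id n)) (cong₂ _∷_ (dot-0ʳ u) (vm-Id u)))) ⟩
      (a ∷ 0ᵛ) ⊕ (0# ∷ u)
        ≡⟨ cong₂ _∷_ (+-identityʳ a) (⊕-identityˡ u) ⟩
      a ∷ u ∎

    ⊗-Id : ∀ {l n} (X : Vec (Row n) l) → X ⊗ Id n ≡ X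
    ⊗-Id X = trans (VecP.map-cong vm-Id X) (VecP.map-id X)

    Id-⊗ : ∀ {k n} (X : Vec (Row n) k) → Id k ⊗ X ≡ X
    Id-⊗ []      = refl
    Id-⊗ {suc k} (r ∷ X) = cong₂ _∷_
      (trans (cong₂ _⊕_ (1⊙ r) (vm-0 X)) (⊕-identityʳ r))
      (trans (sym (VecP.map-∘ _ _ (Id k))) (trans (VecP.map-cong (λ e →
        trans (cong (_⊕ vm e X) (0⊙ r)) (⊕-identityˡ _)) (Id k)) (Id-⊗ X)))

    mv-Id : ∀ {n} (w : Row n) → mv (Id n) w ≡ w
    mv-Id []      = refl
    mv-Id {suc n} (a ∷ w) = cong₂ _∷_
      (trans (cong₂ _+_ (*-identityˡ a) (dot-0ˡ w)) (+-identityʳ a))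
      (trans (sym (VecP.map-∘ _ _ (Id n))) (trans (VecP.map-cong (λ e →
        trans (cong (_+ dot e w) (zeroˡ a)) (+-identityˡ _)) (Id n)) (mv-Id w)))

    transpose-row : ∀ {k n} (r : Row k) (M : Vec (Row n) k) → map (dot r) (Vec.transpose M) ≡ vm r M
    transpose-row []      []      = go _
      where
      go : ∀ n → map (dot []) (replicate n []) ≡ 0ᵛ
      go zero    = refl
      go (suc n) = cong (0# ∷_) (go n)
    transpose-row (a ∷ r) (s ∷ M) = trans (cons s (Vec.transpose M)) (cong (a ⊙ s ⊕_) (transpose-row r M))
      where
      cons : ∀ {n} (s : Row n) T → map (dot (a ∷ r)) ((replicate n _∷_ Vec.⊛ s) Vec.⊛ T) ≡ a ⊙ s ⊕ map (dot r) T
      cons []      []      = refl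
      cons (b ∷ s) (t ∷ T) = cong (_ ∷_) (cons s T)

    mulM≡⊗ : ∀ {n} (X Y : Mat n) → mulM X Y ≡ X ⊗ Y
    mulM≡⊗ X Y = VecP.map-cong (λ r → transpose-row r Y) X

    -- Elements of the exterior algebra of Cⁿ, as functions on subsets of the standard basis.
    Λ : ℕ → Set
    Λ n = Vec Bool n → Carrier

    -- Splitting off the first basis vector e, (a e + v) ∧ (ω₀ + e ∧ ω₁) = v ∧ ω₀ + e ∧ (a ω₀ - v ∧
    -- ω₁); the sign comes from moving v past e.
    wedge : ∀ {n} → Row n → Λ n → Λ n
    wedge []      ω []          = 0#
    wedge (a ∷ v) ω (false ∷ S) = wedge v (λ T → ω (false ∷ T)) S
    wedge (a ∷ v) ω (true  ∷ S) = a * ω (false ∷ S) + - wedge v (λ T → ω (true ∷ T)) S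

    1Λ : ∀ {n} → Λ n
    1Λ []          = 1#
    1Λ (false ∷ S) = 1Λ S
    1Λ (true  ∷ S) = 0#

    ⋀ : ∀ {k n} → Vec (Row n) k → Λ n
    ⋀ []      = 1Λ
    ⋀ (r ∷ M) = wedge r (⋀ M)

    wedge-cong : ∀ {n} (v : Row n) {ω ω′ : Λ n} → (∀ S → ω S ≡ ω′ S) → ∀ S → wedge v ω S ≡ wedge v ω′ S
    wedge-cong []      h []          = refl
    wedge-cong (a ∷ v) h (false ∷ S) = wedge-cong v (λ T → h (false ∷ T)) S
    wedge-cong (a ∷ v) h (true  ∷ S) = cong₂ (λ x y → a * x + - y) (h (false ∷ S)) (wedge-cong v (λ T → h (true ∷ T)) S)

    wedge-linʳ : ∀ {n} (v : Row n) c (ω ω′ : Λ n) S →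
      wedge v (λ T → ω T + c * ω′ T) S ≡ wedge v ω S + c * wedge v ω′ S
    wedge-linʳ []      c ω ω′ []          = sym (trans (cong (0# +_) (zeroʳ c)) (+-identityˡ 0#))
    wedge-linʳ (a ∷ v) c ω ω′ (false ∷ S) = wedge-linʳ v c _ _ S
    wedge-linʳ (a ∷ v) c ω ω′ (true  ∷ S) = trans
      (cong (λ z → a * (ω (false ∷ S) + c * ω′ (false ∷ S)) + - z) (wedge-linʳ v c _ _ S))
      (solve 6 (λ a c x y z w → a :* (x :+ c :* y) :+ :- (z :+ c :* w) :=
         (a :* x :+ :- z) :+ c :* (a :* y :+ :- w)) refl a c _ _ _ _)

    wedge-linˡ : ∀ {n} c (u v : Row n) (ω : Λ n) S →
      wedge (u ⊕ c ⊙ v) ω S ≡ wedge u ω S + c * wedge v ω S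
    wedge-linˡ c []      []      ω []          = sym (trans (cong (0# +_) (zeroʳ c)) (+-identityˡ 0#))
    wedge-linˡ c (a ∷ u) (b ∷ v) ω (false ∷ S) = wedge-linˡ c u v _ S
    wedge-linˡ c (a ∷ u) (b ∷ v) ω (true  ∷ S) = trans
      (cong (λ z → (a + c * b) * ω (false ∷ S) + - z) (wedge-linˡ c u v _ S))
      (solve 6 (λ a b c x z w → (a :+ c :* b) :* x :+ :- (z :+ c :* w) :=
         (a :* x :+ :- z) :+ c :* (b :* x :+ :- w)) refl a b c _ _ _)

    wedge-zeroʳ : ∀ {n} (v : Row n) {ω : Λ n} → (∀ S → ω S ≡ 0#) → ∀ S → wedge v ω S ≡ 0#
    wedge-zeroʳ []      h []          = refl
    wedge-zeroʳ (a ∷ v) h (false ∷ S) = wedge-zeroʳ v (λ T → h (false ∷ T)) S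
    wedge-zeroʳ (a ∷ v) h (true  ∷ S) = trans (cong₂ (λ x y → a * x + - y) (h (false ∷ S)) (wedge-zeroʳ v (λ T → h (true ∷ T)) S))
      (solve 1 (λ a → a :* c0 :+ :- c0 := c0) refl a)

    wedge-0ᵛ : ∀ {n} (ω : Λ n) S → wedge 0ᵛ ω S ≡ 0#
    wedge-0ᵛ ω []          = refl
    wedge-0ᵛ ω (false ∷ S) = wedge-0ᵛ _ S
    wedge-0ᵛ ω (true  ∷ S) = trans (cong (λ y → 0# * ω (false ∷ S) + - y) (wedge-0ᵛ _ S))
      (solve 1 (λ a → c0 :* a :+ :- c0 := c0) refl _)

    wedge-⊙ : ∀ {n} c (v : Row n) (ω : Λ n) S → wedge (c ⊙ v) ω S ≡ c * wedge v ω S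
    wedge-⊙ c v ω S = trans (cong (λ z → wedge z ω S) (sym (⊕-identityˡ (c ⊙ v))))
      (trans (wedge-linˡ c 0ᵛ v ω S) (trans (cong (λ z → z + c * wedge v ω S) (wedge-0ᵛ ω S)) (+-identityˡ _)))

    wedge-⊕ : ∀ {n} (u v : Row n) (ω : Λ n) S → wedge (u ⊕ v) ω S ≡ wedge u ω S + wedge v ω S
    wedge-⊕ u v ω S = trans (cong (λ z → wedge (u ⊕ z) ω S) (sym (1⊙ v)))
      (trans (wedge-linˡ 1# u v ω S) (cong (wedge u ω S +_) (*-identityˡ _)))

    wedge-neg : ∀ {n} (v : Row n) (ω : Λ n) S → wedge v (λ T → - ω T) S ≡ - wedge v ω S
    wedge-neg []      ω []          = solve 0 (c0 := :- c0) refl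
    wedge-neg (a ∷ v) ω (false ∷ S) = wedge-neg v _ S
    wedge-neg (a ∷ v) ω (true  ∷ S) = trans (cong (λ z → a * (- ω (false ∷ S)) + - z) (wedge-neg v _ S))
      (solve 3 (λ a x y → a :* :- x :+ :- (:- y) := :- (a :* x :+ :- y)) refl a _ _)

    wedge-anti : ∀ {n} (u v : Row n) (ω : Λ n) S → wedge u (wedge v ω) S ≡ - wedge v (wedge u ω) S
    wedge-anti []      []      ω []          = solve 0 (c0 := :- c0) refl
    wedge-anti (a ∷ u) (b ∷ v) ω (false ∷ S) = wedge-anti u v _ S
    wedge-anti (a ∷ u) (b ∷ v) ω (true  ∷ S) = trans
      (cong (λ z → a * wedge v ω₀ S + - z) (split u b v))
      (trans (cong (λ z → a * wedge v ω₀ S + - (b * wedge u ω₀ S + - z)) (wedge-anti u v ω₁ S))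
      (trans (solve 5 (λ a b x y z → a :* x :+ :- (b :* y :+ :- (:- z)) := :- (b :* y :+ :- (a :* x :+ :- z))) refl a b _ _ _)
      (cong (λ z → - (b * wedge u ω₀ S + - z)) (sym (split v a u)))))
      where
      ω₀ = λ T → ω (false ∷ T)
      ω₁ = λ T → ω (true ∷ T)
      split : ∀ u b v → wedge u (λ T → b * ω₀ T + - wedge v ω₁ T) S ≡ b * wedge u ω₀ S + - wedge u (wedge v ω₁) S
      split u b v = trans (wedge-cong u (λ T → trans (+-comm _ _) refl) S)
        (trans (wedge-linʳ u b (λ T → - wedge v ω₁ T) ω₀ S)
        (trans (+-comm _ _) (cong (b * wedge u ω₀ S +_) (wedge-neg u (wedge v ω₁) S))))

    -- Proved on its own, since `wedge-anti` only gives x = - x and the characteristic is not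
    -- restricted here.
    wedge-self : ∀ {n} (v : Row n) (ω : Λ n) S → wedge v (wedge v ω) S ≡ 0#
    wedge-self []      ω []          = refl
    wedge-self (a ∷ v) ω (false ∷ S) = wedge-self v _ S
    wedge-self (a ∷ v) ω (true  ∷ S) = trans
      (cong (λ z → a * wedge v ω₀ S + - z) (trans (wedge-cong v (λ T → +-comm _ _) S)
        (trans (wedge-linʳ v a (λ T → - wedge v ω₁ T) ω₀ S)
          (cong (_+ a * wedge v ω₀ S) (trans (wedge-neg v (wedge v ω₁) S) (cong -_ (wedge-self v ω₁ S)))))))
      (solve 2 (λ a x → a :* x :+ :- (:- c0 :+ a :* x) := c0) refl a _)
      where
      ω₀ = λ T → ω (false ∷ T)
      ω₁ = λ T → ω (true ∷ T)

    -- The algebra map Λ(Cⁿ) → Λ(Cᴺ) induced by sending the basis vectors to the rows of Y.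
    push : ∀ {n N} → Vec (Row N) n → Λ n → Λ N
    push []      ω S = ω [] * 1Λ S
    push (y ∷ Y) ω S = push Y (λ T → ω (false ∷ T)) S + wedge y (push Y (λ T → ω (true ∷ T))) S

    push-cong : ∀ {n N} (Y : Vec (Row N) n) {ω ω′ : Λ n} → (∀ S → ω S ≡ ω′ S) → ∀ S → push Y ω S ≡ push Y ω′ S
    push-cong []      h S = cong (_* 1Λ S) (h [])
    push-cong (y ∷ Y) h S = cong₂ _+_ (push-cong Y (λ T → h (false ∷ T)) S)
      (wedge-cong y (push-cong Y (λ T → h (true ∷ T))) S)

    push-lin : ∀ {n N} (Y : Vec (Row N) n) c (ω ω′ : Λ n) S →
      push Y (λ T → ω T + c * ω′ T) S ≡ push Y ω S + c * push Y ω′ S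
    push-lin []      c ω ω′ S = solve 4 (λ x c y e → (x :+ c :* y) :* e := x :* e :+ c :* (y :* e)) refl (ω []) c (ω′ []) (1Λ S)
    push-lin (y ∷ Y) c ω ω′ S = trans
      (cong₂ _+_ (push-lin Y c _ _ S) (trans (wedge-cong y (push-lin Y c _ _) S) (wedge-linʳ y c _ _ S)))
      (solve 5 (λ c p q r s → (p :+ c :* q) :+ (r :+ c :* s) := (p :+ r) :+ c :* (q :+ s)) refl c _ _ _ _)

    push-zero : ∀ {n N} (Y : Vec (Row N) n) {ω : Λ n} → (∀ S → ω S ≡ 0#) → ∀ S → push Y ω S ≡ 0#
    push-zero []      h S = trans (cong (_* 1Λ S) (h [])) (zeroˡ _)
    push-zero (y ∷ Y) h S = trans (cong₂ _+_ (push-zero Y (λ T → h (false ∷ T)) S)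
      (wedge-zeroʳ y (push-zero Y (λ T → h (true ∷ T))) S)) (+-identityˡ 0#)

    -- Multiplicativity of `push Y` when the left factor has degree one; iterated over the rows of X
    -- it yields `⋀-⊗`, hence multiplicativity of the determinant.
    push-wedge : ∀ {n N} (v : Row n) (Y : Vec (Row N) n) (ω : Λ n) S →
      push Y (wedge v ω) S ≡ wedge (vm v Y) (push Y ω) S
    push-wedge []      []      ω S = trans (zeroˡ _) (sym (wedge-0ᵛ (push [] ω) S))
    push-wedge (a ∷ v) (y ∷ Y) ω S = begin
      push Y (wedge v ω₀) S + wedge y (push Y (λ T → a * ω₀ T + - wedge v ω₁ T)) S
        ≡⟨ cong₂ _+_ (push-wedge v Y ω₀ S) (trans (wedge-cong y inner S) (wedge-linʳ y a _ _ S)) ⟩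
      wedge v′ (push Y ω₀) S + (wedge y (λ T → - wedge v′ (push Y ω₁) T) S + a * wedge y (push Y ω₀) S)
        ≡⟨ cong (λ z → wedge v′ (push Y ω₀) S + (z + a * wedge y (push Y ω₀) S))
             (trans (wedge-neg y _ S) (sym (wedge-anti v′ y (push Y ω₁) S))) ⟩
      wedge v′ (push Y ω₀) S + (wedge v′ (wedge y (push Y ω₁)) S + a * wedge y (push Y ω₀) S)
        -- The zero introduced here is the value of y ∧ y ∧ `push Y ω₁`. Adding it lets the terms
        -- with the factor a be collected into a single wedge with `push (y ∷ Y) ω`.
        ≡⟨ solve 5 (λ a p q r z → p :+ (q :+ a :* r) := (a :* (r :+ c0) :+ (p :+ q))) refl a _ _ _ 0# ⟩
      a * (wedge y (push Y ω₀) S + 0#) + (wedge v′ (push Y ω₀) S + wedge v′ (wedge y (push Y ω₁)) S)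
        ≡⟨ cong₂ (λ z w → a * (wedge y (push Y ω₀) S + z) + w) (sym (wedge-self y (push Y ω₁) S)) (sym (wedge-add v′ _ _ S)) ⟩
      a * (wedge y (push Y ω₀) S + wedge y (wedge y (push Y ω₁)) S) + wedge v′ (push (y ∷ Y) ω) S
        ≡⟨ cong (λ z → a * z + wedge v′ (push (y ∷ Y) ω) S) (sym (wedge-add y _ _ S)) ⟩
      a * wedge y (push (y ∷ Y) ω) S + wedge v′ (push (y ∷ Y) ω) S
        ≡⟨ cong (_+ wedge v′ (push (y ∷ Y) ω) S) (sym (wedge-⊙ a y _ S)) ⟩
      wedge (a ⊙ y) (push (y ∷ Y) ω) S + wedge v′ (push (y ∷ Y) ω) S
        ≡⟨ sym (wedge-⊕ (a ⊙ y) v′ _ S) ⟩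
      wedge (a ⊙ y ⊕ v′) (push (y ∷ Y) ω) S ∎
      where
      v′ = vm v Y
      ω₀ = λ T → ω (false ∷ T)
      ω₁ = λ T → ω (true ∷ T)
      wedge-add : ∀ {n} (v : Row n) (ω ω′ : Λ n) S → wedge v (λ T → ω T + ω′ T) S ≡ wedge v ω S + wedge v ω′ S
      wedge-add v ω ω′ S = trans (wedge-cong v (λ T → cong (ω T +_) (sym (*-identityˡ _))) S)
        (trans (wedge-linʳ v 1# ω ω′ S) (cong (wedge v ω S +_) (*-identityˡ _)))
      inner : ∀ T → push Y (λ T → a * ω₀ T + - wedge v ω₁ T) T ≡ - wedge v′ (push Y ω₁) T + a * push Y ω₀ T
      inner T = trans (push-cong Y (λ U → solve 3 (λ a x y → a :* x :+ :- y := a :* x :+ :- c1 :* y) refl a (ω₀ U) (wedge v ω₁ U)) T)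
        (trans (push-lin Y (- 1#) (λ U → a * ω₀ U) (wedge v ω₁) T)
        (trans (cong₂ (λ x y → x + - 1# * y) (push-scale Y a ω₀ T) (push-wedge v Y ω₁ T))
          (solve 2 (λ x y → x :+ :- c1 :* y := :- y :+ x) refl _ _)))
        where
        push-scale : ∀ {n N} (Y : Vec (Row N) n) c (ω : Λ n) S → push Y (λ T → c * ω T) S ≡ c * push Y ω S
        push-scale Y c ω S = trans (push-cong Y (λ T → sym (+-identityˡ _)) S)
          (trans (push-lin Y c (λ _ → 0#) ω S) (trans (cong (λ z → z + c * push Y ω S) (push-zero Y (λ _ → refl) S)) (+-identityˡ _)))

    push-1 : ∀ {n N} (Y : Vec (Row N) n) S → push Y 1Λ S ≡ 1Λ S
    push-1 []      S = *-identityˡ _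
    push-1 (y ∷ Y) S = trans (cong₂ _+_ (push-1 Y S) (wedge-zeroʳ y (push-zero Y (λ _ → refl)) S)) (+-identityʳ _)

    ⋀-⊗ : ∀ {l k n} (X : Vec (Row k) l) (Y : Vec (Row n) k) S → ⋀ (X ⊗ Y) S ≡ push Y (⋀ X) S
    ⋀-⊗ []      Y S = sym (push-1 Y S)
    ⋀-⊗ (r ∷ X) Y S = trans (wedge-cong (vm r Y) (⋀-⊗ X Y) S) (sym (push-wedge r Y (⋀ X) S))

    full : ∀ n → Vec Bool n
    full n = replicate n true

    size : ∀ {n} → Vec Bool n → ℕ
    size []          = 0
    size (false ∷ S) = size S
    size (true  ∷ S) = suc (size S)

    wedge-degree : ∀ {n} (v : Row n) {ω : Λ n} {k} → (∀ S → size S ≢ k → ω S ≡ 0#) →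
      ∀ S → size S ≢ suc k → wedge v ω S ≡ 0#
    wedge-degree []      h []          ne = refl
    wedge-degree (a ∷ v) h (false ∷ S) ne = wedge-degree v (λ T → h (false ∷ T)) S ne
    wedge-degree (a ∷ v) {ω} {k} h (true ∷ S) ne = trans
      (cong₂ (λ x y → a * x + - y) (h (false ∷ S) (λ e → ne (cong suc e))) (tail k h ne))
      (solve 1 (λ a → a :* c0 :+ :- c0 := c0) refl a)
      where
      tail : ∀ k → (∀ S → size S ≢ k → ω S ≡ 0#) → suc (size S) ≢ suc k → wedge v (λ T → ω (true ∷ T)) S ≡ 0#
      tail zero    h ne = wedge-zeroʳ v (λ T → h (true ∷ T) λ ()) S
      tail (suc k) h ne = wedge-degree v (λ T neT → h (true ∷ T) λ e → neT (ℕP.suc-injective e)) S (λ e → ne (cong suc e))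

    ⋀-degree : ∀ {k n} (M : Vec (Row n) k) S → size S ≢ k → ⋀ M S ≡ 0#
    ⋀-degree []      []          ne = contradiction refl ne
    ⋀-degree []      (false ∷ S) ne = ⋀-degree [] S ne
    ⋀-degree []      (true  ∷ S) ne = refl
    ⋀-degree (r ∷ M) S           ne = wedge-degree r (⋀-degree M) S ne

    size≤ : ∀ {n} (S : Vec Bool n) → size S ℕ.≤ n
    size≤ []          = ℕ.z≤n
    size≤ (false ∷ S) = ℕP.m≤n⇒m≤1+n (size≤ S)
    size≤ (true  ∷ S) = ℕ.s≤s (size≤ S)

    -- A form of top degree is a multiple of the wedge of all basis vectors, and `push Y` sends that
    -- wedge to `⋀ Y`. Every other coefficient belongs to a subset of smaller size and is 0.
    push-top : ∀ {n N} (Y : Vec (Row N) n) (ω : Λ n) → (∀ S → size S ≢ n → ω S ≡ 0#) →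
      ∀ S → push Y ω S ≡ ω (full n) * ⋀ Y S
    push-top []      ω h S = refl
    push-top {suc n} (y ∷ Y) ω h S = trans (cong₂ _+_
        (push-zero Y (λ T → h (false ∷ T) λ e → ℕP.<-irrefl e (ℕ.s≤s (size≤ T))) S)
        (trans (wedge-cong y (push-top Y _ λ T ne → h (true ∷ T) λ e → ne (ℕP.suc-injective e)) S)
          (trans (wedge-cong y (λ T → sym (+-identityˡ _)) S)
          (trans (wedge-linʳ y (ω (full (suc n))) (λ _ → 0#) (⋀ Y) S)
            (cong (λ z → z + ω (full (suc n)) * ⋀ (y ∷ Y) S) (wedge-zeroʳ y (λ _ → refl) S))))))
      (solve 1 (λ x → c0 :+ (c0 :+ x) := x) refl _)

    detΛ : ∀ {n} → Mat n → Carrier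
    detΛ {n} M = ⋀ M (full n)

    detΛ-⊗ : ∀ {n} (X Y : Mat n) → detΛ (X ⊗ Y) ≡ detΛ X * detΛ Y
    detΛ-⊗ {n} X Y = trans (⋀-⊗ X Y (full n)) (push-top Y (⋀ X) (⋀-degree X) (full n))

    laplace : ∀ {n} (minors : Fin (suc n) → Carrier) {k} → Row k → Vec (Fin (suc n)) k → Carrier → Carrier
    laplace m []       []       s = 0#
    laplace m (a ∷ as) (j ∷ js) s = (s * (a * m j)) + laplace m as js (- s)

    -- The recursion inside det is local to Defs and has no name; generalising the goal after two
    -- steps makes its length independent of the size of the matrix, so that the placeholder in the type
    -- of det-steps is solved by unification.
    mutual
      det-steps : ∀ n (r : Row (suc n)) (M : Vec (Row (suc n)) n) k (as : Row k) (js : Vec (Fin (suc n)) k) s →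
        _ ≡ laplace (λ j → det (map (dropAt j) M)) as js s
      det-steps n r M _ []       []       s = refl
      det-steps n r M _ (a ∷ as) (j ∷ js) s =
        cong ((s * (a * det (map (dropAt j) M))) +_) (det-steps n r M _ as js (- s))

      det-laplace₂ : ∀ m a b (t : Row m) M → det ((a ∷ b ∷ t) ∷ M)
        ≡ laplace (λ j → det (map (dropAt j) M)) (a ∷ b ∷ t) (Vec.allFin (suc (suc m))) 1#
      det-laplace₂ m a b t M with suc m | a ∷ b ∷ t | Fin.suc (Fin.zero {m})
                                | Vec.tabulate {n = m} (λ x → Fin.suc (Fin.suc x)) | - (- 1#)
      ... | N | r | j₁ | js | s = cong₂ _+_ refl (cong₂ _+_ refl (det-steps N r M m t js s))

    det-laplace : ∀ {n} (r : Row (suc n)) M → det (r ∷ M)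
      ≡ laplace (λ j → det (map (dropAt j) M)) r (Vec.allFin (suc n)) 1#
    det-laplace (a ∷ [])    M = refl
    det-laplace (a ∷ b ∷ t) M = det-laplace₂ _ a b t M

    alt : ∀ {k} → (Fin k → Carrier) → Row k → Carrier
    alt f []       = 0#
    alt f (a ∷ as) = a * f zero + - alt (f ∘ suc) as

    laplace-alt : ∀ {n} (m : Fin (suc n) → Carrier) {k} (as : Row k) (g : Fin k → Fin (suc n)) s →
      laplace m as (Vec.tabulate g) s ≡ s * alt (m ∘ g) as
    laplace-alt m []       g s = sym (zeroʳ s)
    laplace-alt m (a ∷ as) g s = trans (cong (s * (a * m (g zero)) +_) (laplace-alt m as (g ∘ suc) (- s)))
      (solve 4 (λ s a x y → s :* (a :* x) :+ :- s :* y := s :* (a :* x :+ :- y)) refl s a _ _)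

    alt-cong : ∀ {k} {f g : Fin k → Carrier} → (∀ j → f j ≡ g j) → (as : Row k) → alt f as ≡ alt g as
    alt-cong h []       = refl
    alt-cong h (a ∷ as) = cong₂ (λ x y → a * x + - y) (h zero) (alt-cong (λ j → h (suc j)) as)

    skip : ∀ {n} → Fin (suc n) → Vec Bool n → Vec Bool (suc n)
    skip         zero    S       = false ∷ S
    skip {suc n} (suc j) (b ∷ S) = b ∷ skip j S

    wedge-skip : ∀ {n} (j : Fin (suc n)) (v : Row (suc n)) (ω : Λ (suc n)) S →
      wedge v ω (skip j S) ≡ wedge (dropAt j v) (λ T → ω (skip j T)) S
    wedge-skip         zero    (a ∷ v) ω S           = refl
    wedge-skip {suc n} (suc j) (a ∷ v) ω (false ∷ S) = wedge-skip j v _ S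
    wedge-skip {suc n} (suc j) (a ∷ v) ω (true  ∷ S) =
      cong (λ z → a * ω (false ∷ skip j S) + - z) (wedge-skip j v _ S)

    1Λ-skip : ∀ {n} (j : Fin (suc n)) S → 1Λ (skip j S) ≡ 1Λ S
    1Λ-skip         zero    S           = refl
    1Λ-skip {suc n} (suc j) (false ∷ S) = 1Λ-skip j S
    1Λ-skip {suc n} (suc j) (true  ∷ S) = refl

    ⋀-skip : ∀ {k n} (j : Fin (suc n)) (M : Vec (Row (suc n)) k) S → ⋀ M (skip j S) ≡ ⋀ (map (dropAt j) M) S
    ⋀-skip j []      S = 1Λ-skip j S
    ⋀-skip j (r ∷ M) S = trans (wedge-skip j r (⋀ M) S) (wedge-cong (dropAt j r) (⋀-skip j M) S)

    wedge-full : ∀ {n} (v : Row (suc n)) (ω : Λ (suc n)) →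
      wedge v ω (full (suc n)) ≡ alt (λ j → ω (skip j (full n))) v
    wedge-full {zero}  (a ∷ [])    ω = refl
    wedge-full {suc n} (a ∷ b ∷ v) ω = cong (λ z → a * ω (false ∷ full (suc n)) + - z)
      (wedge-full (b ∷ v) (λ T → ω (true ∷ T)))

    -- Both sides are expanded along the first row: the minor that omits column j is the coefficient
    -- of `⋀ M` at the complement of j, which is what `skip j` encodes.
    det≡detΛ : ∀ {n} (M : Mat n) → det M ≡ detΛ M
    det≡detΛ []                = refl
    det≡detΛ {suc n} (r ∷ M) = begin
      det (r ∷ M)
        ≡⟨ trans (det-laplace r M) (trans (laplace-alt minor r id 1#) (*-identityˡ _)) ⟩
      alt minor r
        ≡⟨ alt-cong (λ j → trans (det≡detΛ (map (dropAt j) M)) (sym (⋀-skip j M (full n)))) r ⟩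
      alt (λ j → ⋀ M (skip j (full n))) r
        ≡⟨ sym (wedge-full r (⋀ M)) ⟩
      ⋀ (r ∷ M) (full (suc n)) ∎
      where
      minor = λ j → det (map (dropAt j) M)

    -- det unfolds on explicit matrices; Det is the same function made opaque.
    opaque
      Det : ∀ {n} → Mat n → Carrier
      Det = det

      Det≡det : ∀ {n} (M : Mat n) → Det M ≡ det M
      Det≡det M = refl

      Det≡detΛ : ∀ {n} (M : Mat n) → Det M ≡ detΛ M
      Det≡detΛ = det≡detΛ

-- Adjugates, elimination and generation of SL_n by transvections

module SpecialLinear where
  open LinAlg
  open import Data.Vec.Base using (Vec; []; _∷_; map; zipWith; replicate; lookup; _[_]≔_; tabulate; head; tail)
  open import Data.Fin.Base using (Fin; zero; suc)
  import Data.Fin.Properties as FinP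

  module SL {q : ℕ} (F : FiniteField q) where

    open Linear F public
    open ≡-Reasoning

    infix 4 _≟ᵛ_

    _≟ᵛ_ : ∀ {n} (u v : Row n) → Relation.Nullary.Dec (u ≡ v)
    _≟ᵛ_ = VecP.≡-dec _≟_

    det-⊗ : ∀ {n} (X Y : Mat n) → Det (X ⊗ Y) ≡ Det X * Det Y
    det-⊗ X Y = trans (Det≡detΛ (X ⊗ Y)) (trans (detΛ-⊗ X Y) (sym (cong₂ _*_ (Det≡detΛ X) (Det≡detΛ Y))))

    -- For h in SL_m these matrices form the affine group F^m ⋊ SL_m inside SL_(m+1); `blk-⊗` is its
    -- semidirect product law.
    blk : ∀ {m} → Row m → Mat m → Mat (suc m)
    blk w h = (1# ∷ 0ᵛ) ∷ zipWith _∷_ w h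

    ⋀-false : ∀ {k m} (w : Row k) (h : Vec (Row m) k) S → ⋀ (zipWith _∷_ w h) (false ∷ S) ≡ ⋀ h S
    ⋀-false []      []      S = refl
    ⋀-false (a ∷ w) (r ∷ h) S = wedge-cong r (⋀-false w h) S

    ⋀-true : ∀ {k m} (h : Vec (Row m) k) S → ⋀ (zipWith _∷_ 0ᵛ h) (true ∷ S) ≡ 0#
    ⋀-true []      S = refl
    ⋀-true (r ∷ h) S = trans (cong (λ z → 0# * ⋀ (zipWith _∷_ 0ᵛ h) (false ∷ S) + - z) (wedge-zeroʳ r (⋀-true h) S))
      (solve 1 (λ x → c0 :* x :+ :- c0 := c0) refl _)

    det-lower : ∀ {m} a (w : Row m) (h : Mat m) → Det ((a ∷ 0ᵛ) ∷ zipWith _∷_ w h) ≡ a * Det h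
    det-lower {m} a w h = begin
      Det ((a ∷ 0ᵛ) ∷ zipWith _∷_ w h)
        ≡⟨ Det≡detΛ ((a ∷ 0ᵛ) ∷ zipWith _∷_ w h) ⟩
      a * ⋀ (zipWith _∷_ w h) (false ∷ full m) + - wedge 0ᵛ (λ T → ⋀ (zipWith _∷_ w h) (true ∷ T)) (full m)
        ≡⟨ cong₂ (λ x y → a * x + - y) (⋀-false w h (full m)) (wedge-0ᵛ _ (full m)) ⟩
      a * detΛ h + - 0#
        ≡⟨ solve 1 (λ x → x :+ :- c0 := x) refl _ ⟩
      a * detΛ h
        ≡⟨ cong (a *_) (sym (Det≡detΛ h)) ⟩
      a * Det h ∎

    det-upper : ∀ {m} a (z : Row m) (h : Mat m) → Det ((a ∷ z) ∷ zipWith _∷_ 0ᵛ h) ≡ a * Det h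
    det-upper {m} a z h = begin
      Det ((a ∷ z) ∷ zipWith _∷_ 0ᵛ h)
        ≡⟨ Det≡detΛ ((a ∷ z) ∷ zipWith _∷_ 0ᵛ h) ⟩
      a * ⋀ (zipWith _∷_ 0ᵛ h) (false ∷ full m) + - wedge z (λ T → ⋀ (zipWith _∷_ 0ᵛ h) (true ∷ T)) (full m)
        ≡⟨ cong₂ (λ x y → a * x + - y) (⋀-false 0ᵛ h (full m)) (wedge-zeroʳ z (⋀-true h) (full m)) ⟩
      a * detΛ h + - 0#
        ≡⟨ solve 1 (λ x → x :+ :- c0 := x) refl _ ⟩
      a * detΛ h
        ≡⟨ cong (a *_) (sym (Det≡detΛ h)) ⟩
      a * Det h ∎

    det-blk : ∀ {m} (w : Row m) (h : Mat m) → Det (blk w h) ≡ Det h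
    det-blk w h = trans (det-lower 1# w h) (*-identityˡ _)

    det-Id : ∀ n → Det (Id n) ≡ 1#
    det-Id zero    = Det≡detΛ []
    det-Id (suc n) = trans (cong (λ M → Det ((1# ∷ 0ᵛ) ∷ M)) (map-0∷ (Id n))) (trans (det-blk 0ᵛ (Id n)) (det-Id n))

    Id-blk : ∀ n → Id (suc n) ≡ blk 0ᵛ (Id n)
    Id-blk n = cong ((1# ∷ 0ᵛ) ∷_) (map-0∷ (Id n))

    vm-blk : ∀ {m} a (u w : Row m) h → vm (a ∷ u) (blk w h) ≡ (a + dot u w) ∷ vm u h
    vm-blk a u w h = trans (cong ((a ⊙ (1# ∷ 0ᵛ)) ⊕_) (vm-cons u w h))
      (cong₂ _∷_ (cong (_+ dot u w) (*-identityʳ a)) (trans (cong (_⊕ vm u h) (⊙0 a)) (⊕-identityˡ _)))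

    blk-⊗ : ∀ {m} (w w′ : Row m) h h′ → blk w h ⊗ blk w′ h′ ≡ blk (w ⊕ mv h w′) (h ⊗ h′)
    blk-⊗ w w′ h h′ = cong₂ _∷_
      (trans (vm-blk 1# 0ᵛ w′ h′) (cong₂ _∷_ (trans (cong (1# +_) (dot-0ˡ w′)) (+-identityʳ 1#)) (vm-0 h′)))
      (rest w h)
      where
      rest : ∀ {k} (w : Row k) h → map (λ r → vm r (blk w′ h′)) (zipWith _∷_ w h) ≡ zipWith _∷_ (w ⊕ mv h w′) (h ⊗ h′)
      rest []      []      = refl
      rest (a ∷ w) (r ∷ h) = cong₂ _∷_ (vm-blk a r w′ h′) (rest w h)

    mv-cons : ∀ {k m} a (u : Row m) (w : Row k) h → mv (zipWith _∷_ w h) (a ∷ u) ≡ a ⊙ w ⊕ mv h u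
    mv-cons a u []      []      = refl
    mv-cons a u (b ∷ w) (r ∷ h) = cong₂ _∷_ (cong (_+ dot r u) (*-comm b a)) (mv-cons a u w h)

    -- `τ` parametrises V: right multiplication by `τ w` adds a combination of the other columns to
    -- the first one. `σ` is the transposed family.
    τ σ : ∀ {m} → Row m → Mat (suc m)
    τ w = blk w (Id _)
    σ z = (1# ∷ z) ∷ zipWith _∷_ 0ᵛ (Id _)

    det-τ : ∀ {m} (w : Row m) → Det (τ w) ≡ 1#
    det-τ w = trans (det-blk w (Id _)) (det-Id _)

    det-σ : ∀ {m} (z : Row m) → Det (σ z) ≡ 1#
    det-σ z = trans (det-upper 1# z (Id _)) (trans (*-identityˡ _) (det-Id _))

    vm-τ : ∀ {m} a (u w : Row m) → vm (a ∷ u) (τ w) ≡ (a + dot u w) ∷ u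
    vm-τ a u w = trans (vm-blk a u w (Id _)) (cong ((a + dot u w) ∷_) (vm-Id u))

    vm-σ : ∀ {m} a (u z : Row m) → vm (a ∷ u) (σ z) ≡ a ∷ (a ⊙ z ⊕ u)
    vm-σ a u z = trans (cong ((a ⊙ (1# ∷ z)) ⊕_) (trans (vm-cons u 0ᵛ (Id _)) (cong₂ _∷_ (dot-0ʳ u) (vm-Id u))))
      (cong (_∷ (a ⊙ z ⊕ u)) (solve 1 (λ a → a :* c1 :+ c0 := a) refl a))

    mv-τ : ∀ {m} a (u w : Row m) → mv (τ w) (a ∷ u) ≡ a ∷ (a ⊙ w ⊕ u)
    mv-τ a u w = cong₂ _∷_ (trans (cong (1# * a +_) (dot-0ˡ u)) (solve 1 (λ a → c1 :* a :+ c0 := a) refl a))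
      (trans (mv-cons a u w (Id _)) (cong (a ⊙ w ⊕_) (mv-Id u)))

    mv-σ : ∀ {m} a (u z : Row m) → mv (σ z) (a ∷ u) ≡ (a + dot z u) ∷ u
    mv-σ a u z = cong₂ _∷_ (cong (_+ dot z u) (*-identityˡ a))
      (trans (mv-cons a u 0ᵛ (Id _)) (trans (cong₂ _⊕_ (⊙0 a) (mv-Id u)) (⊕-identityˡ u)))

    vm-linear : ∀ {k n} (L : Row n → Carrier) → L 0ᵛ ≡ 0# → (∀ c u v → L (c ⊙ u ⊕ v) ≡ c * L u + L v) →
      ∀ (v : Row k) M → L (vm v M) ≡ dot v (map L M)
    vm-linear L L0 lin []      []      = L0
    vm-linear L L0 lin (a ∷ v) (r ∷ M) = trans (lin a r (vm v M)) (cong (a * L r +_) (vm-linear L L0 lin v M))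

    functional : ∀ {n} (L : Row n → Carrier) → L 0ᵛ ≡ 0# → (∀ c u v → L (c ⊙ u ⊕ v) ≡ c * L u + L v) →
      ∀ v → dot v (map L (Id n)) ≡ L v
    functional L L0 lin v = trans (sym (vm-linear L L0 lin v (Id _))) (cong L (vm-Id v))

    ⋀-linear : ∀ {k n} (M : Vec (Row n) k) i c u v S →
      ⋀ (M [ i ]≔ (c ⊙ u ⊕ v)) S ≡ c * ⋀ (M [ i ]≔ u) S + ⋀ (M [ i ]≔ v) S
    ⋀-linear (r ∷ M) zero    c u v S = trans (cong (λ z → wedge z (⋀ M) S) (⊕-comm (c ⊙ u) v))
      (trans (wedge-linˡ c v u (⋀ M) S) (+-comm _ _))
    ⋀-linear (r ∷ M) (suc i) c u v S = trans (wedge-cong r (λ T → trans (⋀-linear M i c u v T) (+-comm _ _)) S)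
      (trans (wedge-linʳ r c (⋀ (M [ i ]≔ v)) (⋀ (M [ i ]≔ u)) S) (+-comm _ _))

    ⋀-0 : ∀ {k n} (M : Vec (Row n) k) i S → ⋀ (M [ i ]≔ 0ᵛ) S ≡ 0#
    ⋀-0 (r ∷ M) zero    S = wedge-0ᵛ (⋀ M) S
    ⋀-0 (r ∷ M) (suc i) S = wedge-zeroʳ r (⋀-0 M i) S

    wedge-row : ∀ {k n} (M : Vec (Row n) k) i S → wedge (lookup M i) (⋀ M) S ≡ 0#
    wedge-row (r ∷ M) zero    S = wedge-self r (⋀ M) S
    wedge-row (r ∷ M) (suc i) S = trans (wedge-anti (lookup M i) r (⋀ M) S)
      (trans (cong -_ (wedge-zeroʳ r (wedge-row M i) S)) (solve 0 (:- c0 := c0) refl))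

    ⋀-repeat : ∀ {k n} (M : Vec (Row n) k) i j → i ≢ j → ∀ S → ⋀ (M [ i ]≔ lookup M j) S ≡ 0#
    ⋀-repeat (r ∷ M) zero    zero    ne S = contradiction refl ne
    ⋀-repeat (r ∷ M) zero    (suc j) ne S = wedge-row M j S
    ⋀-repeat (r ∷ M) (suc i) zero    ne S = trans
      (cong (λ z → wedge z (⋀ (M [ i ]≔ r)) S) (sym (VecP.lookup∘updateAt i M)))
      (wedge-row (M [ i ]≔ r) i S)
    ⋀-repeat (r ∷ M) (suc i) (suc j) ne S = wedge-zeroʳ r (⋀-repeat M i j (λ e → ne (cong suc e))) S

    tr : ∀ {k m} → Vec (Row k) m → Vec (Row m) k
    tr []      = replicate _ []
    tr (ξ ∷ Ξ) = zipWith _∷_ ξ (tr Ξ)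

    vm-tr : ∀ {k m} (r : Row k) (Ξ : Vec (Row k) m) → vm r (tr Ξ) ≡ map (dot r) Ξ
    vm-tr r []      = empty (vm r (replicate _ []))
      where
      empty : ∀ (v : Row 0) → v ≡ []
      empty [] = refl
    vm-tr r (ξ ∷ Ξ) = trans (vm-cons r ξ (tr Ξ)) (cong (dot r ξ ∷_) (vm-tr r Ξ))

    module _ {n} (x : Mat n) where

      replaced : Fin n → Row n → Carrier
      replaced i v = Det (x [ i ]≔ v)

      -- The row i of x is varied and the resulting linear functional is recorded by its values on
      -- the standard basis; this gives the cofactors without any bookkeeping of signs.
      cofactors : Fin n → Row n
      cofactors i = map (replaced i) (Id n)

      cofactors-spec : ∀ i v → dot v (cofactors i) ≡ replaced i v
      cofactors-spec i = functional (replaced i)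
        (trans (Det≡detΛ (x [ i ]≔ 0ᵛ)) (⋀-0 x i (full n)))
        (λ c u v → trans (Det≡detΛ (x [ i ]≔ (c ⊙ u ⊕ v))) (trans (⋀-linear x i c u v (full n))
          (cong₂ (λ a b → c * a + b) (sym (Det≡detΛ (x [ i ]≔ u))) (sym (Det≡detΛ (x [ i ]≔ v))))))

    opaque
      adj : ∀ {n} → Mat n → Mat n
      adj x = tr (tabulate (cofactors x))

      vm-adj : ∀ {n} (x : Mat n) r → vm r (adj x) ≡ map (dot r) (tabulate (cofactors x))
      vm-adj x r = vm-tr r (tabulate (cofactors x))

    lookup-Id : ∀ {n} (i : Fin n) → lookup (lookup (Id n) i) i ≡ 1#
    lookup-Id zero    = refl
    lookup-Id {suc n} (suc i) = trans (cong (λ r → lookup r (suc i)) (VecP.lookup-map i (0# ∷_) (Id n))) (lookup-Id i)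

    lookup-Id′ : ∀ {n} (i j : Fin n) → j ≢ i → lookup (lookup (Id n) i) j ≡ 0#
    lookup-Id′ zero    zero    ne = contradiction refl ne
    lookup-Id′ {suc n} zero    (suc j) ne = VecP.lookup-replicate j 0#
    lookup-Id′ {suc n} (suc i) zero    ne = cong (λ r → lookup r zero) (VecP.lookup-map i (0# ∷_) (Id n))
    lookup-Id′ {suc n} (suc i) (suc j) ne = trans (cong (λ r → lookup r (suc j)) (VecP.lookup-map i (0# ∷_) (Id n)))
      (lookup-Id′ i j λ e → ne (cong suc e))

    ext : ∀ {A : Set} {n} {u v : Vec A n} → (∀ i → lookup u i ≡ lookup v i) → u ≡ v
    ext {u = u} {v} h = trans (sym (VecP.tabulate∘lookup u)) (trans (VecP.tabulate-cong h) (VecP.tabulate∘lookup v))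

    -- The entry (k, i) of the product is the determinant of x with row i replaced by row k, and for
    -- k ≠ i this matrix has a repeated row.
    ⊗-adj : ∀ {n} (x : Mat n) → x ⊗ adj x ≡ map (Det x ⊙_) (Id n)
    ⊗-adj {n} x = ext λ k → begin
      lookup (x ⊗ adj x) k
        ≡⟨ trans (VecP.lookup-map k _ x) (vm-adj x (lookup x k)) ⟩
      map (dot (lookup x k)) (tabulate (cofactors x))
        ≡⟨ ext (λ i → trans (trans (VecP.lookup-map i _ (tabulate (cofactors x)))
             (trans (cong (dot (lookup x k)) (VecP.lookup∘tabulate (cofactors x) i)) (cofactors-spec x i (lookup x k))))
             (trans (entry k i) (sym (VecP.lookup-map i (Det x *_) (lookup (Id n) k))))) ⟩
      Det x ⊙ lookup (Id n) k
        ≡⟨ sym (VecP.lookup-map k (Det x ⊙_) (Id n)) ⟩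
      lookup (map (Det x ⊙_) (Id n)) k ∎
      where
      entry : ∀ k i → Det (x [ i ]≔ lookup x k) ≡ Det x * lookup (lookup (Id n) k) i
      entry k i with i FinP.≟ k
      ... | yes refl = trans (cong Det (VecP.[]≔-lookup x i)) (sym (trans (cong (Det x *_) (lookup-Id i)) (*-identityʳ _)))
      ... | no ne    = trans (trans (Det≡detΛ (x [ i ]≔ lookup x k)) (⋀-repeat x i k ne (full n)))
                         (sym (trans (cong (Det x *_) (lookup-Id′ k i ne)) (zeroʳ _)))

    vm-scale : ∀ {k n} c (r : Row k) (M : Vec (Row n) k) → vm r (map (c ⊙_) M) ≡ c ⊙ vm r M
    vm-scale c []      []      = sym (⊙0 c)
    vm-scale c (a ∷ r) (s ∷ M) = trans (cong₂ _⊕_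
        (trans (⊙-⊙ a c s) (trans (cong (_⊙ s) (*-comm a c)) (sym (⊙-⊙ c a s)))) (vm-scale c r M))
      (sym (⊙-⊕ c (a ⊙ s) (vm r M)))

    opaque
      right-inverse : ∀ {n} (x : Mat n) → Det x ≢ 0# → Σ (Mat n) λ z → x ⊗ z ≡ Id n
      right-inverse {n} x d≢0 with inverse (Det x) d≢0
      ... | e , de≡1 = map (e ⊙_) (adj x) , (begin
        x ⊗ map (e ⊙_) (adj x)            ≡⟨ VecP.map-cong (λ r → vm-scale e r (adj x)) x ⟩
        map (λ r → e ⊙ vm r (adj x)) x     ≡⟨ VecP.map-∘ (e ⊙_) (λ r → vm r (adj x)) x ⟩
        map (e ⊙_) (x ⊗ adj x)            ≡⟨ cong (map (e ⊙_)) (⊗-adj x) ⟩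
        map (e ⊙_) (map (Det x ⊙_) (Id n)) ≡⟨ sym (VecP.map-∘ (e ⊙_) (Det x ⊙_) (Id n)) ⟩
        map (λ r → e ⊙ (Det x ⊙ r)) (Id n) ≡⟨ VecP.map-cong (λ r → trans (⊙-⊙ e (Det x) r)
                                                (trans (cong (_⊙ r) (trans (*-comm e (Det x)) de≡1)) (1⊙ r))) (Id n) ⟩
        map id (Id n)                       ≡⟨ VecP.map-id (Id n) ⟩
        Id n ∎)

    unit≢0 : ∀ {a b} → a * b ≡ 1# → b ≢ 0#
    unit≢0 {a} e refl = 0≢1 (trans (sym (zeroʳ a)) e)

    left-inverse : ∀ {n} (x z : Mat n) → x ⊗ z ≡ Id n → z ⊗ x ≡ Id n
    left-inverse {n} x z xz with right-inverse z (unit≢0 (trans (sym (det-⊗ x z)) (trans (cong Det xz) (det-Id n))))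
    ... | y , zy = trans (cong (z ⊗_) x≡y) zy
      where
      x≡y : x ≡ y
      x≡y = trans (sym (⊗-Id x)) (trans (cong (x ⊗_) (sym zy)) (trans (sym (⊗-assoc x z y))
        (trans (cong (_⊗ y) xz) (Id-⊗ y))))

    SL-inverseʳ : ∀ {n} (x : Mat n) → Det x ≡ 1# → x ⊗ adj x ≡ Id n
    SL-inverseʳ {n} x d = trans (⊗-adj x) (trans (VecP.map-cong (λ r → trans (cong (_⊙ r) d) (1⊙ r)) (Id n)) (VecP.map-id (Id n)))

    SL-inverseˡ : ∀ {n} (x : Mat n) → Det x ≡ 1# → adj x ⊗ x ≡ Id n
    SL-inverseˡ x d = left-inverse x (adj x) (SL-inverseʳ x d)

    det-adj : ∀ {n} (x : Mat n) → Det x ≡ 1# → Det (adj x) ≡ 1#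
    det-adj {n} x d = trans (sym (trans (cong (_* Det (adj x)) d) (*-identityˡ _)))
      (trans (sym (det-⊗ x (adj x))) (trans (cong Det (SL-inverseʳ x d)) (det-Id n)))

    ⊗-cancelʳ : ∀ {k n} (u : Vec (Row n) k) (x y : Mat n) → x ⊗ y ≡ Id n → (u ⊗ x) ⊗ y ≡ u
    ⊗-cancelʳ u x y e = trans (⊗-assoc u x y) (trans (cong (u ⊗_) e) (⊗-Id u))

    ⊗-cancelˡ : ∀ {k n} (x y : Mat k) (u : Vec (Row n) k) → x ⊗ y ≡ Id k → x ⊗ (y ⊗ u) ≡ u
    ⊗-cancelˡ x y u e = trans (sym (⊗-assoc x y u)) (trans (cong (_⊗ u) e) (Id-⊗ u))

    det-SLˡ : ∀ {n} (x y : Mat n) → Det x ≡ 1# → Det (x ⊗ y) ≡ Det y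
    det-SLˡ x y d = trans (det-⊗ x y) (trans (cong (_* Det y) d) (*-identityˡ _))

    det-SLʳ : ∀ {n} (x y : Mat n) → Det y ≡ 1# → Det (x ⊗ y) ≡ Det x
    det-SLʳ x y d = trans (det-⊗ x y) (trans (cong (Det x *_) d) (*-identityʳ _))

    e₀ : ∀ {m} → Row (suc m)
    e₀ = 1# ∷ 0ᵛ

    opaque
      nonzero-dot : ∀ {n} (u : Row n) → u ≢ 0ᵛ → ∀ c → Σ (Row n) λ z → dot z u ≡ c
      nonzero-dot []      ne c = contradiction refl ne
      nonzero-dot (a ∷ u) ne c with a ≟ 0#
      ... | no a≢0 = let b , ab = inverse a a≢0 in (c * b ∷ 0ᵛ) ,
        trans (cong (c * b * a +_) (dot-0ˡ u)) (trans (solve 3 (λ c b a → c :* b :* a :+ c0 := c :* (a :* b)) refl c b a)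
          (trans (cong (c *_) ab) (*-identityʳ c)))
      ... | yes refl = let z , e = nonzero-dot u (λ u≡0 → ne (cong (0# ∷_) u≡0)) c in (0# ∷ z) ,
        trans (cong (_+ dot z u) (zeroˡ 0#)) (trans (+-identityˡ _) e)

    ⊙-≢0 : ∀ {n} a (v : Row n) → a ≢ 0# → v ≢ 0ᵛ → a ⊙ v ≢ 0ᵛ
    ⊙-≢0 a v a≢0 v≢0 e = let b , ab = inverse a a≢0 in v≢0 (trans (sym (1⊙ v))
      (trans (cong (_⊙ v) (trans (sym ab) (*-comm a b))) (trans (sym (⊙-⊙ b a v)) (trans (cong (b ⊙_) e) (⊙0 b)))))

    e₀≢0 : ∀ {m} → e₀ {m} ≢ 0ᵛ
    e₀≢0 e = 0≢1 (sym (cong head e))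

    cancel-tail : ∀ {m} (u : Row m) → 1# ⊙ (⊖ u) ⊕ u ≡ 0ᵛ
    cancel-tail u = trans (cong (_⊕ u) (1⊙ (⊖ u))) (⊕-inverseˡ u)

    -- A nonzero tail can be paired with some z to change the leading entry into 1, whatever a was;
    -- then τ clears the tail.
    column-tail : ∀ {m} a (u : Row m) → u ≢ 0ᵛ → Σ (Mat (suc m)) λ k → Det k ≡ 1# × mv k (a ∷ u) ≡ e₀
    column-tail a u u≢0 = let z , e = nonzero-dot u u≢0 (1# + - a) in τ (⊖ u) ⊗ σ z ,
      trans (det-SLˡ (τ (⊖ u)) (σ z) (det-τ (⊖ u))) (det-σ z) , (begin
        mv (τ (⊖ u) ⊗ σ z) (a ∷ u)   ≡⟨ mv-⊗ (τ (⊖ u)) (σ z) (a ∷ u) ⟩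
        mv (τ (⊖ u)) (mv (σ z) (a ∷ u)) ≡⟨ cong (mv (τ (⊖ u))) (trans (mv-σ a u z) (cong (_∷ u) (trans (cong (a +_) e)
             (solve 1 (λ a → a :+ (c1 :+ :- a) := c1) refl a)))) ⟩
        mv (τ (⊖ u)) (1# ∷ u)        ≡⟨ trans (mv-τ 1# u (⊖ u)) (cong (1# ∷_) (cancel-tail u)) ⟩
        e₀ ∎)

    column-to-e₀ : ∀ {m} (u : Row (suc (suc m))) → u ≢ 0ᵛ → Σ (Mat (suc (suc m))) λ k → Det k ≡ 1# × mv k u ≡ e₀
    column-to-e₀ {m} (a ∷ u) ne with u ≟ᵛ 0ᵛ
    ... | no u≢0 = column-tail a u u≢0
    -- With a zero tail, a is first copied into the second entry. This requires at least two
    -- entries.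
    ... | yes refl = let
        a≢0 = λ a≡0 → ne (cong (_∷ 0ᵛ) a≡0)
        k , dk , e = column-tail a (a ⊙ e₀ {m} ⊕ 0ᵛ) (λ z → ⊙-≢0 a e₀ a≢0 e₀≢0 (trans (sym (⊕-identityʳ (a ⊙ e₀))) z))
      in k ⊗ τ e₀ , trans (det-SLˡ k (τ e₀) dk) (det-τ e₀) ,
         trans (mv-⊗ k (τ e₀) (a ∷ 0ᵛ)) (trans (cong (mv k) (mv-τ a 0ᵛ e₀)) e)

    opaque
      column-transitive : ∀ {m} (u w : Row (suc (suc m))) → u ≢ 0ᵛ → w ≢ 0ᵛ →
        Σ (Mat (suc (suc m))) λ k → Det k ≡ 1# × mv k u ≡ w
      column-transitive u w u≢0 w≢0 with column-to-e₀ u u≢0 | column-to-e₀ w w≢0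
      ... | k , dk , ku | l , dl , lw = adj l ⊗ k , trans (det-SLˡ (adj l) k (det-adj l dl)) dk ,
        trans (mv-⊗ (adj l) k u) (trans (cong (mv (adj l)) (trans ku (sym lw)))
          (trans (sym (mv-⊗ (adj l) l w)) (trans (cong (λ M → mv M w) (SL-inverseˡ l dl)) (mv-Id w))))

    shear : ∀ {n} → Row n → Row n → Row n → Row n
    shear a b r = r ⊕ dot r a ⊙ b

    infix 4 _∼_

    -- In matrix terms, map (shear a b) is right multiplication by a transvection 1 + a bᵀ.
    data _∼_ {n} : Mat n → Mat n → Set where
      ∼-refl  : ∀ {x y} → x ≡ y → x ∼ y
      ∼-sym   : ∀ {x y} → x ∼ y → y ∼ x
      ∼-trans : ∀ {x y z} → x ∼ y → y ∼ z → x ∼ z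
      ∼-shear : ∀ x a b → Det x ≡ 1# → dot b a ≡ 0# → x ∼ map (shear a b) x

    shear-τ : ∀ {m} (w : Row m) r → shear (0# ∷ w) e₀ r ≡ vm r (τ w)
    shear-τ w (a ∷ r) = trans (cong₂ _∷_ (solve 2 (λ a x → a :+ (a :* c0 :+ x) :* c1 := a :+ x) refl a (dot r w))
      (trans (cong (r ⊕_) (⊙0 _)) (⊕-identityʳ r))) (sym (vm-τ a r w))

    shear-σ : ∀ {m} (z : Row m) r → shear e₀ (0# ∷ z) r ≡ vm r (σ z)
    shear-σ z (a ∷ r) = trans (cong₂ (λ s t → (a + s * 0#) ∷ (r ⊕ t ⊙ z)) coeff coeff)
        (trans (cong₂ _∷_ (solve 1 (λ a → a :+ a :* c0 := a) refl a) (⊕-comm r (a ⊙ z))) (sym (vm-σ a r z)))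
      where
      coeff : a * 1# + dot r 0ᵛ ≡ a
      coeff = trans (cong (a * 1# +_) (dot-0ʳ r)) (solve 1 (λ a → a :* c1 :+ c0 := a) refl a)

    Reaches : ∀ {n} → Mat n → Set
    Reaches k = ∀ x → Det x ≡ 1# → x ∼ x ⊗ k

    τ-reaches : ∀ {m} (w : Row m) → Reaches (τ w)
    τ-reaches w x d = ∼-trans (∼-shear x (0# ∷ w) e₀ d (trans (cong (1# * 0# +_) (dot-0ˡ w)) (solve 0 (c1 :* c0 :+ c0 := c0) refl)))
      (∼-refl (VecP.map-cong (shear-τ w) x))

    σ-reaches : ∀ {m} (z : Row m) → Reaches (σ z)
    σ-reaches z x d = ∼-trans (∼-shear x e₀ (0# ∷ z) d (trans (cong (0# * 1# +_) (dot-0ʳ z)) (solve 0 (c0 :* c1 :+ c0 := c0) refl)))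
      (∼-refl (VecP.map-cong (shear-σ z) x))

    ⊗-reaches : ∀ {n} {k l : Mat n} → Det k ≡ 1# → Reaches k → Reaches l → Reaches (k ⊗ l)
    ⊗-reaches {k = k} {l} dk rk rl x d = ∼-trans (rk x d)
      (∼-trans (rl (x ⊗ k) (trans (det-SLʳ x k dk) d)) (∼-refl (⊗-assoc x k l)))

    row-tail : ∀ {m} a (u : Row m) → u ≢ 0ᵛ → Σ (Mat (suc m)) λ k → Det k ≡ 1# × Reaches k × vm (a ∷ u) k ≡ e₀
    row-tail a u u≢0 = let z , e = nonzero-dot u u≢0 (1# + - a) in τ z ⊗ σ (⊖ u) ,
      trans (det-SLˡ (τ z) (σ (⊖ u)) (det-τ z)) (det-σ (⊖ u)) ,
      ⊗-reaches (det-τ z) (τ-reaches z) (σ-reaches (⊖ u)) , (begin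
        vm (a ∷ u) (τ z ⊗ σ (⊖ u))      ≡⟨ sym (vm-vm (a ∷ u) (τ z) (σ (⊖ u))) ⟩
        vm (vm (a ∷ u) (τ z)) (σ (⊖ u)) ≡⟨ cong (λ r → vm r (σ (⊖ u))) (trans (vm-τ a u z) (cong (_∷ u) (trans (cong (a +_) (trans (dot-comm u z) e))
             (solve 1 (λ a → a :+ (c1 :+ :- a) := c1) refl a)))) ⟩
        vm (1# ∷ u) (σ (⊖ u))           ≡⟨ trans (vm-σ 1# u (⊖ u)) (cong (1# ∷_) (cancel-tail u)) ⟩
        e₀ ∎)

    row-to-e₀ : ∀ {m} (u : Row (suc (suc m))) → u ≢ 0ᵛ →
      Σ (Mat (suc (suc m))) λ k → Det k ≡ 1# × Reaches k × vm u k ≡ e₀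
    row-to-e₀ {m} (a ∷ u) ne with u ≟ᵛ 0ᵛ
    ... | no u≢0 = row-tail a u u≢0
    ... | yes refl = let
        a≢0 = λ a≡0 → ne (cong (_∷ 0ᵛ) a≡0)
        k , dk , rk , e = row-tail a (a ⊙ e₀ {m} ⊕ 0ᵛ) (λ z → ⊙-≢0 a e₀ a≢0 e₀≢0 (trans (sym (⊕-identityʳ (a ⊙ e₀))) z))
      in σ e₀ ⊗ k , trans (det-SLˡ (σ e₀) k (det-σ e₀)) dk , ⊗-reaches (det-σ e₀) (σ-reaches e₀) rk ,
         trans (sym (vm-vm (a ∷ 0ᵛ) (σ e₀) k)) (trans (cong (λ r → vm r k) (vm-σ a 0ᵛ e₀)) e)

    opaque
      with-first-row : ∀ {m} (b : Row (suc (suc m))) → b ≢ 0ᵛ → Σ (Mat (suc (suc m))) λ P → Det P ≡ 1# × vm e₀ P ≡ b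
      with-first-row b b≢0 with row-to-e₀ b b≢0
      ... | k , dk , _ , e = adj k , det-adj k dk ,
        trans (cong (λ r → vm r (adj k)) (sym e)) (trans (vm-vm b k (adj k)) (trans (cong (vm b) (SL-inverseʳ k dk)) (vm-Id b)))

    det-zero-row : ∀ {m} (M : Vec (Row (suc m)) m) → Det (0ᵛ ∷ M) ≡ 0#
    det-zero-row {m} M = trans (Det≡detΛ (0ᵛ ∷ M)) (wedge-0ᵛ (⋀ M) (full (suc m)))

    recombine : ∀ {k n} (y : Vec (Row (suc n)) k) → zipWith _∷_ (map head y) (map tail y) ≡ y
    recombine []            = refl
    recombine ((a ∷ r) ∷ y) = cong ((a ∷ r) ∷_) (recombine y)

    mv-0 : ∀ {k n} (M : Vec (Row n) k) → mv M 0ᵛ ≡ 0ᵛ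
    mv-0 []      = refl
    mv-0 (r ∷ M) = cong₂ _∷_ (dot-0ʳ r) (mv-0 M)

    ⊗-cons : ∀ {j k n} (K : Vec (Row k) j) (c : Row k) (M : Vec (Row n) k) →
      K ⊗ zipWith _∷_ c M ≡ zipWith _∷_ (mv K c) (K ⊗ M)
    ⊗-cons []      c M = refl
    ⊗-cons (r ∷ K) c M = cong₂ _∷_ (vm-cons r c M) (⊗-cons K c M)

    -- Once elements of SL have turned a nonzero first column into e₀, the lower right block h is
    -- again singular. A kernel vector w of h extends to one of the whole matrix by the leading
    -- entry - z · w, where z is the rest of the first row.
    kernel-split : ∀ n (c : Row (suc n)) (M : Vec (Row n) (suc n)) → Det (zipWith _∷_ c M) ≡ 0# →
      Σ (Row (suc n)) λ w → w ≢ 0ᵛ × mv (zipWith _∷_ c M) w ≡ 0ᵛ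
    kernel-split n c M d with c ≟ᵛ 0ᵛ
    ... | yes refl = e₀ , e₀≢0 , trans (mv-cons 1# 0ᵛ 0ᵛ M) (trans (cong₂ _⊕_ (⊙0 1#) (mv-0 M)) (⊕-identityˡ 0ᵛ))
    kernel-split zero (a ∷ []) ([] ∷ []) d | no c≢0 = contradiction
      (cong (_∷ []) (trans (sym (trans (det-lower a [] []) (trans (cong (a *_) (Det≡detΛ [])) (*-identityʳ a)))) d)) c≢0
    kernel-split (suc n) c M d | no c≢0 with column-to-e₀ c c≢0
    ... | k , dk , kc = finish (k ⊗ M) refl
      where
      y = zipWith _∷_ c M
      finish : (Z : Vec (Row (suc n)) (suc (suc n))) → k ⊗ M ≡ Z → Σ (Row (suc (suc n))) λ w → w ≢ 0ᵛ × mv y w ≡ 0ᵛ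
      finish (z ∷ h) kM = v , (λ v≡0 → proj₁ (proj₂ kernel) (cong tail v≡0)) , (begin
          mv y v                     ≡⟨ cong (λ Y → mv Y v) (sym (⊗-cancelˡ (adj k) k y (SL-inverseˡ k dk))) ⟩
          mv (adj k ⊗ (k ⊗ y)) v     ≡⟨ mv-⊗ (adj k) (k ⊗ y) v ⟩
          mv (adj k) (mv (k ⊗ y) v)  ≡⟨ cong (mv (adj k)) kyv ⟩
          mv (adj k) 0ᵛ              ≡⟨ mv-0 (adj k) ⟩
          0ᵛ ∎)
        where
        ky : k ⊗ y ≡ zipWith _∷_ e₀ (z ∷ h)
        ky = trans (⊗-cons k c M) (cong₂ (zipWith _∷_) kc kM)
        dh : Det h ≡ 0#
        dh = trans (sym (trans (det-upper 1# z h) (*-identityˡ _))) (trans (cong Det (sym ky)) (trans (det-SLˡ k y dk) d))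
        kernel : Σ (Row (suc n)) λ w → w ≢ 0ᵛ × mv h w ≡ 0ᵛ
        kernel with kernel-split n (map head h) (map tail h) (trans (cong Det (recombine h)) dh)
        ... | w , w≢0 , e = w , w≢0 , trans (cong (λ Y → mv Y w) (sym (recombine h))) e
        w = proj₁ kernel
        v = - dot z w ∷ w
        kyv : mv (k ⊗ y) v ≡ 0ᵛ
        kyv = trans (cong (λ Y → mv Y v) ky) (cong₂ _∷_
          (solve 1 (λ x → c1 :* :- x :+ x := c0) refl (dot z w))
          (trans (mv-cons (- dot z w) w 0ᵛ h) (trans (cong₂ _⊕_ (⊙0 _) (proj₂ (proj₂ kernel))) (⊕-identityˡ 0ᵛ))))

    opaque
      kernel-vector : ∀ {n} (y : Mat n) → Det y ≡ 0# → Σ (Row n) λ w → w ≢ 0ᵛ × mv y w ≡ 0ᵛ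
      kernel-vector {zero}  []  d = contradiction (trans (sym d) (Det≡detΛ [])) 0≢1
      kernel-vector {suc n} y   d with kernel-split n (map head y) (map tail y) (trans (cong Det (recombine y)) d)
      ... | w , w≢0 , e = w , w≢0 , trans (cong (λ Y → mv Y w) (sym (recombine y))) e

    hat-∼ : ∀ {m} {x y : Mat m} → x ∼ y → blk 0ᵛ x ∼ blk 0ᵛ y
    hat-∼ (∼-refl e)      = ∼-refl (cong (blk 0ᵛ) e)
    hat-∼ (∼-sym p)       = ∼-sym (hat-∼ p)
    hat-∼ (∼-trans p q)   = ∼-trans (hat-∼ p) (hat-∼ q)
    hat-∼ {m} (∼-shear x a b d e) = ∼-trans
      (∼-shear (blk 0ᵛ x) (0# ∷ a) (0# ∷ b) (trans (det-blk 0ᵛ x) d) (trans (cong (_+ dot b a) (zeroˡ 0#)) (trans (+-identityˡ _) e)))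
      (∼-refl (cong₂ _∷_ first (rest x)))
      where
      first : shear (0# ∷ a) (0# ∷ b) e₀ ≡ e₀
      first = trans (cong (λ c → e₀ ⊕ c ⊙ (0# ∷ b)) (trans (cong (1# * 0# +_) (dot-0ˡ a)) (solve 0 (c1 :* c0 :+ c0 := c0) refl)))
        (trans (cong (e₀ ⊕_) (0⊙ (0# ∷ b))) (⊕-identityʳ e₀))
      rest : ∀ {k} (x : Vec (Row m) k) → map (shear (0# ∷ a) (0# ∷ b)) (zipWith _∷_ 0ᵛ x) ≡ zipWith _∷_ 0ᵛ (map (shear a b) x)
      rest []      = refl
      rest (r ∷ x) = cong₂ _∷_ (cong₂ _∷_ (solve 1 (λ x → c0 :+ (c0 :* c0 :+ x) :* c0 := c0) refl (dot r a))
        (cong (λ c → r ⊕ c ⊙ b) (trans (cong (_+ dot r a) (zeroˡ 0#)) (+-identityˡ _)))) (rest x)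

    -- Column operations turn the first row into e₀, an element of V then clears the first column,
    -- and induction applies to the remaining block, whose transvections embed by `hat-∼`.
    generated : ∀ n (x : Mat (suc n)) → Det x ≡ 1# → x ∼ Id (suc n)
    generated zero    ((a ∷ []) ∷ [])  d = ∼-refl (cong (λ z → (z ∷ []) ∷ [])
      (trans (sym (trans (det-lower a [] []) (trans (cong (a *_) (Det≡detΛ [])) (*-identityʳ a)))) d))
    generated (suc m) (r ∷ M)          d with row-to-e₀ r (λ r≡0 → 0≢1 (trans (sym (det-zero-row M)) (trans (cong (λ z → Det (z ∷ M)) (sym r≡0)) d)))
    ... | k , dk , rk , e = ∼-trans (rk (r ∷ M) d) (∼-trans (∼-refl xk) (∼-trans (τ-reaches w (blk u h) (trans (det-blk u h) dh))
          (∼-trans (∼-refl cleared) (∼-trans (hat-∼ (generated m h dh)) (∼-refl (sym (Id-blk _)))))))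
      where
      u = map head (M ⊗ k)
      h = map tail (M ⊗ k)
      xk : (r ∷ M) ⊗ k ≡ blk u h
      xk = cong₂ _∷_ e (sym (recombine (M ⊗ k)))
      dh : Det h ≡ 1#
      dh = trans (sym (det-blk u h)) (trans (cong Det (sym xk)) (trans (det-SLʳ (r ∷ M) k dk) d))
      w = mv (adj h) (⊖ u)
      cleared : blk u h ⊗ τ w ≡ blk 0ᵛ h
      cleared = trans (blk-⊗ u w h (Id _)) (cong₂ blk
        (trans (cong (u ⊕_) (trans (sym (mv-⊗ h (adj h) (⊖ u))) (trans (cong (λ Y → mv Y (⊖ u)) (SL-inverseʳ h dh)) (mv-Id (⊖ u)))))
          (⊕-inverseʳ u)) (⊗-Id h))

    vm-shear : ∀ {k n} (r : Row k) (u : Vec (Row n) k) a b → vm r (map (shear a b) u) ≡ shear a b (vm r u)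
    vm-shear r u a b = trans (go r u) (cong (λ c → vm r u ⊕ c ⊙ b) (sym (dot-vm r u a)))
      where
      go : ∀ {k} (r : Row k) u → vm r (map (shear a b) u) ≡ vm r u ⊕ dot r (mv u a) ⊙ b
      go []      []      = sym (trans (⊕-identityˡ _) (0⊙ b))
      go (c ∷ r) (s ∷ u) = trans (cong₂ _⊕_ (trans (⊙-⊕ c s (dot s a ⊙ b)) (cong (c ⊙ s ⊕_) (⊙-⊙ c (dot s a) b))) (go r u))
        (trans (⊕-interchange (c ⊙ s) ((c * dot s a) ⊙ b) (vm r u) (dot r (mv u a) ⊙ b))
          (cong ((c ⊙ s ⊕ vm r u) ⊕_) (sym (+-⊙ (c * dot s a) (dot r (mv u a)) b))))

-- Cofactor vectors and lines

module Vectors where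
  open SpecialLinear
  open import Data.Vec.Base using (Vec; []; _∷_; zipWith; replicate; head; tail; lookup)
  open import Data.Fin.Base using (zero; suc)

  module Vec′ {q : ℕ} (F : FiniteField q) where

    open SL F public

    infixl 6 _⊞_

    _⊞_ : ∀ {k n} → Vec (Row n) k → Vec (Row n) k → Vec (Row n) k
    _⊞_ = zipWith _⊕_

    mv-⊞ : ∀ {k n} (x y : Vec (Row n) k) w → mv (x ⊞ y) w ≡ mv x w ⊕ mv y w
    mv-⊞ []      []      w = refl
    mv-⊞ (r ∷ x) (s ∷ y) w = cong₂ _∷_ (dot-⊕ˡ r s w) (mv-⊞ x y w)

    ⊞-⊗ : ∀ {j k n} (x y : Vec (Row k) j) (z : Vec (Row n) k) → (x ⊞ y) ⊗ z ≡ x ⊗ z ⊞ y ⊗ z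
    ⊞-⊗ []      []      z = refl
    ⊞-⊗ (r ∷ x) (s ∷ y) z = cong₂ _∷_ (vm-⊕ r s z) (⊞-⊗ x y z)

    vm-⊞ : ∀ {k n} (r : Row k) (x y : Vec (Row n) k) → vm r (x ⊞ y) ≡ vm r x ⊕ vm r y
    vm-⊞ []      []      []      = sym (⊕-identityˡ 0ᵛ)
    vm-⊞ (a ∷ r) (s ∷ x) (t ∷ y) = trans (cong₂ _⊕_ (⊙-⊕ a s t) (vm-⊞ r x y)) (⊕-interchange (a ⊙ s) (a ⊙ t) (vm r x) (vm r y))

    ⊗-⊞ : ∀ {j k n} (p : Vec (Row k) j) (x y : Vec (Row n) k) → p ⊗ (x ⊞ y) ≡ p ⊗ x ⊞ p ⊗ y
    ⊗-⊞ []      x y = refl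
    ⊗-⊞ (r ∷ p) x y = cong₂ _∷_ (vm-⊞ r x y) (⊗-⊞ p x y)

    cons-⊞ : ∀ {k n} (c d : Row k) (x y : Vec (Row n) k) → zipWith _∷_ c x ⊞ zipWith _∷_ d y ≡ zipWith _∷_ (c ⊕ d) (x ⊞ y)
    cons-⊞ []      []      []      []      = refl
    cons-⊞ (a ∷ c) (b ∷ d) (r ∷ x) (s ∷ y) = cong (((a + b) ∷ (r ⊕ s)) ∷_) (cons-⊞ c d x y)

    -- The generalised cross product of m vectors in dimension m + 1.
    cof : ∀ {m} → Vec (Row (suc m)) m → Row (suc m)
    cof M = cofactors (0ᵛ ∷ M) zero

    dot-cof : ∀ {m} (M : Vec (Row (suc m)) m) v → dot v (cof M) ≡ Det (v ∷ M)
    dot-cof M v = cofactors-spec (0ᵛ ∷ M) zero v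

    mv-cof : ∀ {m} (M : Vec (Row (suc m)) m) → mv M (cof M) ≡ 0ᵛ
    mv-cof {m} M = ext λ i → trans (VecP.lookup-map i _ M) (trans (dot-cof M (lookup M i))
      (trans (trans (Det≡detΛ (lookup M i ∷ M)) (wedge-row M i (full (suc m)))) (sym (VecP.lookup-replicate i 0#))))

    dot-neg : ∀ {n} (z u v : Row n) c → dot z (u ⊕ (- c) ⊙ v) ≡ dot z u + (- (c * dot z v))
    dot-neg z u v c = trans (dot-⊕ʳ z u _) (cong (dot z u +_) (trans (dot-⊙ʳ (- c) z v) (solve 2 (λ c x → :- c :* x := :- (c :* x)) refl c _)))

    ⊕-neg≡0 : ∀ {n} (u v : Row n) c → u ⊕ (- c) ⊙ v ≡ 0ᵛ → u ≡ c ⊙ v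
    ⊕-neg≡0 []      []      c e = refl
    ⊕-neg≡0 (a ∷ u) (b ∷ v) c e = cong₂ _∷_
      (trans (solve 3 (λ a b c → a := (a :+ :- c :* b) :+ c :* b) refl a b c) (trans (cong (_+ c * b) (cong head e)) (+-identityˡ _)))
      (⊕-neg≡0 u v c (cong tail e))

    -- Take z₀ with z₀ · u = 1. If v - (z₀ · v) u is not zero, some y has product 1 with it, and y -
    -- (y · u) z₀ is the vector wanted.
    parallel? : ∀ {n} (u v : Row n) → u ≢ 0ᵛ →
      (Σ (Row n) λ z → dot z u ≡ 0# × dot z v ≡ 1#) ⊎ (Σ Carrier λ c → v ≡ c ⊙ u)
    parallel? u v u≢0 with nonzero-dot u u≢0 1#
    ... | z₀ , z₀u with (v ⊕ (- dot z₀ v) ⊙ u) ≟ᵛ 0ᵛ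
    ...   | yes e = inj₂ (dot z₀ v , ⊕-neg≡0 v u (dot z₀ v) e)
    ...   | no ne with nonzero-dot (v ⊕ (- dot z₀ v) ⊙ u) ne 1#
    ...     | y , yr = inj₁ (y ⊕ (- dot y u) ⊙ z₀ ,
                trans (expand u) (trans (cong (λ t → dot y u + (- (dot y u * t))) z₀u) (solve 1 (λ x → x :+ :- (x :* c1) := c0) refl _)) ,
                trans (expand v) (trans (solve 3 (λ a b c → a :+ :- (b :* c) := a :+ :- (c :* b)) refl (dot y v) (dot y u) (dot z₀ v))
                  (trans (sym (dot-neg y v u (dot z₀ v))) yr)))
      where
      expand : ∀ w → dot (y ⊕ (- dot y u) ⊙ z₀) w ≡ dot y w + (- (dot y u * dot z₀ w))
      expand w = trans (dot-comm _ w) (trans (dot-neg w y z₀ (dot y u)) (cong₂ (λ a b → a + (- (dot y u * b))) (dot-comm w y) (dot-comm w z₀)))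

    dot-separates : ∀ {n} (u v : Row n) → (∀ z → dot z u ≡ dot z v) → u ≡ v
    dot-separates u v h with (u ⊕ (- 1#) ⊙ v) ≟ᵛ 0ᵛ
    ... | yes e = trans (⊕-neg≡0 u v 1# e) (1⊙ v)
    ... | no ne with nonzero-dot _ ne 1#
    ...   | z , e = contradiction (trans (sym (trans (dot-neg z u v 1#) (trans (cong (_+ (- (1# * dot z v))) (h z))
              (solve 1 (λ x → x :+ :- (c1 :* x) := c0) refl (dot z v))))) e) 0≢1

    -- A row z₀ with z₀ · `cof M` = 1 completes M to a matrix of determinant 1. That matrix kills η
    -- - (z₀ · η) `cof M` and is injective.
    kernel-line : ∀ {m} (M : Vec (Row (suc m)) m) → cof M ≢ 0ᵛ → ∀ η → mv M η ≡ 0ᵛ → Σ Carrier λ c → η ≡ c ⊙ cof M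
    kernel-line M ξ≢0 η Mη with nonzero-dot (cof M) ξ≢0 1#
    ... | z₀ , e = dot z₀ η , ⊕-neg≡0 η (cof M) (dot z₀ η) (mv-inj _ (cong₂ _∷_
            (trans (dot-neg z₀ η (cof M) (dot z₀ η)) (trans (cong (λ t → dot z₀ η + (- (dot z₀ η * t))) e)
              (solve 1 (λ x → x :+ :- (x :* c1) := c0) refl _)))
            (trans (mv-lin M η (cof M) (- dot z₀ η)) (trans (cong₂ (λ a b → a ⊕ (- dot z₀ η) ⊙ b) Mη (mv-cof M))
              (trans (⊕-identityˡ _) (⊙0 _))))))
      where
      mv-lin : ∀ {k n} (M : Vec (Row n) k) u v c → mv M (u ⊕ c ⊙ v) ≡ mv M u ⊕ c ⊙ mv M v
      mv-lin []      u v c = refl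
      mv-lin (r ∷ M) u v c = cong₂ _∷_ (trans (dot-⊕ʳ r u (c ⊙ v)) (cong (dot r u +_) (dot-⊙ʳ c r v))) (mv-lin M u v c)
      dy : Det (z₀ ∷ M) ≡ 1#
      dy = trans (sym (dot-cof M z₀)) e
      mv-inj : ∀ u → mv (z₀ ∷ M) u ≡ 0ᵛ → u ≡ 0ᵛ
      mv-inj u e = trans (sym (mv-Id u)) (trans (cong (λ M → mv M u) (sym (SL-inverseˡ (z₀ ∷ M) dy)))
        (trans (mv-⊗ (adj (z₀ ∷ M)) (z₀ ∷ M) u) (trans (cong (mv (adj (z₀ ∷ M))) e) (mv-0 (adj (z₀ ∷ M))))))

    ⊙-cancel : ∀ {n} (v : Row n) → v ≢ 0ᵛ → ∀ {a b} → a ⊙ v ≡ b ⊙ v → a ≡ b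
    ⊙-cancel v v≢0 {a} {b} e = let z , zv = nonzero-dot v v≢0 1# ; at = λ c → trans (dot-⊙ʳ c z v) (trans (cong (c *_) zv) (*-identityʳ c)) in
      trans (sym (at a)) (trans (cong (dot z) e) (at b))

    nonzero-row : ∀ {k n} (M : Vec (Row n) k) → M ≢ replicate k 0ᵛ → Σ (Row n) λ r → r ≢ 0ᵛ × (∀ η → mv M η ≡ 0ᵛ → dot r η ≡ 0#)
    nonzero-row []      ne = contradiction refl ne
    nonzero-row (r ∷ M) ne with r ≟ᵛ 0ᵛ
    ... | no r≢0   = r , r≢0 , λ η e → cong head e
    ... | yes refl = let s , s≢0 , h = nonzero-row M (λ e → ne (cong (0ᵛ ∷_) e)) in s , s≢0 , λ η e → h η (cong tail e)

    a*b≢0 : ∀ {a b} → a ≢ 0# → b ≢ 0# → a * b ≢ 0#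
    a*b≢0 {a} {b} a≢0 b≢0 e = let c , ac = inverse a a≢0 in b≢0 (trans (sym (*-identityˡ b)) (trans (cong (_* b) (sym ac))
      (trans (solve 3 (λ a c b → a :* c :* b := c :* (a :* b)) refl a c b) (trans (cong (c *_) e) (zeroʳ c)))))

    affine-root : ∀ a b s r → a * r ≡ - b → a ≢ 0# → a * s + b ≡ 0# → s ≡ r
    affine-root a b s r ar a≢0 e = let c , ac = inverse a a≢0 in
      trans (scale c ac s) (trans (cong (c *_) (trans (solve 2 (λ x b → x := (x :+ b) :+ :- b) refl (a * s) b)
        (trans (cong (_+ (- b)) e) (trans (+-identityˡ _) (sym ar))))) (sym (scale c ac r)))
      where
      scale : ∀ c → a * c ≡ 1# → ∀ s → s ≡ c * (a * s)
      scale c ac s = trans (sym (*-identityˡ s)) (trans (cong (_* s) (sym ac)) (solve 3 (λ a c s → a :* c :* s := c :* (a :* s)) refl a c s))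

-- Enumerations of vectors and matrices; orbits of SL_n on vectors

module Counting where
  open Integers
  open Sums
  open Vectors
  open import Data.List.Base as List using (concatMap; filter)
  open import Data.List.Membership.Propositional.Properties using (∈-filter⁺; ∈-filter⁻)
  open import Data.Vec.Base using (Vec; []; _∷_; map; zipWith)

  open Finite

  -- Enumerations are opaque, since they unfold at sizes of the form suc n.
  opaque
    vecs : ∀ {A : Set} → List A → ∀ n → List (Vec A n)
    vecs As zero    = [] List.∷ List.[]
    vecs As (suc n) = concatMap (λ a → List.map (a ∷_) (vecs As n)) As

    ∑-vecs-zero : ∀ {A : Set} (As : List A) (f : Vec A zero → ℤ) → ∑ (vecs As zero) f ≡ f []
    ∑-vecs-zero As f = +-identityʳ (f [])

    ∑-vecs : ∀ {A : Set} (As : List A) n (f : Vec A (suc n) → ℤ) →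
      ∑ (vecs As (suc n)) f ≡ ∑[ a ∈ As ] ∑[ v ∈ vecs As n ] f (a ∷ v)
    ∑-vecs As n f = trans (∑-concatMap As _ f) (∑-cong As λ a → ∑-map (vecs As n) (a ∷_) f)

  length-vecs : ∀ {A : Set} (As : List A) n → pos (length (vecs As n)) ≡ pos (length As) ^′ n
  length-vecs As zero    = trans (sym (∑-one (vecs As zero))) (∑-vecs-zero As (λ _ → 1ℤ))
  length-vecs As (suc n) = trans (sym (∑-one (vecs As (suc n)))) (trans (∑-vecs As n (λ _ → 1ℤ))
    (trans (∑-cong As λ a → ∑-one (vecs As n)) (trans (∑-const As _)
      (cong (pos (length As) *_) (length-vecs As n)))))

  module _ {A : Set} (FA : Finite A) where

    vecs-once : ∀ n y → ∑[ x ∈ vecs (enum FA) n ] 𝟙 (VecP.≡-dec (_≟_ FA) x y) ≡ 1ℤ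
    vecs-once zero    []      = ∑-vecs-zero (enum FA) _
    vecs-once (suc n) (b ∷ w) = begin
      ∑[ x ∈ vecs (enum FA) (suc n) ] 𝟙 (VecP.≡-dec (_≟_ FA) x (b ∷ w))
        ≡⟨ ∑-vecs (enum FA) n _ ⟩
      ∑[ a ∈ enum FA ] ∑[ v ∈ vecs (enum FA) n ] 𝟙 (VecP.≡-dec (_≟_ FA) (a ∷ v) (b ∷ w))
        ≡⟨ (∑-cong (enum FA) λ a → ∑-cong (vecs (enum FA) n) λ v → split a v) ⟩
      ∑[ a ∈ enum FA ] ∑[ v ∈ vecs (enum FA) n ] 𝟙 (_≟_ FA a b) * 𝟙 (VecP.≡-dec (_≟_ FA) v w)
        ≡⟨ ∑-prod (enum FA) (vecs (enum FA) n) _ _ ⟩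
      (∑[ a ∈ enum FA ] 𝟙 (_≟_ FA a b)) * (∑[ v ∈ vecs (enum FA) n ] 𝟙 (VecP.≡-dec (_≟_ FA) v w))
        ≡⟨ cong₂ _*_ (once FA b) (vecs-once n w) ⟩
      1ℤ * 1ℤ
        ≡⟨ *-identityˡ 1ℤ ⟩
      1ℤ ∎
      where
      open ≡-Reasoning
      split : ∀ a v → 𝟙 (VecP.≡-dec (_≟_ FA) (a ∷ v) (b ∷ w)) ≡ 𝟙 (_≟_ FA a b) * 𝟙 (VecP.≡-dec (_≟_ FA) v w)
      split a v = 𝟙-× (_≟_ FA a b) (VecP.≡-dec (_≟_ FA) v w) _ VecP.∷-injectiveˡ VecP.∷-injectiveʳ (cong₂ _∷_)

    finVec : ∀ n → Finite (Vec A n)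
    finVec n = record { _≟_ = VecP.≡-dec (_≟_ FA) ; enum = vecs (enum FA) n ; once = vecs-once n }

  module Count {q : ℕ} (F : FiniteField q) where

    open Vec′ F public hiding (solve; _:=_; _:+_; _:*_; _:-_; :-_; con; Polynomial; c0; c1; +-assoc; +-comm;
      +-identityˡ; +-identityʳ; *-assoc; *-comm; *-identityˡ; *-identityʳ; zeroˡ; zeroʳ; distribˡ; distribʳ;
      -‿inverseˡ; -‿inverseʳ)
      renaming (_+_ to infixl 6 _+ᶠ_; _*_ to infixl 7 _*ᶠ_; -_ to infix 8 -ᶠ_; _≟_ to infix 4 _≟ᶠ_)

    open ≡-Reasoning

    finC : Finite Carrier
    finC = record { _≟_ = _≟ᶠ_ ; enum = FiniteField.elements F
      ; once = λ y → count-∈ _≟ᶠ_ _ (FiniteField.elements-unique F) (FiniteField.elements-complete F y) }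

    finRow : ∀ n → Finite (Row n)
    finRow = finVec finC

    finMat : ∀ k n → Finite (Vec (Row n) k)
    finMat k n = finVec (finRow n) k

    Cs : List Carrier
    Cs = enum finC

    rows : ∀ n → List (Row n)
    rows n = enum (finRow n)

    mats : ∀ k n → List (Vec (Row n) k)
    mats k n = enum (finMat k n)

    Q : ℤ
    Q = pos q

    length-Cs : pos (length Cs) ≡ Q
    length-Cs = cong pos (FiniteField.elements-size F)

    length-rows : ∀ n → pos (length (rows n)) ≡ Q ^′ n
    length-rows n = trans (length-vecs Cs n) (cong (_^′ n) length-Cs)

    length-mats : ∀ k n → pos (length (mats k n)) ≡ (Q ^′ n) ^′ k
    length-mats k n = trans (length-vecs (rows n) k) (cong (_^′ k) (length-rows n))

    ∑-rows : ∀ k n (f : Vec (Row n) (suc k) → ℤ) → ∑ (mats (suc k) n) f ≡ ∑[ r ∈ rows n ] ∑[ M ∈ mats k n ] f (r ∷ M)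
    ∑-rows k n f = ∑-vecs (rows n) k f

    ∑-columns : ∀ k n (f : Vec (Row (suc n)) k → ℤ) →
      ∑ (mats k (suc n)) f ≡ ∑[ c ∈ rows k ] ∑[ M ∈ mats k n ] f (zipWith _∷_ c M)
    ∑-columns zero    n f = trans (∑-vecs-zero _ f) (sym (trans (∑-vecs-zero Cs _) (∑-vecs-zero (rows n) _)))
    ∑-columns (suc k) n f = begin
      ∑ (mats (suc k) (suc n)) f
        ≡⟨ trans (∑-rows k (suc n) f) (∑-vecs Cs n _) ⟩
      ∑[ a ∈ Cs ] ∑[ r ∈ rows n ] ∑[ M ∈ mats k (suc n) ] f ((a ∷ r) ∷ M)
        ≡⟨ (∑-cong Cs λ a → trans (∑-cong (rows n) λ r → ∑-columns k n (λ M → f ((a ∷ r) ∷ M))) (∑-swap (rows n) (rows k) _)) ⟩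
      ∑[ a ∈ Cs ] ∑[ c ∈ rows k ] ∑[ r ∈ rows n ] ∑[ M ∈ mats k n ] f ((a ∷ r) ∷ zipWith _∷_ c M)
        ≡⟨ (∑-cong Cs λ a → ∑-cong (rows k) λ c → sym (∑-rows k n _)) ⟩
      ∑[ a ∈ Cs ] ∑[ c ∈ rows k ] ∑[ M ∈ mats (suc k) n ] f (zipWith _∷_ (a ∷ c) M)
        ≡⟨ sym (∑-vecs Cs k _) ⟩
      ∑[ c ∈ rows (suc k) ] ∑[ M ∈ mats (suc k) n ] f (zipWith _∷_ c M) ∎

    dets : ∀ n → Carrier → List (Mat n)
    dets n d = filter (λ x → Det x ≟ᶠ d) (mats n n)

    ∑-dets : ∀ n d f → ∑ (dets n d) f ≡ ∑[ x ∈ mats n n ] 𝟙 (Det x ≟ᶠ d) * f x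
    ∑-dets n d f = ∑-filter (λ x → Det x ≟ᶠ d) (mats n n) f

    ∈-dets⁻ : ∀ {n d x} → x ∈ dets n d → Det x ≡ d
    ∈-dets⁻ {n} {d} p = proj₂ (∈-filter⁻ (λ x → Det x ≟ᶠ d) {xs = mats n n} p)

    ∈-dets⁺ : ∀ {n d x} → Det x ≡ d → x ∈ dets n d
    ∈-dets⁺ {n} {d} {x} e = ∈-filter⁺ (λ x → Det x ≟ᶠ d) (occurs (_≟_ (finMat n n)) (mats n n) (once (finMat n n) x)) e

    once-dets : ∀ {n d y} → y ∈ dets n d → ∑[ x ∈ dets n d ] 𝟙 (_≟_ (finMat n n) x y) ≡ 1ℤ
    once-dets {n} {d} {y} p = trans (∑-dets n d _) (trans (∑-cong (mats n n) λ x → *-comm _ _)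
      (trans (delta (finMat n n) y (λ x → 𝟙 (Det x ≟ᶠ d))) (𝟙-yes (Det y ≟ᶠ d) (∈-dets⁻ p))))

    reindex-dets : ∀ n d d′ (φ ψ : Mat n → Mat n) → (∀ x → ψ (φ x) ≡ x) → (∀ x → φ (ψ x) ≡ x) →
      (∀ x → Det x ≡ d → Det (φ x) ≡ d′) → (∀ x → Det x ≡ d′ → Det (ψ x) ≡ d) → ∀ (f : Mat n → ℤ) →
      ∑[ x ∈ dets n d ] f (φ x) ≡ ∑ (dets n d′) f
    reindex-dets n d d′ φ ψ ψφ φψ dφ dψ f = trans (∑-dets n d _) (trans
      (∑-cong (mats n n) λ x → cong (_* f (φ x)) (𝟙-⇔ (Det x ≟ᶠ d) (Det (φ x) ≟ᶠ d′) (dφ x)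
         (λ e → trans (cong Det (sym (ψφ x))) (dψ (φ x) e))))
      (trans (reindex (finMat n n) (finMat n n) φ ψ ψφ φψ (λ x → 𝟙 (Det x ≟ᶠ d′) * f x)) (sym (∑-dets n d′ f))))

    ∑-SLʳ : ∀ {n} d (p : Mat n) → Det p ≡ 1# → ∀ f → ∑[ x ∈ dets n d ] f (x ⊗ p) ≡ ∑ (dets n d) f
    ∑-SLʳ d p dp = reindex-dets _ d d (_⊗ p) (_⊗ adj p)
      (λ x → ⊗-cancelʳ x p (adj p) (SL-inverseʳ p dp)) (λ x → ⊗-cancelʳ x (adj p) p (SL-inverseˡ p dp))
      (λ x e → trans (det-SLʳ x p dp) e) (λ x e → trans (det-SLʳ x (adj p) (det-adj p dp)) e)

    ∑-SLˡ : ∀ {n} d (p : Mat n) → Det p ≡ 1# → ∀ f → ∑[ x ∈ dets n d ] f (p ⊗ x) ≡ ∑ (dets n d) f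
    ∑-SLˡ d p dp = reindex-dets _ d d (p ⊗_) (adj p ⊗_)
      (λ x → ⊗-cancelˡ (adj p) p x (SL-inverseˡ p dp)) (λ x → ⊗-cancelˡ p (adj p) x (SL-inverseʳ p dp))
      (λ x e → trans (det-SLˡ p x dp) e) (λ x e → trans (det-SLˡ (adj p) x (det-adj p dp)) e)

    ∑-nonzero : ∀ n (Ψ : Row n → ℤ) → ∑[ u ∈ rows n ] (1ℤ - 𝟙 (u ≟ᵛ 0ᵛ)) * Ψ u ≡ ∑ (rows n) Ψ - Ψ 0ᵛ
    ∑-nonzero n Ψ = trans (∑-cong (rows n) λ u → solve 2 (λ a b → (con 1ℤ :- a) :* b := b :- a :* b) refl (𝟙 (u ≟ᵛ 0ᵛ)) (Ψ u))
      (trans (∑-− (rows n) _ _) (cong (λ z → ∑ (rows n) Ψ - z) (delta (finRow n) 0ᵛ Ψ)))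

    mv-injective : ∀ {n} (h : Mat n) u → Det h ≡ 1# → mv h u ≡ 0ᵛ → u ≡ 0ᵛ
    mv-injective h u dh e = trans (sym (mv-Id u)) (trans (cong (λ M → mv M u) (sym (SL-inverseˡ h dh)))
      (trans (mv-⊗ (adj h) h u) (trans (cong (mv (adj h)) e) (mv-0 (adj h)))))

    module _ {m : ℕ} (u : Row (suc (suc m))) (u≢0 : u ≢ 0ᵛ) where

      private
        n = suc (suc m)

      hits : Row n → ℤ
      hits w = ∑[ h ∈ dets n 1# ] 𝟙 (w ≟ᵛ mv h u)

      -- If k u = w, then h ↦ k h is a bijection between the elements fixing u and those sending u
      -- to w.
      hits-const : ∀ w → w ≢ 0ᵛ → hits w ≡ hits u
      hits-const w w≢0 = moved (column-transitive u w u≢0 w≢0)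
        where
        moved : (Σ (Mat n) λ k → Det k ≡ 1# × mv k u ≡ w) → hits w ≡ hits u
        moved (k , dk , ku) = trans (sym (∑-SLˡ 1# k dk λ h → 𝟙 (w ≟ᵛ mv h u)))
          (∑-cong (dets n 1#) λ h → 𝟙-⇔ (w ≟ᵛ mv (k ⊗ h) u) (u ≟ᵛ mv h u)
            (λ e → cancel (trans ku (trans e (mv-⊗ k h u)))) (λ e → trans (sym ku) (trans (cong (mv k) e) (sym (mv-⊗ k h u)))))
          where
          undo : ∀ a → a ≡ mv (adj k) (mv k a)
          undo a = trans (sym (mv-Id a)) (trans (cong (λ M → mv M a) (sym (SL-inverseˡ k dk))) (mv-⊗ (adj k) k a))
          cancel : ∀ {a b} → mv k a ≡ mv k b → a ≡ b
          cancel {a} {b} e = trans (undo a) (trans (cong (mv (adj k)) e) (sym (undo b)))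

      hits-0 : hits 0ᵛ ≡ 0ℤ
      hits-0 = trans (∑-cong∈ (dets n 1#) λ {h} p → 𝟙-no (0ᵛ ≟ᵛ mv h u) λ e → u≢0 (mv-injective h u (∈-dets⁻ p) (sym e)))
        (∑-zero (dets n 1#))

      hits-value : ∀ w → hits w ≡ (1ℤ - 𝟙 (w ≟ᵛ 0ᵛ)) * hits u
      hits-value w with w ≟ᵛ 0ᵛ
      ... | yes refl = trans hits-0 (solve 1 (λ x → con 0ℤ := (con 1ℤ :- con 1ℤ) :* x) refl _)
      ... | no w≢0   = trans (hits-const w w≢0) (solve 1 (λ x → x := (con 1ℤ :- con 0ℤ) :* x) refl _)

      ∑-orbit : ∀ Ψ → ∑[ h ∈ dets n 1# ] Ψ (mv h u) ≡ hits u * (∑ (rows n) Ψ - Ψ 0ᵛ)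
      ∑-orbit Ψ = begin
        ∑[ h ∈ dets n 1# ] Ψ (mv h u)
          ≡⟨ (∑-cong (dets n 1#) λ h → sym (delta (finRow n) (mv h u) Ψ)) ⟩
        ∑[ h ∈ dets n 1# ] ∑[ w ∈ rows n ] 𝟙 (w ≟ᵛ mv h u) * Ψ w
          ≡⟨ (∑-swap₁ (dets n 1#) (rows n) _ λ w → trans (∑-*ʳ (Ψ w) (dets n 1#) _) (cong (_* Ψ w) (hits-value w))) ⟩
        ∑[ w ∈ rows n ] (1ℤ - 𝟙 (w ≟ᵛ 0ᵛ)) * hits u * Ψ w
          ≡⟨ (∑-cong (rows n) λ w → solve 3 (λ a b c → a :* b :* c := b :* (a :* c)) refl (1ℤ - 𝟙 (w ≟ᵛ 0ᵛ)) (hits u) (Ψ w)) ⟩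
        ∑[ w ∈ rows n ] hits u * ((1ℤ - 𝟙 (w ≟ᵛ 0ᵛ)) * Ψ w)
          ≡⟨ trans (∑-*ˡ (hits u) (rows n) _) (cong (hits u *_) (∑-nonzero n Ψ)) ⟩
        hits u * (∑ (rows n) Ψ - Ψ 0ᵛ) ∎

      orbit-size : pos (length (dets n 1#)) ≡ hits u * (Q ^′ n - 1ℤ)
      orbit-size = trans (sym (∑-one (dets n 1#))) (trans (∑-orbit (λ _ → 1ℤ))
        (cong (λ z → hits u * (z - 1ℤ)) (trans (∑-one (rows n)) (length-rows n))))

      -- The common value of `hits` is eliminated between `∑-orbit` for Ψ and for the constant 1,
      -- which avoids a division.
      uniform : ∀ Ψ → (Q ^′ n - 1ℤ) * (∑[ h ∈ dets n 1# ] Ψ (mv h u)) ≡ pos (length (dets n 1#)) * (∑ (rows n) Ψ - Ψ 0ᵛ)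
      uniform Ψ = trans (cong ((Q ^′ n - 1ℤ) *_) (∑-orbit Ψ)) (trans
        (solve 3 (λ a b c → a :* (b :* c) := (b :* a) :* c) refl (Q ^′ n - 1ℤ) (hits u) _)
        (cong (_* (∑ (rows n) Ψ - Ψ 0ᵛ)) (sym orbit-size)))

      hits-bound : 0ℤ ≤ Q ^′ n - 1ℤ → ∀ w → (Q ^′ n - 1ℤ) * hits w ≤ pos (length (dets n 1#))
      hits-bound p w = ≤-trans (*-monoˡ p (≤-trans (≤-reflexive (hits-value w))
          (*-monoʳ (0≤∑𝟙 (dets n 1#) λ h → u ≟ᵛ mv h u) (1-𝟙≤1 (w ≟ᵛ 0ᵛ)))))
        (≤-reflexive (trans (cong ((Q ^′ n - 1ℤ) *_) (*-identityˡ _)) (trans (*-comm _ _) (sym orbit-size))))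

-- The quasirandomness estimate for matrices of fixed nonzero determinant

module MixingSL where
  open Integers
  open Sums
  open Mixing
  open Counting
  open import Data.Vec.Base using (_∷_; map; zipWith; tail)

  open Finite

  nonempty : ∀ {A : Set} {x : A} {xs : List A} → x ∈ xs → 1ℤ ≤ pos (length xs)
  nonempty (here _)  = +≤+ (ℕ.s≤s ℕ.z≤n)
  nonempty (there _) = +≤+ (ℕ.s≤s ℕ.z≤n)

  1≤⇒0< : ∀ {i} → 1ℤ ≤ i → 0ℤ < i
  1≤⇒0< {pos (suc n)} p = +<+ (ℕ.s≤s ℕ.z≤n)
  1≤⇒0< {pos zero} (+≤+ ())

  module MixSL {q : ℕ} (F : FiniteField q) where

    open Count F public

    2≤Q^ : pos 2 ≤ Q → ∀ k → pos 2 ≤ Q ^′ suc k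
    2≤Q^ 2≤q zero    = ≤-trans 2≤q (≤-reflexive (sym (*-identityʳ Q)))
    2≤Q^ 2≤q (suc k) = ≤-trans (≤-trans (≤-reflexive (sym (*-identityʳ (pos 2)))) (*-mono (<⇒≤ 0<2)
      (≤-trans (<⇒≤ 0<2) (2≤Q^ 2≤q k)) 2≤q (≤-trans (+≤+ (ℕ.s≤s ℕ.z≤n)) (2≤Q^ 2≤q k)))) ≤-refl

    d≢0⇒inverse : ∀ {n} (x : Mat n) → Det x ≢ 0# → Σ (Mat n) λ z → x ⊗ z ≡ Id n × z ⊗ x ≡ Id n
    d≢0⇒inverse x d = let z , e = right-inverse x d in z , e , left-inverse x z e

    -- The size m is kept a variable here, with its properties as hypotheses: matrices of explicit size unfold.
    module Translations (m : ℕ) (2≤V : pos 2 ≤ Q ^′ m)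
      (spread : ∀ (u : Row m) → u ≢ 0ᵛ → ∀ (Ψ : Row m → ℤ) →
        (Q ^′ m - 1ℤ) * (∑[ h ∈ dets m 1# ] Ψ (mv h u)) ≡ pos (length (dets m 1#)) * (∑ (rows m) Ψ - Ψ 0ᵛ))
      (first-row : ∀ (b : Row (suc m)) → b ≢ 0ᵛ → Σ (Mat (suc m)) λ P → Det P ≡ 1# × vm e₀ P ≡ b)
      (d : Carrier) (d≢0 : d ≢ 0#) (As : List (Mat (suc m))) (uniq : Unique As) (inSL : All (λ a → Det a ≡ 1#) As) where

      n : ℕ
      n = suc m

      X : List (Mat n)
      X = dets n d

      _·_ : Mat n → Row m → Mat n
      x · w = x ⊗ τ w

      ·-⊕ : ∀ x u v → (x · u) · v ≡ x · (u ⊕ v)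
      ·-⊕ x u v = trans (⊗-assoc x (τ u) (τ v)) (cong (x ⊗_) (trans (blk-⊗ u v (Id m) (Id m))
        (cong₂ blk (cong (u ⊕_) (mv-Id v)) (⊗-Id (Id m)))))

      ·-0 : ∀ x → x · 0ᵛ ≡ x
      ·-0 x = trans (cong (x ⊗_) (sym (Id-blk m))) (⊗-Id x)

      ∈-⊗ʳ : ∀ {x p : Mat n} → x ∈ X → Det p ≡ 1# → (x ⊗ p) ∈ X
      ∈-⊗ʳ {x} {p} x∈ dp = ∈-dets⁺ (trans (det-SLʳ x p dp) (∈-dets⁻ x∈))

      free : ∀ {x} → x ∈ X → ∑[ a ∈ As ] ∑[ b ∈ As ] 𝟙 (_≟_ (finMat n n) (b ⊗ x) (a ⊗ x)) ≡ pos (length As)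
      free {x} x∈ = trans (∑-cong∈ As λ {a} a∈ → trans
          (∑-cong As λ b → 𝟙-⇔ (_≟_ (finMat n n) (b ⊗ x) (a ⊗ x)) (_≟_ (finMat n n) b a)
            (λ e → trans (sym (⊗-cancelʳ b x z xz)) (trans (cong (_⊗ z) e) (⊗-cancelʳ a x z xz))) (cong (_⊗ x)))
          (count-∈ (_≟_ (finMat n n)) As uniq a∈))
        (∑-one As)
        where
        inv = right-inverse x (λ e → d≢0 (trans (sym (∈-dets⁻ x∈)) e))
        z = proj₁ inv
        xz = proj₂ inv

      open Action (finRow m) ⊕-isAbelianGroup X _·_ ·-⊕ (λ v → ∑-SLʳ d (τ v) (det-τ v)) public
      open Averaging (_≟_ (finMat n n)) once-dets ·-0 (λ v x∈ → ∈-⊗ʳ x∈ (det-τ v)) As _⊗_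
        (λ {a} {x} a∈ x∈ → ∈-dets⁺ (trans (det-SLˡ a x (All.lookup inSL a∈)) (∈-dets⁻ x∈)))
        (λ {a} a∈ → ∑-SLˡ d a (All.lookup inSL a∈))
        (λ a x v → sym (⊗-assoc a x (τ v))) free public

      -- The inverse of h is taken so that `τ v` · `hat h` = `hat h` · `τ (h v)`: the automorphism
      -- induced on V is then h itself, for which equidistribution is known.
      hat : Mat m → Mat n
      hat h = blk 0ᵛ (adj h)

      det-hat : ∀ {h} → h ∈ dets m 1# → Det (hat h) ≡ 1#
      det-hat {h} h∈ = trans (det-blk 0ᵛ (adj h)) (det-adj h (∈-dets⁻ h∈))

      R-· : ∀ {h} → h ∈ dets m 1# → ∀ x v → (x · v) ⊗ hat h ≡ (x ⊗ hat h) · mv h v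
      R-· {h} h∈ x v = trans (⊗-assoc x (τ v) (hat h)) (trans (cong (x ⊗_) (trans
          (trans (blk-⊗ v 0ᵛ (Id m) (adj h)) (cong₂ blk
            (trans (cong (v ⊕_) (mv-Id 0ᵛ)) (⊕-identityʳ v)) (Id-⊗ (adj h))))
          (sym (trans (blk-⊗ 0ᵛ (mv h v) (adj h) (Id m)) (cong₂ blk
            (trans (⊕-identityˡ _) (trans (sym (mv-⊗ (adj h) h v)) (trans (cong (λ M → mv M v) (SL-inverseˡ h (∈-dets⁻ h∈))) (mv-Id v))))
            (⊗-Id (adj h)))))))
        (sym (⊗-assoc x (hat h) (τ (mv h v)))))

      uniform′ : ∀ u → u ≢ 0ᵛ → (Ψ : Row m → ℤ) →
        (∣V∣ - 1ℤ) * (∑[ h ∈ dets m 1# ] Ψ (mv h u)) ≡ pos (length (dets m 1#)) * (∑ (rows m) Ψ - Ψ 0ᵛ)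
      uniform′ u u≢0 Ψ = trans (cong (λ z → (z - 1ℤ) * (∑[ h ∈ dets m 1# ] Ψ (mv h u))) (length-rows m)) (spread u u≢0 Ψ)

      1<V : 0ℤ < ∣V∣ - 1ℤ
      1<V = 1≤⇒0< (subst₂ _≤_ (solve 0 (con (pos 2) :- con 1ℤ := con 1ℤ) refl) refl
        (+-mono-≤ (≤-trans 2≤V (≤-reflexive (sym (length-rows m)))) (≤-refl { - 1ℤ})))

      Id∈ : ∀ {n} → Id n ∈ dets n 1#
      Id∈ {n} = ∈-dets⁺ (det-Id n)

      open Transitive (dets m 1#) (λ h x → x ⊗ hat h) mv R-· (λ h a x → ⊗-assoc a x (hat h))
        (λ {h} h∈ → ∑-SLʳ d (hat h) (det-hat h∈)) mv-0 uniform′ (1≤⇒0< (nonempty (Id∈ {m}))) 1<V public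

      d∈ : ((d ∷ 0ᵛ) ∷ zipWith _∷_ 0ᵛ (Id m)) ∈ X
      d∈ = ∈-dets⁺ (trans (det-lower d 0ᵛ (Id m)) (trans (cong (d *ᶠ_) (det-Id m)) (FiniteField-*-identityʳ d)))
        where
        open IsCommutativeRing (FiniteField.isCommutativeRing F) using () renaming (*-identityʳ to FiniteField-*-identityʳ)

      open Connected (dets n 1#) (λ p x → x ⊗ p) (λ p a x → ⊗-assoc a x p)
        (λ {p} p∈ → ∑-SLʳ d p (∈-dets⁻ p∈)) (nonempty (Id∈ {n})) (nonempty d∈) public

      -- A transvection 1 + a bᵀ is conjugate into V by any P whose first row is b: then (P a) bᵀ
      -- P⁻¹ = (P a) e₀ᵀ, and b · a = 0 says that P a has first entry 0, so it is determined by its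
      -- tail.
      shear-conj : ∀ (P : Mat n) (a b : Row n) → Det P ≡ 1# → vm e₀ P ≡ b → dot b a ≡ 0# → ∀ r →
        vm (vm (vm r (adj P)) (τ (tail (mv P a)))) P ≡ shear a b r
      shear-conj P a b dP eP ba r = begin
        vm (vm y (τ w)) P
          ≡⟨ cong (λ z → vm z P) (sym (shear-τ w y)) ⟩
        vm (y ⊕ dot y (0# ∷ w) ⊙ e₀) P
          ≡⟨ trans (vm-⊕ y _ P) (cong₂ _⊕_ sP (trans (vm-⊙ (dot y (0# ∷ w)) e₀ P) (cong (dot y (0# ∷ w) ⊙_) eP))) ⟩
        r ⊕ dot y (0# ∷ w) ⊙ b
          ≡⟨ cong (λ c → r ⊕ c ⊙ b) (trans (cong (dot y) 0w) (trans (dot-vm r (adj P) (mv P a))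
               (cong (dot r) (trans (sym (mv-⊗ (adj P) P a)) (trans (cong (λ M → mv M a) (SL-inverseˡ P dP)) (mv-Id a)))))) ⟩
        r ⊕ dot r a ⊙ b ∎
        where
        open ≡-Reasoning
        y = vm r (adj P)
        w = tail (mv P a)
        sP : vm y P ≡ r
        sP = trans (vm-vm r (adj P) P) (trans (cong (vm r) (SL-inverseˡ P dP)) (vm-Id r))
        0w : 0# ∷ w ≡ mv P a
        0w = go P eP
          where
          go : ∀ (P : Mat n) → vm e₀ P ≡ b → 0# ∷ tail (mv P a) ≡ mv P a
          go (p ∷ P) e = cong (_∷ mv P a) (trans (sym ba) (cong (λ z → dot z a)
            (trans (sym e) (trans (cong₂ _⊕_ (1⊙ p) (vm-0 P)) (⊕-identityʳ p)))))

      conn-shear : ∀ {x} → x ∈ X → ∀ a b → dot b a ≡ 0# → Conn x (map (shear a b) x)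
      conn-shear {x} x∈ a b ba with b ≟ᵛ 0ᵛ
      ... | yes refl = conn-refl (sym (trans (VecP.map-cong (λ r → trans (cong (r ⊕_) (⊙0 (dot r a))) (⊕-identityʳ r)) x) (VecP.map-id x)))
      ... | no b≢0 = conjugated (first-row b b≢0)
        where
        conjugated : (Σ (Mat n) λ P → Det P ≡ 1# × vm e₀ P ≡ b) → Conn x (map (shear a b) x)
        conjugated (P , dP , eP) = subst₂ Conn (⊗-cancelʳ x (adj P) P (SL-inverseˡ P dP)) moved
            (conn-step (∈-dets⁺ dP) (∈-⊗ʳ x∈ (det-adj P dP)) (tail (mv P a)))
          where
          moved : ((x ⊗ adj P) · tail (mv P a)) ⊗ P ≡ map (shear a b) x
          moved = trans (cong (_⊗ P) (sym (VecP.map-∘ _ _ x))) (trans (sym (VecP.map-∘ _ _ x))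
            (VecP.map-cong (shear-conj P a b dP eP ba) x))

      conn-∼ : ∀ {u v} → u ∼ v → ∀ {x} → x ∈ X → Conn (x ⊗ u) (x ⊗ v)
      conn-∼ (∼-refl e)    {x} x∈ = conn-refl (cong (x ⊗_) e)
      conn-∼ (∼-sym p)     {x} x∈ = conn-sym (conn-∼ p x∈)
      conn-∼ (∼-trans p r) {x} x∈ = conn-trans (conn-∼ p x∈) (conn-∼ r x∈)
      conn-∼ (∼-shear u a b du ba) {x} x∈ = subst (Conn (x ⊗ u))
        (trans (sym (VecP.map-∘ _ _ x)) (VecP.map-cong (λ r → sym (vm-shear r u a b)) x))
        (conn-shear (∈-⊗ʳ {p = u} x∈ du) a b ba)

      -- Equal determinants put x⁻¹ y into SL_n, where `generated` joins it to the identity by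
      -- transvections; left multiplication by x transports this chain to X.
      conn : ∀ {x y} → x ∈ X → y ∈ X → Conn x y
      conn {x} {y} x∈ y∈ = joined (d≢0⇒inverse x (λ e → d≢0 (trans (sym (∈-dets⁻ x∈)) e)))
        where
        joined : (Σ (Mat n) λ z → x ⊗ z ≡ Id n × z ⊗ x ≡ Id n) → Conn x y
        joined (z , xz , zx) = subst₂ Conn (⊗-Id x) (⊗-cancelˡ x z y xz) (conn-sym (conn-∼ (generated m (z ⊗ y) dzy) x∈))
          where
          dzy : Det (z ⊗ y) ≡ 1#
          dzy = trans (det-⊗ z y) (trans (cong (Det z *ᶠ_) (trans (∈-dets⁻ y∈) (sym (∈-dets⁻ x∈))))
            (trans (sym (det-⊗ z x)) (trans (cong Det zx) (det-Id n))))

      open Poincare conn public using (mixing; G)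

      mixing-SL : ∀ g → Q ^′ m * pos (length X) * (∑[ t ∈ X ] (∑[ a ∈ As ] g (a ⊗ t)) * (∑[ a ∈ As ] g (a ⊗ t)))
        ≤ pos (length X) * pos (length X) * pos (length As) * (∑[ x ∈ X ] g x * g x)
          + Q ^′ m * (pos (length As) * pos (length As)) * (∑ X g * ∑ X g)
      mixing-SL g = subst (λ v → v * ∣X∣ * s g ≤ ∣X∣ * ∣X∣ * ∣A∣ * N g + v * (∣A∣ * ∣A∣) * (G g * G g)) (length-rows m) (mixing g)

-- Near independence of det x and det (x + M)

module Correlations where
  open Integers
  open Sums
  open Vectors
  open Counting
  open import Data.Vec.Base using (Vec; []; _∷_; map; zipWith; replicate; head; tail)

  open Finite

  ^-distrib : ∀ a b n → (a * b) ^′ n ≡ a ^′ n * b ^′ n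
  ^-distrib a b zero    = sym (*-identityˡ 1ℤ)
  ^-distrib a b (suc n) = trans (cong (a * b *_) (^-distrib a b n))
    (solve 4 (λ a b x y → a :* b :* (x :* y) := a :* x :* (b :* y)) refl a b (a ^′ n) (b ^′ n))

  0<^ : ∀ {a} n → 0ℤ < a → 0ℤ < a ^′ n
  0<^ zero    p = +<+ (ℕ.s≤s ℕ.z≤n)
  0<^ (suc n) p = 0<m*n p (0<^ n p)

  cancel-factor : ∀ {a y P} → 1ℤ ≤ a → 0ℤ ≤ P → a * y ≤ P → y ≤ P
  cancel-factor {a} {y} {P} 1≤a 0≤P h with ≤-total y 0ℤ
  ... | inj₁ y≤0 = ≤-trans y≤0 0≤P
  ... | inj₂ 0≤y = ≤-trans (≤-trans (≤-reflexive (sym (*-identityˡ y))) (*-monoʳ 0≤y 1≤a)) h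

  module Correlation {q : ℕ} (F : FiniteField q) (2≤q : pos 2 ≤ pos q) where

    open Count F public
    module R = Vec′ F

    Q−1 : ℤ
    Q−1 = Q - 1ℤ

    1≤Q−1 : 1ℤ ≤ Q−1
    1≤Q−1 = ≤-trans (≤-reflexive (solve 0 (con 1ℤ := con (pos 2) :- con 1ℤ) refl)) (+-mono-≤ 2≤q ≤-refl)

    0≤Q−1 : 0ℤ ≤ Q−1
    0≤Q−1 = ≤-trans 0≤1 1≤Q−1

    0≤Q : 0ℤ ≤ Q
    0≤Q = 0≤pos q

    0<Q : 0ℤ < Q
    0<Q = 2≤⇒0< 2≤q
      where
      2≤⇒0< : ∀ {n} → pos 2 ≤ pos n → 0ℤ < pos n
      2≤⇒0< (+≤+ (ℕ.s≤s _)) = +<+ (ℕ.s≤s ℕ.z≤n)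

    nz : Carrier → ℤ
    nz s = 1ℤ - 𝟙 (s ≟ᶠ 0#)

    nzᵛ : ∀ {n} → Row n → ℤ
    nzᵛ v = 1ℤ - 𝟙 (v ≟ᵛ 0ᵛ)

    1-𝟙-yes : ∀ {P : Set} (d : Dec P) → P → 1ℤ - 𝟙 d ≡ 0ℤ
    1-𝟙-yes d p = trans (cong (λ z → 1ℤ - z) (𝟙-yes d p)) (-‿inverseʳ 1ℤ)

    1-𝟙-no : ∀ {P : Set} (d : Dec P) → ¬ P → 1ℤ - 𝟙 d ≡ 1ℤ
    1-𝟙-no d ¬p = trans (cong (λ z → 1ℤ - z) (𝟙-no d ¬p)) (solve 0 (con 1ℤ :- con 0ℤ := con 1ℤ) refl)

    0≤1-𝟙 : ∀ {P : Set} (d : Dec P) → 0ℤ ≤ 1ℤ - 𝟙 d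
    0≤1-𝟙 d = to-diff (𝟙≤1 d)

    𝟙-sym : ∀ (s t : Carrier) → 𝟙 (s ≟ᶠ t) ≡ 𝟙 (t ≟ᶠ s)
    𝟙-sym s t = 𝟙-⇔ (s ≟ᶠ t) (t ≟ᶠ s) sym sym

    ∑-nz : ∑ Cs nz ≡ Q−1
    ∑-nz = trans (∑-− Cs _ _) (cong₂ _-_ (trans (∑-one Cs) length-Cs) (once finC 0#))

    -- q - 1 times the projection of functions on F^× to those of mean zero.
    κ : Carrier → Carrier → ℤ
    κ s t = Q−1 * (nz s * 𝟙 (s ≟ᶠ t)) - nz s * nz t

    κ-0ˡ : ∀ t → κ 0# t ≡ 0ℤ
    κ-0ˡ t = trans (cong (λ z → Q−1 * (z * 𝟙 (0# ≟ᶠ t)) - z * nz t) (1-𝟙-yes (0# ≟ᶠ 0#) refl))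
      (solve 3 (λ q x y → q :* (con 0ℤ :* x) :- con 0ℤ :* y := con 0ℤ) refl Q−1 (𝟙 (0# ≟ᶠ t)) (nz t))

    κ-0ʳ : ∀ s → κ s 0# ≡ 0ℤ
    κ-0ʳ s = trans (cong₂ (λ z w → Q−1 * z - nz s * w) vanish (1-𝟙-yes (0# ≟ᶠ 0#) refl))
      (solve 2 (λ q x → q :* con 0ℤ :- x :* con 0ℤ := con 0ℤ) refl Q−1 (nz s))
      where
      vanish : nz s * 𝟙 (s ≟ᶠ 0#) ≡ 0ℤ
      vanish = trans (trans (distribʳ (𝟙 (s ≟ᶠ 0#)) 1ℤ _) refl) (trans
        (solve 2 (λ a b → con 1ℤ :* a :+ :- a :* a := a :- a :* a) refl (𝟙 (s ≟ᶠ 0#)) 0ℤ)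
        (trans (cong (λ z → 𝟙 (s ≟ᶠ 0#) - z) (𝟙-idem (s ≟ᶠ 0#))) (-‿inverseʳ _)))

    ∑-κ : ∀ s → ∑ Cs (κ s) ≡ 0ℤ
    ∑-κ s = begin
      ∑[ t ∈ Cs ] (Q−1 * (nz s * 𝟙 (s ≟ᶠ t)) - nz s * nz t)
        ≡⟨ trans (∑-− Cs _ _) (cong₂ _-_ (trans (∑-*ˡ Q−1 Cs _) (cong (Q−1 *_) (∑-*ˡ (nz s) Cs _))) (∑-*ˡ (nz s) Cs nz)) ⟩
      Q−1 * (nz s * (∑[ t ∈ Cs ] 𝟙 (s ≟ᶠ t))) - nz s * ∑ Cs nz
        ≡⟨ cong₂ (λ a b → Q−1 * (nz s * a) - nz s * b) (trans (∑-cong Cs λ t → 𝟙-sym s t) (once finC s)) ∑-nz ⟩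
      Q−1 * (nz s * 1ℤ) - nz s * Q−1
        ≡⟨ solve 2 (λ q x → q :* (x :* con 1ℤ) :- x :* q := con 0ℤ) refl Q−1 (nz s) ⟩
      0ℤ ∎
      where open ≡-Reasoning

    ∑-shift : ∀ a (f : Carrier → ℤ) → ∑[ c ∈ Cs ] f (a +ᶠ c) ≡ ∑ Cs f
    ∑-shift a = reindex finC finC (a +ᶠ_) ((-ᶠ a) +ᶠ_)
      (λ c → R.solve 2 (λ a c → R.:- a R.:+ (a R.:+ c) R.:= c) refl a c)
      (λ c → R.solve 2 (λ a c → a R.:+ (R.:- a R.:+ c) R.:= c) refl a c)

    line-average : ∀ {n} (z : Row n) (f : Row n → ℤ) → Q * ∑ (rows n) f ≡ ∑[ x ∈ rows n ] ∑[ c ∈ Cs ] f (x ⊕ c ⊙ z)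
    line-average {n} z f = sym (trans (∑-swap₁ (rows n) Cs _ λ c → reindex (finRow n) (finRow n)
        (_⊕ c ⊙ z) (_⊕ ⊖ (c ⊙ z)) (λ x → back x (c ⊙ z) _ (⊕-inverseʳ (c ⊙ z))) (λ x → back x _ (c ⊙ z) (⊕-inverseˡ (c ⊙ z))) f)
      (trans (∑-const Cs _) (cong (_* ∑ (rows n) f) length-Cs)))
      where
      back : ∀ x u v → u ⊕ v ≡ 0ᵛ → (x ⊕ u) ⊕ v ≡ x
      back x u v e = trans (⊕-assoc x u v) (trans (cong (x ⊕_) e) (⊕-identityʳ x))

    dot-line : ∀ {n} (x z ξ : Row n) c → dot (x ⊕ c ⊙ z) ξ ≡ dot x ξ +ᶠ c *ᶠ dot z ξ
    dot-line x z ξ c = trans (dot-⊕ˡ x (c ⊙ z) ξ) (cong (dot x ξ +ᶠ_) (dot-⊙ˡ c z ξ))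

    -- The contribution to Γ of all x with prescribed lower rows: as functions of the first row, the
    -- two determinants are a linear form and an affine form, with the cofactor vectors as
    -- coefficients.
    inner : ∀ {n} → Row n → Row n → Carrier → ℤ
    inner {n} ξ ξ̂ δ = ∑[ x ∈ rows n ] κ (dot x ξ) (dot x ξ̂ +ᶠ δ)

    -- Along the direction z the first argument of κ is constant while the second runs through the
    -- whole field, and by `∑-κ` such a sum vanishes.
    inner-transverse : ∀ {n} (ξ ξ̂ z : Row n) δ → dot z ξ ≡ 0# → dot z ξ̂ ≡ 1# → Q * inner ξ ξ̂ δ ≡ 0ℤ
    inner-transverse {n} ξ ξ̂ z δ e ê = trans (line-average z _) (∑-zero′ (rows n) λ x → trans
      (∑-cong Cs λ c → cong₂ κ
        (trans (dot-line x z ξ c) (trans (cong (λ t → dot x ξ +ᶠ c *ᶠ t) e) (R.solve 2 (λ s c → s R.:+ c R.:* R.c0 R.:= s) refl (dot x ξ) c)))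
        (trans (cong (_+ᶠ δ) (trans (dot-line x z ξ̂ c) (cong (λ t → dot x ξ̂ +ᶠ c *ᶠ t) ê)))
          (R.solve 3 (λ s c d → s R.:+ c R.:* R.c1 R.:+ d R.:= (s R.:+ d) R.:+ c) refl (dot x ξ̂) c δ)))
      (trans (∑-shift (dot x ξ̂ +ᶠ δ) (κ (dot x ξ))) (∑-κ (dot x ξ))))

    K : Carrier → Carrier → ℤ
    K l δ = ∑[ s ∈ Cs ] κ s (l *ᶠ s +ᶠ δ)

    inner-parallel : ∀ {n} (ξ z : Row n) l δ → dot z ξ ≡ 1# → Q * inner ξ (l ⊙ ξ) δ ≡ Q ^′ n * K l δ
    inner-parallel {n} ξ z l δ e = trans (line-average z _) (trans (∑-cong (rows n) λ x → trans
      (∑-cong Cs λ c → trans (cong (λ t → κ (dot (x ⊕ c ⊙ z) ξ) (t +ᶠ δ)) (dot-⊙ʳ l (x ⊕ c ⊙ z) ξ))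
        (cong (λ t → κ t (l *ᶠ t +ᶠ δ)) (trans (dot-line x z ξ c) (trans (cong (λ t → dot x ξ +ᶠ c *ᶠ t) e)
          (R.solve 2 (λ s c → s R.:+ c R.:* R.c1 R.:= s R.:+ c) refl (dot x ξ) c)))))
      (∑-shift (dot x ξ) λ t → κ t (l *ᶠ t +ᶠ δ)))
      (trans (∑-const (rows n) _) (cong (_* K l δ) (length-rows n))))

    -- An upper bound for `K l δ`, where `eq` is the indicator of l = 1. For δ = 0 it is written so
    -- that, weighted by the nonvanishing of the determinants, it becomes κ again one dimension
    -- lower.
    ω : Carrier → ℤ → ℤ
    ω δ eq = nz δ + 𝟙 (δ ≟ᶠ 0#) * (Q−1 * (Q−1 * eq - 1ℤ))

    K-split : ∀ l δ → K l δ ≡ Q−1 * (∑[ s ∈ Cs ] nz s * 𝟙 (s ≟ᶠ l *ᶠ s +ᶠ δ)) - (∑[ s ∈ Cs ] nz s * nz (l *ᶠ s +ᶠ δ))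
    K-split l δ = trans (∑-− Cs _ _) (cong (λ z → z - (∑[ s ∈ Cs ] nz s * nz (l *ᶠ s +ᶠ δ))) (∑-*ˡ Q−1 Cs _))

    ω-yes : ∀ eq → ω 0# eq ≡ Q−1 * (Q−1 * eq - 1ℤ)
    ω-yes eq = trans (cong₂ (λ a b → a + b * (Q−1 * (Q−1 * eq - 1ℤ))) (1-𝟙-yes (0# ≟ᶠ 0#) refl) (𝟙-yes (0# ≟ᶠ 0#) refl))
      (solve 1 (λ x → con 0ℤ :+ con 1ℤ :* x := x) refl _)

    ω-no : ∀ δ eq → δ ≢ 0# → ω δ eq ≡ 1ℤ
    ω-no δ eq ne = trans (cong₂ (λ a b → a + b * (Q−1 * (Q−1 * eq - 1ℤ))) (1-𝟙-no (δ ≟ᶠ 0#) ne) (𝟙-no (δ ≟ᶠ 0#) ne))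
      (solve 1 (λ x → con 1ℤ :+ con 0ℤ :* x := con 1ℤ) refl _)

    nz-square : ∀ s → nz s * nz s ≡ nz s
    nz-square s with s ≟ᶠ 0#
    ... | yes _ = solve 0 ((con 1ℤ :- con 1ℤ) :* (con 1ℤ :- con 1ℤ) := con 1ℤ :- con 1ℤ) refl
    ... | no _  = solve 0 ((con 1ℤ :- con 0ℤ) :* (con 1ℤ :- con 0ℤ) := con 1ℤ :- con 0ℤ) refl

    -- For δ = 0 both counts in `K-split` are explicit. For δ ≠ 0 the equation s = l s + δ has at
    -- most one solution, while s and l s + δ are both nonzero for at least q - 2 values of s, so K
    -- is at most (q - 1) - (q - 2) = 1.
    K≤ω : ∀ l δ → l ≢ 0# → K l δ ≤ ω δ (𝟙 (1# ≟ᶠ l))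
    K≤ω l δ l≢0 with δ ≟ᶠ 0# | 1# ≟ᶠ l
    ... | yes refl | yes refl = ≤-reflexive (trans (K-split 1# 0#) (trans
          (cong₂ (λ a b → Q−1 * a - b)
            (trans (∑-cong Cs λ s → trans (cong (nz s *_) (𝟙-yes (s ≟ᶠ 1# *ᶠ s +ᶠ 0#) (sym (id₁ s)))) (*-identityʳ (nz s))) ∑-nz)
            (trans (∑-cong Cs λ s → trans (cong (λ t → nz s * nz t) (id₁ s)) (nz-square s)) ∑-nz))
          (solve 1 (λ q → q :* q :- q := (con 1ℤ :- con 1ℤ) :+ con 1ℤ :* (q :* (q :* con 1ℤ :- con 1ℤ))) refl Q−1)))
      where
      id₁ : ∀ s → 1# *ᶠ s +ᶠ 0# ≡ s
      id₁ s = R.solve 1 (λ s → R.c1 R.:* s R.:+ R.c0 R.:= s) refl s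
    ... | yes refl | no l≢1 = ≤-reflexive (trans (K-split l 0#) (trans
          (cong₂ (λ a b → Q−1 * a - b) (∑-zero′ Cs none) (trans (∑-cong Cs λ s → trans (cong (nz s *_) (same s)) (nz-square s)) ∑-nz))
          (solve 1 (λ q → q :* con 0ℤ :- q := (con 1ℤ :- con 1ℤ) :+ con 1ℤ :* (q :* (q :* con 0ℤ :- con 1ℤ))) refl Q−1)))
      where
      root : ∀ s → s ≢ 0# → s ≢ l *ᶠ s +ᶠ 0#
      root s s≢0 e = l≢1 (let c , sc = inverse s s≢0 in
        trans (sym sc) (trans (cong (_*ᶠ c) e) (trans (R.solve 3 (λ l s c → (l R.:* s R.:+ R.c0) R.:* c R.:= l R.:* (s R.:* c)) refl l s c)
          (trans (cong (l *ᶠ_) sc) (R.solve 1 (λ l → l R.:* R.c1 R.:= l) refl l)))))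
      none : ∀ s → nz s * 𝟙 (s ≟ᶠ l *ᶠ s +ᶠ 0#) ≡ 0ℤ
      none s = go (s ≟ᶠ 0#)
        where
        go : Dec (s ≡ 0#) → nz s * 𝟙 (s ≟ᶠ l *ᶠ s +ᶠ 0#) ≡ 0ℤ
        go (yes s≡0) = trans (cong (_* 𝟙 (s ≟ᶠ l *ᶠ s +ᶠ 0#)) (1-𝟙-yes (s ≟ᶠ 0#) s≡0)) (zeroˡ _)
        go (no s≢0)  = trans (cong (nz s *_) (𝟙-no (s ≟ᶠ l *ᶠ s +ᶠ 0#) (root s s≢0))) (zeroʳ _)
      same : ∀ s → nz (l *ᶠ s +ᶠ 0#) ≡ nz s
      same s = cong (λ z → 1ℤ - z) (𝟙-⇔ (l *ᶠ s +ᶠ 0# ≟ᶠ 0#) (s ≟ᶠ 0#)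
        (λ e → affine-root l 0# s 0# (R.solve 1 (λ l → l R.:* R.c0 R.:= R.:- R.c0) refl l) l≢0 e)
        (λ e → trans (cong (λ s → l *ᶠ s +ᶠ 0#) e) (R.solve 1 (λ l → l R.:* R.c0 R.:+ R.c0 R.:= R.c0) refl l)))
    ... | no δ≢0 | e = ≤-trans (≤-reflexive (K-split l δ)) (≤-trans (+-mono-≤ (*-monoˡ 0≤Q−1 solutions) (neg-mono-≤ both-nonzero))
          (≤-reflexive (solve 2 (λ q x → (q :* con 1ℤ) :+ :- (q :- con 1ℤ) := (con 1ℤ :- con 0ℤ) :+ con 0ℤ :* x) refl Q−1 _)))
      where
      solutions : ∑[ s ∈ Cs ] nz s * 𝟙 (s ≟ᶠ l *ᶠ s +ᶠ δ) ≤ 1ℤ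
      solutions = go (1# +ᶠ -ᶠ l ≟ᶠ 0#)
        where
        drop-nz : ∀ s {b} → 𝟙 (s ≟ᶠ l *ᶠ s +ᶠ δ) ≤ b → nz s * 𝟙 (s ≟ᶠ l *ᶠ s +ᶠ δ) ≤ b
        drop-nz s h = ≤-trans (≤-trans (*-monoʳ (𝟙-nonneg (s ≟ᶠ l *ᶠ s +ᶠ δ)) (1-𝟙≤1 (s ≟ᶠ 0#))) (≤-reflexive (*-identityˡ _))) h
        move : ∀ s → s ≡ l *ᶠ s +ᶠ δ → (1# +ᶠ -ᶠ l) *ᶠ s +ᶠ -ᶠ δ ≡ 0#
        move s h = trans (R.solve 3 (λ l s d → (R.c1 R.:+ R.:- l) R.:* s R.:+ R.:- d R.:= s R.:+ R.:- (l R.:* s R.:+ d)) refl l s δ)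
          (trans (cong (λ t → s +ᶠ -ᶠ t) (sym h)) (R.-‿inverseʳ s))
        go : Dec (1# +ᶠ -ᶠ l ≡ 0#) → ∑[ s ∈ Cs ] nz s * 𝟙 (s ≟ᶠ l *ᶠ s +ᶠ δ) ≤ 1ℤ
        go (yes a≡0) = ≤-trans (∑-mono Cs λ s → drop-nz s (≤-reflexive (𝟙-no (s ≟ᶠ l *ᶠ s +ᶠ δ) λ h → δ≢0 (
            trans (R.solve 1 (λ d → d R.:= R.:- (R.c0 R.:+ R.:- d)) refl δ) (trans (cong -ᶠ_ (trans (cong (_+ᶠ -ᶠ δ)
              (sym (trans (cong (_*ᶠ s) a≡0) (R.zeroˡ s)))) (move s h))) (R.solve 0 (R.:- R.c0 R.:= R.c0) refl))))))
          (≤-trans (≤-reflexive (∑-zero Cs)) 0≤1)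
        go (no a≢0) = ≤-trans (∑-mono Cs λ s → drop-nz s (𝟙-mono (s ≟ᶠ l *ᶠ s +ᶠ δ) (s ≟ᶠ r) λ h →
            affine-root (1# +ᶠ -ᶠ l) (-ᶠ δ) s r r-spec a≢0 (move s h))) (≤-reflexive (once finC r))
          where
          inv = inverse (1# +ᶠ -ᶠ l) a≢0
          r = proj₁ inv *ᶠ δ
          r-spec : (1# +ᶠ -ᶠ l) *ᶠ r ≡ -ᶠ (-ᶠ δ)
          r-spec = trans (sym (R.*-assoc _ _ δ)) (trans (cong (_*ᶠ δ) (proj₂ inv)) (R.solve 1 (λ d → R.c1 R.:* d R.:= R.:- (R.:- d)) refl δ))
      both-nonzero : Q−1 - 1ℤ ≤ ∑[ s ∈ Cs ] nz s * nz (l *ᶠ s +ᶠ δ)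
      both-nonzero = ≤-trans (≤-reflexive (sym total)) (∑-mono Cs λ s → product (s ≟ᶠ 0#) (l *ᶠ s +ᶠ δ ≟ᶠ 0#) (s ≟ᶠ r)
          λ h → affine-root l δ s r r-spec l≢0 h)
        where
        inv = inverse l l≢0
        r = proj₁ inv *ᶠ (-ᶠ δ)
        r-spec : l *ᶠ r ≡ -ᶠ δ
        r-spec = trans (sym (R.*-assoc _ _ _)) (trans (cong (_*ᶠ (-ᶠ δ)) (proj₂ inv)) (R.*-identityˡ _))
        total : ∑[ s ∈ Cs ] (1ℤ - 𝟙 (s ≟ᶠ 0#) - 𝟙 (s ≟ᶠ r)) ≡ Q−1 - 1ℤ
        total = trans (∑-− Cs _ _) (cong₂ _-_ ∑-nz (once finC r))
        product : ∀ {A B C : Set} (a : Dec A) (b : Dec B) (c : Dec C) → (B → C) →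
          1ℤ - 𝟙 a - 𝟙 c ≤ (1ℤ - 𝟙 a) * (1ℤ - 𝟙 b)
        product (yes _) (yes h) (yes _) f = from-diff {k = 1ℤ} (solve 0 ((con 1ℤ :- con 1ℤ) :* (con 1ℤ :- con 1ℤ) :- (con 1ℤ :- con 1ℤ :- con 1ℤ) := con 1ℤ) refl) 0≤1
        product (yes _) (no h)  (yes _) f = from-diff {k = 1ℤ} (solve 0 ((con 1ℤ :- con 1ℤ) :* (con 1ℤ :- con 0ℤ) :- (con 1ℤ :- con 1ℤ :- con 1ℤ) := con 1ℤ) refl) 0≤1
        product (yes _) (no h)  (no _)  f = from-diff {k = 0ℤ} (solve 0 ((con 1ℤ :- con 1ℤ) :* (con 1ℤ :- con 0ℤ) :- (con 1ℤ :- con 1ℤ :- con 0ℤ) := con 0ℤ) refl) ≤-refl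
        product (no _)  (yes h) (yes _) f = from-diff {k = 0ℤ} (solve 0 ((con 1ℤ :- con 0ℤ) :* (con 1ℤ :- con 1ℤ) :- (con 1ℤ :- con 0ℤ :- con 1ℤ) := con 0ℤ) refl) ≤-refl
        product (no _)  (no h)  (yes _) f = from-diff {k = 1ℤ} (solve 0 ((con 1ℤ :- con 0ℤ) :* (con 1ℤ :- con 0ℤ) :- (con 1ℤ :- con 0ℤ :- con 1ℤ) := con 1ℤ) refl) 0≤1
        product (no _)  (no h)  (no _)  f = from-diff {k = 0ℤ} (solve 0 ((con 1ℤ :- con 0ℤ) :* (con 1ℤ :- con 0ℤ) :- (con 1ℤ :- con 0ℤ :- con 0ℤ) := con 0ℤ) refl) ≤-refl
        product a       (yes h) (no ¬c) f = contradiction (f h) ¬c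

    lift : ∀ {m} → Mat m → Vec (Row (suc m)) m
    lift Y = zipWith _∷_ 0ᵛ Y

    0ᴹ : ∀ {k n} → Vec (Row n) k
    0ᴹ = replicate _ 0ᵛ

    Γ : ∀ n → Mat n → ℤ
    Γ n M = ∑[ x ∈ mats n n ] κ (Det x) (Det (x ⊞ M))

    det-lift : ∀ {m} (r : Row (suc m)) (Y : Mat m) → Det (r ∷ lift Y) ≡ head r *ᶠ Det Y
    det-lift (a ∷ z) Y = det-upper a z Y

    mv-e₀ : ∀ {k m} (X : Vec (Row (suc m)) k) → mv X e₀ ≡ map head X
    mv-e₀ []            = refl
    mv-e₀ ((a ∷ r) ∷ X) = cong₂ _∷_ (trans (cong (a *ᶠ 1# +ᶠ_) (dot-0ʳ r))
      (R.solve 1 (λ a → a R.:* R.c1 R.:+ R.c0 R.:= a) refl a)) (mv-e₀ X)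

    head-cons : ∀ {k m} (c : Row k) (Y : Vec (Row m) k) → map head (zipWith _∷_ c Y) ≡ c
    head-cons []      []      = refl
    head-cons (a ∷ c) (r ∷ Y) = cong (a ∷_) (head-cons c Y)

    lift-0 : ∀ {k m} → zipWith _∷_ (0ᵛ {k}) (0ᴹ {k} {m}) ≡ 0ᴹ
    lift-0 {zero}  = refl
    lift-0 {suc k} = cong (0ᵛ ∷_) (lift-0 {k})

    0ᴹ-⊗ : ∀ {k l n} (x : Vec (Row n) l) → 0ᴹ {k} ⊗ x ≡ 0ᴹ
    0ᴹ-⊗ {zero}  x = refl
    0ᴹ-⊗ {suc k} x = cong₂ _∷_ (vm-0 x) (0ᴹ-⊗ {k} x)

    lift-⊞ : ∀ {m} (Y Y′ : Mat m) → lift Y ⊞ lift Y′ ≡ lift (Y ⊞ Y′)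
    lift-⊞ Y Y′ = trans (cons-⊞ 0ᵛ 0ᵛ Y Y′) (cong (λ c → zipWith _∷_ c (Y ⊞ Y′)) (⊕-identityˡ 0ᵛ))

    -- A hyperplane η^⊥ is coordinatised by a k ∈ SL with k η = e₀.
    module Hyperplane {m} (η : Row (suc m)) (k : Mat (suc m)) (dk : Det k ≡ 1#) (kη : mv k η ≡ e₀) where

      adj-e₀ : mv (adj k) e₀ ≡ η
      adj-e₀ = trans (cong (mv (adj k)) (sym kη)) (trans (sym (mv-⊗ (adj k) k η))
        (trans (cong (λ M → mv M η) (SL-inverseˡ k dk)) (mv-Id η)))

      ∑-hyperplane : ∀ (f : Vec (Row (suc m)) m → ℤ) →
        ∑[ x ∈ mats m (suc m) ] 𝟙 (mv x η ≟ᵛ 0ᵛ) * f x ≡ ∑[ Y ∈ mats m m ] f (lift Y ⊗ k)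
      ∑-hyperplane f = begin
        ∑[ x ∈ mats m (suc m) ] 𝟙 (mv x η ≟ᵛ 0ᵛ) * f x
          ≡⟨ sym (reindex (finMat m (suc m)) (finMat m (suc m)) (_⊗ k) (_⊗ adj k)
               (λ x → ⊗-cancelʳ x k (adj k) (SL-inverseʳ k dk)) (λ x → ⊗-cancelʳ x (adj k) k (SL-inverseˡ k dk))
               (λ x → 𝟙 (mv x η ≟ᵛ 0ᵛ) * f x)) ⟩
        ∑[ x ∈ mats m (suc m) ] 𝟙 (mv (x ⊗ k) η ≟ᵛ 0ᵛ) * f (x ⊗ k)
          ≡⟨ ∑-columns m m _ ⟩
        ∑[ c ∈ rows m ] ∑[ Y ∈ mats m m ] 𝟙 (mv (zipWith _∷_ c Y ⊗ k) η ≟ᵛ 0ᵛ) * f (zipWith _∷_ c Y ⊗ k)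
          ≡⟨ (∑-cong (rows m) λ c → trans (∑-cong (mats m m) λ Y → cong (λ z → 𝟙 (z ≟ᵛ 0ᵛ) * f (zipWith _∷_ c Y ⊗ k)) (column c Y))
               (∑-*ˡ (𝟙 (c ≟ᵛ 0ᵛ)) (mats m m) _)) ⟩
        ∑[ c ∈ rows m ] 𝟙 (c ≟ᵛ 0ᵛ) * (∑[ Y ∈ mats m m ] f (zipWith _∷_ c Y ⊗ k))
          ≡⟨ delta (finRow m) 0ᵛ _ ⟩
        ∑[ Y ∈ mats m m ] f (lift Y ⊗ k) ∎
        where
        open ≡-Reasoning
        column : ∀ c (Y : Mat m) → mv (zipWith _∷_ c Y ⊗ k) η ≡ c
        column c Y = trans (mv-⊗ (zipWith _∷_ c Y) k η) (trans (cong (mv (zipWith _∷_ c Y)) kη)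
          (trans (mv-e₀ (zipWith _∷_ c Y)) (head-cons c Y)))

      on-hyperplane : ∀ (M : Vec (Row (suc m)) m) → mv M η ≡ 0ᵛ → Σ (Mat m) λ Y → M ≡ lift Y ⊗ k
      on-hyperplane M e = map tail (M ⊗ adj k) , trans (sym (⊗-cancelʳ M (adj k) k (SL-inverseˡ k dk)))
        (cong (_⊗ k) (trans (sym (recombine (M ⊗ adj k))) (cong (λ c → zipWith _∷_ c (map tail (M ⊗ adj k)))
          (trans (sym (mv-e₀ (M ⊗ adj k))) (trans (mv-⊗ M (adj k) e₀) (trans (cong (mv M) adj-e₀) e))))))

      -- For rows in the hyperplane, the cofactor vector is `Det Y` times a fixed normal vector.
      -- Conditions on cofactor vectors thus turn into conditions on determinants of size m.
      dot-cof-lift : ∀ (Y : Mat m) v → dot v (cof (lift Y ⊗ k)) ≡ head (vm v (adj k)) *ᶠ Det Y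
      dot-cof-lift Y v = trans (dot-cof (lift Y ⊗ k) v) (trans (cong (λ r → Det (r ∷ (lift Y ⊗ k)))
          (sym (trans (vm-vm v (adj k) k) (trans (cong (vm v) (SL-inverseˡ k dk)) (vm-Id v)))))
        (trans (det-SLʳ (vm v (adj k) ∷ lift Y) k dk) (det-lift (vm v (adj k)) Y)))

      dot-cof-base : ∀ (Y : Mat m) → dot (vm e₀ k) (cof (lift Y ⊗ k)) ≡ Det Y
      dot-cof-base Y = trans (dot-cof-lift Y (vm e₀ k)) (trans (cong (λ r → head r *ᶠ Det Y)
        (trans (vm-vm e₀ k (adj k)) (trans (cong (vm e₀) (SL-inverseʳ k dk)) (vm-Id e₀)))) (R.*-identityˡ _))

      cof-≡ : ∀ (Y Y′ : Mat m) → 𝟙 (cof (lift Y ⊗ k) ≟ᵛ cof (lift Y′ ⊗ k)) ≡ 𝟙 (Det Y ≟ᶠ Det Y′)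
      cof-≡ Y Y′ = 𝟙-⇔ (cof (lift Y ⊗ k) ≟ᵛ cof (lift Y′ ⊗ k)) (Det Y ≟ᶠ Det Y′)
        (λ e → trans (sym (dot-cof-base Y)) (trans (cong (dot (vm e₀ k)) e) (dot-cof-base Y′)))
        (λ e → dot-separates _ _ λ z → trans (dot-cof-lift Y z) (trans (cong (head (vm z (adj k)) *ᶠ_) e) (sym (dot-cof-lift Y′ z))))

      nz-cof : ∀ (Y : Mat m) → nzᵛ (cof (lift Y ⊗ k)) ≡ nz (Det Y)
      nz-cof Y = cong (λ z → 1ℤ - z) (𝟙-⇔ (cof (lift Y ⊗ k) ≟ᵛ 0ᵛ) (Det Y ≟ᶠ 0#)
        (λ e → trans (sym (dot-cof-base Y)) (trans (cong (dot (vm e₀ k)) e) (dot-0ʳ (vm e₀ k))))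
        (λ e → dot-separates _ _ λ z → trans (dot-cof-lift Y z) (trans (cong (head (vm z (adj k)) *ᶠ_) e) (trans (R.zeroʳ _) (sym (dot-0ʳ z))))))

    -- This is where the induction closes: the weight ω for δ = 0 is converted into κ of the smaller
    -- determinants.
    κ-nz : ∀ s t → nz s * nz t * (Q−1 * (Q−1 * 𝟙 (s ≟ᶠ t) - 1ℤ)) ≡ Q−1 * κ s t
    κ-nz s t = go (s ≟ᶠ t)
      where
      go : Dec (s ≡ t) → nz s * nz t * (Q−1 * (Q−1 * 𝟙 (s ≟ᶠ t) - 1ℤ)) ≡ Q−1 * κ s t
      go (yes refl) = trans (cong₂ (λ a b → a * (Q−1 * (Q−1 * b - 1ℤ))) (nz-square s) (𝟙-yes (s ≟ᶠ s) refl))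
        (sym (trans (cong₂ (λ a b → Q−1 * (Q−1 * (nz s * a) - b)) (𝟙-yes (s ≟ᶠ s) refl) (nz-square s))
          (solve 2 (λ q x → q :* (q :* (x :* con 1ℤ) :- x) := x :* (q :* (q :* con 1ℤ :- con 1ℤ))) refl Q−1 (nz s))))
      go (no ne) = trans (cong (λ b → nz s * nz t * (Q−1 * (Q−1 * b - 1ℤ))) (𝟙-no (s ≟ᶠ t) ne))
        (sym (trans (cong (λ a → Q−1 * (Q−1 * (nz s * a) - nz s * nz t)) (𝟙-no (s ≟ᶠ t) ne))
          (solve 3 (λ q x y → q :* (q :* (x :* con 0ℤ) :- x :* y) := x :* y :* (q :* (q :* con 0ℤ :- con 1ℤ))) refl Q−1 (nz s) (nz t))))

    -- For M = 0 each nonsingular x contributes q - 2 to Γ, so the bound asserts a saving of order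
    -- q³ compared with M = 0.
    Bound : ∀ n → Set
    Bound n = ∀ (M : Mat n) → M ≢ 0ᴹ → Q−1 * (Q−1 * Γ n M) ≤ (Q ^′ n) ^′ n

    module Step (m : ℕ) (to-e₀ : ∀ (η : Row (suc m)) → η ≢ 0ᵛ → Σ (Mat (suc m)) λ k → Det k ≡ 1# × mv k η ≡ e₀)
      (IH : Bound m) (m₀ : Row (suc m)) (M : Vec (Row (suc m)) m) (M≢0 : M ≢ 0ᴹ) where

      n = suc m
      P = (Q ^′ m) ^′ m

      0≤P : 0ℤ ≤ P
      0≤P = 0≤^ m (0≤^ m 0≤Q)

      ξ ξ̂ : Vec (Row n) m → Row n
      ξ x = cof x
      ξ̂ x = cof (x ⊞ M)

      -- ω depends on its first argument only through its vanishing. When ξ and ξ̂ are nonzero and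
      -- parallel and η is a nonzero multiple of ξ, m₀ · η vanishes exactly when m₀ · ξ̂ does, so η
      -- can replace ξ̂ here.
      ωη : Vec (Row n) m → Row n → ℤ
      ωη x η = ω (dot m₀ η) (𝟙 (ξ x ≟ᵛ ξ̂ x))

      A : Vec (Row n) m → Row n → ℤ
      A x η = nzᵛ η * 𝟙 (mv x η ≟ᵛ 0ᵛ) * 𝟙 (mv M η ≟ᵛ 0ᵛ)

      -- A bound for `I x` spread over the nonzero vectors η killed by both x and M. This permits an
      -- exchange of sums: with η fixed, the rows of x and of M lie in one hyperplane and the
      -- problem drops to size m.
      W : Vec (Row n) m → Row n → ℤ
      W x η = A x η * (nzᵛ (ξ x) * nzᵛ (ξ̂ x) * ωη x η)

      I : Vec (Row n) m → ℤ
      I x = inner (ξ x) (ξ̂ x) (dot m₀ (ξ̂ x))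

      shifted : ∀ x η → mv x η ≡ 0ᵛ → mv M η ≡ 0ᵛ → mv (x ⊞ M) η ≡ 0ᵛ
      shifted x η e e′ = trans (mv-⊞ x M η) (trans (cong₂ _⊕_ e e′) (⊕-identityˡ 0ᵛ))

      parallel-A : ∀ x l → ξ x ≢ 0ᵛ → l ≢ 0# → ξ̂ x ≡ l ⊙ ξ x → ∀ η →
        A x η ≡ ∑[ c ∈ Cs ] nz c * 𝟙 (η ≟ᵛ c ⊙ ξ x)
      parallel-A x l ξ≢0 l≢0 e η = go (mv x η ≟ᵛ 0ᵛ)
        where
        unscale : mv M (ξ x) ≡ 0ᵛ
        unscale = trans (sym (trans (mv-⊞ x M (ξ x)) (trans (cong (_⊕ mv M (ξ x)) (mv-cof x)) (⊕-identityˡ _))))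
          (cancel (mv (x ⊞ M) (ξ x)) (trans (sym (mv-⊙ (x ⊞ M) l (ξ x))) (trans (cong (mv (x ⊞ M)) (sym e)) (mv-cof (x ⊞ M)))))
          where
          mv-⊙ : ∀ {k} (M : Vec (Row n) k) c v → mv M (c ⊙ v) ≡ c ⊙ mv M v
          mv-⊙ []      c v = refl
          mv-⊙ (r ∷ M) c v = cong₂ _∷_ (dot-⊙ʳ c r v) (mv-⊙ M c v)
          cancel : ∀ {k} (v : Row k) → l ⊙ v ≡ 0ᵛ → v ≡ 0ᵛ
          cancel v h = dec (v ≟ᵛ 0ᵛ)
            where
            dec : Dec (v ≡ 0ᵛ) → v ≡ 0ᵛ
            dec (yes p) = p
            dec (no ¬p) = contradiction h (⊙-≢0 l v l≢0 ¬p)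
        mv-⊙0 : ∀ {k} (M : Vec (Row n) k) c v → mv M v ≡ 0ᵛ → mv M (c ⊙ v) ≡ 0ᵛ
        mv-⊙0 []      c v h = refl
        mv-⊙0 (r ∷ M) c v h = cong₂ _∷_ (trans (dot-⊙ʳ c r v) (trans (cong (c *ᶠ_) (cong head h)) (R.zeroʳ c))) (mv-⊙0 M c v (cong tail h))
        go : Dec (mv x η ≡ 0ᵛ) → A x η ≡ ∑[ c ∈ Cs ] nz c * 𝟙 (η ≟ᵛ c ⊙ ξ x)
        go (no ne) = trans (trans (cong (λ z → nzᵛ η * z * 𝟙 (mv M η ≟ᵛ 0ᵛ)) (𝟙-no (mv x η ≟ᵛ 0ᵛ) ne))
            (solve 2 (λ a b → a :* con 0ℤ :* b := con 0ℤ) refl (nzᵛ η) _))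
          (sym (∑-zero′ Cs λ c → trans (cong (nz c *_) (𝟙-no (η ≟ᵛ c ⊙ ξ x) λ h → ne (trans (cong (mv x) h) (mv-⊙0 x c (ξ x) (mv-cof x))))) (zeroʳ _)))
        go (yes xη) = on-line (kernel-line x ξ≢0 η xη)
          where
          on-line : (Σ Carrier λ c → η ≡ c ⊙ ξ x) → A x η ≡ ∑[ c ∈ Cs ] nz c * 𝟙 (η ≟ᵛ c ⊙ ξ x)
          on-line (c₀ , refl) = trans (trans
              (cong₂ (λ a b → nzᵛ η * a * b) (𝟙-yes (mv x η ≟ᵛ 0ᵛ) xη) (𝟙-yes (mv M η ≟ᵛ 0ᵛ) (mv-⊙0 M c₀ (ξ x) unscale)))
              (solve 1 (λ a → a :* con 1ℤ :* con 1ℤ := a) refl (nzᵛ η)))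
            (sym (trans (∑-cong Cs λ c → trans (*-comm (nz c) _) (cong (_* nz c) (𝟙-⇔ (η ≟ᵛ c ⊙ ξ x) (c ≟ᶠ c₀)
                (λ h → sym (⊙-cancel (ξ x) ξ≢0 h)) (λ h → cong (_⊙ ξ x) (sym h)))))
              (trans (delta finC c₀ nz) (cong (λ z → 1ℤ - z) (𝟙-⇔ (c₀ ≟ᶠ 0#) (η ≟ᵛ 0ᵛ)
                (λ h → trans (cong (_⊙ ξ x) h) (0⊙ (ξ x))) (λ h → ⊙-cancel (ξ x) ξ≢0 (trans h (sym (0⊙ (ξ x))))))))))

      W-zero : ∀ x → (∀ η → η ≢ 0ᵛ → mv x η ≡ 0ᵛ → mv M η ≡ 0ᵛ → nzᵛ (ξ x) * nzᵛ (ξ̂ x) ≡ 0ℤ) → ∑ (rows n) (W x) ≡ 0ℤ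
      W-zero x h = ∑-zero′ (rows n) λ η → go η (η ≟ᵛ 0ᵛ) (mv x η ≟ᵛ 0ᵛ) (mv M η ≟ᵛ 0ᵛ)
        where
        a b : Row n → ℤ
        a η = 𝟙 (mv x η ≟ᵛ 0ᵛ)
        b η = 𝟙 (mv M η ≟ᵛ 0ᵛ)
        rest : Row n → ℤ
        rest η = nzᵛ (ξ x) * nzᵛ (ξ̂ x) * ωη x η
        go : ∀ η → Dec (η ≡ 0ᵛ) → Dec (mv x η ≡ 0ᵛ) → Dec (mv M η ≡ 0ᵛ) → W x η ≡ 0ℤ
        go η (yes e) _ _ = trans (cong (λ z → z * a η * b η * rest η) (1-𝟙-yes (η ≟ᵛ 0ᵛ) e))
          (solve 3 (λ a b c → con 0ℤ :* a :* b :* c := con 0ℤ) refl (a η) (b η) (rest η))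
        go η (no _) (no e) _ = trans (cong (λ z → nzᵛ η * z * b η * rest η) (𝟙-no (mv x η ≟ᵛ 0ᵛ) e))
          (solve 3 (λ a b c → a :* con 0ℤ :* b :* c := con 0ℤ) refl (nzᵛ η) (b η) (rest η))
        go η (no _) (yes _) (no e) = trans (cong (λ z → nzᵛ η * a η * z * rest η) (𝟙-no (mv M η ≟ᵛ 0ᵛ) e))
          (solve 3 (λ a b c → a :* b :* con 0ℤ :* c := con 0ℤ) refl (nzᵛ η) (a η) (rest η))
        go η (no η≢0) (yes e) (yes e′) = trans (cong (λ z → A x η * (z * ωη x η)) (h η η≢0 e e′))
          (solve 2 (λ a c → a :* (con 0ℤ :* c) := con 0ℤ) refl (A x η) (ωη x η))

      -- If ξ or ξ̂ vanishes, or if they are not parallel, both sides are 0. Otherwise the common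
      -- kernel is the line of ξ, its q - 1 nonzero vectors carry equal weight, and `K≤ω` applies.
      pointwise : ∀ x → Q−1 * (Q * I x) ≤ Q ^′ n * ∑ (rows n) (W x)
      pointwise x = go (ξ x ≟ᵛ 0ᵛ) (ξ̂ x ≟ᵛ 0ᵛ)
        where
        both-zero : Q * I x ≡ 0ℤ → ∑ (rows n) (W x) ≡ 0ℤ → Q−1 * (Q * I x) ≤ Q ^′ n * ∑ (rows n) (W x)
        both-zero e e′ = ≤-reflexive (trans (trans (cong (Q−1 *_) e) (zeroʳ Q−1)) (sym (trans (cong (Q ^′ n *_) e′) (zeroʳ _))))
        go : Dec (ξ x ≡ 0ᵛ) → Dec (ξ̂ x ≡ 0ᵛ) → Q−1 * (Q * I x) ≤ Q ^′ n * ∑ (rows n) (W x)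
        go (yes e) _ = both-zero
          (trans (cong (Q *_) (∑-zero′ (rows n) λ y → trans (cong (λ s → κ s (dot y (ξ̂ x) +ᶠ dot m₀ (ξ̂ x)))
            (trans (cong (dot y) e) (dot-0ʳ y))) (κ-0ˡ _))) (zeroʳ Q))
          (W-zero x λ _ _ _ _ → trans (cong (_* nzᵛ (ξ̂ x)) (1-𝟙-yes (ξ x ≟ᵛ 0ᵛ) e)) (zeroˡ _))
        go (no _) (yes e) = both-zero
          (trans (cong (Q *_) (∑-zero′ (rows n) λ y → trans (cong (κ (dot y (ξ x)))
            (trans (cong (λ v → dot y v +ᶠ dot m₀ v) e) (trans (cong₂ _+ᶠ_ (dot-0ʳ y) (dot-0ʳ m₀)) (R.+-identityˡ 0#)))) (κ-0ʳ _))) (zeroʳ Q))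
          (W-zero x λ _ _ _ _ → trans (cong (nzᵛ (ξ x) *_) (1-𝟙-yes (ξ̂ x ≟ᵛ 0ᵛ) e)) (zeroʳ _))
        go (no ξ≢0) (no ξ̂≢0) = cases (parallel? (ξ x) (ξ̂ x) ξ≢0)
          where
          cases : (Σ (Row n) λ z → dot z (ξ x) ≡ 0# × dot z (ξ̂ x) ≡ 1#) ⊎ (Σ Carrier λ c → ξ̂ x ≡ c ⊙ ξ x) →
            Q−1 * (Q * I x) ≤ Q ^′ n * ∑ (rows n) (W x)
          cases (inj₁ (z , zξ , zξ̂)) = both-zero (inner-transverse (ξ x) (ξ̂ x) z _ zξ zξ̂)
            (W-zero x λ η η≢0 e e′ → contradiction (collapse η (kernel-line x ξ≢0 η e) (kernel-line (x ⊞ M) ξ̂≢0 η (shifted x η e e′))) η≢0)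
            where
            collapse : ∀ η → (Σ Carrier λ c → η ≡ c ⊙ ξ x) → (Σ Carrier λ c → η ≡ c ⊙ ξ̂ x) → η ≡ 0ᵛ
            collapse η (a , ea) (b , eb) = trans eb (trans (cong (_⊙ ξ̂ x) b≡0) (0⊙ (ξ̂ x)))
              where
              b≡0 : b ≡ 0#
              b≡0 = trans (sym (R.*-identityʳ b)) (trans (cong (b *ᶠ_) (sym zξ̂)) (trans (sym (dot-⊙ʳ b z (ξ̂ x)))
                (trans (cong (dot z) (trans (sym eb) ea)) (trans (dot-⊙ʳ a z (ξ x)) (trans (cong (a *ᶠ_) zξ) (R.zeroʳ a))))))
          cases (inj₂ (l , e)) = scaled (nonzero-dot (ξ x) ξ≢0 1#)
            where
            l≢0 : l ≢ 0#
            l≢0 l≡0 = ξ̂≢0 (trans e (trans (cong (_⊙ ξ x) l≡0) (0⊙ (ξ x))))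
            δ = dot m₀ (ξ̂ x)
            δ≡ : δ ≡ l *ᶠ dot m₀ (ξ x)
            δ≡ = trans (cong (dot m₀) e) (dot-⊙ʳ l m₀ (ξ x))
            same-ω : ∀ c → c ≢ 0# → ωη x (c ⊙ ξ x) ≡ ω δ (𝟙 (1# ≟ᶠ l))
            same-ω c c≢0 = cong₂ (λ a b → (1ℤ - a) + a * (Q−1 * (Q−1 * b - 1ℤ)))
              (𝟙-⇔ (dot m₀ (c ⊙ ξ x) ≟ᶠ 0#) (δ ≟ᶠ 0#)
                (λ h → trans δ≡ (trans (cong (l *ᶠ_) (zero-factor c≢0 (trans (sym (dot-⊙ʳ c m₀ (ξ x))) h))) (R.zeroʳ l)))
                (λ h → trans (dot-⊙ʳ c m₀ (ξ x)) (trans (cong (c *ᶠ_) (zero-factor l≢0 (trans (sym δ≡) h))) (R.zeroʳ c))))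
              (𝟙-⇔ (ξ x ≟ᵛ ξ̂ x) (1# ≟ᶠ l)
                (λ h → ⊙-cancel (ξ x) ξ≢0 (trans (1⊙ (ξ x)) (trans h e)))
                (λ h → trans (sym (1⊙ (ξ x))) (trans (cong (_⊙ ξ x) h) (sym e))))
              where
              zero-factor : ∀ {a b} → a ≢ 0# → a *ᶠ b ≡ 0# → b ≡ 0#
              zero-factor {a} {b} a≢0 h = dec (b ≟ᶠ 0#)
                where
                dec : Dec (b ≡ 0#) → b ≡ 0#
                dec (yes p) = p
                dec (no ¬p) = contradiction h (a*b≢0 a≢0 ¬p)
            ∑W : ∑ (rows n) (W x) ≡ Q−1 * ω δ (𝟙 (1# ≟ᶠ l))
            ∑W = begin
              ∑ (rows n) (W x)
                ≡⟨ (∑-cong (rows n) λ η → trans (cong₂ _*_ (parallel-A x l ξ≢0 l≢0 e η)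
                     (trans (cong₂ (λ a b → a * b * ωη x η) (1-𝟙-no (ξ x ≟ᵛ 0ᵛ) ξ≢0) (1-𝟙-no (ξ̂ x ≟ᵛ 0ᵛ) ξ̂≢0))
                       (solve 1 (λ a → con 1ℤ :* con 1ℤ :* a := a) refl (ωη x η))))
                     (sym (∑-*ʳ (ωη x η) Cs _))) ⟩
              ∑[ η ∈ rows n ] ∑[ c ∈ Cs ] nz c * 𝟙 (η ≟ᵛ c ⊙ ξ x) * ωη x η
                ≡⟨ (∑-swap₁ (rows n) Cs _ λ c → trans (∑-cong (rows n) λ η → *-assoc (nz c) _ _) (trans (∑-*ˡ (nz c) (rows n) _)
                     (cong (nz c *_) (delta (finRow n) (c ⊙ ξ x) (ωη x))))) ⟩
              ∑[ c ∈ Cs ] nz c * ωη x (c ⊙ ξ x)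
                ≡⟨ (∑-cong Cs λ c → scale c (c ≟ᶠ 0#)) ⟩
              ∑[ c ∈ Cs ] nz c * ω δ (𝟙 (1# ≟ᶠ l))
                ≡⟨ trans (∑-*ʳ _ Cs nz) (cong (_* ω δ (𝟙 (1# ≟ᶠ l))) ∑-nz) ⟩
              Q−1 * ω δ (𝟙 (1# ≟ᶠ l)) ∎
              where
              open ≡-Reasoning
              scale : ∀ c → Dec (c ≡ 0#) → nz c * ωη x (c ⊙ ξ x) ≡ nz c * ω δ (𝟙 (1# ≟ᶠ l))
              scale c (yes h) = trans (trans (cong (_* ωη x (c ⊙ ξ x)) (1-𝟙-yes (c ≟ᶠ 0#) h)) (zeroˡ _))
                (sym (trans (cong (_* ω δ (𝟙 (1# ≟ᶠ l))) (1-𝟙-yes (c ≟ᶠ 0#) h)) (zeroˡ _)))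
              scale c (no h)  = cong (nz c *_) (same-ω c h)
            scaled : (Σ (Row n) λ z → dot z (ξ x) ≡ 1#) → Q−1 * (Q * I x) ≤ Q ^′ n * ∑ (rows n) (W x)
            scaled (z , zξ) = ≤-trans (≤-reflexive (cong (Q−1 *_) (trans (cong (λ v → Q * inner (ξ x) v δ) e) (inner-parallel (ξ x) z l δ zξ))))
              (≤-trans (≤-reflexive (solve 3 (λ a b c → a :* (b :* c) := b :* (a :* c)) refl Q−1 (Q ^′ n) (K l δ)))
              (*-monoˡ (0≤^ n 0≤Q) (≤-trans (*-monoˡ 0≤Q−1 (K≤ω l δ l≢0)) (≤-reflexive (sym ∑W)))))

      B : Row n → ℤ
      B η = ∑[ x ∈ mats m n ] 𝟙 (mv x η ≟ᵛ 0ᵛ) * (nzᵛ (ξ x) * nzᵛ (ξ̂ x) * ωη x η)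

      -- If m₀ · η ≠ 0, each Y contributes at most 1. If m₀ · η = 0, the sum is (q - 1) times Γ of
      -- size m, and the induction hypothesis has a factor q - 1 to spare.
      B≤P : ∀ η → η ≢ 0ᵛ → mv M η ≡ 0ᵛ → B η ≤ P
      B≤P η η≢0 Mη = transform (to-e₀ η η≢0)
        where
        δ = dot m₀ η
        transform : (Σ (Mat n) λ k → Det k ≡ 1# × mv k η ≡ e₀) → B η ≤ P
        transform (k , dk , kη) = lower (on-hyperplane M Mη)
          where
          open Hyperplane η k dk kη
          lower : (Σ (Mat m) λ Y → M ≡ lift Y ⊗ k) → B η ≤ P
          lower (Ml , eM) = ≤-trans (≤-reflexive (trans (∑-hyperplane _) (∑-cong (mats m m) λ Y →
              cong₂ _*_ (cong₂ _*_ (nz-cof Y) (trans (cong (λ X → nzᵛ (cof X)) (sum Y)) (nz-cof (Y ⊞ Ml))))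
                (cong (ω δ) (trans (cong (λ X → 𝟙 (cof (lift Y ⊗ k) ≟ᵛ cof X)) (sum Y)) (cof-≡ Y (Y ⊞ Ml)))))))
            (by-δ (δ ≟ᶠ 0#))
            where
            sum : ∀ Y → lift Y ⊗ k ⊞ M ≡ lift (Y ⊞ Ml) ⊗ k
            sum Y = trans (cong (lift Y ⊗ k ⊞_) eM) (trans (sym (⊞-⊗ (lift Y) (lift Ml) k)) (cong (_⊗ k) (lift-⊞ Y Ml)))
            Ml≢0 : Ml ≢ 0ᴹ
            Ml≢0 e = M≢0 (trans eM (trans (cong (λ Y → lift Y ⊗ k) e) (trans (cong (_⊗ k) (lift-0 {m} {m})) (0ᴹ-⊗ {m} k))))
            by-δ : Dec (δ ≡ 0#) → ∑[ Y ∈ mats m m ] nz (Det Y) * nz (Det (Y ⊞ Ml)) * ω δ (𝟙 (Det Y ≟ᶠ Det (Y ⊞ Ml))) ≤ P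
            by-δ (no δ≢0) = ≤-trans (∑-mono (mats m m) λ Y → ≤-trans (≤-reflexive (trans (cong (nz (Det Y) * nz (Det (Y ⊞ Ml)) *_) (ω-no δ _ δ≢0)) (*-identityʳ _)))
                (≤-trans (*-mono (0≤1-𝟙 (Det Y ≟ᶠ 0#)) 0≤1 (1-𝟙≤1 (Det Y ≟ᶠ 0#)) (1-𝟙≤1 (Det (Y ⊞ Ml) ≟ᶠ 0#))) (≤-reflexive (*-identityˡ 1ℤ))))
              (≤-reflexive (trans (∑-one (mats m m)) (length-mats m m)))
            by-δ (yes δ≡0) = ≤-trans (≤-reflexive (trans (∑-cong (mats m m) λ Y →
                  trans (cong (nz (Det Y) * nz (Det (Y ⊞ Ml)) *_) (trans (cong (λ d → ω d (𝟙 (Det Y ≟ᶠ Det (Y ⊞ Ml)))) δ≡0) (ω-yes _)))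
                    (κ-nz (Det Y) (Det (Y ⊞ Ml)))) (∑-*ˡ Q−1 (mats m m) _)))
              (cancel-factor 1≤Q−1 0≤P (IH Ml Ml≢0))

      kernel-count : ∑[ η ∈ rows n ] 𝟙 (mv M η ≟ᵛ 0ᵛ) ≤ Q ^′ m
      kernel-count = *-cancelˡ 0<Q (by-row (nonzero-row M M≢0))
        where
        by-row : (Σ (Row n) λ r → r ≢ 0ᵛ × (∀ η → mv M η ≡ 0ᵛ → dot r η ≡ 0#)) →
          Q * (∑[ η ∈ rows n ] 𝟙 (mv M η ≟ᵛ 0ᵛ)) ≤ Q * Q ^′ m
        by-row (r , r≢0 , h) = ≤-trans (*-monoˡ 0≤Q (∑-mono (rows n) λ η → 𝟙-mono (mv M η ≟ᵛ 0ᵛ) (dot η r ≟ᶠ 0#) λ e → trans (dot-comm η r) (h η e)))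
          (≤-reflexive (average (nonzero-dot r r≢0 1#)))
          where
          average : (Σ (Row n) λ z → dot z r ≡ 1#) → Q * (∑[ η ∈ rows n ] 𝟙 (dot η r ≟ᶠ 0#)) ≡ Q * Q ^′ m
          average (z , zr) = trans (line-average z _) (trans (∑-cong (rows n) λ η → trans
              (∑-cong Cs λ c → cong (λ t → 𝟙 (t ≟ᶠ 0#)) (trans (dot-line η z r c) (trans (cong (λ t → dot η r +ᶠ c *ᶠ t) zr)
                (cong (dot η r +ᶠ_) (R.*-identityʳ c)))))
              (trans (∑-shift (dot η r) λ t → 𝟙 (t ≟ᶠ 0#)) (once finC 0#)))
            (trans (∑-one (rows n)) (length-rows n)))

      Γ-fibres : Γ n (m₀ ∷ M) ≡ ∑ (mats m n) I
      Γ-fibres = trans (∑-rows m n _) (trans (∑-swap (rows n) (mats m n) _) (∑-cong (mats m n) λ x → ∑-cong (rows n) λ r →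
        cong₂ κ (sym (dot-cof x r)) (trans (sym (dot-cof (x ⊞ M) (r ⊕ m₀))) (dot-⊕ˡ r m₀ (ξ̂ x)))))

      -- At most q^m vectors η are killed by M, so (q - 1) q Γ ≤ q^n · q^m · P. Cancelling q and
      -- enlarging the second factor q - 1 to q gives exactly q^(n²).
      bound : Q−1 * (Q−1 * Γ n (m₀ ∷ M)) ≤ (Q ^′ n) ^′ n
      bound = ≤-trans (*-monoˡ 0≤Q−1 once-bound) (≤-trans (*-monoʳ 0≤C Q−1≤Q) (≤-reflexive
          (trans (solve 3 (λ q a p → q :* (a :* (a :* p)) := (q :* a) :* (a :* p)) refl Q (Q ^′ m) P)
            (cong (Q ^′ n *_) (trans (cong (_* P) (sym refl)) (power-split))))))
        where
        C = Q ^′ m * (Q ^′ m * P)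
        0≤C : 0ℤ ≤ C
        0≤C = 0≤m*n (0≤^ m 0≤Q) (0≤m*n (0≤^ m 0≤Q) 0≤P)
        Q−1≤Q : Q−1 ≤ Q
        Q−1≤Q = from-diff {k = 1ℤ} (solve 1 (λ q → q :- (q :- con 1ℤ) := con 1ℤ) refl Q) 0≤1
        power-split : Q ^′ m * P ≡ (Q ^′ n) ^′ m
        power-split = sym (^-distrib Q (Q ^′ m) m)
        sums : ∑[ x ∈ mats m n ] ∑ (rows n) (W x) ≤ Q ^′ m * P
        sums = ≤-trans (≤-reflexive (∑-swap₁ (mats m n) (rows n) _ λ η → trans
              (∑-cong (mats m n) λ x → solve 4 (λ a b c d → a :* b :* c :* d := (a :* c) :* (b :* d)) refl
                (nzᵛ η) (𝟙 (mv x η ≟ᵛ 0ᵛ)) (𝟙 (mv M η ≟ᵛ 0ᵛ)) (nzᵛ (ξ x) * nzᵛ (ξ̂ x) * ωη x η))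
              (∑-*ˡ (nzᵛ η * 𝟙 (mv M η ≟ᵛ 0ᵛ)) (mats m n) _)))
          (≤-trans (∑-mono (rows n) λ η → term η (η ≟ᵛ 0ᵛ) (mv M η ≟ᵛ 0ᵛ))
          (≤-trans (≤-reflexive (∑-*ʳ P (rows n) _)) (*-monoʳ 0≤P kernel-count)))
          where
          0≤𝟙P : ∀ η → 0ℤ ≤ 𝟙 (mv M η ≟ᵛ 0ᵛ) * P
          0≤𝟙P η = 0≤m*n (𝟙-nonneg (mv M η ≟ᵛ 0ᵛ)) 0≤P
          term : ∀ η → Dec (η ≡ 0ᵛ) → Dec (mv M η ≡ 0ᵛ) → nzᵛ η * 𝟙 (mv M η ≟ᵛ 0ᵛ) * B η ≤ 𝟙 (mv M η ≟ᵛ 0ᵛ) * P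
          term η (yes e) _ = ≤-trans (≤-reflexive (trans (cong (λ z → z * 𝟙 (mv M η ≟ᵛ 0ᵛ) * B η) (1-𝟙-yes (η ≟ᵛ 0ᵛ) e))
            (solve 2 (λ a b → con 0ℤ :* a :* b := con 0ℤ) refl _ (B η)))) (0≤𝟙P η)
          term η (no _) (no e) = ≤-trans (≤-reflexive (trans (cong (λ z → nzᵛ η * z * B η) (𝟙-no (mv M η ≟ᵛ 0ᵛ) e))
            (solve 2 (λ a b → a :* con 0ℤ :* b := con 0ℤ) refl (nzᵛ η) (B η)))) (0≤𝟙P η)
          term η (no η≢0) (yes e) = subst₂ _≤_
            (sym (trans (cong₂ (λ a b → a * b * B η) (1-𝟙-no (η ≟ᵛ 0ᵛ) η≢0) (𝟙-yes (mv M η ≟ᵛ 0ᵛ) e)) (solve 1 (λ b → con 1ℤ :* con 1ℤ :* b := b) refl (B η))))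
            (sym (trans (cong (_* P) (𝟙-yes (mv M η ≟ᵛ 0ᵛ) e)) (*-identityˡ P))) (B≤P η η≢0 e)
        once-bound : Q−1 * Γ n (m₀ ∷ M) ≤ C
        once-bound = *-cancelˡ 0<Q (≤-trans (≤-reflexive (trans
            (trans (solve 3 (λ a b c → a :* (b :* c) := b :* (a :* c)) refl Q Q−1 (Γ n (m₀ ∷ M))) (cong (λ z → Q−1 * (Q * z)) Γ-fibres))
            (trans (cong (Q−1 *_) (sym (∑-*ˡ Q (mats m n) I))) (sym (∑-*ˡ Q−1 (mats m n) _)))))
          (≤-trans (∑-mono (mats m n) pointwise) (≤-trans (≤-reflexive (∑-*ˡ (Q ^′ n) (mats m n) _))
          (≤-trans (*-monoˡ (0≤^ n 0≤Q) sums) (≤-reflexive (*-assoc Q (Q ^′ m) _))))))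

    Γ-⊗ : ∀ {n} (p : Mat n) → Det p ≡ 1# → ∀ M → Γ n (p ⊗ M) ≡ Γ n M
    Γ-⊗ {n} p dp M = trans (sym (reindex (finMat n n) (finMat n n) (p ⊗_) (adj p ⊗_)
        (λ x → ⊗-cancelˡ (adj p) p x (SL-inverseˡ p dp)) (λ x → ⊗-cancelˡ p (adj p) x (SL-inverseʳ p dp)) (λ x → κ (Det x) (Det (x ⊞ p ⊗ M)))))
      (∑-cong (mats n n) λ x → cong₂ κ (det-SLˡ p x dp) (trans (cong Det (sym (⊗-⊞ p x M))) (det-SLˡ p (x ⊞ M) dp)))

    -- The two determinants differ for every x, so the positive part of κ never occurs.
    bound-one : Bound 1
    bound-one M@((c ∷ []) ∷ []) M≢0 = ≤-trans (*-monoˡ 0≤Q−1 (≤-trans (*-monoˡ 0≤Q−1 Γ≤0) (≤-reflexive (zeroʳ Q−1))))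
        (≤-trans (≤-reflexive (zeroʳ Q−1)) (0≤^ 1 (0≤^ 1 0≤Q)))
      where
      det₁ : ∀ a → Det ((a ∷ []) ∷ []) ≡ a
      det₁ a = trans (det-lower a [] []) (trans (cong (a *ᶠ_) (det-Id 0)) (R.*-identityʳ a))
      ne : ∀ a → a ≢ a +ᶠ c
      ne a e = M≢0 (cong (λ z → (z ∷ []) ∷ []) (trans (R.solve 2 (λ a c → c R.:= (a R.:+ c) R.:+ R.:- a) refl a c)
        (trans (cong (_+ᶠ -ᶠ a) (sym e)) (R.-‿inverseʳ a))))
      term : ∀ (x : Mat 1) → κ (Det x) (Det (x ⊞ M)) ≤ 0ℤ
      term ((a ∷ []) ∷ []) = ≤-trans (≤-reflexive (trans (cong₂ κ (det₁ a) (det₁ (a +ᶠ c)))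
          (trans (cong (λ z → Q−1 * (nz a * z) - nz a * nz (a +ᶠ c)) (𝟙-no (a ≟ᶠ a +ᶠ c) (ne a)))
            (solve 3 (λ q x y → q :* (x :* con 0ℤ) :- x :* y := :- (x :* y)) refl Q−1 (nz a) (nz (a +ᶠ c))))))
        (≤-trans (neg-mono-≤ (0≤m*n (0≤1-𝟙 (a ≟ᶠ 0#)) (0≤1-𝟙 (a +ᶠ c ≟ᶠ 0#)))) (≤-reflexive (solve 0 (:- con 0ℤ := con 0ℤ) refl)))
      Γ≤0 : Γ 1 M ≤ 0ℤ
      Γ≤0 = ≤-trans (∑-mono (mats 1 1) term) (≤-reflexive (∑-zero (mats 1 1)))

    -- If only the first row of M is nonzero, add it to the second one.
    spread-row : ∀ {m} (m₀ : Row (suc m)) (M : Vec (Row (suc m)) m) → m₀ ≢ 0ᵛ → M ≡ 0ᴹ → ∀ (w : Row m) → w ≢ 0ᵛ →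
      Σ (Vec (Row (suc m)) m) λ M′ → M′ ≢ 0ᴹ × τ w ⊗ (m₀ ∷ M) ≡ m₀ ∷ M′
    spread-row {m} m₀ M m₀≢0 refl w w≢0 = map (λ r → vm r (m₀ ∷ M)) (zipWith _∷_ w (Id m)) , nonzero w (Id m) w≢0 ,
      cong (_∷ map (λ r → vm r (m₀ ∷ M)) (zipWith _∷_ w (Id m)))
        (trans (cong₂ _⊕_ (1⊙ m₀) (vm-0 M)) (⊕-identityʳ m₀))
      where
      vm-0ᴹ : ∀ {k n} (r : Row k) → vm r (0ᴹ {k} {n}) ≡ 0ᵛ
      vm-0ᴹ []      = refl
      vm-0ᴹ (a ∷ r) = trans (cong₂ _⊕_ (⊙0 a) (vm-0ᴹ r)) (⊕-identityˡ 0ᵛ)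
      nonzero : ∀ {k} (w : Row k) (h : Vec (Row m) k) → w ≢ 0ᵛ → map (λ r → vm r (m₀ ∷ 0ᴹ)) (zipWith _∷_ w h) ≢ 0ᴹ
      nonzero []      []      w≢0 e = w≢0 refl
      nonzero (a ∷ w) (r ∷ h) w≢0 e = go (a ≟ᶠ 0#)
        where
        row : a ⊙ m₀ ≡ 0ᵛ
        row = trans (sym (trans (cong (a ⊙ m₀ ⊕_) (vm-0ᴹ r)) (⊕-identityʳ _))) (cong head e)
        go : Dec (a ≡ 0#) → _
        go (no a≢0)  = ⊙-≢0 a m₀ a≢0 m₀≢0 row
        go (yes a≡0) = nonzero w h (λ w≡0 → w≢0 (cong₂ _∷_ a≡0 w≡0)) (cong tail e)

    bound-step : ∀ m → (∀ (η : Row (suc m)) → η ≢ 0ᵛ → Σ (Mat (suc m)) λ k → Det k ≡ 1# × mv k η ≡ e₀) →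
      (Σ (Row m) λ w → w ≢ 0ᵛ) → Bound m → Bound (suc m)
    bound-step m to-e₀ (w , w≢0) IH (m₀ ∷ M) ne = go (_≟_ (finMat m (suc m)) M 0ᴹ)
      where
      go : Dec (M ≡ 0ᴹ) → Q−1 * (Q−1 * Γ (suc m) (m₀ ∷ M)) ≤ (Q ^′ suc m) ^′ suc m
      go (no M≢0)  = Step.bound m to-e₀ IH m₀ M M≢0
      go (yes M≡0) = moved (spread-row m₀ M (λ e → ne (cong₂ _∷_ e M≡0)) M≡0 w w≢0)
        where
        moved : (Σ (Vec (Row (suc m)) m) λ M′ → M′ ≢ 0ᴹ × τ w ⊗ (m₀ ∷ M) ≡ m₀ ∷ M′) → _
        moved (M′ , M′≢0 , e) = ≤-trans (≤-reflexive (cong (λ z → Q−1 * (Q−1 * z))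
            (trans (sym (Γ-⊗ (τ w) (det-τ w) (m₀ ∷ M))) (cong (Γ (suc m)) e))))
          (Step.bound m to-e₀ IH m₀ M′ M′≢0)

    Γ-bound : ∀ m → Bound (suc m)
    Γ-bound zero    = bound-one
    Γ-bound (suc m) = bound-step (suc m) column-to-e₀ (e₀ , e₀≢0) (Γ-bound m)

-- Additive energy and the distribution of det (b + c)

module SumEnergy where
  open Integers
  open Sums
  open Counting
  open Correlations
  open import Data.Vec.Base using (Vec; []; _∷_; map)

  open Finite

  module SumSets {q : ℕ} (F : FiniteField q) (2≤q : pos 2 ≤ pos q) where

    open Correlation F 2≤q public

    ∑-nz-𝟙 : ∀ s (g : Carrier → ℤ) → ∑[ d ∈ Cs ] nz d * (𝟙 (s ≟ᶠ d) * g d) ≡ nz s * g s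
    ∑-nz-𝟙 s g = trans (∑-cong Cs λ d → trans (cong (λ z → nz d * (z * g d)) (𝟙-sym s d))
        (solve 3 (λ a b c → a :* (b :* c) := b :* (a :* c)) refl (nz d) (𝟙 (d ≟ᶠ s)) (g d)))
      (delta finC s λ d → nz d * g d)

    -- For d ≠ 0, q - 1 times the deviation of the indicator of s = d from its average over nonzero
    -- s, extended by 0 to s = 0; the Gram matrix of these functions over d is (q - 1) κ.
    dev : Carrier → Carrier → ℤ
    dev d s = Q−1 * 𝟙 (s ≟ᶠ d) - nz s

    ∑-dev : ∀ s t → ∑[ d ∈ Cs ] nz d * (dev d s * dev d t) ≡ Q−1 * κ s t
    ∑-dev s t = begin
      ∑[ d ∈ Cs ] nz d * (dev d s * dev d t)
        ≡⟨ (∑-cong Cs λ d → solve 6 (λ n q a b x y → n :* ((q :* a :- x) :* (q :* b :- y)) :=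
             (q :* q :* (n :* (a :* b)) :- q :* y :* (n :* (a :* con 1ℤ))) :- (q :* x :* (n :* (b :* con 1ℤ)) :- x :* y :* n))
             refl (nz d) Q−1 (𝟙 (s ≟ᶠ d)) (𝟙 (t ≟ᶠ d)) (nz s) (nz t)) ⟩
      ∑[ d ∈ Cs ] ((Q−1 * Q−1 * (nz d * (𝟙 (s ≟ᶠ d) * 𝟙 (t ≟ᶠ d))) - Q−1 * nz t * (nz d * (𝟙 (s ≟ᶠ d) * 1ℤ)))
         - (Q−1 * nz s * (nz d * (𝟙 (t ≟ᶠ d) * 1ℤ)) - nz s * nz t * nz d))
        ≡⟨ trans (∑-− Cs _ _) (cong₂ _-_
             (trans (∑-− Cs _ _) (cong₂ _-_ (trans (∑-*ˡ (Q−1 * Q−1) Cs _) (cong (Q−1 * Q−1 *_) (∑-nz-𝟙 s λ d → 𝟙 (t ≟ᶠ d))))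
               (trans (∑-*ˡ (Q−1 * nz t) Cs _) (cong (Q−1 * nz t *_) (∑-nz-𝟙 s λ _ → 1ℤ)))))
             (trans (∑-− Cs _ _) (cong₂ _-_ (trans (∑-*ˡ (Q−1 * nz s) Cs _) (cong (Q−1 * nz s *_) (∑-nz-𝟙 t λ _ → 1ℤ)))
               (trans (∑-*ˡ (nz s * nz t) Cs _) (cong (nz s * nz t *_) ∑-nz))))) ⟩
      (Q−1 * Q−1 * (nz s * 𝟙 (t ≟ᶠ s)) - Q−1 * nz t * (nz s * 1ℤ)) - (Q−1 * nz s * (nz t * 1ℤ) - nz s * nz t * Q−1)
        ≡⟨ cong (λ z → (Q−1 * Q−1 * (nz s * z) - Q−1 * nz t * (nz s * 1ℤ)) - (Q−1 * nz s * (nz t * 1ℤ) - nz s * nz t * Q−1)) (𝟙-sym t s) ⟩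
      (Q−1 * Q−1 * (nz s * 𝟙 (s ≟ᶠ t)) - Q−1 * nz t * (nz s * 1ℤ)) - (Q−1 * nz s * (nz t * 1ℤ) - nz s * nz t * Q−1)
        ≡⟨ solve 4 (λ q x y e → (q :* q :* (x :* e) :- q :* y :* (x :* con 1ℤ)) :- (q :* x :* (y :* con 1ℤ) :- x :* y :* q)
             := q :* (q :* (x :* e) :- x :* y)) refl Q−1 (nz s) (nz t) (𝟙 (s ≟ᶠ t)) ⟩
      Q−1 * κ s t ∎
      where open ≡-Reasoning

    negᴹ : ∀ {k n} → Vec (Row n) k → Vec (Row n) k
    negᴹ = map ⊖_

    ⊞-cancel : ∀ {k n} (x c : Vec (Row n) k) → (x ⊞ c) ⊞ negᴹ c ≡ x
    ⊞-cancel []      []      = refl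
    ⊞-cancel (r ∷ x) (s ∷ c) = cong₂ _∷_ (trans (⊕-assoc r s (⊖ s)) (trans (cong (r ⊕_) (⊕-inverseʳ s)) (⊕-identityʳ r))) (⊞-cancel x c)

    ⊞-cancel′ : ∀ {k n} (x c : Vec (Row n) k) → (x ⊞ negᴹ c) ⊞ c ≡ x
    ⊞-cancel′ []      []      = refl
    ⊞-cancel′ (r ∷ x) (s ∷ c) = cong₂ _∷_ (trans (⊕-assoc r (⊖ s) s) (trans (cong (r ⊕_) (⊕-inverseˡ s)) (⊕-identityʳ r))) (⊞-cancel′ x c)

    ⊞-assoc : ∀ {k n} (x y z : Vec (Row n) k) → (x ⊞ y) ⊞ z ≡ x ⊞ (y ⊞ z)
    ⊞-assoc []      []      []      = refl
    ⊞-assoc (r ∷ x) (s ∷ y) (t ∷ z) = cong₂ _∷_ (⊕-assoc r s t) (⊞-assoc x y z)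

    ⊞-comm : ∀ {k n} (x y : Vec (Row n) k) → x ⊞ y ≡ y ⊞ x
    ⊞-comm []      []      = refl
    ⊞-comm (r ∷ x) (s ∷ y) = cong₂ _∷_ (⊕-comm r s) (⊞-comm x y)

    ⊞-0ᴹ : ∀ {k n} (x : Vec (Row n) k) → x ⊞ 0ᴹ ≡ x
    ⊞-0ᴹ []      = refl
    ⊞-0ᴹ (r ∷ x) = cong₂ _∷_ (⊕-identityʳ r) (⊞-0ᴹ x)

    difference-zero : ∀ {k n} (x y : Vec (Row n) k) → negᴹ x ⊞ y ≡ 0ᴹ → y ≡ x
    difference-zero x y e = trans (sym (⊞-cancel y (negᴹ x)) ) (trans (cong (_⊞ negᴹ (negᴹ x)) (trans (⊞-comm y (negᴹ x)) e)) (neg-neg x))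
      where
      neg-neg : ∀ {k n} (x : Vec (Row n) k) → 0ᴹ ⊞ negᴹ (negᴹ x) ≡ x
      neg-neg []      = refl
      neg-neg (r ∷ x) = cong₂ _∷_ (row r) (neg-neg x)
        where
        row : ∀ {n} (r : Row n) → 0ᵛ ⊕ ⊖ (⊖ r) ≡ r
        row []      = refl
        row (a ∷ r) = cong₂ _∷_ (R.solve 1 (λ a → R.c0 R.:+ R.:- (R.:- a) R.:= a) refl a) (row r)

    ∑-translate : ∀ {n} (c : Mat n) (f : Mat n → ℤ) → ∑[ y ∈ mats n n ] f (y ⊞ c) ≡ ∑ (mats n n) f
    ∑-translate {n} c = reindex (finMat n n) (finMat n n) (_⊞ c) (_⊞ negᴹ c) (λ y → ⊞-cancel y c) (λ y → ⊞-cancel′ y c)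

    module Additive (n : ℕ) (Γb : Bound n) (C : List (Mat n)) (uniqC : Unique C) where

      Ms = mats n n
      P = (Q ^′ n) ^′ n
      ∣C∣ = pos (length C)
      _≟ᴹ_ = _≟_ (finMat n n)

      0≤P : 0ℤ ≤ P
      0≤P = 0≤^ n (0≤^ n 0≤Q)

      Y : Carrier → Mat n → ℤ
      Y d y = ∑[ c ∈ C ] dev d (Det (y ⊞ c))

      -- P = q^(n²) for each pair of elements of C, by the correlation bound, and a further q³ P for
      -- each diagonal pair, where only the trivial estimate is available.
      W : ℤ
      W = P * (∣C∣ * ∣C∣ + ∣C∣ * (Q * (Q * Q)))

      Z : ℤ
      Z = ∑[ d ∈ Cs ] nz d * (∑[ y ∈ Ms ] Y d y * Y d y)

      Z-Γ : Z ≡ Q−1 * (∑[ c ∈ C ] ∑[ c′ ∈ C ] Γ n (negᴹ c ⊞ c′))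
      Z-Γ = begin
        ∑[ d ∈ Cs ] nz d * (∑[ y ∈ Ms ] Y d y * Y d y)
          ≡⟨ (∑-cong Cs λ d → trans (sym (∑-*ˡ (nz d) Ms _)) (∑-cong Ms λ y →
               trans (cong (nz d *_) (sym (∑-prod C C _ _))) (trans (sym (∑-*ˡ (nz d) C _)) (∑-cong C λ c → sym (∑-*ˡ (nz d) C _))))) ⟩
        ∑[ d ∈ Cs ] ∑[ y ∈ Ms ] ∑[ c ∈ C ] ∑[ c′ ∈ C ] nz d * (dev d (Det (y ⊞ c)) * dev d (Det (y ⊞ c′)))
          ≡⟨ (∑-swap₁ Cs Ms _ λ y → ∑-swap₁ Cs C _ λ c → ∑-swap₁ Cs C _ λ c′ → ∑-dev (Det (y ⊞ c)) (Det (y ⊞ c′))) ⟩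
        ∑[ y ∈ Ms ] ∑[ c ∈ C ] ∑[ c′ ∈ C ] Q−1 * κ (Det (y ⊞ c)) (Det (y ⊞ c′))
          ≡⟨ (∑-swap₁ Ms C _ λ c → ∑-swap₁ Ms C _ λ c′ → trans (∑-*ˡ Q−1 Ms _) (cong (Q−1 *_) (shifted c c′))) ⟩
        ∑[ c ∈ C ] ∑[ c′ ∈ C ] Q−1 * Γ n (negᴹ c ⊞ c′)
          ≡⟨ trans (∑-cong C λ c → ∑-*ˡ Q−1 C _) (∑-*ˡ Q−1 C _) ⟩
        Q−1 * (∑[ c ∈ C ] ∑[ c′ ∈ C ] Γ n (negᴹ c ⊞ c′)) ∎
        where
        open ≡-Reasoning
        shifted : ∀ c c′ → ∑[ y ∈ Ms ] κ (Det (y ⊞ c)) (Det (y ⊞ c′)) ≡ Γ n (negᴹ c ⊞ c′)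
        shifted c c′ = trans (∑-cong Ms λ y → cong (λ z → κ (Det (y ⊞ c)) (Det z))
            (trans (cong (_⊞ c′) (sym (⊞-cancel y c))) (⊞-assoc (y ⊞ c) (negᴹ c) c′)))
          (∑-translate c λ y → κ (Det y) (Det (y ⊞ (negᴹ c ⊞ c′))))

      κ≤ : ∀ s → κ s s ≤ Q−1
      κ≤ s = ≤-trans (+-mono-≤ (*-monoˡ 0≤Q−1 (*-mono (0≤1-𝟙 (s ≟ᶠ 0#)) 0≤1 (1-𝟙≤1 (s ≟ᶠ 0#)) (𝟙≤1 (s ≟ᶠ s))))
          (neg-mono-≤ (0≤sq (nz s)))) (≤-reflexive (solve 1 (λ q → q :* (con 1ℤ :* con 1ℤ) :+ :- con 0ℤ := q) refl Q−1))

      Q−1≤Q : Q−1 ≤ Q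
      Q−1≤Q = from-diff {k = 1ℤ} (solve 1 (λ q → q :- (q :- con 1ℤ) := con 1ℤ) refl Q) 0≤1

      diagonal : Q−1 * (Q−1 * Γ n 0ᴹ) ≤ Q * (Q * Q) * P
      diagonal = ≤-trans (*-monoˡ 0≤Q−1 (*-monoˡ 0≤Q−1 (≤-trans (∑-mono Ms λ x →
            ≤-trans (≤-reflexive (cong (λ z → κ (Det x) (Det z)) (⊞-0ᴹ x))) (κ≤ (Det x)))
            (≤-reflexive (trans (∑-const Ms Q−1) (cong (_* Q−1) (length-mats n n)))))))
        (≤-trans (≤-reflexive (solve 2 (λ q p → q :* (q :* (p :* q)) := q :* (q :* q) :* p) refl Q−1 P))
          (*-monoʳ 0≤P (*-mono 0≤Q−1 (0≤m*n 0≤Q 0≤Q) Q−1≤Q (*-mono 0≤Q−1 0≤Q Q−1≤Q Q−1≤Q))))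

      pair-bound : ∀ c c′ → Q−1 * (Q−1 * Γ n (negᴹ c ⊞ c′)) ≤ P + 𝟙 (c′ ≟ᴹ c) * (Q * (Q * Q) * P)
      pair-bound c c′ = go (_≟_ (finMat n n) (negᴹ c ⊞ c′) 0ᴹ)
        where
        0≤D : 0ℤ ≤ Q * (Q * Q) * P
        0≤D = 0≤m*n (0≤m*n 0≤Q (0≤m*n 0≤Q 0≤Q)) 0≤P
        go : Dec (negᴹ c ⊞ c′ ≡ 0ᴹ) → _
        go (no ne) = ≤-trans (Γb _ ne) (≤-trans (≤-reflexive (sym (+-identityʳ P))) (+-mono-≤ ≤-refl (0≤m*n (𝟙-nonneg (c′ ≟ᴹ c)) 0≤D)))
        go (yes e) = ≤-trans (≤-reflexive (cong (λ z → Q−1 * (Q−1 * Γ n z)) e)) (≤-trans diagonal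
          (≤-trans (≤-reflexive (trans (sym (*-identityˡ _)) (trans (cong (_* (Q * (Q * Q) * P)) (sym (𝟙-yes (c′ ≟ᴹ c) (difference-zero c c′ e)))) (sym (+-identityˡ _)))))
            (+-mono-≤ 0≤P ≤-refl)))

      Z≤W : Q−1 * Z ≤ W
      Z≤W = ≤-trans (≤-reflexive (trans (cong (Q−1 *_) Z-Γ) (trans
          (trans (cong (Q−1 *_) (trans (sym (∑-*ˡ Q−1 C _)) (∑-cong C λ c → sym (∑-*ˡ Q−1 C _)))) (sym (∑-*ˡ Q−1 C _)))
          (∑-cong C λ c → sym (∑-*ˡ Q−1 C _)))))
        (≤-trans (∑-mono C λ c → ∑-mono C λ c′ → pair-bound c c′) (≤-trans (≤-reflexive
            (∑-cong C λ c → trans (∑-+ C _ _) (cong₂ _+_ (∑-const C P) (∑-*ʳ (Q * (Q * Q) * P) C _))))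
          (≤-trans (∑-mono C λ c → +-mono-≤ ≤-refl (*-monoʳ 0≤D (count≤1 _≟ᴹ_ C c uniqC)))
          (≤-reflexive (trans (∑-const C _) (solve 3 (λ c q p → c :* (c :* p :+ con 1ℤ :* (q :* p)) := p :* (c :* c :+ c :* q)) refl ∣C∣ (Q * (Q * Q)) P))))))
        where
        0≤D : 0ℤ ≤ Q * (Q * Q) * P
        0≤D = 0≤m*n (0≤m*n 0≤Q (0≤m*n 0≤Q 0≤Q)) 0≤P

      -- Used twice: the indicator of B gives the second moment of the determinants of b + c, and
      -- the representation function ρ gives the energy.
      large-sieve : ∀ (h : Mat n → ℤ) →
        Q−1 * (∑[ d ∈ Cs ] nz d * ((∑[ y ∈ Ms ] h y * Y d y) * (∑[ y ∈ Ms ] h y * Y d y))) ≤ (∑[ y ∈ Ms ] h y * h y) * W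
      large-sieve h = ≤-trans (*-monoˡ 0≤Q−1 (∑-mono Cs λ d → *-monoˡ (0≤1-𝟙 (d ≟ᶠ 0#)) (cauchy-schwarz Ms h (Y d))))
        (≤-trans (≤-reflexive (trans (cong (Q−1 *_) (trans (∑-cong Cs λ d → solve 3 (λ a b c → a :* (b :* c) := b :* (a :* c)) refl (nz d) (∑[ y ∈ Ms ] h y * h y) _)
            (∑-*ˡ (∑[ y ∈ Ms ] h y * h y) Cs _))) (solve 3 (λ a b c → a :* (b :* c) := b :* (a :* c)) refl Q−1 _ Z)))
          (*-monoˡ (∑-nonneg Ms λ y → 0≤sq (h y)) Z≤W))

      module Pairs (B : List (Mat n)) (uniqB : Unique B) (inSL : All (λ b → Det b ≡ 1#) B) where

        ∣B∣ = pos (length B)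
        N = ∣B∣ * ∣C∣

        1B : Mat n → ℤ
        1B y = ∑[ b ∈ B ] 𝟙 (y ≟ᴹ b)

        0≤1B : ∀ y → 0ℤ ≤ 1B y
        0≤1B y = 0≤∑𝟙 B λ b → y ≟ᴹ b

        ∑-1B : ∀ (f : Mat n → ℤ) → ∑[ y ∈ Ms ] 1B y * f y ≡ ∑ B f
        ∑-1B f = trans (∑-cong Ms λ y → sym (∑-*ʳ (f y) B _)) (∑-swap₁ Ms B _ λ b → delta (finMat n n) b f)

        1B≤1 : ∀ y → 1B y ≤ 1ℤ
        1B≤1 y = ≤-trans (≤-reflexive (∑-cong B λ b → 𝟙-⇔ (y ≟ᴹ b) (b ≟ᴹ y) sym sym)) (count≤1 _≟ᴹ_ B y uniqB)

        1B≤SL : ∀ y → 1B y ≤ 𝟙 (Det y ≟ᶠ 1#)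
        1B≤SL y = go (Det y ≟ᶠ 1#)
          where
          go : Dec (Det y ≡ 1#) → 1B y ≤ 𝟙 (Det y ≟ᶠ 1#)
          go (yes e) = ≤-trans (1B≤1 y) (≤-reflexive (sym (𝟙-yes (Det y ≟ᶠ 1#) e)))
          go (no ne) = ≤-trans (≤-reflexive (trans (∑-cong∈ B λ {b} p → 𝟙-no (y ≟ᴹ b) λ e → ne (trans (cong Det e) (All.lookup inSL p))) (∑-zero B))) (𝟙-nonneg (Det y ≟ᶠ 1#))

        Nd : Carrier → ℤ
        Nd d = ∑[ b ∈ B ] ∑[ c ∈ C ] 𝟙 (Det (b ⊞ c) ≟ᶠ d)

        N* : ℤ
        N* = ∑[ b ∈ B ] ∑[ c ∈ C ] nz (Det (b ⊞ c))

        S₂ : ℤ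
        S₂ = ∑[ d ∈ Cs ] nz d * (Nd d * Nd d)

        ∑-Nd : ∑[ d ∈ Cs ] nz d * Nd d ≡ N*
        ∑-Nd = trans (∑-cong Cs λ d → trans (sym (∑-*ˡ (nz d) B _)) (∑-cong B λ b → sym (∑-*ˡ (nz d) C _)))
          (∑-swap₁ Cs B _ λ b → ∑-swap₁ Cs C _ λ c → trans (∑-cong Cs λ d → cong (nz d *_) (sym (*-identityʳ _)))
            (trans (∑-nz-𝟙 (Det (b ⊞ c)) λ _ → 1ℤ) (*-identityʳ _)))

        -- For the indicator of B the inner sums in the large sieve are (q - 1) `Nd d` - `N*`. Their
        -- squares over d ≠ 0 add up to a variance, since `N*` is the sum of the `Nd d`.
        second-moment : Q−1 * (Q−1 * Q−1 * S₂ - Q−1 * (N* * N*)) ≤ ∣B∣ * W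
        second-moment = ≤-trans (≤-reflexive (cong (Q−1 *_) (sym expand))) (≤-trans (large-sieve 1B)
            (*-monoʳ (0≤m*n 0≤P (0≤i+j (0≤m*n (0≤pos _) (0≤pos _)) (0≤m*n (0≤pos _) (0≤m*n 0≤Q (0≤m*n 0≤Q 0≤Q)))))
              (≤-trans (≤-reflexive (∑-1B 1B)) (≤-trans (∑-mono B 1B≤1) (≤-reflexive (∑-one B))))))
          where
          at : ∀ d → ∑[ y ∈ Ms ] 1B y * Y d y ≡ Q−1 * Nd d - N*
          at d = trans (∑-1B (Y d)) (trans (∑-cong B λ b → trans (∑-− C _ _) (cong (λ z → z - (∑[ c ∈ C ] nz (Det (b ⊞ c)))) (∑-*ˡ Q−1 C _)))
            (trans (∑-− B _ _) (cong (_- N*) (∑-*ˡ Q−1 B _))))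
          expand : ∑[ d ∈ Cs ] nz d * ((∑[ y ∈ Ms ] 1B y * Y d y) * (∑[ y ∈ Ms ] 1B y * Y d y)) ≡ Q−1 * Q−1 * S₂ - Q−1 * (N* * N*)
          expand = trans (∑-cong Cs λ d → trans (cong (λ z → nz d * (z * z)) (at d))
              (solve 4 (λ n q a b → n :* ((q :* a :- b) :* (q :* a :- b)) := (q :* q :* (n :* (a :* a)) :- con (pos 2) :* q :* b :* (n :* a)) :+ b :* b :* n)
                refl (nz d) Q−1 (Nd d) N*))
            (trans (∑-+ Cs _ _) (trans (cong₂ _+_ (trans (∑-− Cs _ _) (cong₂ _-_ (∑-*ˡ (Q−1 * Q−1) Cs _)
                (trans (∑-*ˡ (pos 2 * Q−1 * N*) Cs _) (cong (pos 2 * Q−1 * N* *_) ∑-Nd)))) (trans (∑-*ˡ (N* * N*) Cs nz) (cong (N* * N* *_) ∑-nz)))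
              (solve 3 (λ q s b → (q :* q :* s :- con (pos 2) :* q :* b :* b) :+ b :* b :* q := q :* q :* s :- q :* (b :* b)) refl Q−1 S₂ N*)))

        -- The number of representations y = b - c. Differences match the argument y + c of `Y`, and
        -- they have the same energy as sums.
        ρ : Mat n → ℤ
        ρ y = ∑[ c ∈ C ] 1B (y ⊞ c)

        E : ℤ
        E = ∑[ y ∈ Ms ] ρ y * ρ y

        0≤ρ : ∀ y → 0ℤ ≤ ρ y
        0≤ρ y = ∑-nonneg C λ c → 0≤1B (y ⊞ c)

        ∑-ρ : ∑ Ms ρ ≡ ∣C∣ * ∣B∣
        ∑-ρ = trans (∑-swap₁ Ms C _ λ c → trans (∑-translate c 1B) (trans (trans (∑-cong Ms λ y → sym (*-identityʳ _)) (∑-1B λ _ → 1ℤ)) (∑-one B))) (∑-const C _)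

        S : ℤ
        S = ∑[ y ∈ Ms ] ρ y * Y 1# y

        -- In one of the two factors ρ, membership in B is weakened to determinant 1. This brings in
        -- `dev 1#`, at the price of the average term.
        E≤ : Q−1 * E ≤ S + ∣C∣ * N
        E≤ = ≤-trans (≤-reflexive (sym (∑-*ˡ Q−1 Ms _))) (≤-trans (∑-mono Ms per-y)
            (≤-reflexive (trans (∑-+ Ms _ _) (cong (S +_) (trans (∑-*ʳ ∣C∣ Ms ρ) (trans (cong (_* ∣C∣) ∑-ρ)
              (solve 2 (λ c b → c :* b :* c := c :* (b :* c)) refl ∣C∣ ∣B∣)))))))
          where
          per-c : ∀ y c → Q−1 * 1B (y ⊞ c) ≤ dev 1# (Det (y ⊞ c)) + 1ℤ
          per-c y c = ≤-trans (*-monoˡ 0≤Q−1 (1B≤SL (y ⊞ c))) (from-diff {k = 1ℤ - nz (Det (y ⊞ c))}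
            (solve 2 (λ a b → a :- b :+ con 1ℤ :- a := con 1ℤ :- b) refl (Q−1 * 𝟙 (Det (y ⊞ c) ≟ᶠ 1#)) (nz (Det (y ⊞ c))))
            (to-diff (1-𝟙≤1 (Det (y ⊞ c) ≟ᶠ 0#))))
          per-y : ∀ y → Q−1 * (ρ y * ρ y) ≤ ρ y * Y 1# y + ρ y * ∣C∣
          per-y y = ≤-trans (≤-reflexive (trans (solve 2 (λ q r → q :* (r :* r) := r :* (q :* r)) refl Q−1 (ρ y)) (cong (ρ y *_) (sym (∑-*ˡ Q−1 C _)))))
            (≤-trans (*-monoˡ (0≤ρ y) (∑-mono C (per-c y))) (≤-reflexive (trans (cong (ρ y *_) (trans (∑-+ C _ _) (cong (Y 1# y +_) (∑-one C)))) (distribˡ (ρ y) (Y 1# y) ∣C∣))))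

        S²≤ : Q−1 * (S * S) ≤ E * W
        S²≤ = ≤-trans (*-monoˡ 0≤Q−1 (≤-trans (≤-reflexive (sym (trans (cong (_* (S * S)) (1-𝟙-no (1# ≟ᶠ 0#) λ e → 0≢1 (sym e))) (*-identityˡ _))))
            (term≤∑ Cs {λ d → nz d * ((∑[ y ∈ Ms ] ρ y * Y d y) * (∑[ y ∈ Ms ] ρ y * Y d y))} {1#}
              (λ d → 0≤m*n (0≤1-𝟙 (d ≟ᶠ 0#)) (0≤sq _)) (FiniteField.elements-complete F 1#))))
          (large-sieve ρ)

        0≤W : 0ℤ ≤ W
        0≤W = 0≤m*n 0≤P (0≤i+j (0≤m*n (0≤pos _) (0≤pos _)) (0≤m*n (0≤pos _) (0≤m*n 0≤Q (0≤m*n 0≤Q 0≤Q))))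

        0≤E : 0ℤ ≤ E
        0≤E = ∑-nonneg Ms λ y → 0≤sq (ρ y)

        -- If s ≤ a, then q e ≤ 2 a and the first term suffices. Otherwise q e ≤ 2 s; squaring and
        -- using the second inequality gives q³ e² ≤ 4 e w, from which e is cancelled.
        quadratic : ∀ {q e s a w} → 0ℤ ≤ q → 0ℤ ≤ e → 0ℤ ≤ a → 0ℤ ≤ w → q * e ≤ s + a → q * (s * s) ≤ e * w →
          q * (q * (q * e)) ≤ pos 2 * (q * (q * a)) + pos 4 * w
        quadratic {q} {e} {s} {a} {w} 0≤q 0≤e 0≤a 0≤w h₁ h₂ with ≤-total s a
        ... | inj₁ s≤a = ≤-trans (*-monoˡ 0≤q (*-monoˡ 0≤q (≤-trans h₁ (+-mono-≤ s≤a ≤-refl))))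
          (from-diff {k = pos 4 * w} (solve 3 (λ q a w → con (pos 2) :* (q :* (q :* a)) :+ con (pos 4) :* w :- q :* (q :* (a :+ a)) := con (pos 4) :* w) refl q a w)
            (0≤m*n (0≤pos 4) 0≤w))
        ... | inj₂ a≤s = ≤-trans (by-e e refl)
            (≤-trans (≤-reflexive (sym (+-identityˡ _))) (+-mono-≤ (0≤m*n (0≤pos 2) (0≤m*n 0≤q (0≤m*n 0≤q 0≤a))) ≤-refl))
          where
          0≤s : 0ℤ ≤ s
          0≤s = ≤-trans 0≤a a≤s
          qe≤2s : q * e ≤ s + s
          qe≤2s = ≤-trans h₁ (+-mono-≤ ≤-refl a≤s)
          big : e * (q * (q * (q * e))) ≤ e * (pos 4 * w)
          big = ≤-trans (≤-reflexive (solve 2 (λ q e → e :* (q :* (q :* (q :* e))) := q :* ((q :* e) :* (q :* e))) refl q e))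
            (≤-trans (*-monoˡ 0≤q (*-mono (0≤m*n 0≤q 0≤e) (0≤i+j 0≤s 0≤s) qe≤2s qe≤2s))
            (≤-trans (≤-reflexive (solve 2 (λ q s → q :* ((s :+ s) :* (s :+ s)) := con (pos 4) :* (q :* (s :* s))) refl q s))
            (≤-trans (*-monoˡ (0≤pos 4) h₂) (≤-reflexive (solve 2 (λ e w → con (pos 4) :* (e :* w) := e :* (con (pos 4) :* w)) refl e w)))))
          by-e : ∀ e′ → e ≡ e′ → q * (q * (q * e)) ≤ pos 4 * w
          by-e (pos zero) refl = ≤-trans (≤-reflexive (solve 1 (λ q → q :* (q :* (q :* con 0ℤ)) := con 0ℤ) refl q)) (0≤m*n (0≤pos 4) 0≤w)
          by-e (pos (suc k)) refl = *-cancelˡ (+<+ (ℕ.s≤s ℕ.z≤n)) big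
          by-e (negative k) refl = contradiction 0≤e (negative-absurd k)

        energy : Q−1 * (Q−1 * (Q−1 * E)) ≤ pos 2 * (Q−1 * (Q−1 * (∣C∣ * N))) + pos 4 * W
        energy = quadratic {s = S} 0≤Q−1 0≤E (0≤m*n (0≤pos _) (0≤m*n (0≤pos _) (0≤pos _))) 0≤W E≤ S²≤

-- The size of SL_n and the scarcity of singular sums

module Sizes where
  open Integers
  open Sums
  open Counting
  open Correlations
  open SumEnergy
  open import Data.Vec.Base using (Vec; []; _∷_; zipWith; head; tail)

  open Finite

  module Cardinalities {q : ℕ} (F : FiniteField q) (2≤q : pos 2 ≤ pos q) where

    open SumSets F 2≤q public

    ∣dets∣ : ℕ → Carrier → ℤ
    ∣dets∣ n d = pos (length (dets n d))

    dets-sum : ∀ n d → ∣dets∣ n d ≡ ∑[ x ∈ mats n n ] 𝟙 (Det x ≟ᶠ d)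
    dets-sum n d = trans (sym (∑-one (dets n d))) (trans (∑-dets n d _) (∑-cong (mats n n) λ x → *-identityʳ _))

    functional-fibre : ∀ {n} (ξ : Row n) d → d ≢ 0# → Q * (∑[ r ∈ rows n ] 𝟙 (dot r ξ ≟ᶠ d)) ≡ Q ^′ n * nzᵛ ξ
    functional-fibre {n} ξ d d≢0 = go (ξ ≟ᵛ 0ᵛ)
      where
      go : Dec (ξ ≡ 0ᵛ) → Q * (∑[ r ∈ rows n ] 𝟙 (dot r ξ ≟ᶠ d)) ≡ Q ^′ n * nzᵛ ξ
      go (yes e) = trans (trans (cong (Q *_) (∑-zero′ (rows n) λ r → 𝟙-no (dot r ξ ≟ᶠ d) λ h → d≢0
          (trans (sym h) (trans (cong (dot r) e) (dot-0ʳ r))))) (zeroʳ Q))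
        (sym (trans (cong (Q ^′ n *_) (1-𝟙-yes (ξ ≟ᵛ 0ᵛ) e)) (zeroʳ _)))
      go (no ne) = averaged (nonzero-dot ξ ne 1#)
        where
        averaged : (Σ (Row n) λ z → dot z ξ ≡ 1#) → _
        averaged (z , zξ) = trans (line-average z _) (trans (∑-cong (rows n) λ r → trans
            (∑-cong Cs λ c → cong (λ t → 𝟙 (t ≟ᶠ d)) (trans (dot-line r z ξ c) (trans (cong (λ t → dot r ξ +ᶠ c *ᶠ t) zξ)
              (cong (dot r ξ +ᶠ_) (R.*-identityʳ c)))))
            (trans (∑-shift (dot r ξ) λ t → 𝟙 (t ≟ᶠ d)) (once finC d)))
          (trans (∑-one (rows n)) (trans (length-rows n) (sym (trans (cong (Q ^′ n *_) (1-𝟙-no (ξ ≟ᵛ 0ᵛ) ne)) (*-identityʳ _))))))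

    -- Once the lower rows are fixed, the determinant is a linear form in the first row. Unless it
    -- is zero, all its fibres have q^m elements, so the count is the same for every nonzero d.
    dets-size : ∀ m d → d ≢ 0# → Q * ∣dets∣ (suc m) d ≡ Q ^′ suc m * (∑[ x ∈ mats m (suc m) ] nzᵛ (cof x))
    dets-size m d d≢0 = trans (cong (Q *_) (trans (dets-sum (suc m) d) (trans (∑-rows m (suc m) _) (∑-swap (rows (suc m)) (mats m (suc m)) _))))
      (trans (sym (∑-*ˡ Q (mats m (suc m)) _)) (trans (∑-cong (mats m (suc m)) λ x → trans
          (cong (Q *_) (∑-cong (rows (suc m)) λ r → cong (λ t → 𝟙 (t ≟ᶠ d)) (sym (dot-cof x r)))) (functional-fibre (cof x) d d≢0))
        (∑-*ˡ (Q ^′ suc m) (mats m (suc m)) _)))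

    1≢0 : 1# ≢ 0#
    1≢0 e = 0≢1 (sym e)

    dets-equal : ∀ m d → d ≢ 0# → ∣dets∣ (suc m) d ≡ ∣dets∣ (suc m) 1#
    dets-equal m d d≢0 = *-cancelˡ-≡ 0<Q (trans (dets-size m d d≢0) (sym (dets-size m 1# 1≢0)))

    dets-upper : ∀ m → Q * ∣dets∣ (suc m) 1# ≤ (Q ^′ suc m) ^′ suc m
    dets-upper m = ≤-trans (≤-reflexive (dets-size m 1# 1≢0)) (*-monoˡ (0≤^ (suc m) 0≤Q)
      (≤-trans (∑-mono (mats m (suc m)) λ x → 1-𝟙≤1 (cof x ≟ᵛ 0ᵛ)) (≤-reflexive (trans (∑-one (mats m (suc m))) (length-mats m (suc m))))))

    -- The cofactor vector of the lower rows is nonzero as soon as the square block behind their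
    -- first column is invertible; that block has (q - 1) |SL_(m+1)| choices and the column is free.
    dets-recursion : ∀ m → Q ^′ suc (suc m) * (Q ^′ suc m * (Q−1 * ∣dets∣ (suc m) 1#)) ≤ Q * ∣dets∣ (suc (suc m)) 1#
    dets-recursion m = ≤-trans (*-monoˡ (0≤^ (suc (suc m)) 0≤Q) (at (suc m) (dets-equal m))) (≤-reflexive (sym (dets-size (suc m) 1# 1≢0)))
      where
      at : ∀ k → (∀ d → d ≢ 0# → ∣dets∣ k d ≡ ∣dets∣ k 1#) → Q ^′ k * (Q−1 * ∣dets∣ k 1#) ≤ ∑[ x ∈ mats k (suc k) ] nzᵛ (cof x)
      at k eq = ≤-trans (≤-reflexive (trans (cong (_* (Q−1 * ∣dets∣ k 1#)) (sym (length-rows k))) (trans (sym (∑-const (rows k) _))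
          (∑-cong (rows k) λ _ → sym total))))
        (≤-trans (∑-mono (rows k) λ c → ∑-mono (mats k k) λ Y → below c Y) (≤-reflexive (sym (∑-columns k k _))))
        where
        total : ∑[ Y ∈ mats k k ] nz (Det Y) ≡ Q−1 * ∣dets∣ k 1#
        total = trans (∑-cong (mats k k) λ Y → sym (trans (∑-nz-𝟙 (Det Y) λ _ → 1ℤ) (*-identityʳ _)))
          (trans (∑-swap₁ (mats k k) Cs _ λ d → trans (∑-*ˡ (nz d) (mats k k) _) (trans
              (cong (nz d *_) (trans (∑-cong (mats k k) λ Y → *-identityʳ _) (sym (dets-sum k d)))) (same d (d ≟ᶠ 0#))))
            (trans (∑-*ʳ (∣dets∣ k 1#) Cs nz) (cong (_* ∣dets∣ k 1#) ∑-nz)))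
          where
          same : ∀ d → Dec (d ≡ 0#) → nz d * ∣dets∣ k d ≡ nz d * ∣dets∣ k 1#
          same d (yes e) = trans (trans (cong (_* ∣dets∣ k d) (1-𝟙-yes (d ≟ᶠ 0#) e)) (zeroˡ _))
            (sym (trans (cong (_* ∣dets∣ k 1#) (1-𝟙-yes (d ≟ᶠ 0#) e)) (zeroˡ _)))
          same d (no ne) = cong (nz d *_) (eq d ne)
        below : ∀ c (Y : Mat k) → nz (Det Y) ≤ nzᵛ (cof (zipWith _∷_ c Y))
        below c Y = +-mono-≤ (≤-refl {1ℤ}) (neg-mono-≤ (𝟙-mono (cof (zipWith _∷_ c Y) ≟ᵛ 0ᵛ) (Det Y ≟ᶠ 0#) λ e →
          trans (sym (trans (dot-cof (zipWith _∷_ c Y) e₀) (det-blk c Y))) (trans (cong (dot e₀) e) (dot-0ʳ (e₀ {k})))))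

    Q≤2Q−1 : Q ≤ pos 2 * Q−1
    Q≤2Q−1 = from-diff {k = Q - pos 2} (solve 1 (λ q → con (pos 2) :* (q :- con 1ℤ) :- q := q :- con (pos 2)) refl Q) (to-diff 2≤q)

    -- Each step of the recursion loses the factor q/(q - 1), here bounded crudely by 2.
    dets-lower : ∀ m → (Q ^′ suc m) ^′ suc m ≤ pos 2 ^′ m * (Q * ∣dets∣ (suc m) 1#)
    dets-lower zero = ≤-trans (≤-reflexive (solve 1 (λ q → q :* con 1ℤ :* con 1ℤ := con 1ℤ :* (q :* con 1ℤ)) refl Q))
      (*-monoˡ 0≤1 (*-monoˡ 0≤Q one))
      where
      one : 1ℤ ≤ ∣dets∣ 1 1#
      one = ≤-trans (≤-reflexive (sym (*-identityʳ 1ℤ))) (≤-trans (≤-reflexive (trans (*-identityʳ 1ℤ) (sym (𝟙-yes (Det (Id 1) ≟ᶠ 1#) (det-Id 1)))))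
        (≤-trans (term≤∑ (mats 1 1) {λ x → 𝟙 (Det x ≟ᶠ 1#)} (λ x → 𝟙-nonneg (Det x ≟ᶠ 1#))
          (occurs (_≟_ (finMat 1 1)) (mats 1 1) (once (finMat 1 1) (Id 1)))) (≤-reflexive (sym (dets-sum 1 1#)))))
    dets-lower (suc m) = ≤-trans (≤-reflexive (trans (cong (Q ^′ suc (suc m) *_) (^-distrib Q (Q ^′ suc m) (suc m))) refl))
      (≤-trans (*-monoˡ 0≤QQ (*-monoˡ 0≤Qm (dets-lower m)))
      (≤-trans (≤-reflexive (solve 5 (λ a b t q x → a :* (b :* (t :* (q :* x))) := a :* (b :* (q :* (t :* x)))) refl
          (Q ^′ suc (suc m)) (Q ^′ suc m) T Q (∣dets∣ (suc m) 1#)))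
      (≤-trans (*-monoˡ 0≤QQ (*-monoˡ 0≤Qm (*-monoʳ (0≤m*n 0≤T (0≤pos _)) Q≤2Q−1)))
      (≤-trans (≤-reflexive (solve 5 (λ a b t q x → a :* (b :* (con (pos 2) :* q :* (t :* x))) := con (pos 2) :* t :* (a :* (b :* (q :* x)))) refl
          (Q ^′ suc (suc m)) (Q ^′ suc m) T Q−1 (∣dets∣ (suc m) 1#)))
      (*-monoˡ (0≤m*n (0≤pos 2) 0≤T) (dets-recursion m))))))
      where
      T = pos 2 ^′ m
      0≤T : 0ℤ ≤ T
      0≤T = 0≤^ m (0≤pos 2)
      0≤QQ = 0≤^ (suc (suc m)) 0≤Q
      0≤Qm = 0≤^ (suc m) 0≤Q

    module Singular (n : ℕ) (1<V : 0ℤ < Q ^′ n - 1ℤ)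
      (hit-bound : ∀ (w : Row n) → w ≢ 0ᵛ → ∀ u → (Q ^′ n - 1ℤ) * (∑[ h ∈ dets n 1# ] 𝟙 (u ≟ᵛ mv h w)) ≤ ∣dets∣ n 1#) where

      X₁ = dets n 1#

      ∑-nzᵛ : ∑ (rows n) nzᵛ ≡ Q ^′ n - 1ℤ
      ∑-nzᵛ = trans (∑-− (rows n) _ _) (cong₂ _-_ (trans (∑-one (rows n)) (length-rows n)) (once (finRow n) 0ᵛ))

      kernel-weight : ∀ (y : Mat n) → Q−1 * 𝟙 (Det y ≟ᶠ 0#) ≤ ∑[ w ∈ rows n ] nzᵛ w * 𝟙 (mv y w ≟ᵛ 0ᵛ)
      kernel-weight y = go (Det y ≟ᶠ 0#)
        where
        0≤term : ∀ w → 0ℤ ≤ nzᵛ w * 𝟙 (mv y w ≟ᵛ 0ᵛ)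
        0≤term w = 0≤m*n (0≤1-𝟙 (w ≟ᵛ 0ᵛ)) (𝟙-nonneg (mv y w ≟ᵛ 0ᵛ))
        go : Dec (Det y ≡ 0#) → _
        go (no ne) = ≤-trans (≤-reflexive (trans (cong (Q−1 *_) (𝟙-no (Det y ≟ᶠ 0#) ne)) (zeroʳ Q−1))) (∑-nonneg (rows n) 0≤term)
        go (yes e) = ≤-trans (≤-reflexive (trans (cong (Q−1 *_) (𝟙-yes (Det y ≟ᶠ 0#) e)) (*-identityʳ Q−1))) (multiples (kernel-vector y e))
          where
          multiples : (Σ (Row n) λ w → w ≢ 0ᵛ × mv y w ≡ 0ᵛ) → Q−1 ≤ ∑[ w ∈ rows n ] nzᵛ w * 𝟙 (mv y w ≟ᵛ 0ᵛ)
          multiples (w₀ , w₀≢0 , yw₀) = ≤-trans (≤-reflexive (sym along)) (∑-mono (rows n) λ w → by-line w)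
            where
            along : ∑[ w ∈ rows n ] ∑[ c ∈ Cs ] nz c * 𝟙 (w ≟ᵛ c ⊙ w₀) ≡ Q−1
            along = trans (∑-swap₁ (rows n) Cs _ λ c → trans (∑-*ˡ (nz c) (rows n) _) (trans (cong (nz c *_) (once (finRow n) (c ⊙ w₀))) (*-identityʳ _))) ∑-nz
            mv-⊙0 : ∀ {k} (M : Vec (Row n) k) c → mv M w₀ ≡ 0ᵛ → mv M (c ⊙ w₀) ≡ 0ᵛ
            mv-⊙0 []      c h = refl
            mv-⊙0 (r ∷ M) c h = cong₂ _∷_ (trans (dot-⊙ʳ c r w₀) (trans (cong (c *ᶠ_) (cong head h)) (R.zeroʳ c))) (mv-⊙0 M c (cong tail h))
            by-line : ∀ w → ∑[ c ∈ Cs ] nz c * 𝟙 (w ≟ᵛ c ⊙ w₀) ≤ nzᵛ w * 𝟙 (mv y w ≟ᵛ 0ᵛ)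
            by-line w = side (w ≟ᵛ 0ᵛ) (mv y w ≟ᵛ 0ᵛ)
              where
              vanish : (∀ c → c ≢ 0# → w ≢ c ⊙ w₀) → ∑[ c ∈ Cs ] nz c * 𝟙 (w ≟ᵛ c ⊙ w₀) ≤ nzᵛ w * 𝟙 (mv y w ≟ᵛ 0ᵛ)
              vanish h = ≤-trans (≤-reflexive (∑-zero′ Cs λ c → vanish-at c (c ≟ᶠ 0#))) (0≤term w)
                where
                vanish-at : ∀ c → Dec (c ≡ 0#) → nz c * 𝟙 (w ≟ᵛ c ⊙ w₀) ≡ 0ℤ
                vanish-at c (yes c≡0) = trans (cong (_* 𝟙 (w ≟ᵛ c ⊙ w₀)) (1-𝟙-yes (c ≟ᶠ 0#) c≡0)) (zeroˡ _)
                vanish-at c (no c≢0)  = trans (cong (nz c *_) (𝟙-no (w ≟ᵛ c ⊙ w₀) (h c c≢0))) (zeroʳ _)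
              side : Dec (w ≡ 0ᵛ) → Dec (mv y w ≡ 0ᵛ) → _
              side (yes w≡0) _ = vanish λ c c≢0 h → ⊙-≢0 c w₀ c≢0 w₀≢0 (trans (sym h) w≡0)
              side (no _) (no yw) = vanish λ c _ h → yw (trans (cong (mv y) h) (mv-⊙0 y c yw₀))
              side (no w≢0) (yes yw) = ≤-trans (∑-mono Cs λ c → ≤-trans (*-monoʳ (𝟙-nonneg (w ≟ᵛ c ⊙ w₀)) (1-𝟙≤1 (c ≟ᶠ 0#)))
                  (≤-reflexive (*-identityˡ _)))
                (≤-trans (unique-multiple w) (≤-reflexive (sym (trans (cong₂ _*_ (1-𝟙-no (w ≟ᵛ 0ᵛ) w≢0) (𝟙-yes (mv y w ≟ᵛ 0ᵛ) yw)) (*-identityˡ 1ℤ)))))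
                where
                unique-multiple : ∀ w → ∑[ c ∈ Cs ] 𝟙 (w ≟ᵛ c ⊙ w₀) ≤ 1ℤ
                unique-multiple w = project (nonzero-dot w₀ w₀≢0 1#)
                  where
                  project : (Σ (Row n) λ z → dot z w₀ ≡ 1#) → ∑[ c ∈ Cs ] 𝟙 (w ≟ᵛ c ⊙ w₀) ≤ 1ℤ
                  project (z , zw) = ≤-trans (∑-mono Cs λ c → 𝟙-mono (w ≟ᵛ c ⊙ w₀) (c ≟ᶠ dot z w) λ h →
                    sym (trans (cong (dot z) h) (trans (dot-⊙ʳ c z w₀) (trans (cong (c *ᶠ_) zw) (R.*-identityʳ c))))) (≤-reflexive (once finC (dot z w)))

      -- A singular b + c has at least q - 1 kernel vectors w, each prescribing b w.
      singular-count : ∀ (c : Mat n) → Q−1 * (∑[ b ∈ X₁ ] 𝟙 (Det (b ⊞ c) ≟ᶠ 0#)) ≤ ∣dets∣ n 1#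
      singular-count c = *-cancelˡ 1<V (≤-trans (*-monoˡ (<⇒≤ 1<V) (≤-trans (≤-reflexive (sym (∑-*ˡ Q−1 X₁ _)))
          (≤-trans (∑-mono X₁ λ b → kernel-weight (b ⊞ c)) (≤-reflexive (∑-swap₁ X₁ (rows n) _ λ w → ∑-*ˡ (nzᵛ w) X₁ _)))))
        (≤-trans (≤-reflexive (trans (sym (∑-*ˡ (Q ^′ n - 1ℤ) (rows n) _)) (∑-cong (rows n) λ w →
            solve 3 (λ a b c → a :* (b :* c) := b :* (a :* c)) refl (Q ^′ n - 1ℤ) (nzᵛ w) _)))
        (≤-trans (∑-mono (rows n) λ w → per-w w (w ≟ᵛ 0ᵛ))
        (≤-reflexive (trans (∑-*ʳ (∣dets∣ n 1#) (rows n) nzᵛ) (cong (_* ∣dets∣ n 1#) ∑-nzᵛ))))))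
        where
        prescribed : ∀ w b → mv (b ⊞ c) w ≡ 0ᵛ → ⊖ mv c w ≡ mv b w
        prescribed w b e = trans (sym (⊕-identityˡ _)) (trans (cong (_⊕ ⊖ mv c w) (trans (sym e) (mv-⊞ b c w)))
          (trans (⊕-assoc (mv b w) (mv c w) _) (trans (cong (mv b w ⊕_) (⊕-inverseʳ (mv c w))) (⊕-identityʳ _))))
        per-w : ∀ w → Dec (w ≡ 0ᵛ) → nzᵛ w * ((Q ^′ n - 1ℤ) * (∑[ b ∈ X₁ ] 𝟙 (mv (b ⊞ c) w ≟ᵛ 0ᵛ))) ≤ nzᵛ w * ∣dets∣ n 1#
        per-w w (yes e) = ≤-reflexive (trans (trans (cong (_* ((Q ^′ n - 1ℤ) * (∑[ b ∈ X₁ ] 𝟙 (mv (b ⊞ c) w ≟ᵛ 0ᵛ)))) (1-𝟙-yes (w ≟ᵛ 0ᵛ) e)) (zeroˡ _)) (sym (trans (cong (_* ∣dets∣ n 1#) (1-𝟙-yes (w ≟ᵛ 0ᵛ) e)) (zeroˡ _))))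
        per-w w (no ne) = *-monoˡ (0≤1-𝟙 (w ≟ᵛ 0ᵛ)) (≤-trans (*-monoˡ (<⇒≤ 1<V) (∑-mono X₁ λ b →
          𝟙-mono (mv (b ⊞ c) w ≟ᵛ 0ᵛ) (⊖ mv c w ≟ᵛ mv b w) (prescribed w b))) (hit-bound w ne (⊖ mv c w)))

-- Combining the estimates

module Numerics where
  open Integers
  open Sums
  open MixingSL

  three-way : ∀ {X T t₁ t₂ t₃} → 0ℤ ≤ T → X ≤ pos 4 * (T * (t₁ + t₂ + t₃)) →
    (X ≤ pos 12 * (T * t₁)) ⊎ (X ≤ pos 12 * (T * t₂)) ⊎ (X ≤ pos 12 * (T * t₃))
  three-way {X} {T} {t₁} {t₂} {t₃} 0≤T h = pick (≤-total t₁ t₂) (≤-total t₁ t₃) (≤-total t₂ t₃)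
    where
    below : ∀ t → t₁ ≤ t → t₂ ≤ t → t₃ ≤ t → X ≤ pos 12 * (T * t)
    below t p q r = ≤-trans h (≤-trans (*-monoˡ (0≤pos 4) (*-monoˡ 0≤T (+-mono-≤ (+-mono-≤ p q) r)))
      (≤-reflexive (solve 2 (λ T t → con (pos 4) :* (T :* (t :+ t :+ t)) := con (pos 12) :* (T :* t)) refl T t)))
    pick : _ → _ → _ → _
    pick (inj₁ p) _        (inj₁ r) = inj₂ (inj₂ (below t₃ (≤-trans p r) r ≤-refl))
    pick (inj₁ p) _        (inj₂ r) = inj₂ (inj₁ (below t₂ p ≤-refl r))
    pick (inj₂ p) (inj₁ q) _        = inj₂ (inj₂ (below t₃ q (≤-trans p q) ≤-refl))
    pick (inj₂ p) (inj₂ q) _        = inj₁ (below t₁ ≤-refl p q)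

  square-mono : ∀ {i j} → 0ℤ ≤ i → i ≤ j → i * i ≤ j * j
  square-mono 0≤i p = *-mono 0≤i (≤-trans 0≤i p) p p

  -- Dictionary: P = q^(n²), x = |SL_n|, v = q^(n-1), L = 2^(n-1); a, b, c and T are the sizes of A,
  -- B, C and the image; `M′` is Σ_t (Σ_{a ∈ A} r(a⁻¹t))² over nonsingular t; `N*` and `N₀` count
  -- the pairs with nonsingular and singular sum.
  module Inequalities
    {Q q₁ P b c N₀ N* x S₂ E a T M′ v L : ℤ}
    (0<Q : 0ℤ < Q) (q₁-def : q₁ ≡ Q - 1ℤ) (1≤q₁ : 1ℤ ≤ q₁) (Q≤2q₁ : Q ≤ pos 2 * q₁)
    (0<P : 0ℤ < P) (0<b : 0ℤ < b) (0<c : 0ℤ < c) (0≤N₀ : 0ℤ ≤ N₀) (0≤N* : 0ℤ ≤ N*) (0<x : 0ℤ < x)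
    (0≤S₂ : 0ℤ ≤ S₂) (0≤E : 0ℤ ≤ E) (0<a : 0ℤ < a) (0≤T : 0ℤ ≤ T) (0<v : 0ℤ < v) (0≤L : 0ℤ ≤ L)
    (B-large : pos 4 * P ≤ b * (Q * Q)) (C-large : Q * (Q * Q) ≤ c)
    (x-upper : Q * x ≤ P) (x-lower : P ≤ L * (Q * x))
    (total : N* + N₀ ≡ b * c) (singular : q₁ * N₀ ≤ c * x)
    (moment : q₁ * (q₁ * q₁ * S₂ - q₁ * (N* * N*)) ≤ b * (P * (c * c + c * (Q * (Q * Q)))))
    (energy : q₁ * (q₁ * (q₁ * E)) ≤ pos 2 * (q₁ * (q₁ * (c * (b * c)))) + pos 4 * (P * (c * c + c * (Q * (Q * Q)))))
    (mixing : v * x * M′ ≤ x * x * a * E + v * (a * a) * S₂)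
    (incidences : (a * N*) * (a * N*) ≤ T * M′)
    where

    N : ℤ
    N = b * c

    0≤Q : 0ℤ ≤ Q
    0≤Q = <⇒≤ 0<Q
    0<q₁ : 0ℤ < q₁
    0<q₁ = 1≤⇒0< 1≤q₁
    0≤q₁ : 0ℤ ≤ q₁
    0≤q₁ = <⇒≤ 0<q₁
    0≤b : 0ℤ ≤ b
    0≤b = <⇒≤ 0<b
    0≤c : 0ℤ ≤ c
    0≤c = <⇒≤ 0<c
    0≤P : 0ℤ ≤ P
    0≤P = <⇒≤ 0<P
    0<N : 0ℤ < N
    0<N = 0<m*n 0<b 0<c
    0≤N : 0ℤ ≤ N
    0≤N = <⇒≤ 0<N
    0≤x : 0ℤ ≤ x
    0≤x = <⇒≤ 0<x
    0≤a : 0ℤ ≤ a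
    0≤a = <⇒≤ 0<a
    0≤v : 0ℤ ≤ v
    0≤v = <⇒≤ 0<v

    q₁≤Q : q₁ ≤ Q
    q₁≤Q = from-diff {k = 1ℤ} (trans (cong (λ z → Q - z) q₁-def) (solve 1 (λ q → q :- (q :- con 1ℤ) := con 1ℤ) refl Q)) 0≤1

    -- The factor 4 in `B-large` is spent here: 4 q (q - 1) N₀ ≤ 4 c q x ≤ 4 c P ≤ q² N ≤ 2 q (q -
    -- 1) N, so at most half of the pairs have a singular sum.
    N≤2N* : N ≤ pos 2 * N*
    N≤2N* = from-diff {k = N - pos 2 * N₀} (trans (cong (λ z → pos 2 * N* - z) (sym total))
        (trans (solve 2 (λ s z → con (pos 2) :* s :- (s :+ z) := (s :+ z) :- con (pos 2) :* z) refl N* N₀) (cong (_- pos 2 * N₀) total)))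
      (to-diff (*-cancelˡ {pos 2} 0<2 (≤-trans (≤-reflexive (solve 1 (λ z → con (pos 2) :* (con (pos 2) :* z) := con (pos 4) :* z) refl N₀)) four)))
      where
      four : pos 4 * N₀ ≤ pos 2 * N
      four = *-cancelˡ 0<q₁ (*-cancelˡ 0<Q (≤-trans (≤-reflexive (solve 3 (λ q p z → q :* (p :* (con (pos 4) :* z)) := con (pos 4) :* (q :* (p :* z))) refl Q q₁ N₀))
        (≤-trans (*-monoˡ (0≤pos 4) (*-monoˡ 0≤Q singular))
        (≤-trans (≤-reflexive (solve 3 (λ q c x → con (pos 4) :* (q :* (c :* x)) := con (pos 4) :* c :* (q :* x)) refl Q c x))
        (≤-trans (*-monoˡ (0≤m*n (0≤pos 4) 0≤c) x-upper)
        (≤-trans (≤-reflexive (solve 2 (λ c p → con (pos 4) :* c :* p := c :* (con (pos 4) :* p)) refl c P))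
        (≤-trans (*-monoˡ 0≤c B-large)
        (≤-trans (≤-reflexive (solve 3 (λ c b q → c :* (b :* (q :* q)) := q :* ((b :* c) :* q)) refl c b Q))
        (≤-trans (*-monoˡ 0≤Q (*-monoˡ 0≤N Q≤2q₁))
        (≤-reflexive (solve 3 (λ q n p → q :* (n :* (con (pos 2) :* p)) := q :* (p :* (con (pos 2) :* n))) refl Q N q₁)))))))))))

    N*≤N : N* ≤ N
    N*≤N = from-diff {k = N₀} (trans (cong (_- N*) (sym total)) (solve 2 (λ s z → s :+ z :- s := z) refl N* N₀)) 0≤N₀

    P≤bQQ : P ≤ b * (Q * Q)
    P≤bQQ = ≤-trans (from-diff {k = pos 3 * P} (solve 1 (λ p → con (pos 4) :* p :- p := con (pos 3) :* p) refl P) (0≤m*n (0≤pos 3) 0≤P)) B-large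

    Q³ : ℤ
    Q³ = Q * (Q * Q)

    0≤Q³ : 0ℤ ≤ Q³
    0≤Q³ = 0≤m*n 0≤Q (0≤m*n 0≤Q 0≤Q)

    Q³≤8q₁³ : Q³ ≤ pos 8 * (q₁ * (q₁ * q₁))
    Q³≤8q₁³ = ≤-trans (*-mono 0≤Q (0≤m*n (0≤m*n (0≤pos 2) 0≤q₁) (0≤m*n (0≤pos 2) 0≤q₁)) Q≤2q₁ (*-mono 0≤Q (0≤m*n (0≤pos 2) 0≤q₁) Q≤2q₁ Q≤2q₁))
      (≤-reflexive (solve 1 (λ q → con (pos 2) :* q :* (con (pos 2) :* q :* (con (pos 2) :* q)) := con (pos 8) :* (q :* (q :* q))) refl q₁))

    -- 24 = 8 · 3: the 8 replaces (q - 1)³ by q³, and 3 = 2 + 1 collects the variance and the main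
    -- term. The size of C makes c q³ at most c².
    QS₂ : Q * S₂ ≤ pos 24 * (N * N)
    QS₂ = *-cancelˡ 0<Q (*-cancelˡ 0<Q (≤-trans (≤-reflexive (solve 2 (λ q s → q :* (q :* (q :* s)) := q :* (q :* q) :* s) refl Q S₂))
        (≤-trans (*-monoʳ 0≤S₂ Q³≤8q₁³) (≤-trans (≤-reflexive (solve 2 (λ q s → con (pos 8) :* (q :* (q :* q)) :* s := con (pos 8) :* (q :* (q :* (q :* s)))) refl q₁ S₂))
        (≤-trans (*-monoˡ (0≤pos 8) cubic) (≤-reflexive (solve 2 (λ q n → con (pos 8) :* (con (pos 3) :* (q :* q :* (n :* n))) := q :* (q :* (con (pos 24) :* (n :* n)))) refl Q N)))))))
      where
      bW : b * (P * (c * c + c * Q³)) ≤ pos 2 * (Q * Q * (N * N))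
      bW = ≤-trans (*-monoˡ 0≤b (*-mono 0≤P (0≤i+j (0≤m*n 0≤c 0≤c) (0≤m*n 0≤c 0≤c)) P≤bQQ (+-mono-≤ ≤-refl (*-monoˡ 0≤c C-large))))
        (≤-reflexive (solve 3 (λ b q c → b :* (b :* (q :* q) :* (c :* c :+ c :* c)) := con (pos 2) :* (q :* q :* ((b :* c) :* (b :* c)))) refl b Q c))
      cubic : q₁ * (q₁ * (q₁ * S₂)) ≤ pos 3 * (Q * Q * (N * N))
      cubic = ≤-trans (≤-reflexive (solve 3 (λ q s n → q :* (q :* (q :* s)) := q :* (q :* q :* s :- q :* (n :* n)) :+ q :* q :* (n :* n)) refl q₁ S₂ N*))
        (≤-trans (+-mono-≤ (≤-trans moment bW) (*-mono (0≤m*n 0≤q₁ 0≤q₁) (0≤sq N) (*-mono 0≤q₁ 0≤Q q₁≤Q q₁≤Q) (square-mono 0≤N* N*≤N)))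
        (≤-reflexive (solve 1 (λ y → con (pos 2) :* y :+ y := con (pos 3) :* y) refl (Q * Q * (N * N)))))

    -- 48 = 8 · 6 and 32 = 8 · 4, where 8 again replaces (q - 1)³ by q³ and 6 = 2 + 4 adds the two
    -- occurrences of c N.
    QE : Q * E ≤ pos 48 * (c * N) + pos 32 * (Q * (c * P))
    QE = *-cancelˡ 0<Q (*-cancelˡ 0<Q (≤-trans (≤-reflexive (solve 2 (λ q s → q :* (q :* (q :* s)) := q :* (q :* q) :* s) refl Q E))
        (≤-trans (*-monoʳ 0≤E Q³≤8q₁³) (≤-trans (≤-reflexive (solve 2 (λ q s → con (pos 8) :* (q :* (q :* q)) :* s := con (pos 8) :* (q :* (q :* (q :* s)))) refl q₁ E))
        (≤-trans (*-monoˡ (0≤pos 8) cubic) (≤-reflexive (solve 4 (λ q c n p → con (pos 8) :* (con (pos 6) :* (q :* q :* (c :* n)) :+ con (pos 4) :* (q :* (q :* q) :* (c :* p)))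
             := q :* (q :* (con (pos 48) :* (c :* n) :+ con (pos 32) :* (q :* (c :* p))))) refl Q c N P)))))))
      where
      W≤ : P * (c * c + c * Q³) ≤ Q * Q * (c * N) + Q³ * (c * P)
      W≤ = ≤-trans (≤-reflexive (solve 3 (λ p c q → p :* (c :* c :+ c :* q) := p :* (c :* c) :+ q :* (c :* p)) refl P c Q³))
        (+-mono-≤ (≤-trans (*-monoʳ (0≤m*n 0≤c 0≤c) P≤bQQ) (≤-reflexive (solve 3 (λ b q c → b :* (q :* q) :* (c :* c) := q :* q :* (c :* (b :* c))) refl b Q c))) ≤-refl)
      cubic : q₁ * (q₁ * (q₁ * E)) ≤ pos 6 * (Q * Q * (c * N)) + pos 4 * (Q³ * (c * P))
      cubic = ≤-trans energy (≤-trans (+-mono-≤ (*-monoˡ (0≤pos 2) (≤-trans (≤-reflexive (sym (*-assoc q₁ q₁ (c * N)))) (*-monoʳ (0≤m*n 0≤c 0≤N) (*-mono 0≤q₁ 0≤Q q₁≤Q q₁≤Q))))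
          (*-monoˡ (0≤pos 4) W≤))
        (≤-reflexive (solve 2 (λ y z → con (pos 2) :* y :+ con (pos 4) :* (y :+ z) := con (pos 6) :* y :+ con (pos 4) :* z) refl (Q * Q * (c * N)) (Q³ * (c * P)))))

    y t₁ t₂ t₃ : ℤ
    y = Q * x
    t₁ = pos 48 * (y * y * (c * N))
    t₂ = pos 32 * (y * y * (Q * (c * P)))
    t₃ = pos 24 * (v * (Q * Q) * a * (N * N))

    0<y : 0ℤ < y
    0<y = 0<m*n 0<Q 0<x

    0≤y : 0ℤ ≤ y
    0≤y = <⇒≤ 0<y

    -- `incidences` and `mixing` multiplied together, with q³ distributed over the terms so that
    -- `QE` and `QS₂` can be inserted; the 4 is the square of the 2 in `N≤2N*`.
    main : v * (Q * Q) * y * a * (N * N) ≤ pos 4 * (T * (t₁ + t₂ + t₃))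
    main = *-cancelˡ 0<a (≤-trans (≤-reflexive (solve 5 (λ a v q x n → a :* (v :* (q :* q) :* (q :* x) :* a :* (n :* n)) := q :* (q :* q) :* (v :* x) :* (a :* a :* (n :* n))) refl a v Q x N))
      (≤-trans (*-monoˡ 0≤QQQvx (*-monoˡ (0≤m*n 0≤a 0≤a) (≤-trans (square-mono 0≤N N≤2N*) (≤-reflexive (solve 1 (λ s → con (pos 2) :* s :* (con (pos 2) :* s) := con (pos 4) :* (s :* s)) refl N*)))))
      (≤-trans (≤-reflexive (solve 4 (λ u a s z → u :* z :* (a :* a :* (con (pos 4) :* (s :* s))) := con (pos 4) :* (u :* (z :* (a :* s :* (a :* s))))) refl Q³ a N* (v * x)))
      (≤-trans (*-monoˡ (0≤pos 4) (*-monoˡ 0≤Q³ (≤-trans (*-monoˡ (0≤m*n 0≤v 0≤x) incidences)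
          (≤-trans (≤-reflexive (solve 3 (λ z t m → z :* (t :* m) := t :* (z :* m)) refl (v * x) T M′)) (*-monoˡ 0≤T mixing)))))
      (≤-trans (≤-reflexive (solve 7 (λ q t x a e v s → con (pos 4) :* (q :* (q :* q) :* (t :* (x :* x :* a :* e :+ v :* (a :* a) :* s)))
            := con (pos 4) :* (a :* (t :* (q :* x :* (q :* x) :* (q :* e) :+ v :* (q :* q) :* a :* (q :* s))))) refl Q T x a E v S₂))
      (≤-trans (*-monoˡ (0≤pos 4) (*-monoˡ 0≤a (*-monoˡ 0≤T (+-mono-≤ (*-monoˡ (0≤m*n 0≤y 0≤y) QE) (*-monoˡ (0≤m*n (0≤m*n 0≤v (0≤m*n 0≤Q 0≤Q)) 0≤a) QS₂)))))
      (≤-reflexive (solve 7 (λ a t y n q w z → con (pos 4) :* (a :* (t :* (y :* (con (pos 48) :* n :+ con (pos 32) :* q) :+ w :* (con (pos 24) :* z))))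
            := a :* (con (pos 4) :* (t :* (con (pos 48) :* (y :* n) :+ con (pos 32) :* (y :* q) :+ con (pos 24) :* (w :* z))))) refl
            a T (y * y) (c * N) (Q * (c * P)) (v * (Q * Q) * a) (N * N)))))))))
      where
      0≤QQQvx : 0ℤ ≤ Q³ * (v * x)
      0≤QQQvx = 0≤m*n 0≤Q³ (0≤m*n 0≤v 0≤x)

    -- The largest of three summands is at least a third of the total, so 4 becomes 12, and 12 times
    -- 48, 32 and 24 are the constants. The first two cases use the upper bound for |SL_n|, the last
    -- one the lower bound.
    trichotomy : (v * Q * Q * (a * b) ≤ pos 576 * (T * P)) ⊎ (v * Q * (a * b * b * c) ≤ pos 384 * (T * (P * P))) ⊎ (P ≤ pos 288 * L * T)
    trichotomy = conclude (three-way {X = v * (Q * Q) * y * a * (N * N)} {T} {t₁} {t₂} {t₃} 0≤T main)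
      where
      X = v * (Q * Q) * y * a * (N * N)
      conclude : (X ≤ pos 12 * (T * t₁)) ⊎ (X ≤ pos 12 * (T * t₂)) ⊎ (X ≤ pos 12 * (T * t₃)) →
        (v * Q * Q * (a * b) ≤ pos 576 * (T * P)) ⊎ (v * Q * (a * b * b * c) ≤ pos 384 * (T * (P * P))) ⊎ (P ≤ pos 288 * L * T)
      conclude (inj₁ h) = inj₁ (*-cancelˡ 0<k (≤-trans (≤-reflexive (solve 6 (λ v q y a b c → y :* (b :* c) :* c :* (v :* q :* q :* (a :* b)) := v :* (q :* q) :* y :* a :* (b :* c :* (b :* c))) refl v Q y a b c))
            (≤-trans h (≤-trans (≤-reflexive (solve 4 (λ t y c n → con (pos 12) :* (t :* (con (pos 48) :* (y :* y :* (c :* n)))) := con (pos 576) :* (t :* (y :* n :* c)) :* y) refl T y c N))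
              (≤-trans (*-monoˡ (0≤m*n (0≤pos 576) (0≤m*n 0≤T (0≤m*n (0≤m*n 0≤y 0≤N) 0≤c))) x-upper)
                (≤-reflexive (solve 3 (λ t z p → con (pos 576) :* (t :* z) :* p := z :* (con (pos 576) :* (t :* p))) refl T (y * N * c) P)))))))
        where
        0<k : 0ℤ < y * N * c
        0<k = 0<m*n (0<m*n 0<y 0<N) 0<c
      conclude (inj₂ (inj₁ h)) = inj₂ (inj₁ (*-cancelˡ 0<k (≤-trans (≤-reflexive (solve 6 (λ v q y a b c → y :* c :* q :* (v :* q :* (a :* b :* b :* c)) := v :* (q :* q) :* y :* a :* (b :* c :* (b :* c))) refl v Q y a b c))
            (≤-trans h (≤-trans (≤-reflexive (solve 5 (λ t y q c p → con (pos 12) :* (t :* (con (pos 32) :* (y :* y :* (q :* (c :* p))))) := con (pos 384) :* (t :* (y :* c :* q :* p)) :* y) refl T y Q c P))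
              (≤-trans (*-monoˡ (0≤m*n (0≤pos 384) (0≤m*n 0≤T (0≤m*n (<⇒≤ 0<k) 0≤P))) x-upper)
                (≤-reflexive (solve 3 (λ t z p → con (pos 384) :* (t :* (z :* p)) :* p := z :* (con (pos 384) :* (t :* (p :* p)))) refl T (y * c * Q) P))))))))
        where
        0<k : 0ℤ < y * c * Q
        0<k = 0<m*n (0<m*n 0<y 0<c) 0<Q
      conclude (inj₂ (inj₂ h)) = inj₂ (inj₂ (≤-trans x-lower (≤-trans (*-monoˡ 0≤L y≤) (≤-reflexive (solve 2 (λ l t → l :* (con (pos 288) :* t) := con (pos 288) :* l :* t) refl L T)))))
        where
        k = v * (Q * Q) * a * (N * N)
        0<k : 0ℤ < k
        0<k = 0<m*n (0<m*n (0<m*n 0<v (0<m*n 0<Q 0<Q)) 0<a) (0<m*n 0<N 0<N)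
        y≤ : y ≤ pos 288 * T
        y≤ = *-cancelˡ 0<k (≤-trans (≤-reflexive (solve 5 (λ v q a n y → v :* q :* a :* n :* y := v :* q :* y :* a :* n) refl v (Q * Q) a (N * N) y))
          (≤-trans h (≤-reflexive (solve 2 (λ t k → con (pos 12) :* (t :* (con (pos 24) :* k)) := k :* (con (pos 288) :* t)) refl T k))))

-- Counting solutions of a (b + c) = t

module Incidences where
  open Integers
  open Sums
  open Counting
  open MixingSL
  open Correlations
  open Sizes
  open Numerics
  open import Data.List.Membership.Propositional.Properties using (∈-map⁺; ∈-concatMap⁺; ∈-deduplicate⁺)
  open import Data.List.Relation.Unary.Any as Any using (Any)
  open import Data.List.Relation.Unary.All as All using ([]; _∷_)
  import Data.List.Relation.Unary.All.Properties as AllP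
  open import Data.List.Relation.Unary.AllPairs using ([]; _∷_)
  open import Data.List.Relation.Unary.Unique.DecPropositional.Properties using (deduplicate-!)
  open import Data.List.Properties using (length-map)
  open import Data.Vec.Base using ([]; _∷_; map)

  open Finite

  module Assembly {q : ℕ} (F : FiniteField q) (2≤q : pos 2 ≤ pos q) where

    open Cardinalities F 2≤q
    open MixSL F using (module Translations; 2≤Q^)

    uniq-map : ∀ {A B : Set} (f : A → B) {P : A → Set} → (∀ {x y} → P x → P y → f x ≡ f y → x ≡ y) →
      ∀ {xs} → All P xs → Unique xs → Unique (List.map f xs)
    uniq-map f inj []       []      = []
    uniq-map f inj (p ∷ ps) (n ∷ u) = fresh ps n ∷ uniq-map f inj ps u
      where
      fresh : ∀ {ys} → All _ ys → All (λ y → _ ≢ y) ys → All (λ y → f _ ≢ y) (List.map f ys)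
      fresh []       []       = []
      fresh (p′ ∷ ps) (ne ∷ ns) = (λ e → ne (inj p p′ e)) ∷ fresh ps ns

    adj-injective : ∀ {n} {x y : Mat n} → Det x ≡ 1# → Det y ≡ 1# → adj x ≡ adj y → x ≡ y
    adj-injective {n} {x} {y} dx dy e = trans (sym (⊗-cancelʳ x (adj y) y (SL-inverseˡ y dy)))
      (trans (cong (_⊗ y) (trans (cong (x ⊗_) (sym e)) (SL-inverseʳ x dx))) (Id-⊗ y))

    module Sized (m : ℕ) (2≤V : pos 2 ≤ Q ^′ m)
      (spread : ∀ (u : Row m) → u ≢ 0ᵛ → ∀ (Ψ : Row m → ℤ) →
        (Q ^′ m - 1ℤ) * (∑[ h ∈ dets m 1# ] Ψ (mv h u)) ≡ pos (length (dets m 1#)) * (∑ (rows m) Ψ - Ψ 0ᵛ))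
      (first-row : ∀ (b : Row (suc m)) → b ≢ 0ᵛ → Σ (Mat (suc m)) λ P → Det P ≡ 1# × vm e₀ P ≡ b)
      (1<V : 0ℤ < Q ^′ suc m - 1ℤ)
      (hit-bound : ∀ (w : Row (suc m)) → w ≢ 0ᵛ → ∀ u →
        (Q ^′ suc m - 1ℤ) * (∑[ h ∈ dets (suc m) 1# ] 𝟙 (u ≟ᵛ mv h w)) ≤ ∣dets∣ (suc m) 1#)
      (A B C : List (Mat (suc m))) (uniqA : Unique A) (uniqB : Unique B) (uniqC : Unique C)
      (A⊂SL : All (λ a → Det a ≡ 1#) A) (B⊂SL : All (λ b → Det b ≡ 1#) B) where

      n = suc m

      open Additive n (Γ-bound m) C uniqC
      open Pairs B uniqB B⊂SL
      open Singular n 1<V hit-bound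

      x : ℤ
      x = ∣dets∣ n 1#

      ∣A∣ = pos (length A)

      r : Mat n → ℤ
      r y = ∑[ b ∈ B ] ∑[ c ∈ C ] 𝟙 (y ≟ᴹ (b ⊞ c))

      ∑-r : ∀ f → ∑[ y ∈ Ms ] r y * f y ≡ ∑[ b ∈ B ] ∑[ c ∈ C ] f (b ⊞ c)
      ∑-r f = trans (∑-cong Ms λ y → trans (sym (∑-*ʳ (f y) B _)) (∑-cong B λ b → sym (∑-*ʳ (f y) C _)))
        (∑-swap₁ Ms B _ λ b → ∑-swap₁ Ms C _ λ c → delta (finMat n n) (b ⊞ c) f)

      -- b + c = b′ + c′ is the same equation as b - c′ = b′ - c, so exchanging c and c′ turns the
      -- energy of sums into that of differences.
      energy-≡ : ∑[ y ∈ Ms ] r y * r y ≡ E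
      energy-≡ = begin
        ∑[ y ∈ Ms ] r y * r y
          ≡⟨ ∑-r r ⟩
        ∑[ b ∈ B ] ∑[ c ∈ C ] ∑[ b′ ∈ B ] ∑[ c′ ∈ C ] 𝟙 ((b ⊞ c) ≟ᴹ (b′ ⊞ c′))
          ≡⟨ (∑-cong B λ b → trans (∑-cong C λ c → ∑-swap B C _) (trans (∑-swap C C _) (∑-cong C λ c′ → ∑-swap C B _))) ⟩
        ∑[ b ∈ B ] ∑[ c′ ∈ C ] ∑[ b′ ∈ B ] ∑[ c ∈ C ] 𝟙 ((b ⊞ c) ≟ᴹ (b′ ⊞ c′))
          ≡⟨ (∑-cong B λ b → ∑-cong C λ c′ → trans (∑-swap B C _) (∑-cong C λ c → ∑-cong B λ b′ →
               𝟙-⇔ ((b ⊞ c) ≟ᴹ (b′ ⊞ c′)) (((b ⊞ negᴹ c′) ⊞ c) ≟ᴹ b′)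
                 (λ e → trans (rotate b c c′) (trans (cong (_⊞ negᴹ c′) e) (⊞-cancel b′ c′)))
                 (λ e → trans (sym (⊞-cancel′ (b ⊞ c) c′)) (cong (_⊞ c′) (trans (sym (rotate b c c′)) e))))) ⟩
        ∑[ b ∈ B ] ∑[ c′ ∈ C ] ρ (b ⊞ negᴹ c′)
          ≡⟨ sym ∑-ρρ ⟩
        E ∎
        where
        open ≡-Reasoning
        rotate : ∀ b c c′ → (b ⊞ negᴹ c′) ⊞ c ≡ (b ⊞ c) ⊞ negᴹ c′
        rotate b c c′ = trans (⊞-assoc b (negᴹ c′) c) (trans (cong (b ⊞_) (⊞-comm (negᴹ c′) c)) (sym (⊞-assoc b c (negᴹ c′))))
        ∑-ρρ : E ≡ ∑[ b ∈ B ] ∑[ c ∈ C ] ρ (b ⊞ negᴹ c)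
        ∑-ρρ = trans (∑-cong Ms λ y → sym (∑-*ʳ (ρ y) C _)) (trans (∑-swap₁ Ms C _ λ c → trans
            (∑-cong Ms λ y → cong (λ z → 1B (y ⊞ c) * ρ z) (sym (⊞-cancel y c)))
            (trans (∑-translate c λ y → 1B y * ρ (y ⊞ negᴹ c)) (∑-1B λ y → ρ (y ⊞ negᴹ c))))
          (∑-swap C B _))

      -- The estimate sums g(a t), whereas a solution of t = a (b + c) is found by evaluating r at
      -- a⁻¹ t; for determinant 1 the adjugate is the inverse.
      A⁻¹ : List (Mat n)
      A⁻¹ = List.map adj A

      A⁻¹⊂SL : All (λ a → Det a ≡ 1#) A⁻¹
      A⁻¹⊂SL = AllP.map⁺ (All.map (λ {a} d → det-adj a d) A⊂SL)

      uniqA⁻¹ : Unique A⁻¹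
      uniqA⁻¹ = uniq-map adj adj-injective A⊂SL uniqA

      u : Mat n → ℤ
      u t = ∑[ a ∈ A⁻¹ ] r (a ⊗ t)

      M′ : ℤ
      M′ = ∑[ t ∈ Ms ] nz (Det t) * (u t * u t)

      by-det : ∀ (f : Mat n → ℤ) → ∑[ d ∈ Cs ] nz d * ∑ (dets n d) f ≡ ∑[ t ∈ Ms ] nz (Det t) * f t
      by-det f = trans (∑-cong Cs λ d → trans (cong (nz d *_) (∑-dets n d f)) (sym (∑-*ˡ (nz d) Ms _)))
        (∑-swap₁ Cs Ms _ λ t → ∑-nz-𝟙 (Det t) λ _ → f t)

      mixing-d : ∀ d → d ≢ 0# → Q ^′ m * x * (∑[ t ∈ dets n d ] u t * u t)
        ≤ x * x * ∣A∣ * (∑[ y ∈ dets n d ] r y * r y) + Q ^′ m * (∣A∣ * ∣A∣) * (Nd d * Nd d)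
      mixing-d d d≢0 = subst₂ _≤_
        (cong (λ z → Q ^′ m * z * (∑[ t ∈ dets n d ] u t * u t)) (dets-equal m d d≢0))
        (trans (cong₂ (λ z w → z * z * w * (∑[ y ∈ dets n d ] r y * r y) + Q ^′ m * (w * w) * (∑ (dets n d) r * ∑ (dets n d) r))
            (dets-equal m d d≢0) (cong pos (length-map adj A)))
          (cong (λ z → x * x * ∣A∣ * (∑[ y ∈ dets n d ] r y * r y) + Q ^′ m * (∣A∣ * ∣A∣) * (z * z)) class-sum))
        (Translations.mixing-SL m 2≤V spread first-row d d≢0 A⁻¹ uniqA⁻¹ A⁻¹⊂SL r)
        where
        class-sum : ∑ (dets n d) r ≡ Nd d
        class-sum = trans (∑-dets n d r) (trans (∑-cong Ms λ y → *-comm _ (r y)) (∑-r λ y → 𝟙 (Det y ≟ᶠ d)))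

      mixing-total : Q ^′ m * x * M′ ≤ x * x * ∣A∣ * E + Q ^′ m * (∣A∣ * ∣A∣) * S₂
      mixing-total = ≤-trans (≤-reflexive (trans (cong (Q ^′ m * x *_) (sym (by-det λ t → u t * u t)))
          (trans (sym (∑-*ˡ (Q ^′ m * x) Cs _)) (∑-cong Cs λ d → solve 3 (λ a b c → a :* (b :* c) := b :* (a :* c)) refl (Q ^′ m * x) (nz d) _))))
        (≤-trans (∑-mono Cs λ d → per-d d (d ≟ᶠ 0#))
        (≤-trans (≤-reflexive (trans (∑-cong Cs λ d → solve 5 (λ n a e b s → n :* (a :* e :+ b :* s) := a :* (n :* e) :+ b :* (n :* s)) refl
              (nz d) (x * x * ∣A∣) (∑[ y ∈ dets n d ] r y * r y) (Q ^′ m * (∣A∣ * ∣A∣)) (Nd d * Nd d))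
            (trans (∑-+ Cs _ _) (cong₂ _+_ (trans (∑-*ˡ (x * x * ∣A∣) Cs _) (cong (x * x * ∣A∣ *_) (by-det λ y → r y * r y))) (∑-*ˡ (Q ^′ m * (∣A∣ * ∣A∣)) Cs _)))))
        (+-mono-≤ (*-monoˡ (0≤m*n (0≤m*n (0≤pos _) (0≤pos _)) (0≤pos _)) (≤-trans
            (∑-mono Ms λ y → ≤-trans (*-monoʳ (0≤sq (r y)) (1-𝟙≤1 (Det y ≟ᶠ 0#))) (≤-reflexive (*-identityˡ _)))
            (≤-reflexive energy-≡))) ≤-refl)))
        where
        per-d : ∀ d → Dec (d ≡ 0#) → nz d * (Q ^′ m * x * (∑[ t ∈ dets n d ] u t * u t))
          ≤ nz d * (x * x * ∣A∣ * (∑[ y ∈ dets n d ] r y * r y) + Q ^′ m * (∣A∣ * ∣A∣) * (Nd d * Nd d))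
        per-d d (yes e) = ≤-reflexive (trans (trans (cong (_* (Q ^′ m * x * (∑[ t ∈ dets n d ] u t * u t))) (1-𝟙-yes (d ≟ᶠ 0#) e)) (zeroˡ _))
          (sym (trans (cong (_* (x * x * ∣A∣ * (∑[ y ∈ dets n d ] r y * r y) + Q ^′ m * (∣A∣ * ∣A∣) * (Nd d * Nd d))) (1-𝟙-yes (d ≟ᶠ 0#) e)) (zeroˡ _))))
        per-d d (no ne) = *-monoˡ (0≤1-𝟙 (d ≟ᶠ 0#)) (mixing-d d ne)

      image : List (Mat n)
      image = Matrices.fImage F A B C

      image-unique : Unique image
      image-unique = deduplicate-! _≟M_ _

      image-∈ : ∀ {a b c} → a ∈ A → b ∈ B → c ∈ C → (a ⊗ (b ⊞ c)) ∈ image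
      image-∈ {a} {b} {c} a∈ b∈ c∈ = subst (_∈ image) (mulM≡⊗ a (b ⊞ c)) (∈-deduplicate⁺ _≟M_
        (∈-concatMap⁺ _ (Any.map (λ { refl → ∈-concatMap⁺ _ (Any.map (λ { refl → ∈-map⁺ _ c∈ }) b∈) }) a∈)))

      1T : Mat n → ℤ
      1T t = ∑[ z ∈ image ] 𝟙 (z ≟ᴹ t)

      T : ℤ
      T = pos (length image)

      -- A nonzero term of `u t` exhibits t as some a (b + c). The factor `1T` is what lets
      -- Cauchy-Schwarz bring in the size of the image.
      supported : ∀ t → u t ≤ u t * 1T t
      supported t = ≤-trans (≤-reflexive (∑-map A adj _)) (≤-trans (∑-mono∈ A λ {a} a∈ → ∑-mono∈ B λ {b} b∈ → ∑-mono∈ C λ {c} c∈ →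
          at a∈ b∈ c∈ ((adj a ⊗ t) ≟ᴹ (b ⊞ c)))
        (≤-reflexive (trans (∑-cong A λ a → trans (∑-cong B λ b → ∑-*ʳ (1T t) C _) (∑-*ʳ (1T t) B _))
          (trans (∑-*ʳ (1T t) A _) (cong (_* 1T t) (sym (∑-map A adj _)))))))
        where
        at : ∀ {a b c} → a ∈ A → b ∈ B → c ∈ C → Dec (adj a ⊗ t ≡ b ⊞ c) →
          𝟙 ((adj a ⊗ t) ≟ᴹ (b ⊞ c)) ≤ 𝟙 ((adj a ⊗ t) ≟ᴹ (b ⊞ c)) * 1T t
        at {a} {b} {c} a∈ b∈ c∈ (no ne) = ≤-reflexive (trans (𝟙-no ((adj a ⊗ t) ≟ᴹ (b ⊞ c)) ne)
          (sym (trans (cong (_* 1T t) (𝟙-no ((adj a ⊗ t) ≟ᴹ (b ⊞ c)) ne)) (zeroˡ _))))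
        at {a} {b} {c} a∈ b∈ c∈ (yes e) = ≤-reflexive (sym (trans (cong (𝟙 ((adj a ⊗ t) ≟ᴹ (b ⊞ c)) *_)
          (count-∈ _≟ᴹ_ image image-unique (subst (_∈ image) (trans (cong (a ⊗_) (sym e)) (⊗-cancelˡ a (adj a) t (SL-inverseʳ a (All.lookup A⊂SL a∈)))) (image-∈ a∈ b∈ c∈))))
          (*-identityʳ _)))

      total-incidences : ∣A∣ * N* ≡ ∑[ t ∈ Ms ] nz (Det t) * u t
      total-incidences = sym (begin
        ∑[ t ∈ Ms ] nz (Det t) * u t
          ≡⟨ (∑-cong Ms λ t → trans (cong (nz (Det t) *_) (∑-map A adj _)) (sym (∑-*ˡ (nz (Det t)) A _))) ⟩
        ∑[ t ∈ Ms ] ∑[ a ∈ A ] nz (Det t) * r (adj a ⊗ t)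
          ≡⟨ ∑-swap Ms A _ ⟩
        ∑[ a ∈ A ] ∑[ t ∈ Ms ] nz (Det t) * r (adj a ⊗ t)
          ≡⟨ (∑-cong∈ A λ {a} a∈ → per-a a (All.lookup A⊂SL a∈)) ⟩
        ∑[ a ∈ A ] N*
          ≡⟨ ∑-const A N* ⟩
        ∣A∣ * N* ∎)
        where
        open ≡-Reasoning
        per-a : ∀ a → Det a ≡ 1# → ∑[ t ∈ Ms ] nz (Det t) * r (adj a ⊗ t) ≡ N*
        per-a a da = trans (∑-cong Ms λ t → cong (λ d → nz d * r (adj a ⊗ t)) (sym (det-SLˡ (adj a) t (det-adj a da))))
          (trans (reindex (finMat n n) (finMat n n) (adj a ⊗_) (a ⊗_)
              (λ t → ⊗-cancelˡ a (adj a) t (SL-inverseʳ a da)) (λ t → ⊗-cancelˡ (adj a) a t (SL-inverseˡ a da)) (λ t → nz (Det t) * r t))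
            (trans (∑-cong Ms λ t → *-comm (nz (Det t)) (r t)) (∑-r λ y → nz (Det y))))

      0≤N* : 0ℤ ≤ N*
      0≤N* = ∑-nonneg B λ b → ∑-nonneg C λ c → 0≤1-𝟙 (Det (b ⊞ c) ≟ᶠ 0#)

      incidences : (∣A∣ * N*) * (∣A∣ * N*) ≤ T * M′
      incidences = ≤-trans (square-mono (0≤m*n (0≤pos _) 0≤N*) (≤-trans (≤-reflexive total-incidences)
          (≤-trans (∑-mono Ms λ t → *-monoˡ (0≤1-𝟙 (Det t ≟ᶠ 0#)) (supported t)) (≤-reflexive (∑-cong Ms λ t → sym (*-assoc _ _ _))))))
        (≤-trans (cauchy-schwarz Ms (λ t → nz (Det t) * u t) 1T)
        (≤-trans (≤-reflexive (cong (_* (∑[ t ∈ Ms ] 1T t * 1T t)) (∑-cong Ms λ t → trans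
            (solve 2 (λ a b → a :* b :* (a :* b) := a :* a :* (b :* b)) refl (nz (Det t)) (u t)) (cong (_* (u t * u t)) (nz-square (Det t))))))
        (≤-trans (*-monoˡ (∑-nonneg Ms λ t → 0≤m*n (0≤1-𝟙 (Det t ≟ᶠ 0#)) (0≤sq (u t))) image-count) (≤-reflexive (*-comm M′ T)))))
        where
        image-count : ∑[ t ∈ Ms ] 1T t * 1T t ≤ T
        image-count = ≤-trans (≤-reflexive (trans (∑-cong Ms λ t → sym (∑-*ʳ (1T t) image _)) (∑-swap₁ Ms image _ λ z →
            trans (∑-cong Ms λ t → cong (_* 1T t) (𝟙-⇔ (z ≟ᴹ t) (t ≟ᴹ z) sym sym)) (delta (finMat n n) z 1T))))
          (≤-trans (∑-mono image λ z → count≤1 _≟ᴹ_ image z image-unique) (≤-reflexive (∑-one image)))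

      N₀ : ℤ
      N₀ = ∑[ b ∈ B ] ∑[ c ∈ C ] 𝟙 (Det (b ⊞ c) ≟ᶠ 0#)

      0≤N₀ : 0ℤ ≤ N₀
      0≤N₀ = ∑-nonneg B λ b → 0≤∑𝟙 C λ c → Det (b ⊞ c) ≟ᶠ 0#

      total : N* + N₀ ≡ ∣B∣ * ∣C∣
      total = trans (sym (∑-+ B _ _)) (trans (∑-cong B λ b → trans (sym (∑-+ C _ _)) (trans
        (∑-cong C λ c → solve 1 (λ a → con 1ℤ :- a :+ a := con 1ℤ) refl (𝟙 (Det (b ⊞ c) ≟ᶠ 0#))) (∑-one C))) (∑-const B _))

      singular : Q−1 * N₀ ≤ ∣C∣ * x
      singular = ≤-trans (≤-reflexive (trans (cong (Q−1 *_) (∑-swap B C _)) (sym (∑-*ˡ Q−1 C _))))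
        (≤-trans (∑-mono C λ c → ≤-trans (*-monoˡ 0≤Q−1 (in-SL c)) (singular-count c)) (≤-reflexive (∑-const C _)))
        where
        in-SL : ∀ c → ∑[ b ∈ B ] 𝟙 (Det (b ⊞ c) ≟ᶠ 0#) ≤ ∑[ b ∈ X₁ ] 𝟙 (Det (b ⊞ c) ≟ᶠ 0#)
        in-SL c = ≤-trans (≤-reflexive (sym (∑-1B λ b → 𝟙 (Det (b ⊞ c) ≟ᶠ 0#)))) (≤-trans
          (∑-mono Ms λ y → *-monoʳ (𝟙-nonneg (Det (y ⊞ c) ≟ᶠ 0#)) (1B≤SL y)) (≤-reflexive (sym (∑-dets n 1# _))))

      conclusion : 0ℤ < ∣A∣ → pos 4 * P ≤ ∣B∣ * (Q * Q) → Q * (Q * Q) ≤ ∣C∣ →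
        (Q ^′ m * Q * Q * (∣A∣ * ∣B∣) ≤ pos 576 * (T * P)) ⊎ (Q ^′ m * Q * (∣A∣ * ∣B∣ * ∣B∣ * ∣C∣) ≤ pos 384 * (T * (P * P)))
          ⊎ (P ≤ pos 288 * pos 2 ^′ m * T)
      conclusion 0<A B-large C-large = Inequalities.trichotomy {Q} {Q−1} {P} {∣B∣} {∣C∣} {N₀} {N*} {x} {S₂} {E} {∣A∣} {T} {M′} {Q ^′ m} {pos 2 ^′ m}
        0<Q refl 1≤Q−1 Q≤2Q−1 0<P 0<B (1≤⇒0< (≤-trans (1≤cube 0<Q) C-large)) 0≤N₀ 0≤N* 0<x
        (∑-nonneg Cs λ d → 0≤m*n (0≤1-𝟙 (d ≟ᶠ 0#)) (0≤sq (Nd d))) 0≤E 0<A (0≤pos _) (0<^ m 0<Q) (0≤^ m (0≤pos 2))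
        B-large C-large (dets-upper m) (dets-lower m) total singular second-moment energy mixing-total incidences
        where
        0<P : 0ℤ < P
        0<P = 0<^ n (0<^ n 0<Q)
        0<⇒1≤ : ∀ {i} → 0ℤ < i → 1ℤ ≤ i
        0<⇒1≤ p = i<j⇒suc[i]≤j p
        1≤cube : ∀ {i} → 0ℤ < i → 1ℤ ≤ i * (i * i)
        1≤cube p = 0<⇒1≤ (0<m*n p (0<m*n p p))
        positive-factor : ∀ k {j i} → 0ℤ < j → j ≤ pos k * i → 0ℤ < pos k
        positive-factor zero {j} {i} p h = contradiction p (≤⇒≯ (≤-trans h (≤-reflexive (zeroˡ i))))
        positive-factor (suc k) p h = +<+ (ℕ.s≤s ℕ.z≤n)
        0<B : 0ℤ < ∣B∣
        0<B = positive-factor (length B) (0<m*n (+<+ (ℕ.s≤s ℕ.z≤n)) 0<P) B-large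
        0<x : 0ℤ < x
        0<x = positive-factor (length (dets n 1#)) 0<P (≤-trans (dets-lower m) (≤-reflexive
          (solve 3 (λ a b c → a :* (b :* c) := c :* (a :* b)) refl (pos 2 ^′ m) Q x)))

    spread-out : ∀ k → pos 2 ≤ Q ^′ suc k × 0ℤ < Q ^′ suc k - 1ℤ
    spread-out k = 2≤V , 1≤⇒0< (subst₂ _≤_ (solve 0 (con (pos 2) :- con 1ℤ := con 1ℤ) refl) refl
      (+-mono-≤ 2≤V (≤-refl { - 1ℤ})))
      where
      2≤V = 2≤Q^ 2≤q k

    growth : ∀ k → let m = suc (suc k) ; P = (Q ^′ suc m) ^′ suc m in (A B C : List (Mat (suc m))) →
      Unique A → Unique B → Unique C → All (λ a → Det a ≡ 1#) A → All (λ b → Det b ≡ 1#) B →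
      let ∣A∣ = pos (length A) ; ∣B∣ = pos (length B) ; ∣C∣ = pos (length C) ; T = pos (length (Matrices.fImage F A B C)) in
      0ℤ < ∣A∣ → pos 4 * P ≤ ∣B∣ * (Q * Q) → Q * (Q * Q) ≤ ∣C∣ →
      (Q ^′ m * Q * Q * (∣A∣ * ∣B∣) ≤ pos 576 * (T * P)) ⊎ (Q ^′ m * Q * (∣A∣ * ∣B∣ * ∣B∣ * ∣C∣) ≤ pos 384 * (T * (P * P)))
        ⊎ (P ≤ pos 288 * pos 2 ^′ m * T)
    growth k A B C uA uB uC A⊂SL B⊂SL = Sized.conclusion (suc (suc k)) (proj₁ (spread-out (suc k))) uniform with-first-row
      (proj₂ (spread-out (suc (suc k)))) (λ w w≢0 → hits-bound w w≢0 (<⇒≤ (proj₂ (spread-out (suc (suc k))))))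
      A B C uA uB uC A⊂SL B⊂SL

-- Exponents and rational constants

module Bounds where
  open import Data.Nat
  open import Data.Nat.Properties
  open import Data.Nat.Solver using (module +-*-Solver)
  open import Data.Rational.Unnormalised using (mkℚᵘ; *≤*)
  import Data.Rational.Unnormalised.Properties as ℚᵘP
  open import Data.Nat.Primality using (prime)
  open +-*-Solver using (solve; _:=_; _:+_; _:*_; con)

  oddPrimePower⇒2≤ : ∀ {q} → IsOddPrimePower q → 2 ≤ q
  oddPrimePower⇒2≤ (p , k , prime {{nt}} _ , _ , 1≤k , refl) = ≤-trans (nonTrivial⇒n>1 p)
    (subst (_≤ p ^ k) (*-identityʳ p) (^-monoʳ-≤ p {{nonTrivial⇒nonZero p}} 1≤k))

  module _ (K : ℕ) .{{_ : NonZero K}} where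

    0<1÷ : 0ℚ ℚ.< 1 ÷ K
    0<1÷ = positive K
      where
      positive : ∀ K .{{_ : NonZero K}} → 0ℚ ℚ.< 1 ÷ K
      positive (suc k) = ℚP.positive⁻¹ (1 ÷ suc k) {{ℚP.normalize-pos 1 (suc k)}}

    -- Proved in the unnormalised rationals, where the order is cross-multiplication and no gcd
    -- intervenes.
    ÷-bound : ∀ x D T .{{_ : NonZero D}} → x ≤ K * T * D → (1 ÷ K) ℚ.* (x ÷ D) ℚ.≤ T ÷ 1
    ÷-bound = bound K
      where
      bound : ∀ K .{{_ : NonZero K}} x D T .{{_ : NonZero D}} → x ≤ K * T * D → (1 ÷ K) ℚ.* (x ÷ D) ℚ.≤ T ÷ 1
      bound (suc k) x (suc d) T h = ℚP.toℚᵘ-cancel-≤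
        (ℚᵘP.≤-respˡ-≃ (ℚᵘP.≃-sym (ℚᵘP.≃-trans (ℚP.toℚᵘ-homo-* (1 ÷ suc k) (x ÷ suc d))
            (ℚᵘP.*-cong (ℚP.toℚᵘ-fromℚᵘ (mkℚᵘ (ℤ.+ 1) k)) (ℚP.toℚᵘ-fromℚᵘ (mkℚᵘ (ℤ.+ x) d)))))
        (ℚᵘP.≤-respʳ-≃ (ℚᵘP.≃-sym (ℚP.toℚᵘ-fromℚᵘ (mkℚᵘ (ℤ.+ T) 0))) (*≤* (subst₂ ℤ._≤_
          (trans (sym (ℤP.*-identityˡ (ℤ.+ x))) (sym (ℤP.*-identityʳ (ℤ.+ 1 ℤ.* ℤ.+ x))))
          (trans (cong ℤ.+_ (solve 3 (λ k t d → k :* t :* d := t :* (k :* d)) refl (suc k) T (suc d))) (ℤP.pos-* T _))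
          (ℤ.+≤+ h)))))

    min-bound : ∀ X Y D Z D′ T .{{_ : NonZero D}} .{{_ : NonZero D′}} →
      (Z ≤ K * T * D′) ⊎ (Y ≤ K * T * D) ⊎ (X ≤ K * T) → (1 ÷ K) ℚ.* minℚ3 (X ÷ 1) (Y ÷ D) (Z ÷ D′) ℚ.≤ T ÷ 1
    min-bound X Y D Z D′ T = λ where
        (inj₁ h)        → ℚP.≤-trans (scaled (ℚP.≤-trans (ℚP.p⊓q≤q (X ÷ 1) _) (ℚP.p⊓q≤q (Y ÷ D) (Z ÷ D′)))) (÷-bound Z D′ T h)
        (inj₂ (inj₁ h)) → ℚP.≤-trans (scaled (ℚP.≤-trans (ℚP.p⊓q≤q (X ÷ 1) _) (ℚP.p⊓q≤p (Y ÷ D) (Z ÷ D′)))) (÷-bound Y D T h)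
        (inj₂ (inj₂ h)) → ℚP.≤-trans (scaled (ℚP.p⊓q≤p (X ÷ 1) _)) (÷-bound X 1 T (≤-trans h (≤-reflexive (sym (*-identityʳ _)))))
      where
      scaled : ∀ {r s} → r ℚ.≤ s → (1 ÷ K) ℚ.* r ℚ.≤ (1 ÷ K) ℚ.* s
      scaled = ℚP.*-monoˡ-≤-nonNeg (1 ÷ K) {{ℚ.nonNegative (ℚP.<⇒≤ 0<1÷)}}

  module Exponents (q : ℕ) .{{_ : NonZero q}} (m : ℕ) (2≤m : 2 ≤ m) where

    private
      n = suc m
      K = 576 * 2 ^ m
      P = (q ^ n) ^ n
      D₂ = q ^ (3 * (n * n) ∸ 3 * n ∸ 2)
      D₃ = q ^ (n * n ∸ n ∸ 1)

    3n≤n² : 3 * n ≤ n * n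
    3n≤n² = *-monoˡ-≤ n (s≤s 2≤m)

    P≡ : P ≡ q ^ (n * n)
    P≡ = ^-*-assoc q n n

    cancel : ∀ k e .{{_ : NonZero e}} x L → k ≤ K → e * x ≤ k * (L * e) → x ≤ K * L
    cancel k e x L k≤K h = *-cancelˡ-≤ {x} {K * L} e (≤-trans h (≤-trans (*-monoˡ-≤ (L * e) k≤K)
      (≤-reflexive (solve 3 (λ a b c → a :* (b :* c) := c :* (a :* b)) refl K L e))))

    K-large : ∀ k → k ≤ 576 → k ≤ K
    K-large k h = ≤-trans h (m≤m*n 576 (2 ^ m) {{m^n≢0 2 m}})

    third-exponent : (n * n ∸ n ∸ 1) + (m + 2) ≡ n * n
    third-exponent = trans (cong₂ _+_ (∸-+-assoc (n * n) n 1) (solve 1 (λ m → m :+ con 2 := (con 1 :+ m) :+ con 1) refl m))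
      (m∸n+n≡m (≤-trans (≤-trans (+-monoʳ-≤ n (s≤s z≤n)) (m≤n+m (n + n) n)) (≤-trans (≤-reflexive (solve 1 (λ n → n :+ (n :+ n) := con 3 :* n) refl n)) 3n≤n²)))

    third : ∀ x T → q ^ m * q * q * x ≤ 576 * (T * P) → x ≤ K * T * D₃
    third x T h = ≤-trans (cancel 576 e {{m^n≢0 q (m + 2)}} x (T * D₃) (K-large 576 ≤-refl) (subst₂ _≤_
        (cong (_* x) q²) (cong (576 *_) (trans (cong (T *_) P-split) (sym (*-assoc T D₃ e)))) h))
      (≤-reflexive (sym (*-assoc K T D₃)))
      where
      e = q ^ (m + 2)
      q² : q ^ m * q * q ≡ e
      q² = trans (solve 2 (λ a b → a :* b :* b := a :* (b :* (b :* con 1))) refl (q ^ m) q) (sym (^-distribˡ-+-* q m 2))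
      P-split : P ≡ D₃ * e
      P-split = trans P≡ (trans (cong (q ^_) (sym third-exponent)) (^-distribˡ-+-* q (n * n ∸ n ∸ 1) (m + 2)))

    -- The estimates give the denominator q^(2n² - n). It is at most the one of the theorem, because
    -- n² ≥ 2n + 2 for n ≥ 3.
    second-exponent : n * n + n * n ≤ (3 * (n * n) ∸ 3 * n ∸ 2) + n
    second-exponent = +-cancelʳ-≤ (3 * n + 2) _ _ (≤-trans bound (≤-reflexive (sym (trans
        (solve 3 (λ e n s → e :+ n :+ s := e :+ s :+ n) refl (3 * (n * n) ∸ 3 * n ∸ 2) n (3 * n + 2))
        (cong (_+ n) (trans (cong (_+ (3 * n + 2)) (∸-+-assoc (3 * (n * n)) (3 * n) 2)) (m∸n+n≡m enough)))))))
      where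
      2n+2≤n² : n + n + 2 ≤ n * n
      2n+2≤n² = ≤-trans (≤-trans (+-monoʳ-≤ (n + n) (≤-trans 2≤m (n≤1+n m))) (≤-reflexive (solve 1 (λ n → n :+ n :+ n := con 3 :* n) refl n))) 3n≤n²
      enough : 3 * n + 2 ≤ 3 * (n * n)
      enough = ≤-trans (+-mono-≤ 3n≤n² (≤-trans (m≤n+m 2 (n + n)) 2n+2≤n²)) (≤-trans (m≤m+n (n * n + n * n) (n * n))
        (≤-reflexive (solve 1 (λ s → s :+ s :+ s := con 3 :* s) refl (n * n))))
      bound : n * n + n * n + (3 * n + 2) ≤ 3 * (n * n) + n
      bound = ≤-trans (≤-reflexive (solve 2 (λ s n → s :+ s :+ (con 3 :* n :+ con 2) := s :+ s :+ n :+ (n :+ n :+ con 2)) refl (n * n) n))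
        (≤-trans (+-monoʳ-≤ (n * n + n * n + n) 2n+2≤n²)
        (≤-reflexive (solve 2 (λ s n → s :+ s :+ n :+ s := con 3 :* s :+ n) refl (n * n) n)))

    second : ∀ x T → q ^ m * q * x ≤ 384 * (T * (P * P)) → x ≤ K * T * D₂
    second x T h = ≤-trans (cancel 384 e {{m^n≢0 q n}} x (T * D₂) (K-large 384 (m≤m+n 384 192)) (≤-trans (subst (λ z → z * x ≤ 384 * (T * (P * P)))
        (*-comm (q ^ m) q) h) (*-monoʳ-≤ 384 (≤-trans (*-monoʳ-≤ T P²≤) (≤-reflexive (sym (*-assoc T D₂ e)))))))
      (≤-reflexive (sym (*-assoc K T D₂)))
      where
      e = q ^ n
      P²≤ : P * P ≤ D₂ * e
      P²≤ = ≤-trans (≤-reflexive (trans (cong₂ _*_ P≡ P≡) (sym (^-distribˡ-+-* q (n * n) (n * n)))))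
        (≤-trans (^-monoʳ-≤ q second-exponent) (≤-reflexive (^-distribˡ-+-* q (3 * (n * n) ∸ 3 * n ∸ 2) n)))

    first : ∀ T → P ≤ 288 * 2 ^ m * T → q ^ (n * n) ≤ K * T
    first T h = ≤-trans (≤-reflexive (sym P≡)) (≤-trans h (*-monoˡ-≤ T (*-monoˡ-≤ (2 ^ m) (m≤m+n 288 288))))

    B-large : ∀ b → 4 * q ^ (n * n ∸ 2) ≤ b → 4 * P ≤ b * (q * q)
    B-large b h = ≤-trans (≤-reflexive (trans (cong (4 *_) (trans P≡ (trans (cong (q ^_) (sym (m∸n+n≡m
          (≤-trans (≤-trans 2≤m (n≤1+n m)) (m≤n*m n n))))) (^-distribˡ-+-* q (n * n ∸ 2) 2))))
        (solve 3 (λ c x q → c :* (x :* (q :* (q :* con 1))) := c :* x :* (q :* q)) refl 4 (q ^ (n * n ∸ 2)) q)))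
      (*-monoˡ-≤ (q * q) h)

    -- Only |C| ≥ q³ enters the estimates, and (n - 1)² ≥ 4 because n ≥ 3.
    C-large : ∀ c → 4 * q ^ (m * m) ≤ c → q * (q * q) ≤ c
    C-large c h = ≤-trans (≤-trans (≤-reflexive (solve 1 (λ q → q :* (q :* q) := q :* (q :* (q :* con 1))) refl q))
      (≤-trans (^-monoʳ-≤ q (≤-trans (m≤m+n 3 1) (*-mono-≤ 2≤m 2≤m))) (m≤n*m (q ^ (m * m)) 4))) h

-- From integers to natural numbers and to the final inequality

module ImageSize where
  open Integers
  open Sums
  open Incidences
  open Bounds

  infixl 7 _·_
  _·_ : ∀ {i j x y} → i ≡ pos x → j ≡ pos y → i * j ≡ pos (x ℕ.* y)
  p · r = trans (cong₂ _*_ p r) (sym (pos-* _ _))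

  pos-^ : ∀ {i q} k → i ≡ pos q → i ^′ k ≡ pos (q ℕ.^ k)
  pos-^ zero    e = refl
  pos-^ (suc k) e = e · pos-^ k e

  reflect : ∀ {i j x y} → i ≡ pos x → j ≡ pos y → i ≤ j → x ℕ.≤ y
  reflect p r h = ℤP.drop‿+≤+ (subst₂ _≤_ p r h)

  reify : ∀ {i j x y} → i ≡ pos x → j ≡ pos y → x ℕ.≤ y → i ≤ j
  reify p r h = subst₂ _≤_ (sym p) (sym r) (+≤+ h)

  module _ {q : ℕ} (F : FiniteField q) (2≤q : 2 ℕ.≤ q) (k : ℕ) where
    open Matrices F

    private
      m n : ℕ
      m = suc (suc k)
      n = suc m
      P = (q ℕ.^ n) ℕ.^ n

    growth-ℕ : (A B C : List (Mat n)) → Unique A → Unique B → Unique C → All InSL A → All InSL B →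
      let a = length A ; b = length B ; c = length C ; T = length (fImage A B C) in
      0 ℕ.< a → 4 ℕ.* P ℕ.≤ b ℕ.* (q ℕ.* q) → q ℕ.* (q ℕ.* q) ℕ.≤ c →
      (q ℕ.^ m ℕ.* q ℕ.* q ℕ.* (a ℕ.* b) ℕ.≤ 576 ℕ.* (T ℕ.* P)) ⊎
      (q ℕ.^ m ℕ.* q ℕ.* (a ℕ.* b ℕ.* b ℕ.* c) ℕ.≤ 384 ℕ.* (T ℕ.* (P ℕ.* P))) ⊎
      (P ℕ.≤ 288 ℕ.* 2 ℕ.^ m ℕ.* T)
    growth-ℕ A B C uA uB uC A⊂SL B⊂SL 0<a hB hC = Sum.map
      (reflect (pos-^ m refl · refl · refl · (refl · refl)) (refl · (refl · posP)))
      (Sum.map (reflect (pos-^ m refl · refl · (refl · refl · refl · refl)) (refl · (refl · (posP · posP))))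
        (reflect posP (refl · pos-^ m refl · refl)))
      (Assembly.growth F (+≤+ 2≤q) k A B C uA uB uC (All.map special A⊂SL) (All.map special B⊂SL) (+<+ 0<a)
        (reify (refl · posP) (refl · (refl · refl)) hB) (reify (refl · (refl · refl)) refl hC))
      where
      special : ∀ {M : Mat n} → InSL M → LinAlg.Linear.Det F M ≡ FiniteField.1# F
      special {M} e = trans (LinAlg.Linear.Det≡det F M) e
      posP : (pos q ^′ n) ^′ n ≡ pos P
      posP = pos-^ n (pos-^ n refl)

    module E = Exponents q {{ℕ.>-nonZero (ℕP.≤-trans (ℕ.s≤s ℕ.z≤n) 2≤q)}} m (ℕ.s≤s (ℕ.s≤s ℕ.z≤n))

    image-bound : (A B C : List (Mat n)) → Unique A → Unique B → Unique C → All InSL A → All InSL B →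
      4 ℕ.* q ℕ.^ (n ℕ.* n ℕ.∸ 2) ℕ.≤ length B → 4 ℕ.* q ℕ.^ (m ℕ.* m) ℕ.≤ length C →
      (1 ÷ (576 ℕ.* 2 ℕ.^ m)) ℚ.* minℚ3 ((q ℕ.^ (n ℕ.* n)) ÷ 1)
        ((length A ℕ.* length B ℕ.* length B ℕ.* length C) ÷ (q ℕ.^ (3 ℕ.* (n ℕ.* n) ℕ.∸ 3 ℕ.* n ℕ.∸ 2)))
        ((length A ℕ.* length B) ÷ (q ℕ.^ (n ℕ.* n ℕ.∸ n ℕ.∸ 1)))
      ℚ.≤ (length (fImage A B C) ÷ 1)
    image-bound A B C uA uB uC A⊂SL B⊂SL hB hC =
      min-bound K {{K≢0}} (q ℕ.^ (n ℕ.* n)) (a ℕ.* b ℕ.* b ℕ.* c) (q ℕ.^ e) (a ℕ.* b) (q ℕ.^ e′) T {{q^≢0 e}} {{q^≢0 e′}}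
        (by-size a refl)
      where
      a b c T K e e′ : ℕ
      a = length A
      b = length B
      c = length C
      T = length (fImage A B C)
      K = 576 ℕ.* 2 ℕ.^ m
      e = 3 ℕ.* (n ℕ.* n) ℕ.∸ 3 ℕ.* n ℕ.∸ 2
      e′ = n ℕ.* n ℕ.∸ n ℕ.∸ 1
      q^≢0 : ∀ d → ℕ.NonZero (q ℕ.^ d)
      q^≢0 d = ℕP.m^n≢0 q d {{ℕ.>-nonZero (ℕP.≤-trans (ℕ.s≤s ℕ.z≤n) 2≤q)}}
      K≢0 : ℕ.NonZero K
      K≢0 = ℕP.m*n≢0 576 (2 ℕ.^ m) {{_}} {{ℕP.m^n≢0 2 m}}
      by-size : ∀ a′ → a ≡ a′ →
        (a ℕ.* b ℕ.≤ K ℕ.* T ℕ.* q ℕ.^ e′) ⊎ (a ℕ.* b ℕ.* b ℕ.* c ℕ.≤ K ℕ.* T ℕ.* q ℕ.^ e) ⊎ (q ℕ.^ (n ℕ.* n) ℕ.≤ K ℕ.* T)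
      -- The trichotomy was obtained by dividing by |A|; for empty A the third entry of the minimum
      -- is 0.
      by-size zero     a≡0 = inj₁ (ℕP.≤-trans (ℕP.≤-reflexive (cong (ℕ._* b) a≡0)) ℕ.z≤n)
      by-size (suc a′) a≡  = Sum.map (E.third (a ℕ.* b) T) (Sum.map (E.second (a ℕ.* b ℕ.* b ℕ.* c) T) (E.first T))
        (growth-ℕ A B C uA uB uC A⊂SL B⊂SL (subst (0 ℕ.<_) (sym a≡) (ℕ.s≤s ℕ.z≤n)) (E.B-large b hB) (E.C-large c hC))

open import Data.Nat using (s≤s; z≤n; _≤_; _<_; _*_; _^_; _∸_)
open import Data.Nat.Properties using (m*n≢0; m^n≢0)
open Bounds using (0<1÷; oddPrimePower⇒2≤)

theorem1p6 : (n : ℕ) → 3 ≤ n →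
    Σ ℕ λ C₀ → Σ ℚ λ c → (0 < C₀) × (0ℚ ℚ.< c) ×
    ((q : ℕ) → IsOddPrimePower q → (F : FiniteField q) →
    let open Matrices F in
    (A B C : List (Mat n)) →
    Unique A → Unique B → Unique C →
    All InSL A → All InSL B →
    C₀ * q ^ (n * n ∸ 2) ≤ length B →
    C₀ * q ^ ((n ∸ 1) * (n ∸ 1)) ≤ length C →
    c ℚ.* minℚ3 ((q ^ (n * n)) ÷ 1)
    ((length A * length B * length B * length C) ÷ (q ^ (3 * (n * n) ∸ 3 * n ∸ 2)))
    ((length A * length B) ÷ (q ^ (n * n ∸ n ∸ 1)))
    ℚ.≤ (length (fImage A B C) ÷ 1))
theorem1p6 (suc (suc (suc k))) (s≤s (s≤s (s≤s z≤n))) =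
  -- 576 dominates the constants 576, 384 and 288 of the three cases, and 2^(n-1) is the loss in the
  -- lower bound for |SL_n|; the constants depend on n alone.
  4 , 1 ÷ K , s≤s z≤n , 0<1÷ K {{m*n≢0 576 (2 ^ suc (suc k)) {{_}} {{m^n≢0 2 (suc (suc k))}}}} ,
  λ q q-odd F → ImageSize.image-bound F (oddPrimePower⇒2≤ q-odd) k
  where
  K = 576 * 2 ^ suc (suc k)
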